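{- Let $d,k\in\mathbb N$ and let $(U,\mathcal F)$ be an instance of \textsc{$d$-Hitting Set} with $n=|\mathcal F|$ sets and $m=|U|$ elements. The static kernel $(U',\mathcal F')$ of $(U,\mathcal F)$, where $\mathcal F'$ is the family of inclusion-minimal good sets (defined in the context) and $U'=\bigcup_{S\in\mathcal F'}S$, can be computed in $O(3^d n+m)$ time.
   Context: An instance $(U,\mathcal F)$ of \textsc{$d$-Hitting Set} consists of a finite universe $U$ and a family $\mathcal F$ of subsets of $U$, each of cardinality exactly $d$; running times are on a word-RAM. For $r\in\mathbb N$ let $\nu_r = r!\,(k+1)^r$. The notion of an "$(\ell,r)$-good" set is defined inductively, in decreasing order of $\ell$ from $d$ to $1$, and for fixed $\ell<d$, for increasing $r$ from $1$ to $d-\ell$: \begin{itemize} \item The $(d,r)$-good sets are the sets $S\in\mathcal F$ (for every $r$). \item A set $S\subseteq U$ is $\ell$-good if $S$ is $(\ell,r)$-good for some $r$. \item A set $S\subseteq U$ is $(\ell',r)$-strong if $S$ is $\ell'$-good and does not contain any $(\ell'-j,j)$-good subset for any $j\in\{1,\dots,r-1\}$. \item For $\ell<d$, a set $S\subseteq U$ is $(\ell,r)$-good if $|S|=\ell$ and $S$ is contained in at least $\nu_r$ sets that are $(\ell+r,r)$-strong. \item A set $S\subseteq U$ is good if $S$ is $\ell$-good for $\ell=|S|$. \end{itemize} $\mathcal F'$ consists of those sets $S\subseteq U$ that are good and none of whose proper subsets are good; $U'$ consists of all $u\in U$ contained in some set of $\mathcal F'$. -}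

module Defs where

open import Data.Bool using (Bool; true; false; if_then_else_; _∧_; _∨_; _xor_)
open import Data.Empty using (⊥-elim)
open import Data.Fin using (Fin; toℕ)
open import Data.Fin.Subset using (Subset; _⊆_; _⊂_; ∣_∣)
import Data.Fin.Subset as Sub
open import Data.List using (List; []; _∷_; _++_; length; map; concatMap; head; drop; lookup)
open import Data.List.Membership.Propositional using (_∈_)
open import Data.List.Relation.Binary.Pointwise using (Pointwise)
open import Data.List.Relation.Unary.All using (All)
import Data.List.Relation.Unary.All as All
open import Data.List.Relation.Unary.Unique.Propositional using (Unique)
open import Data.Maybe using (Maybe; just; nothing)
open import Data.Nat using (ℕ; zero; suc; _+_; _*_; _∸_; _^_; _!; _/_; _%_; _≤_; _<_; _≡ᵇ_; _<ᵇ_)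
open import Data.Nat.Properties using (m^n≢0; ≤-trans; ≤-reflexive; <-irrefl; +-identityʳ; +-assoc; +-comm; +-monoˡ-≤; +-monoʳ-≤; +-∸-assoc; m<n⇒0<n∸m; m≤m+n; m≤n+m; <⇒≤)
open import Data.Product using (∃; _×_; _,_)
open import Data.Sum using (_⊎_; inj₁; inj₂)
open import Function using (_⇔_; mk⇔)
open import Relation.Binary.PropositionalEquality using (_≡_; refl; sym; subst)
open import Relation.Nullary using (¬_)

-- The universe U is Fin m.
record Instance (d m : ℕ) : Set where
  field
    sets     : List (Subset m)
    distinct : Unique sets
    uniform  : All (λ S → ∣ S ∣ ≡ d) sets

open Instance public

AtLeast : {A : Set} → ℕ → (A → Set) → Set
AtLeast {A} N P = ∃ λ (xs : List A) → Unique xs × All P xs × N ≤ length xs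

module Goodness {d m : ℕ} (k : ℕ) (I : Instance d m) where

  ν : ℕ → ℕ
  ν r = r ! * (k + 1) ^ r

  -- (ℓ,r)-goodness refers only to levels ℓ′ with ℓ < ℓ′ ≤ d, so it is a
  -- recursion on d ∸ ℓ.  The first argument of GoodUpTo bounds the depth
  -- of that recursion; any bound f with d ≤ ℓ + f gives the same notion
  -- at level ℓ (`depth-irrelevant`), and with the bound d the defining
  -- clauses hold literally (`good-unfold`).
  mutual
    GoodUpTo : ℕ → (ℓ r : ℕ) → Subset m → Set
    GoodUpTo zero    ℓ r S = ℓ ≡ d × S ∈ sets I
    GoodUpTo (suc f) ℓ r S =
      (ℓ ≡ d × S ∈ sets I) ⊎
      (1 ≤ ℓ × ℓ < d × 1 ≤ r × r ≤ d ∸ ℓ × ∣ S ∣ ≡ ℓ ×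
        AtLeast (ν r) (λ T → S ⊆ T × StrongUpTo f (ℓ + r) r T))

    StrongUpTo : ℕ → (ℓ′ r : ℕ) → Subset m → Set
    StrongUpTo f ℓ′ r T =
      (∃ λ s → GoodUpTo f ℓ′ s T) ×
      (∀ j → 1 ≤ j → j < r → ¬ (∃ λ R → R ⊆ T × GoodUpTo f (ℓ′ ∸ j) j R))

  -- GoodAt ℓ r is "(ℓ,r)-good", LevelGood ℓ is "ℓ-good".
  GoodAt : (ℓ r : ℕ) → Subset m → Set
  GoodAt ℓ r = GoodUpTo d ℓ r

  LevelGood : ℕ → Subset m → Set
  LevelGood ℓ S = ∃ λ r → GoodAt ℓ r S

  Strong : (ℓ′ r : ℕ) → Subset m → Set
  Strong ℓ′ r S =
    LevelGood ℓ′ S ×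
    (∀ j → 1 ≤ j → j < r → ¬ (∃ λ R → R ⊆ S × GoodAt (ℓ′ ∸ j) j R))

  Good : Subset m → Set
  Good S = LevelGood ∣ S ∣ S

  KernelSet : Subset m → Set
  KernelSet S = Good S × (∀ R → R ⊂ S → ¬ Good R)

  KernelElement : Fin m → Set
  KernelElement u = ∃ λ S → KernelSet S × u Sub.∈ S

  private
    above : ∀ {ℓ r f} → 1 ≤ r → d ≤ ℓ + suc f → d ≤ (ℓ + r) + f
    above {ℓ} {r} {f} 1≤r p = ≤-trans p (≤-trans (+-monoʳ-≤ ℓ (+-monoˡ-≤ f 1≤r)) (≤-reflexive (sym (+-assoc ℓ r f))))

    above′ : ∀ {ℓ r f} j → j < r → d ≤ ℓ + suc f → d ≤ (ℓ + r ∸ j) + f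
    above′ {ℓ} {r} {f} j j<r p =
      subst (λ x → d ≤ x + f) (sym (+-∸-assoc ℓ (<⇒≤ j<r))) (above {ℓ} (m<n⇒0<n∸m j<r) p)

    noRoom : {A : Set} {ℓ : ℕ} → ℓ < d → d ≤ ℓ + 0 → A
    noRoom {_} {ℓ} ℓ<d p = ⊥-elim (<-irrefl refl (≤-trans ℓ<d (≤-trans p (≤-reflexive (+-identityʳ ℓ)))))

  depth-irrelevant : ∀ f g {ℓ r S} → d ≤ ℓ + f → d ≤ ℓ + g → GoodUpTo f ℓ r S → GoodUpTo g ℓ r S
  depth-irrelevant zero    zero    p q x = x
  depth-irrelevant zero    (suc g) p q x = inj₁ x
  depth-irrelevant (suc f) zero    p q (inj₁ x) = x
  depth-irrelevant (suc f) zero    p q (inj₂ (_ , ℓ<d , _)) = noRoom ℓ<d q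
  depth-irrelevant (suc f) (suc g) p q (inj₁ x) = inj₁ x
  depth-irrelevant (suc f) (suc g) {ℓ} {r} {S} p q (inj₂ (a , b , 1≤r , c , e , Ts , u , all , n)) =
    inj₂ (a , b , 1≤r , c , e , Ts , u , All.map transfer all , n)
    where
    transfer : ∀ {T} → S ⊆ T × StrongUpTo f (ℓ + r) r T → S ⊆ T × StrongUpTo g (ℓ + r) r T
    transfer (S⊆T , (s , gd) , no) =
      (λ {x} → S⊆T {x}) ,
      (s , depth-irrelevant f g (above {ℓ} 1≤r p) (above {ℓ} 1≤r q) gd) ,
      λ j 1≤j j<r (R , R⊆T , h) →
        no j 1≤j j<r (R , (λ {x} → R⊆T {x}) ,
          depth-irrelevant g f (above′ {ℓ} j j<r q) (above′ {ℓ} j j<r p) h)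

  Clauses : (ℓ r : ℕ) → Subset m → Set
  Clauses ℓ r S =
    (ℓ ≡ d × S ∈ sets I) ⊎
    (1 ≤ ℓ × ℓ < d × 1 ≤ r × r ≤ d ∸ ℓ × ∣ S ∣ ≡ ℓ ×
      AtLeast (ν r) (λ T → S ⊆ T × Strong (ℓ + r) r T))

  good-unfold : ∀ {ℓ r S} → GoodAt ℓ r S ⇔ Clauses ℓ r S
  good-unfold {ℓ} {r} {S} = mk⇔ to from
    where
    p : d ≤ ℓ + d
    p = m≤n+m d ℓ

    q : d ≤ ℓ + suc d
    q = ≤-trans p (+-monoʳ-≤ ℓ (≤-trans (m≤m+n d 1) (≤-reflexive (+-comm d 1))))

    to : GoodAt ℓ r S → Clauses ℓ r S
    to x = depth-irrelevant d (suc d) p q x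

    from : Clauses ℓ r S → GoodAt ℓ r S
    from x = depth-irrelevant (suc d) d q p x

open Goodness public using (KernelSet; KernelElement)

-- Word-RAM.  Words are the naturals below 2 ^ w; a program is a finite
-- list of instructions, independent of w, each executed at unit cost.
data Op : Set where
  add sub mul div mod and or xor shl shr : Op

data Instr : Set where
  const : (r c : ℕ) → Instr
  arith : Op → (r a b : ℕ) → Instr
  load  : (r a : ℕ) → Instr
  store : (a b : ℕ) → Instr
  jump  : (l : ℕ) → Instr
  jeq   : (a b l : ℕ) → Instr
  jlt   : (a b l : ℕ) → Instr
  halt  : Instr

Program : Set
Program = List Instr

record Config : Set where
  constructor ⟨_,_,_⟩
  field
    pc  : ℕ
    reg : ℕ → ℕ
    mem : ℕ → ℕ

open Config public

_[_↦_] : (ℕ → ℕ) → ℕ → ℕ → (ℕ → ℕ)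
(f [ a ↦ v ]) x = if x ≡ᵇ a then v else f x

fetch : Program → ℕ → Maybe Instr
fetch P i = head (drop i P)

bit : Bool → ℕ
bit true  = 1
bit false = 0

bitwise : (Bool → Bool → Bool) → (w a b : ℕ) → ℕ
bitwise f zero    a b = 0
bitwise f (suc w) a b =
  bit (f (a % 2 ≡ᵇ 1) (b % 2 ≡ᵇ 1)) + 2 * bitwise f w (a / 2) (b / 2)

module _ (w : ℕ) where

  trunc : ℕ → ℕ
  trunc x = _%_ x (2 ^ w) {{m^n≢0 2 w}}

  -- Division and remainder by zero return 0.
  eval : Op → ℕ → ℕ → ℕ
  eval add a b = trunc (a + b)
  eval sub a b = trunc (a + (2 ^ w ∸ b))
  eval mul a b = trunc (a * b)
  eval div a zero = 0
  eval div a (suc b) = a / suc b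
  eval mod a zero = 0
  eval mod a (suc b) = a % suc b
  eval and a b = bitwise _∧_ w a b
  eval or  a b = bitwise _∨_ w a b
  eval xor a b = bitwise _xor_ w a b
  eval shl a b = trunc (a * 2 ^ b)
  eval shr a b = _/_ a (2 ^ b) {{m^n≢0 2 b}}

  exec : Instr → Config → Config
  exec (const r c)     ⟨ i , R , M ⟩ = ⟨ suc i , R [ r ↦ trunc c ] , M ⟩
  exec (arith o r a b) ⟨ i , R , M ⟩ = ⟨ suc i , R [ r ↦ eval o (R a) (R b) ] , M ⟩
  exec (load r a)      ⟨ i , R , M ⟩ = ⟨ suc i , R [ r ↦ M (R a) ] , M ⟩
  exec (store a b)     ⟨ i , R , M ⟩ = ⟨ suc i , R , M [ R a ↦ R b ] ⟩
  exec (jump l)        ⟨ i , R , M ⟩ = ⟨ l , R , M ⟩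
  exec (jeq a b l)     ⟨ i , R , M ⟩ = ⟨ (if R a ≡ᵇ R b then l else suc i) , R , M ⟩
  exec (jlt a b l)     ⟨ i , R , M ⟩ = ⟨ (if R a <ᵇ R b then l else suc i) , R , M ⟩
  exec halt            c             = c

  step : Program → Config → Config
  step P c with fetch P (pc c)
  ... | nothing = c
  ... | just ι  = exec ι c

  run : Program → ℕ → Config → Config
  run P zero    c = c
  run P (suc t) c = run P t (step P c)

Halted : Program → Config → Set
Halted P c = fetch P (pc c) ≡ just halt ⊎ fetch P (pc c) ≡ nothing

Enumerates : {A : Set} → List A → (A → Set) → Set
Enumerates xs P = Unique xs × (∀ x → x ∈ xs ⇔ P x)

-- Each row lists the elements of the corresponding set once, in any order.
ListsSets : ∀ {m} → List (List (Fin m)) → List (Subset m) → Set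
ListsSets = Pointwise (λ row S → Enumerates row (Sub._∈ S))

encodeInput : ∀ (d k m : ℕ) → List (List (Fin m)) → List ℕ
encodeInput d k m rows = d ∷ k ∷ m ∷ length rows ∷ concatMap (map toℕ) rows

encodeOutput : ∀ {m} → List (Fin m) → List (List (Fin m)) → List ℕ
encodeOutput us rows =
  (length us ∷ map toℕ us) ++
  (length rows ∷ concatMap (λ row → length row ∷ map toℕ row) rows)

contents : List ℕ → ℕ → ℕ
contents []       _       = 0
contents (x ∷ xs) zero    = x
contents (x ∷ xs) (suc a) = contents xs a

initial : List ℕ → Config
initial input = ⟨ 0 , (λ _ → 0) , contents input ⟩

-- The output is a contiguous block of memory starting at address R[0].
Outputs : (w : ℕ) → Config → List ℕ → Set
Outputs w c out =
  reg c 0 + length out ≤ 2 ^ w ×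
  (∀ (i : Fin (length out)) → mem c (reg c 0 + toℕ i) ≡ lookup out i)

OutputsKernel : ∀ {d m} → (w k : ℕ) → Instance d m → Config → Set
OutputsKernel {d} {m} w k I c =
  ∃ λ (us : List (Fin m)) → ∃ λ (Ss : List (Subset m)) → ∃ λ (rows : List (List (Fin m))) →
    Enumerates us (KernelElement k I) ×
    Enumerates Ss (KernelSet k I) ×
    ListsSets rows Ss ×
    Outputs w c (encodeOutput us rows)

{-# OPTIONS --safe #-}

-- The subsets of the rows are numbered as the nodes of a trie.  Elements e are
-- inserted in increasing order into the rows F that contain them: for each set
-- S already recorded below F the node of S ∪ {e} is looked up in an array
-- indexed by S, stamped with e, so that no dictionary is needed.  A node T is
-- created together with the list of its 2 ^ |T| subsets, obtained from that of
-- its parent R by copying it twice, once with e added; the subsets of R come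
-- before R, so that their extensions exist already.  The potential
-- Σ_F 3 ^ |F inserted so far| pays for this, and it ends at 3 ^ d · n.
--
-- The pairs S ⊆ T are then sorted by |S| and swept from |S| = d - 1 down to 1.
-- When level ℓ is reached, "T is (|T|, |T| - ℓ)-strong" means that T is good and
-- contains no (|T| - j, j)-good set of a level above ℓ, so a single flag per T
-- suffices: it is set when T becomes good and cleared after the level at which
-- T first fails.  The thresholds r! (k + 1) ^ r may exceed a word; they are
-- tested by repeated floor division of the counts.
--
-- The algorithm is written in a small structured language with a clock, which
-- is compiled to the RAM; its arrays have length X = (2 ^ w - 1) / 22 each.
module Submission where

-- The bound has no polynomial factor in d, while n * 3 ^ d is already the number of pairs S ⊆ T of
-- subsets of the rows, counted with repetition. So a pair may cost only a constant, and a set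
-- shared by many rows must be recognised without ever being compared as a whole. Extending rows one
-- element at a time achieves this: to extend a part P of a row by e, the 2 ^ |P| subsets S of P are
-- visited, and making the node of S ∪ {e} costs about 2 ^ |S|. By the binomial theorem this is O(3
-- ^ |P|) in all, whether or not the nodes exist, while the term 3 ^ |P| of the potential grows by 2
-- * 3 ^ |P|. Work per node, as opposed to work per pair, may be polynomial in d, since there are at
-- most n * 2 ^ d nodes and (d + 1) ^ 3 * 2 ^ d is at most 31 * 3 ^ d. This leaves room for testing
-- every r at every node, with r divisions each. No time is spent on clearing arrays: memory beyond
-- the input is zero at the start, and 0 is made to mean null pointer, unstamped, not good.

module Language where

  open import Defs
  open import Data.Bool using (Bool; true; false; if_then_else_; _∨_; T; not)
  open import Data.Empty using (⊥-elim)
  open import Data.List using (List; []; _∷_; head)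
  open import Data.List.Relation.Unary.All using (All; []; _∷_)
  open import Data.Nat
  open import Data.Nat.Properties
  open import Data.Product using (∃; _×_; _,_)
  open import Data.Unit using (⊤; tt)
  open import Relation.Binary.PropositionalEquality
  open import Relation.Nullary using (no; contradiction)

  -- A structured language with a clock

  infix  30 `_ #_
  infixl 26 _⊗_ _⊘_
  infixl 25 _⊕_ _⊖_
  infix  28 _⟦_⟧

  -- e ⊘ f is the floor of e / (1 + f), so that no division by zero arises.
  data Expr : Set where
    `_ #_ : ℕ → Expr
    _⊕_ _⊗_ _⊖_ _⊘_ : Expr → Expr → Expr
    _⟦_⟧ : ℕ → Expr → Expr

  infix 24 _≺_ _≐_
  data Cond : Set where
    _≺_ _≐_ : Expr → Expr → Cond

  infix  23 _≔_ _⟦_⟧≔_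
  infixr 22 _⨾_

  -- `for x b s` runs s for x = 0, …, b - 1.  `walk q j h nx s` runs s with j
  -- ranging over the linked list with head h and successor array nx, where
  -- 0 is the null pointer and 1 + j points to j.
  data Stmt : Set where
    _≔_ : ℕ → Expr → Stmt
    _⟦_⟧≔_ : ℕ → Expr → Expr → Stmt
    _⨾_ : Stmt → Stmt → Stmt
    when : Cond → Stmt → Stmt
    for : (x b : ℕ) → Stmt → Stmt
    walk : (q j : ℕ) → Expr → (nx : ℕ) → Stmt → Stmt
    block : Stmt → Stmt

  record State : Set where
    constructor ⟪_,_,_⟫
    field
      clk : ℕ
      var : ℕ → ℕ
      arr : ℕ → ℕ → ℕ

  open State public

  val : Expr → State → ℕ
  val (` x)     σ = var σ x
  val (# c)     σ = c
  val (a ⊕ b)   σ = val a σ + val b σ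
  val (a ⊗ b)   σ = val a σ * val b σ
  val (a ⊖ b)   σ = val a σ ∸ val b σ
  val (a ⊘ b)   σ = val a σ / suc (val b σ)
  val (j ⟦ a ⟧) σ = arr σ j (val a σ)

  holds fails : Cond → State → Set
  holds (a ≺ b) σ = val a σ < val b σ
  holds (a ≐ b) σ = val a σ ≡ val b σ
  fails (a ≺ b) σ = val b σ ≤ val a σ
  fails (a ≐ b) σ = val a σ ≢ val b σ

  setV : ℕ → ℕ → State → State
  setV x v ⟪ c , V , A ⟫ = ⟪ suc c , V [ x ↦ v ] , A ⟫

  setA : ℕ → ℕ → ℕ → State → State
  setA j y v ⟪ c , V , A ⟫ = ⟪ suc c , V , (λ j′ → if j′ ≡ᵇ j then A j [ y ↦ v ] else A j′) ⟫

  tick : State → State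
  tick ⟪ c , V , A ⟫ = ⟪ suc c , V , A ⟫

  writesV writesA : Stmt → ℕ → Bool
  writesV (x ≔ e)            y = y ≡ᵇ x
  writesV (j ⟦ a ⟧≔ e)       y = false
  writesV (s ⨾ t)            y = writesV s y ∨ writesV t y
  writesV (when c s)         y = writesV s y
  writesV (for x b s)        y = (y ≡ᵇ x) ∨ writesV s y
  writesV (walk q j h nx s)  y = (y ≡ᵇ q) ∨ ((y ≡ᵇ j) ∨ writesV s y)
  writesV (block s)          y = writesV s y

  writesA (x ≔ e)            i = false
  writesA (j ⟦ a ⟧≔ e)       i = i ≡ᵇ j
  writesA (s ⨾ t)            i = writesA s i ∨ writesA t i
  writesA (when c s)         i = writesA s i
  writesA (for x b s)        i = writesA s i
  writesA (walk q j h nx s)  i = writesA s i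
  writesA (block s)          i = writesA s i

  -- The state σ′ reached from σ by s, presented so that the components s does
  -- not write are, by computation, those of σ.
  merge : Stmt → State → State → State
  merge s σ σ′ =
    ⟪ clk σ′ , (λ y → if writesV s y then var σ′ y else var σ y) , (λ j → if writesA s j then arr σ′ j else arr σ j) ⟫

  forSt : (x b : ℕ) → Stmt → State → ℕ → State → State
  forSt x b s σ i σ′ = setV x i (merge (for x b s) σ σ′)

  -- The pointer has already advanced when the body starts, and the successor is read from the array
  -- as it was on entry to the loop. This is right because `wf` forbids the body to write `nx`, `q`
  -- or `j`.
  walkSt : (q j : ℕ) → Expr → (nx : ℕ) → Stmt → State → ℕ → State → State
  walkSt q j h nx s σ y σ′ =
    let σ₁ = merge (walk q j h nx s) σ σ′ in ⟪ suc (clk σ′) , var σ₁ [ q ↦ arr σ nx y ] [ j ↦ y ] , arr σ₁ ⟫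

  walkEnd : (q j : ℕ) → Expr → (nx : ℕ) → Stmt → State → State → State
  walkEnd q j h nx s σ σ′ = setV q 0 (merge (walk q j h nx s) σ σ′)

  Chain : (ℕ → ℕ) → ℕ → List ℕ → Set
  Chain nx q []       = q ≡ 0
  Chain nx q (y ∷ ys) = q ≡ suc y × Chain nx (nx y) ys

  -- Taking the predicate transformer `W` of the body as a parameter leaves `wp` structurally
  -- recursive in the statement. The number of rounds is known on entry, so a precondition
  -- guarantees termination without a variant.
  iterFor : ((State → Set) → State → Set) → (ℕ → State → State) → (State → Set) → ℕ → ℕ → State → Set
  iterFor W F Q zero    i σ = Q (F i σ)
  iterFor W F Q (suc k) i σ = W (iterFor W F Q k (suc i)) (F i σ)

  iterWalk : ((State → Set) → State → Set) → (ℕ → State → State) → (State → State) → (State → Set) → List ℕ → State → Set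
  iterWalk W F E Q []       σ = Q (E σ)
  iterWalk W F E Q (y ∷ ys) σ = W (iterWalk W F E Q ys) (F y σ)

  -- Weakest preconditions and loop rules

  module Logic (w X : ℕ) where

    -- These are the conditions under which word arithmetic agrees with arithmetic on ℕ: no
    -- wrap-around, no truncated difference, no index outside an array. A quotient needs none of its
    -- own, even if its divisor overflows.
    safe : Expr → State → Set
    safe (` x)     σ = ⊤
    safe (# c)     σ = ⊤
    safe (a ⊕ b)   σ = safe a σ × safe b σ × val a σ + val b σ < 2 ^ w
    safe (a ⊗ b)   σ = safe a σ × safe b σ × val a σ * val b σ < 2 ^ w
    safe (a ⊖ b)   σ = safe a σ × safe b σ × val b σ ≤ val a σ
    safe (a ⊘ b)   σ = safe a σ × safe b σ
    safe (j ⟦ a ⟧) σ = safe a σ × val a σ < X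

    safeC : Cond → State → Set
    safeC (a ≺ b) σ = safe a σ × safe b σ
    safeC (a ≐ b) σ = safe a σ × safe b σ

    wp : Stmt → (State → Set) → State → Set
    wp (x ≔ e)           Q σ = safe e σ × Q (setV x (val e σ) σ)
    wp (j ⟦ a ⟧≔ e)      Q σ = safe a σ × safe e σ × val a σ < X × Q (setA j (val a σ) (val e σ) σ)
    wp (s ⨾ t)           Q σ = wp s (wp t Q) σ
    wp (when c s)        Q σ = safeC c σ × (holds c σ → wp s Q (tick σ)) × (fails c σ → Q (tick σ))
    wp (for x b s)       Q σ = iterFor (wp s) (forSt x b s σ) Q (var σ b) 0 σ
    -- The list of visited positions is a witness to be supplied; that it exists says that the
    -- pointers form a finite chain, so the walk ends.
    wp (walk q j h nx s) Q σ = safe h σ × ∃ λ ys → Chain (arr σ nx) (val h σ) ys × All (_< X) ys ×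
      iterWalk (wp s) (walkSt q j h nx s σ) (walkEnd q j h nx s σ) Q ys σ
    wp (block s)         Q σ = wp s (λ σ′ → Q (merge s σ σ′)) σ

    wp-mono : ∀ s {Q Q′ : State → Set} → (∀ σ → Q σ → Q′ σ) → ∀ {σ} → wp s Q σ → wp s Q′ σ
    wp-mono (x ≔ e)           f (a , p) = a , f _ p
    wp-mono (j ⟦ i ⟧≔ e)      f (a , b , c , p) = a , b , c , f _ p
    wp-mono (s ⨾ t)           f p = wp-mono s (λ _ → wp-mono t f) p
    wp-mono (when c s)        f (a , p , q) = a , (λ h → wp-mono s f (p h)) , λ h → f _ (q h)
    wp-mono (for x b s) {Q} {Q′} f {σ} p = go (var σ b) 0 σ p
      where
      go : ∀ k i τ → iterFor (wp s) (forSt x b s σ) Q k i τ → iterFor (wp s) (forSt x b s σ) Q′ k i τ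
      go zero    i τ p = f _ p
      go (suc k) i τ p = wp-mono s (go k (suc i)) p
    wp-mono (walk q j h nx s) {Q} {Q′} f {σ} (a , ys , c , l , p) = a , ys , c , l , go ys σ p
      where
      go : ∀ ys τ → iterWalk (wp s) (walkSt q j h nx s σ) (walkEnd q j h nx s σ) Q ys τ →
           iterWalk (wp s) (walkSt q j h nx s σ) (walkEnd q j h nx s σ) Q′ ys τ
      go []       τ p = f _ p
      go (y ∷ ys) τ p = wp-mono s (go ys) p
    wp-mono (block s)         f p = wp-mono s (λ _ → f _) p

    -- Fits a phase with its own postcondition `R` into a longer program. Whatever the phase does
    -- not write is afterwards definitionally what it was before, so the specifications of phases
    -- contain no frame conditions.
    block-rule : ∀ s {R Q : State → Set} {σ} → wp s R σ → (∀ σ′ → R σ′ → Q (merge s σ σ′)) → wp (block s) Q σ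
    block-rule s p f = wp-mono s f p

    for-rule : ∀ {x b s Q σ} (I : ℕ → State → Set) → I 0 σ →
      (∀ i τ → i < var σ b → I i τ → wp s (I (suc i)) (forSt x b s σ i τ)) →
      (∀ τ → I (var σ b) τ → Q (forSt x b s σ (var σ b) τ)) → wp (for x b s) Q σ
    for-rule {x} {b} {s} {Q} {σ} I init stp fin = go (var σ b) 0 σ (+-identityʳ _) init
      where
      go : ∀ k i τ → k + i ≡ var σ b → I i τ → iterFor (wp s) (forSt x b s σ) Q k i τ
      go zero    i τ refl p = fin τ p
      go (suc k) i τ e    p =
        wp-mono s (λ τ′ → go k (suc i) τ′ (trans (+-suc k i) e)) (stp i τ (≤-trans (s≤s (m≤n+m i k)) (≤-reflexive e)) p)

    -- Separates the clock from the functional invariant: a round has one tick of its own besides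
    -- the at most `c` ticks of its body.
    for-cost : ∀ {x b s Q σ} (c : ℕ) (I : ℕ → State → Set) → I 0 σ →
      (∀ i τ → i < var σ b → I i τ → wp s (λ τ′ → I (suc i) τ′ × clk τ′ ≤ c + suc (clk τ)) (forSt x b s σ i τ)) →
      (∀ τ → I (var σ b) τ → clk τ ≤ var σ b * suc c + clk σ → Q (forSt x b s σ (var σ b) τ)) → wp (for x b s) Q σ
    for-cost {x} {b} {s} {Q} {σ} c I init stp fin = for-rule {x} {b} {s} (λ i τ → I i τ × clk τ ≤ i * suc c + clk σ) (init , ≤-refl)
      (λ i τ i<b (p , t) → wp-mono s (λ τ′ (q , u) → q , ≤-trans u (next i t)) (stp i τ i<b p))
      (λ τ (p , t) → fin τ p t)
      where
      next : ∀ i {m} → m ≤ i * suc c + clk σ → c + suc m ≤ suc c + i * suc c + clk σ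
      next i {m} h = ≤-trans (≤-reflexive (+-suc c m)) (≤-trans (+-monoʳ-≤ (suc c) h) (≤-reflexive (sym (+-assoc (suc c) (i * suc c) (clk σ)))))

    walk-rule : ∀ {q j h nx s Q σ} (ys : List ℕ) (I : List ℕ → State → Set) →
      safe h σ → Chain (arr σ nx) (val h σ) ys → All (_< X) ys → I ys σ →
      (∀ y zs τ → All (_< X) (y ∷ zs) → I (y ∷ zs) τ → wp s (I zs) (walkSt q j h nx s σ y τ)) →
      (∀ τ → I [] τ → Q (walkEnd q j h nx s σ τ)) → wp (walk q j h nx s) Q σ
    walk-rule {q} {j} {h} {nx} {s} {Q} {σ} ys I sf ch bd init stp fin = sf , ys , ch , bd , go ys σ bd init
      where
      go : ∀ ys τ → All (_< X) ys → I ys τ → iterWalk (wp s) (walkSt q j h nx s σ) (walkEnd q j h nx s σ) Q ys τ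
      go []       τ bd       p = fin τ p
      go (y ∷ ys) τ (b ∷ bd) p = wp-mono s (λ τ′ → go ys τ′ bd) (stp y ys τ (b ∷ bd) p)

  upd-same : ∀ (f : ℕ → ℕ) a v → (f [ a ↦ v ]) a ≡ v
  upd-same f a v with a ≡ᵇ a in eq
  ... | true  = refl
  ... | false = ⊥-elim (subst T eq (≡⇒≡ᵇ a a refl))

  upd-other : ∀ (f : ℕ → ℕ) {a x} v → x ≢ a → (f [ a ↦ v ]) x ≡ f x
  upd-other f {a} {x} v x≢a with x ≡ᵇ a in eq
  ... | true  = contradiction (≡ᵇ⇒≡ x a (subst T (sym eq) tt)) x≢a
  ... | false = refl

  upd-<  : ∀ (f : ℕ → ℕ) {a x} v → x < a → (f [ a ↦ v ]) x ≡ f x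
  upd-< f v x<a = upd-other f v (<⇒≢ x<a)

-- Translation of the language into RAM code

module Compiler where

  open Language
  open import Defs
  open import Data.Bool using (_∨_; T; not)
  open import Data.List using (List; []; _∷_; _++_; length; head; drop)
  open import Data.List.Properties using (++-assoc; length-++; drop-drop)
  open import Data.List.Relation.Unary.All using ([]; _∷_)
  open import Data.Maybe using (just)
  open import Data.Nat
  open import Data.Nat.Properties
  open import Data.Product using (_×_)
  open import Relation.Binary.PropositionalEquality

  -- Registers below nV hold the variables, register nV the array length X,
  -- and the registers above nV are temporaries.
  nV nA : ℕ
  nV = 50
  nA = 22

  -- Jump targets are absolute, so code must know the length of the code that follows it. Lengths
  -- are therefore computed from the syntax beforehand, and `len-compS` confirms them.
  lenE : Expr → ℕ
  lenE (` x)     = 2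
  lenE (# c)     = 1
  lenE (a ⊕ b)   = lenE a + lenE b + 1
  lenE (a ⊗ b)   = lenE a + lenE b + 1
  lenE (a ⊖ b)   = lenE a + lenE b + 1
  lenE (a ⊘ b)   = lenE a + lenE b + 3
  lenE (j ⟦ a ⟧) = lenE a + 4

  compE : Expr → ℕ → List Instr
  -- The machine has no move instruction; a right shift by 0 copies a register unchanged.
  compE (` x)     t = const t 0 ∷ arith shr t x t ∷ []
  compE (# c)     t = const t c ∷ []
  compE (a ⊕ b)   t = compE a t ++ compE b (suc t) ++ arith add t t (suc t) ∷ []
  compE (a ⊗ b)   t = compE a t ++ compE b (suc t) ++ arith mul t t (suc t) ∷ []
  compE (a ⊖ b)   t = compE a t ++ compE b (suc t) ++ arith sub t t (suc t) ∷ []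
  compE (a ⊘ b)   t = compE a t ++ compE b (suc t) ++
    const (2 + t) 1 ∷ arith add (suc t) (suc t) (2 + t) ∷ arith div t t (suc t) ∷ []
  -- Array `j` starts at address `j * X`. Since `X` depends on the word length, the product is
  -- formed at run time.
  compE (j ⟦ a ⟧) t = compE a t ++ const (suc t) j ∷ arith mul (suc t) (suc t) nV ∷ arith add t t (suc t) ∷ load t t ∷ []

  lenA : ℕ → Expr → ℕ
  lenA x e = lenE e + 2

  compA : ℕ → Expr → List Instr
  compA x e = compE e (suc nV) ++ const (2 + nV) 0 ∷ arith shr x (suc nV) (2 + nV) ∷ []

  lenC : Cond → ℕ
  lenC (a ≺ b) = lenE a + lenE b + 1
  lenC (a ≐ b) = lenE a + lenE b + 1

  compC : Cond → ℕ → List Instr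
  compC (a ≺ b) l = compE a (suc nV) ++ compE b (2 + nV) ++ jlt (suc nV) (2 + nV) l ∷ []
  compC (a ≐ b) l = compE a (suc nV) ++ compE b (2 + nV) ++ jeq (suc nV) (2 + nV) l ∷ []

  pred′ : ℕ → Expr
  pred′ q = ` q ⊖ # 1

  next′ : ℕ → ℕ → Expr
  next′ j nx = nx ⟦ ` j ⟧

  inc : ℕ → Expr
  inc x = # 1 ⊕ ` x

  lenS : Stmt → ℕ
  lenS (x ≔ e)           = lenA x e
  lenS (j ⟦ a ⟧≔ e)      = lenE a + lenE e + 4
  lenS (s ⨾ t)           = lenS s + lenS t
  lenS (when c s)        = lenC c + suc (lenS s)
  lenS (for x b s)       = lenA x (# 0) + (lenC (` x ≺ ` b) + suc (lenS s + (lenA x (inc x) + 1)))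
  lenS (walk q j h nx s) = lenA q h + (lenC (# 0 ≺ ` q) + suc (lenA j (pred′ q) + (lenA q (next′ j nx) + (lenS s + 1))))
  lenS (block s)         = lenS s

  compS : ℕ → Stmt → List Instr
  compS p (x ≔ e)           = compA x e
  compS p (j ⟦ a ⟧≔ e)      = compE a (suc nV) ++ compE e (2 + nV) ++
    const (3 + nV) j ∷ arith mul (3 + nV) (3 + nV) nV ∷ arith add (suc nV) (suc nV) (3 + nV) ∷ store (suc nV) (2 + nV) ∷ []
  compS p (s ⨾ t)           = compS p s ++ compS (p + lenS s) t
  compS p (when c s)        = let l = suc (p + lenC c) in
    compC c l ++ jump (l + lenS s) ∷ compS l s
  compS p (for x b s)       =
    let p₁ = p + lenA x (# 0)
        l  = suc (p₁ + lenC (` x ≺ ` b))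
        l₁ = l + lenS s + lenA x (inc x)
    in compA x (# 0) ++ compC (` x ≺ ` b) l ++ jump (suc l₁) ∷ compS l s ++ compA x (inc x) ++ jump p₁ ∷ []
  compS p (walk q j h nx s) =
    let p₁ = p + lenA q h
        l  = suc (p₁ + lenC (# 0 ≺ ` q))
        l₁ = l + lenA j (pred′ q) + lenA q (next′ j nx)
        l₂ = l₁ + lenS s
    in compA q h ++ compC (# 0 ≺ ` q) l ++ jump (suc l₂) ∷ compA j (pred′ q) ++ compA q (next′ j nx) ++ compS l₁ s ++ jump p₁ ∷ []
  compS p (block s)         = compS p s

  -- The side conditions are Boolean tests, which evaluate to the unit type on a concrete program,
  -- so that `wf-main` needs no proof. Constants stay below 32 because 32 ≤ 2 ^ w is what the
  -- simulation assumes of the word length.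
  wfE : Expr → Set
  wfE (` x)     = T (x <ᵇ nV)
  wfE (# c)     = T (c <ᵇ 32)
  wfE (a ⊕ b)   = wfE a × wfE b
  wfE (a ⊗ b)   = wfE a × wfE b
  wfE (a ⊖ b)   = wfE a × wfE b
  wfE (a ⊘ b)   = wfE a × wfE b
  wfE (j ⟦ a ⟧) = T (j <ᵇ 22) × wfE a

  short : Expr → Set
  short e = T (lenE e ≤ᵇ 30) × wfE e

  wfC : Cond → Set
  wfC (a ≺ b) = short a × short b
  wfC (a ≐ b) = short a × short b

  wf : Stmt → Set
  wf (x ≔ e)           = T (x <ᵇ nV) × short e
  wf (j ⟦ a ⟧≔ e)      = T (j <ᵇ nA) × short a × short e
  wf (s ⨾ t)           = wf s × wf t
  wf (when c s)        = wfC c × wf s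
  wf (for x b s)       = T (x <ᵇ nV) × T (b <ᵇ nV) × T (not (writesV s x)) × T (not ((b ≡ᵇ x) ∨ writesV s b)) × wf s
  wf (walk q j h nx s) = T (q <ᵇ nV) × T (j <ᵇ nV) × T (nx <ᵇ nA) × short h × T (not (q ≡ᵇ j)) × T (not (writesV s q)) × T (not (writesV s j)) × T (not (writesA s nx)) × wf s
  wf (block s)         = wf s

  -- A record instead of a bare equation, so that code and length are found by unification and not
  -- lost when `length` unfolds.
  record HasLen (xs : List Instr) (n : ℕ) : Set where
    constructor len
    field unLen : length xs ≡ n
  open HasLen

  infixr 5 _⊹_
  _⊹_ : ∀ {a b m n} → HasLen a m → HasLen b n → HasLen (a ++ b) (m + n)
  _⊹_ {a} (len refl) (len refl) = len (length-++ a)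

  one∷ : ∀ {ι a n} → HasLen a n → HasLen (ι ∷ a) (suc n)
  one∷ (len refl) = len refl

  relen : ∀ {a m n} → m ≡ n → HasLen a m → HasLen a n
  relen refl h = h

  len-compE : ∀ e t → HasLen (compE e t) (lenE e)
  len-compE (` x)     t = len refl
  len-compE (# c)     t = len refl
  len-compE (a ⊕ b)   t = relen (sym (+-assoc (lenE a) _ _)) (len-compE a t ⊹ len-compE b (suc t) ⊹ len refl)
  len-compE (a ⊗ b)   t = relen (sym (+-assoc (lenE a) _ _)) (len-compE a t ⊹ len-compE b (suc t) ⊹ len refl)
  len-compE (a ⊖ b)   t = relen (sym (+-assoc (lenE a) _ _)) (len-compE a t ⊹ len-compE b (suc t) ⊹ len refl)
  len-compE (a ⊘ b)   t = relen (sym (+-assoc (lenE a) _ _)) (len-compE a t ⊹ len-compE b (suc t) ⊹ len refl)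
  len-compE (j ⟦ a ⟧) t = len-compE a t ⊹ len refl

  len-compA : ∀ x e → HasLen (compA x e) (lenA x e)
  len-compA x e = len-compE e (suc nV) ⊹ len refl

  len-compC : ∀ c l → HasLen (compC c l) (lenC c)
  len-compC (a ≺ b) l = relen (sym (+-assoc (lenE a) _ _)) (len-compE a (suc nV) ⊹ len-compE b (2 + nV) ⊹ len refl)
  len-compC (a ≐ b) l = relen (sym (+-assoc (lenE a) _ _)) (len-compE a (suc nV) ⊹ len-compE b (2 + nV) ⊹ len refl)

  len-compS : ∀ s p → HasLen (compS p s) (lenS s)
  len-compS (x ≔ e)           p = len-compA x e
  len-compS (j ⟦ a ⟧≔ e)      p = relen (sym (+-assoc (lenE a) _ _)) (len-compE a (suc nV) ⊹ len-compE e (2 + nV) ⊹ len refl)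
  len-compS (s ⨾ t)           p = len-compS s p ⊹ len-compS t _
  len-compS (when c s)        p = len-compC c _ ⊹ one∷ (len-compS s _)
  len-compS (for x b s)       p = len-compA x (# 0) ⊹ len-compC (` x ≺ ` b) _ ⊹ one∷ (len-compS s _ ⊹ len-compA x (inc x) ⊹ len refl)
  len-compS (walk q j h nx s) p = len-compA q h ⊹ len-compC (# 0 ≺ ` q) _ ⊹
    one∷ (len-compA j (pred′ q) ⊹ len-compA q (next′ j nx) ⊹ len-compS s _ ⊹ len refl)
  len-compS (block s)         p = len-compS s p

  record At (P : Program) (p : ℕ) (code : List Instr) : Set where
    constructor place
    field
      suf    : List Instr
      placed : drop p P ≡ code ++ suf

  At-++ˡ : ∀ {P p} a {b} → At P p (a ++ b) → At P p a
  At-++ˡ a {b} (place suf e) = place (b ++ suf) (trans e (++-assoc a b suf))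

  drop-++ : ∀ {A : Set} (a {b} : List A) → drop (length a) (a ++ b) ≡ b
  drop-++ []      = refl
  drop-++ (x ∷ a) = drop-++ a

  At-++ʳ : ∀ {P p a b n} → HasLen a n → At P p (a ++ b) → At P (p + n) b
  At-++ʳ {P} {p} {a} {b} (len refl) (place suf e) =
    place suf (trans (sym (drop-drop p (length a) P)) (trans (cong (drop (length a)) (trans e (++-assoc a b suf))) (drop-++ a)))

  At-tail : ∀ {P p ι code} → At P p (ι ∷ code) → At P (suc p) code
  At-tail {P} {p} {ι} {code} (place suf e) =
    place suf (trans (cong (λ i → drop i P) (+-comm 1 p)) (trans (sym (drop-drop p 1 P)) (cong (drop 1) e)))

  At-fetch : ∀ {P p ι code} → At P p (ι ∷ code) → fetch P p ≡ just ι
  At-fetch (place suf e) = cong head e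

-- Correctness and cost of the compiled code

module Simulation where

  open Language
  open Compiler
  open import Defs
  open import Data.Bool using (Bool; true; false; if_then_else_; _∨_; T; not)
  open import Data.Empty using (⊥-elim)
  open import Data.List using ([]; _∷_; _++_)
  open import Data.List.Relation.Unary.All using (All; []; _∷_)
  open import Data.Maybe using (just)
  open import Data.Nat
  open import Data.Nat.DivMod using (m<n⇒m%n≡m; n/1≡n; m/n≤m; m<n⇒m/n≡0; n%n≡0; [m+n]%n≡m%n)
  open import Data.Nat.Properties
  open import Data.Nat.Solver using (module +-*-Solver)
  open import Data.Product using (∃; _×_; _,_; proj₁; proj₂)
  open import Data.Sum using (_⊎_; inj₁; inj₂)
  open import Data.Unit using (tt)
  open import Function using (_∘_)
  open import Relation.Binary.PropositionalEquality
  open import Relation.Nullary using (yes; no; contradiction)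
  open +-*-Solver using (solve; _:+_; _:=_; con)

  Frame : Stmt → State → State → Set
  Frame s σ σ′ = (∀ y → writesV s y ≡ false → var σ′ y ≡ var σ y) × (∀ j → writesA s j ≡ false → ∀ y → arr σ′ j y ≡ arr σ j y)

  false-not : ∀ {b} → T (not b) → b ≡ false
  false-not {false} _ = refl

  ∨-false : ∀ {a b} → a ∨ b ≡ false → a ≡ false × b ≡ false
  ∨-false {false} {false} refl = refl , refl

  ≡ᵇ-false : ∀ {a b} → (a ≡ᵇ b) ≡ false → a ≢ b
  ≡ᵇ-false {a} e refl = subst T e (≡⇒≡ᵇ a a refl)

  module Machine (w : ℕ) (P : Program) where

    run-+ : ∀ a b c → run w P (a + b) c ≡ run w P b (run w P a c)
    run-+ zero    b c = refl
    run-+ (suc a) b c = run-+ a b (step w P c)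

    infix 3 _⟶[_]_
    record _⟶[_]_ (c : Config) (t : ℕ) (c′ : Config) : Set where
      constructor steps
      field reaches : run w P t c ≡ c′
    open _⟶[_]_ public

    infixr 5 _then_
    _then_ : ∀ {a b c c₁ c₂} → c ⟶[ a ] c₁ → c₁ ⟶[ b ] c₂ → c ⟶[ a + b ] c₂
    _then_ {a} {b} {c} (steps refl) (steps q) = steps (trans (run-+ a b c) q)

    go1 : ∀ {p ι code R M} → At P p (ι ∷ code) → ⟨ p , R , M ⟩ ⟶[ 1 ] exec w ι ⟨ p , R , M ⟩
    go1 {p} {ι} {R = R} {M} a = steps lemma
      where
      lemma : step w P ⟨ p , R , M ⟩ ≡ exec w ι ⟨ p , R , M ⟩
      lemma with fetch P p | At-fetch a
      ... | just _ | refl = refl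

    at : ∀ {t c p q R M} → p ≡ q → c ⟶[ t ] ⟨ p , R , M ⟩ → c ⟶[ t ] ⟨ q , R , M ⟩
    at refl e = e

    taking : ∀ {t u c c′} → t ≡ u → c ⟶[ t ] c′ → c ⟶[ u ] c′
    taking refl e = e

    trunc-id : ∀ {v} → v < 2 ^ w → trunc w v ≡ v
    trunc-id v< = m<n⇒m%n≡m {{m^n≢0 2 w}} v<

  -- K machine steps are charged per tick of the clock of the structured language.
  module Soundness (w X : ℕ) (P : Program) (K : ℕ) (100≤K : 100 ≤ K) (32≤ : 32 ≤ 2 ^ w) (fits : nA * X ≤ 2 ^ w) where
    open Logic w X
    open Machine w P

    record Sim (σ : State) (R M : ℕ → ℕ) : Set where
      field
        reg-var : ∀ x → x < nV → R x ≡ var σ x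
        reg-X   : R nV ≡ X
        var<    : ∀ x → x < nV → var σ x < 2 ^ w
        mem-arr : ∀ j y → j < nA → y < X → M (j * X + y) ≡ arr σ j y
        arr<    : ∀ j y → j < nA → y < X → arr σ j y < 2 ^ w
    open Sim public

    Sim-ext : ∀ {σ τ R M} → (∀ y → var τ y ≡ var σ y) → (∀ j y → arr τ j y ≡ arr σ j y) → Sim σ R M → Sim τ R M
    Sim-ext f g S = record
      { reg-var = λ x x< → trans (reg-var S x x<) (sym (f x))
      ; reg-X   = reg-X S
      ; var<    = λ x x< → subst (_< 2 ^ w) (sym (f x)) (var< S x x<)
      ; mem-arr = λ j y j< y< → trans (mem-arr S j y j< y<) (sym (g j y))
      ; arr<    = λ j y j< y< → subst (_< 2 ^ w) (sym (g j y)) (arr< S j y j< y<) }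

    Sim-regs : ∀ {σ R R′ M t} → nV < t → (∀ r → r < t → R′ r ≡ R r) → Sim σ R M → Sim σ R′ M
    Sim-regs nV< f S = record
      { reg-var = λ x x< → trans (f x (<-trans x< nV<)) (reg-var S x x<)
      ; reg-X   = trans (f nV nV<) (reg-X S)
      ; var<    = var< S
      ; mem-arr = mem-arr S
      ; arr<    = arr< S }

    small< : ∀ {c} → T (c <ᵇ 32) → c < 2 ^ w
    small< {c} h = ≤-trans (<ᵇ⇒< c 32 h) 32≤

    address : ∀ {j y} → j < nA → y < X → j * X + y < 2 ^ w
    address {j} {y} j< y< = ≤-trans (+-monoʳ-< (j * X) y<) (≤-trans (≤-trans (≤-reflexive (+-comm (j * X) X)) (*-monoˡ-≤ X j<)) fits)

    val< : ∀ e {σ R M} → Sim σ R M → safe e σ → wfE e → val e σ < 2 ^ w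
    val< (` x)     S sf wfe = var< S x (<ᵇ⇒< x nV wfe)
    val< (# c)     S sf wfe = small< wfe
    val< (a ⊕ b)   S (_ , _ , h) wfe = h
    val< (a ⊗ b)   S (_ , _ , h) wfe = h
    val< (a ⊖ b)   S (sa , _ , h) (wa , _) = ≤-<-trans (m∸n≤m (val a _) (val b _)) (val< a S sa wa)
    val< (a ⊘ b)   S (sa , _) (wa , _) = ≤-<-trans (m/n≤m (val a _) (suc (val b _))) (val< a S sa wa)
    val< (j ⟦ a ⟧) S (sa , h) (j< , _) = arr< S j _ (<ᵇ⇒< j nA j<) h

    -- The registers from `t` on act as an evaluation stack. Everything below `t` survives: all
    -- variables, and also a first operand left in `t` while the second one is computed from `suc t`
    -- on.
    EOut : Expr → ℕ → ℕ → (R M : ℕ → ℕ) → State → Set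
    EOut e t p R M σ = ∃ λ R′ → (⟨ p , R , M ⟩ ⟶[ lenE e ] ⟨ p + lenE e , R′ , M ⟩) × R′ t ≡ val e σ × (∀ r → r < t → R′ r ≡ R r)

    shr0 : ∀ a {b} → b ≡ 0 → eval w shr a b ≡ a
    shr0 a refl = n/1≡n a

    trunc0 : trunc w 0 ≡ 0
    trunc0 = trunc-id (≤-trans (s≤s z≤n) 32≤)

    eval-sub : ∀ {a b} → a < 2 ^ w → b ≤ a → eval w sub a b ≡ a ∸ b
    eval-sub {a} {b} a< b≤a =
      trans (cong (trunc w) eq) (trans ([m+n]%n≡m%n (a ∸ b) (2 ^ w) {{m^n≢0 2 w}}) (trunc-id (≤-<-trans (m∸n≤m a b) a<)))
      where
      eq : a + (2 ^ w ∸ b) ≡ (a ∸ b) + 2 ^ w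
      eq = trans (sym (+-∸-assoc a (≤-trans b≤a (<⇒≤ a<)))) (+-∸-comm (2 ^ w) b≤a)

    -- The divisor 1 + b wraps around to 0 exactly when it exceeds every word.
    eval-div : ∀ {a b} → a < 2 ^ w → b < 2 ^ w → eval w div a (eval w add b 1) ≡ a / suc b
    eval-div {a} {b} a< b< with m≤n⇒m<n∨m≡n b<
    ... | inj₁ lt rewrite +-comm b 1 | trunc-id lt = refl
    ... | inj₂ eq = trans (cong (eval w div a) (trans (cong (trunc w) (trans (+-comm b 1) eq)) (n%n≡0 (2 ^ w) {{m^n≢0 2 w}})))
                          (sym (m<n⇒m/n≡0 (subst (a <_) (sym eq) a<)))

    pos2 : ∀ p a b → suc (p + a + b) ≡ p + (a + b + 1)
    pos2 = solve 3 (λ p a b → con 1 :+ (p :+ a :+ b) := p :+ (a :+ b :+ con 1)) refl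

    expr : ∀ e {t p R M σ} → At P p (compE e t) → nV < t → Sim σ R M → safe e σ → wfE e → EOut e t p R M σ

    binary : ∀ o a b {t p R M σ} → At P p (compE a t ++ compE b (suc t) ++ arith o t t (suc t) ∷ []) → nV < t →
      Sim σ R M → safe a σ → safe b σ → wfE a → wfE b →
      ∃ λ R′ → (⟨ p , R , M ⟩ ⟶[ lenE a + lenE b + 1 ] ⟨ p + (lenE a + lenE b + 1) , R′ , M ⟩) ×
        R′ t ≡ eval w o (val a σ) (val b σ) × (∀ r → r < t → R′ r ≡ R r)
    binary o a b {t} {p} {R} {M} {σ} c nV< S sa sb wa wb
      with expr a (At-++ˡ (compE a t) c) nV< S sa wa
    ... | R₁ , run₁ , v₁ , f₁
      with expr b (At-++ˡ (compE b (suc t)) (At-++ʳ (len-compE a t) c)) (<-trans nV< ≤-refl) (Sim-regs nV< f₁ S) sb wb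
    ... | R₂ , run₂ , v₂ , f₂ =
      R₂ [ t ↦ eval w o (R₂ t) (R₂ (suc t)) ] ,
      at (pos2 p (lenE a) (lenE b)) ((run₁ then run₂) then go1 (At-++ʳ (len-compE b (suc t)) (At-++ʳ (len-compE a t) c))) ,
      trans (upd-same R₂ t _) (cong₂ (eval w o) (trans (f₂ t ≤-refl) v₁) v₂) ,
      λ r r< → trans (upd-< R₂ _ r<) (trans (f₂ r (m<n⇒m<1+n r<)) (f₁ r r<))

    expr (` x) {t} {p} {R} {M} {σ} c nV< S sf wfe =
      R₂ , at (+-comm 2 p) (go1 c then go1 (At-tail c)) ,
      trans (upd-same R₁ t _) (trans (shr0 (R₁ x) (trans (upd-same R t _) trunc0)) (trans (upd-< R _ x<t) (reg-var S x x<))) ,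
      λ r r< → trans (upd-< R₁ _ r<) (upd-< R _ r<)
      where
      x< = <ᵇ⇒< x nV wfe
      x<t = <-trans x< nV<
      R₁ = R [ t ↦ trunc w 0 ]
      R₂ = R₁ [ t ↦ eval w shr (R₁ x) (R₁ t) ]
    expr (# k) {t} {p} {R} c nV< S sf wfe =
      R [ t ↦ trunc w k ] , at (+-comm 1 p) (go1 c) , trans (upd-same R t _) (trunc-id (small< wfe)) , λ r r< → upd-< R _ r<
    expr (a ⊕ b) c nV< S (sa , sb , h) (wa , wb) with binary add a b c nV< S sa sb wa wb
    ... | R′ , r , v , f = R′ , r , trans v (trunc-id h) , f
    expr (a ⊗ b) c nV< S (sa , sb , h) (wa , wb) with binary mul a b c nV< S sa sb wa wb
    ... | R′ , r , v , f = R′ , r , trans v (trunc-id h) , f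
    expr (a ⊖ b) c nV< S (sa , sb , h) (wa , wb) with binary sub a b c nV< S sa sb wa wb
    ... | R′ , r , v , f = R′ , r , trans v (eval-sub (val< a S sa wa) h) , f
    expr (a ⊘ b) {t} {p} {R} {M} {σ} c nV< S (sa , sb) (wa , wb)
      with expr a (At-++ˡ (compE a t) c) nV< S sa wa
    ... | R₁ , run₁ , v₁ , f₁
      with expr b (At-++ˡ (compE b (suc t)) (At-++ʳ (len-compE a t) c)) (<-trans nV< ≤-refl) (Sim-regs nV< f₁ S) sb wb
    ... | R₂ , run₂ , v₂ , f₂ = R₅ ,
      at (pos p (lenE a) (lenE b)) ((run₁ then run₂) then (go1 c₁ then (go1 (At-tail c₁) then go1 (At-tail (At-tail c₁))))) ,
      trans (upd-same R₄ t _) (trans (cong₂ (eval w div) e₁ e₂) (eval-div (val< a S sa wa) (val< b S sb wb))) ,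
      λ r r< → trans (upd-< R₄ _ r<) (trans (upd-< R₃ _ (m<n⇒m<1+n r<)) (trans (upd-< R₂ _ (m<n⇒m<1+n (m<n⇒m<1+n r<)))
                 (trans (f₂ r (m<n⇒m<1+n r<)) (f₁ r r<))))
      where
      c₁ = At-++ʳ (len-compE b (suc t)) (At-++ʳ (len-compE a t) c)
      R₃ = R₂ [ 2 + t ↦ trunc w 1 ]
      R₄ = R₃ [ suc t ↦ eval w add (R₃ (suc t)) (R₃ (2 + t)) ]
      R₅ = R₄ [ t ↦ eval w div (R₄ t) (R₄ (suc t)) ]
      e₁ : R₄ t ≡ val a σ
      e₁ = trans (upd-< R₃ _ ≤-refl) (trans (upd-< R₂ _ (m<n⇒m<1+n ≤-refl)) (trans (f₂ t ≤-refl) v₁))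
      e₂ : R₄ (suc t) ≡ eval w add (val b σ) 1
      e₂ = trans (upd-same R₃ (suc t) _) (cong₂ (eval w add) (trans (upd-< R₂ _ ≤-refl) v₂)
             (trans (upd-same R₂ (2 + t) _) (trunc-id (small< _))))
      pos : ∀ p a b → suc (suc (suc (p + a + b))) ≡ p + (a + b + 3)
      pos = solve 3 (λ p a b → con 3 :+ (p :+ a :+ b) := p :+ (a :+ b :+ con 3)) refl
    expr (j ⟦ a ⟧) {t} {p} {R} {M} {σ} c nV< S (sa , y<) (j<ᵇ , wa)
      with expr a (At-++ˡ (compE a t) c) nV< S sa wa
    ... | R₁ , run₁ , v₁ , f₁ = R₅ ,
      at (pos p (lenE a)) (run₁ then go1 c₁ then (go1 (At-tail c₁) then (go1 (At-tail (At-tail c₁)) then go1 (At-tail (At-tail (At-tail c₁)))))) ,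
      trans (upd-same R₄ t _) (trans (cong M e₃) (mem-arr S j _ j< y<)) ,
      λ r r< → trans (upd-< R₄ _ r<) (trans (upd-< R₃ _ r<) (trans (upd-< R₂ _ (m<n⇒m<1+n r<))
                 (trans (upd-< R₁ _ (m<n⇒m<1+n r<)) (f₁ r r<))))
      where
      j< = <ᵇ⇒< j nA j<ᵇ
      c₁ = At-++ʳ (len-compE a t) c
      R₂ = R₁ [ suc t ↦ trunc w j ]
      R₃ = R₂ [ suc t ↦ eval w mul (R₂ (suc t)) (R₂ nV) ]
      R₄ = R₃ [ t ↦ eval w add (R₃ t) (R₃ (suc t)) ]
      R₅ = R₄ [ t ↦ M (R₄ t) ]
      e₁ : R₃ (suc t) ≡ j * X
      e₁ = trans (upd-same R₂ (suc t) _) (trans (cong (trunc w) (cong₂ _*_ (trans (upd-same R₁ (suc t) _) (trunc-id (≤-trans j< (≤-trans (≤ᵇ⇒≤ nA 32 _) 32≤))))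
             (trans (upd-< R₁ _ (m<n⇒m<1+n nV<)) (trans (f₁ nV nV<) (reg-X S)))))
             (trunc-id (≤-<-trans (m≤m+n (j * X) (val a σ)) (address j< y<))))
      e₃ : R₄ t ≡ j * X + val a σ
      e₃ = trans (upd-same R₃ t _) (trans (cong (trunc w) (trans (cong₂ _+_ (trans (upd-< R₂ _ ≤-refl) (trans (upd-< R₁ _ ≤-refl) v₁)) e₁) (+-comm (val a σ) (j * X))))
             (trunc-id (address j< y<)))
      pos : ∀ p a → suc (suc (suc (suc (p + a)))) ≡ p + (a + 4)
      pos = solve 2 (λ p a → con 4 :+ (p :+ a) := p :+ (a :+ con 4)) refl

    Sim-setV : ∀ {σ R R′ M x v} → v < 2 ^ w → R′ x ≡ v → (∀ y → y < suc nV → y ≢ x → R′ y ≡ R y) → x < nV → Sim σ R M → Sim (setV x v σ) R′ M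
    Sim-setV {σ} {R} {R′} {M} {x} {v} v< e f x< S = record
      { reg-var = rv
      ; reg-X   = trans (f nV ≤-refl (<⇒≢ x< ∘ sym)) (reg-X S)
      ; var<    = vb
      ; mem-arr = mem-arr S
      ; arr<    = arr< S }
      where
      rv : ∀ y → y < nV → R′ y ≡ (var σ [ x ↦ v ]) y
      rv y y< with y ≟ x
      ... | yes refl = trans e (sym (upd-same (var σ) x v))
      ... | no y≢x   = trans (f y (m<n⇒m<1+n y<) y≢x) (trans (reg-var S y y<) (sym (upd-other (var σ) v y≢x)))
      vb : ∀ y → y < nV → (var σ [ x ↦ v ]) y < 2 ^ w
      vb y y< with y ≟ x
      ... | yes refl = subst (_< 2 ^ w) (sym (upd-same (var σ) x v)) v<
      ... | no y≢x   = subst (_< 2 ^ w) (sym (upd-other (var σ) v y≢x)) (var< S y y<)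

    assign : ∀ x e {p R M σ} → At P p (compA x e) → Sim σ R M → safe e σ → wfE e → x < nV →
      ∃ λ R′ → (⟨ p , R , M ⟩ ⟶[ lenA x e ] ⟨ p + lenA x e , R′ , M ⟩) × Sim (setV x (val e σ) σ) R′ M
    assign x e {p} {R} {M} {σ} c S sf wfe x< with expr e (At-++ˡ (compE e (suc nV)) c) ≤-refl S sf wfe
    ... | R₁ , run₁ , v₁ , f₁ = R₃ ,
      at (pos p (lenE e)) (run₁ then (go1 c₁ then go1 (At-tail c₁))) ,
      Sim-setV (val< e S sf wfe) e₃ (λ y y< y≢x → trans (upd-other R₂ _ y≢x) (trans (upd-< R₁ _ (m<n⇒m<1+n y<)) (f₁ y y<))) x< S
      where
      c₁ = At-++ʳ (len-compE e (suc nV)) c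
      R₂ = R₁ [ 2 + nV ↦ trunc w 0 ]
      R₃ = R₂ [ x ↦ eval w shr (R₂ (suc nV)) (R₂ (2 + nV)) ]
      e₃ : R₃ x ≡ val e σ
      e₃ = trans (upd-same R₂ x _) (trans (shr0 (R₂ (suc nV)) (trans (upd-same R₁ (2 + nV) _) trunc0)) v₁)
      pos : ∀ p a → suc (suc (p + a)) ≡ p + (a + 2)
      pos = solve 2 (λ p a → con 2 :+ (p :+ a) := p :+ (a :+ con 2)) refl

    operands : ∀ a b {p R M σ rest} → At P p (compE a (suc nV) ++ compE b (2 + nV) ++ rest) → Sim σ R M →
      safe a σ → safe b σ → wfE a → wfE b →
      ∃ λ R′ → (⟨ p , R , M ⟩ ⟶[ lenE a + lenE b ] ⟨ p + lenE a + lenE b , R′ , M ⟩) × Sim σ R′ M ×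
        R′ (suc nV) ≡ val a σ × R′ (2 + nV) ≡ val b σ × At P (p + lenE a + lenE b) rest
    operands a b {p} {R} {M} {σ} c S sa sb wa wb
      with expr a (At-++ˡ (compE a (suc nV)) c) ≤-refl S sa wa
    ... | R₁ , run₁ , v₁ , f₁
      with expr b (At-++ˡ (compE b (2 + nV)) (At-++ʳ (len-compE a (suc nV)) c)) (m<n⇒m<1+n ≤-refl) (Sim-regs ≤-refl f₁ S) sb wb
    ... | R₂ , run₂ , v₂ , f₂ = R₂ , run₁ then run₂ , Sim-regs (m<n⇒m<1+n ≤-refl) f₂ (Sim-regs ≤-refl f₁ S) ,
      trans (f₂ (suc nV) ≤-refl) v₁ , v₂ , At-++ʳ (len-compE b (2 + nV)) (At-++ʳ (len-compE a (suc nV)) c)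

    COut : Cond → ℕ → ℕ → (R M : ℕ → ℕ) → State → Set
    COut c l p R M σ = ∃ λ R′ → Sim σ R′ M ×
      ((holds c σ × (⟨ p , R , M ⟩ ⟶[ lenC c ] ⟨ l , R′ , M ⟩)) ⊎ (fails c σ × (⟨ p , R , M ⟩ ⟶[ lenC c ] ⟨ p + lenC c , R′ , M ⟩)))

    branch : ∀ {c t l p R M} {β β′ : Bool} → β ≡ β′ → c ⟶[ t ] ⟨ (if β then l else p) , R , M ⟩ →
      (β′ ≡ true × (c ⟶[ t ] ⟨ l , R , M ⟩)) ⊎ (β′ ≡ false × (c ⟶[ t ] ⟨ p , R , M ⟩))
    branch {β = true}  refl r = inj₁ (refl , r)
    branch {β = false} refl r = inj₂ (refl , r)

    cond : ∀ c l {p R M σ} → At P p (compC c l) → Sim σ R M → safeC c σ → wfC c → COut c l p R M σ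
    cond (a ≺ b) l {p} {σ = σ} cd S (sa , sb) ((_ , wa) , (_ , wb)) with operands a b cd S sa sb wa wb
    ... | R₂ , run₂ , S₂ , v₁ , v₂ , c₂ with branch (cong₂ _<ᵇ_ v₁ v₂) (run₂ then go1 c₂)
    ... | inj₁ (eq , r) = R₂ , S₂ , inj₁ (<ᵇ⇒< _ _ (subst T (sym eq) tt) , r)
    ... | inj₂ (eq , r) = R₂ , S₂ , inj₂ (≮⇒≥ (λ lt → subst T eq (<⇒<ᵇ lt)) , at (pos2 p (lenE a) (lenE b)) r)
    cond (a ≐ b) l {p} {σ = σ} cd S (sa , sb) ((_ , wa) , (_ , wb)) with operands a b cd S sa sb wa wb
    ... | R₂ , run₂ , S₂ , v₁ , v₂ , c₂ with branch (cong₂ _≡ᵇ_ v₁ v₂) (run₂ then go1 c₂)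
    ... | inj₁ (eq , r) = R₂ , S₂ , inj₁ (≡ᵇ⇒≡ _ _ (subst T (sym eq) tt) , r)
    ... | inj₂ (eq , r) = R₂ , S₂ , inj₂ (≡ᵇ-false eq , at (pos2 p (lenE a) (lenE b)) r)

    record Out (s : Stmt) (Q : State → Set) (σ : State) (p : ℕ) (R M : ℕ → ℕ) : Set where
      constructor out
      field
        {time}   : ℕ
        {R′ M′}  : ℕ → ℕ
        {σ′}     : State
        moves    : ⟨ p , R , M ⟩ ⟶[ time ] ⟨ p + lenS s , R′ , M′ ⟩
        sim      : Sim σ′ R′ M′
        post     : Q σ′
        frame    : Frame s σ σ′
        cost     : time + K * clk σ ≤ K * clk σ′

    -- The longest fragment without a loop that is charged to one tick is an array assignment, with
    -- at most 64 instructions since its two expressions are `short`; 100 leaves a margin.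
    one-tick : ∀ {t} c → t ≤ 100 → t + K * c ≤ K * suc c
    one-tick c t≤ = ≤-trans (+-monoˡ-≤ (K * c) (≤-trans t≤ 100≤K)) (≤-reflexive (sym (*-suc K c)))

    short≤ : ∀ e → short e → lenE e ≤ 30
    short≤ e (h , _) = ≤ᵇ⇒≤ (lenE e) 30 h

    short2≤ : ∀ a b k → short a → short b → lenE a + lenE b + k ≤ 60 + k
    short2≤ a b k sa sb = +-monoˡ-≤ k (+-mono-≤ (short≤ a sa) (short≤ b sb))

    lenC≤ : ∀ c → wfC c → lenC c ≤ 61
    lenC≤ (a ≺ b) (sa , sb) = short2≤ a b 1 sa sb
    lenC≤ (a ≐ b) (sa , sb) = short2≤ a b 1 sa sb

    setV-frame : ∀ {x v σ} y → (y ≡ᵇ x) ≡ false → var (setV x v σ) y ≡ var σ y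
    setV-frame y h rewrite h = refl

    setA-frame : ∀ {i a v σ} j → (j ≡ᵇ i) ≡ false → ∀ y → arr (setA i a v σ) j y ≡ arr σ j y
    setA-frame j h y rewrite h = refl

    -- Uniqueness of quotient and remainder modulo `X`. It makes arrays disjoint, so that a store
    -- changes a single cell of a single array.
    address-injective : ∀ {i j a b} → a < X → b < X → i * X + a ≡ j * X + b → i ≡ j × a ≡ b
    address-injective {zero}  {zero}  a< b< e = refl , e
    address-injective {zero}  {suc j} {a} {b} a< b< e = ⊥-elim (<-irrefl refl (<-≤-trans a< (≤-trans (m≤m+n X (j * X + b)) (≤-reflexive (trans (sym (+-assoc X (j * X) b)) (sym e))))))
    address-injective {suc i} {zero}  {a} {b} a< b< e = ⊥-elim (<-irrefl refl (<-≤-trans b< (≤-trans (m≤m+n X (i * X + a)) (≤-reflexive (trans (sym (+-assoc X (i * X) a)) e)))))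
    address-injective {suc i} {suc j} {a} {b} a< b< e
      with address-injective {i} {j} a< b< (+-cancelˡ-≡ X _ _ (trans (sym (+-assoc X (i * X) a)) (trans e (+-assoc X (j * X) b))))
    ... | refl , e′ = refl , e′

    Sim-setA : ∀ {σ R M i a v} → i < nA → a < X → v < 2 ^ w → Sim σ R M → Sim (setA i a v σ) R (M [ i * X + a ↦ v ])
    Sim-setA {σ} {R} {M} {i} {a} {v} i< a< v< S = record
      { reg-var = reg-var S ; reg-X = reg-X S ; var< = var< S
      ; mem-arr = λ j y j< y< → proj₁ (both j y j< y<)
      ; arr<    = λ j y j< y< → proj₂ (both j y j< y<) }
      where
      both : ∀ j y → j < nA → y < X → (M [ i * X + a ↦ v ]) (j * X + y) ≡ arr (setA i a v σ) j y × arr (setA i a v σ) j y < 2 ^ w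
      both j y j< y< with j ≡ᵇ i in eq
      ... | false = trans (upd-other M v (λ e → ≡ᵇ-false {j} {i} eq (proj₁ (address-injective {j} {i} y< a< e)))) (mem-arr S j y j< y<) , arr< S j y j< y<
      ... | true with ≡ᵇ⇒≡ j i (subst T (sym eq) tt)
      ... | refl with y ≟ a
      ... | yes refl rewrite upd-same (arr σ i) a v = upd-same M _ v , v<
      ... | no y≢a rewrite upd-other (arr σ i) v y≢a =
        trans (upd-other M v (λ e → y≢a (proj₂ (address-injective {j} {j} y< a< e)))) (mem-arr S j y j< y<) , arr< S j y j< y<

    merge-var : ∀ s {σ τ} → Frame s σ τ → ∀ y → var (merge s σ τ) y ≡ var τ y
    merge-var s (f , _) y with writesV s y in eq
    ... | true  = refl
    ... | false = sym (f y eq)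

    merge-arr : ∀ s {σ τ} → Frame s σ τ → ∀ j y → arr (merge s σ τ) j y ≡ arr τ j y
    merge-arr s (_ , g) j y with writesA s j in eq
    ... | true  = refl
    ... | false = sym (g j eq y)

    merge-Frame : ∀ s {σ τ} → Frame s σ (merge s σ τ)
    merge-Frame s {σ} {τ} = f , g
      where
      f : ∀ y → writesV s y ≡ false → var (merge s σ τ) y ≡ var σ y
      f y h rewrite h = refl
      g : ∀ j → writesA s j ≡ false → ∀ y → arr (merge s σ τ) j y ≡ arr σ j y
      g j h y rewrite h = refl

    entry-cost : ∀ c → c + 10 ≤ 100 → ∀ {t a b} → t + K * suc a ≤ b + 10 → c + t + K * a ≤ b
    entry-cost c c≤ {t} {a} {b} h = +-cancelʳ-≤ 10 _ _ (≤-trans (≤-reflexive (solve 3 (λ c t a → c :+ t :+ a :+ con 10 := t :+ (c :+ con 10 :+ a)) refl c t (K * a)))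
      (≤-trans (+-monoʳ-≤ t (one-tick a c≤)) h))

    iteration-cost : ∀ c → c ≤ 100 → ∀ {t₂ t₄ a b d} → t₂ + a ≤ K * b → t₄ + K * suc b ≤ d → c + (t₂ + t₄) + a ≤ d
    iteration-cost c c≤ {t₂} {t₄} {a} {b} h₁ h₂ = ≤-trans (≤-reflexive (solve 4 (λ c t u a → c :+ (t :+ u) :+ a := u :+ (c :+ (t :+ a))) refl c t₂ t₄ a))
      (≤-trans (+-monoʳ-≤ t₄ (≤-trans (+-monoʳ-≤ c h₁) (one-tick b c≤))) h₂)

    -- The run starts at the loop test, and the tick of the coming round, or of the exit, is already
    -- counted on the left as `suc (clk τ)`. The slack 10 pays for the final test and jump, and
    -- `entry-cost` takes it, together with the code before the loop, from the first tick.
    record LoopOut (s : Stmt) (Q : State → Set) (σ τ : State) (p p₁ : ℕ) (R M : ℕ → ℕ) : Set where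
      constructor out
      field
        {time}   : ℕ
        {R′ M′}  : ℕ → ℕ
        {σ′}     : State
        moves    : ⟨ p₁ , R , M ⟩ ⟶[ time ] ⟨ p + lenS s , R′ , M′ ⟩
        sim      : Sim σ′ R′ M′
        post     : Q σ′
        frame    : Frame s σ σ′
        cost     : time + K * suc (clk τ) ≤ K * clk σ′ + 10

    sound : ∀ s {Q p R M σ} → At P p (compS p s) → wf s → Sim σ R M → wp s Q σ → Out s Q σ p R M

    -- The induction on the remaining rounds begins at the test, because this is where the backward
    -- jump lands.
    forLoop : ∀ x b s {Q p σ} → At P p (compS p (for x b s)) → wf (for x b s) →
      ∀ k i τ {R M} → k + i ≡ var σ b → Sim (forSt x b s σ i τ) R M → iterFor (wp s) (forSt x b s σ) Q k i τ →
      LoopOut (for x b s) Q σ τ p (p + lenA x (# 0)) R M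
    forLoop x b s {Q} {p} {σ} cd (x<ᵇ , b<ᵇ , nx , nb , wfs) = loop
      where
      x< = <ᵇ⇒< x nV x<ᵇ
      b< = <ᵇ⇒< b nV b<ᵇ
      p₁ = p + lenA x (# 0)
      l = suc (p₁ + lenC (` x ≺ ` b))
      cTest = At-++ʳ (len-compA x (# 0)) cd
      cJump = At-++ʳ (len-compC (` x ≺ ` b) l) cTest
      cBody = At-tail cJump
      cInc  = At-++ʳ (len-compS s l) cBody
      cBack = At-++ʳ (len-compA x (inc x)) cInc
      b≢x = proj₁ (∨-false {b ≡ᵇ x} (false-not nb))
      pos-end : suc (l + lenS s + lenA x (inc x)) ≡ p + lenS (for x b s)
      pos-end = solve 5 (λ p a b c d → con 1 :+ (con 1 :+ (p :+ a :+ b) :+ c :+ d) := p :+ (a :+ (b :+ (con 1 :+ (c :+ (d :+ con 1)))))) refl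
                  p (lenA x (# 0)) (lenC (` x ≺ ` b)) (lenS s) (lenA x (inc x))
      at-x : ∀ i τ → var (forSt x b s σ i τ) x ≡ i
      at-x i τ = upd-same (var (merge (for x b s) σ τ)) x i
      at-b : ∀ i τ → var (forSt x b s σ i τ) b ≡ var σ b
      at-b i τ rewrite b≢x | proj₂ (∨-false {b ≡ᵇ x} (false-not nb)) = refl
      forFrame : ∀ i τ → Frame (for x b s) σ (forSt x b s σ i τ)
      forFrame i τ = f , λ j h y → proj₂ (merge-Frame (for x b s) {σ} {τ}) j h y
        where
        f : ∀ y → writesV (for x b s) y ≡ false → var (forSt x b s σ i τ) y ≡ var σ y
        f y h with ∨-false {y ≡ᵇ x} h
        ... | h₁ , h₂ rewrite h₁ | h₂ = refl
      -- The code increments whatever `x` holds after the body, whereas `forSt` sets `x` to `suc i`;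
      -- they agree because the body does not write `x`.
      next-var : ∀ i τ τ′ → Frame s (forSt x b s σ i τ) τ′ → ∀ y → var (forSt x b s σ (suc i) τ′) y ≡ var (setV x (suc (var τ′ x)) τ′) y
      next-var i τ τ′ (f , _) y with y ≡ᵇ x in eq | writesV s y in eq₂
      ... | true  | _     = cong suc (sym (trans (f x (false-not nx)) (at-x i τ)))
      ... | false | true  = refl
      ... | false | false = sym (trans (f y eq₂) (proj₁ (forFrame i τ) y (cong₂ _∨_ eq eq₂)))
      next-arr : ∀ i τ τ′ → Frame s (forSt x b s σ i τ) τ′ → ∀ j y → arr (forSt x b s σ (suc i) τ′) j y ≡ arr τ′ j y
      next-arr i τ τ′ (_ , g) j y with writesA s j in eq
      ... | true  = refl
      ... | false = sym (trans (g j eq y) (proj₂ (forFrame i τ) j eq y))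

      loop : ∀ k i τ {R M} → k + i ≡ var σ b → Sim (forSt x b s σ i τ) R M → iterFor (wp s) (forSt x b s σ) Q k i τ →
        LoopOut (for x b s) Q σ τ p p₁ R M
      loop k i τ eq S it with cond (` x ≺ ` b) l (At-++ˡ (compC (` x ≺ ` b) l) cTest) S _ ((_ , x<ᵇ) , (_ , b<ᵇ))
      loop zero i τ eq S it | R₁ , S₁ , inj₁ (h , _) = ⊥-elim (<-irrefl (trans eq (sym (at-b i τ))) (subst (_< var (forSt x b s σ i τ) b) (at-x i τ) h))
      loop zero i τ eq S it | R₁ , S₁ , inj₂ (h , r) =
        out (at pos-end (r then go1 cJump)) S₁ it (forFrame i τ) (≤-trans (+-monoˡ-≤ (K * suc (clk τ)) (≤ᵇ⇒≤ 6 10 _)) (≤-reflexive (+-comm 10 (K * suc (clk τ)))))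
      loop (suc k) i τ eq S it | R₁ , S₁ , inj₂ (h , _) =
        ⊥-elim (<-irrefl (sym eq) (s≤s (≤-trans (subst₂ _≤_ (at-b i τ) (at-x i τ) h) (m≤n+m i k))))
      loop (suc k) i τ eq S it | R₁ , S₁ , inj₁ (h , r)
        with sound s (At-++ˡ (compS l s) cBody) wfs S₁ it
      ... | out {t₂} {R₂} {M₂} {τ′} r₂ S₂ it₂ fr₂ cost₂
        with assign x (inc x) (At-++ˡ (compA x (inc x)) cInc) S₂
               (_ , _ , ≤-<-trans (≤-trans (≤-reflexive (cong suc (trans (proj₁ fr₂ x (false-not nx)) (at-x i τ))))
                          (≤-trans (s≤s (m≤n+m i k)) (≤-reflexive (trans eq (sym (at-b i τ)))))) (var< S b b<)) (_ , x<ᵇ) x<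
      ... | R₃ , r₃ , S₃
        with loop k (suc i) τ′ (trans (+-suc k i) eq) (Sim-ext (next-var i τ τ′ fr₂) (next-arr i τ τ′ fr₂) S₃) it₂
      ... | out {t₄} r₄ S₄ post fr cost₄ =
        out (taking (solve 2 (λ t u → (con 5 :+ t) :+ (con 7 :+ u) := con 12 :+ (t :+ u)) refl t₂ t₄) ((r then r₂) then (r₃ then (go1 cBack then r₄))))
          S₄ post fr (iteration-cost 12 (≤ᵇ⇒≤ 12 100 _) {t₂} cost₂ cost₄)

    walkLoop : ∀ q j h nx s {Q p σ} → At P p (compS p (walk q j h nx s)) → wf (walk q j h nx s) →
      ∀ ys v τ {R M} → Chain (arr σ nx) v ys → All (_< X) ys → Frame (walk q j h nx s) σ τ → Sim (setV q v τ) R M →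
      iterWalk (wp s) (walkSt q j h nx s σ) (walkEnd q j h nx s σ) Q ys τ →
      LoopOut (walk q j h nx s) Q σ τ p (p + lenA q h) R M
    walkLoop q j h nx s {Q} {p} {σ} cd (q<ᵇ , j<ᵇ , nx<ᵇ , (hlen , hwf) , q≢j , nq , nj , nnx , wfs) = loop
      where
      W = walk q j h nx s
      q< = <ᵇ⇒< q nV q<ᵇ
      j< = <ᵇ⇒< j nV j<ᵇ
      p₁ = p + lenA q h
      l = suc (p₁ + lenC (# 0 ≺ ` q))
      l₁ = l + lenA j (pred′ q) + lenA q (next′ j nx)
      cTest = At-++ʳ (len-compA q h) cd
      cJump = At-++ʳ (len-compC (# 0 ≺ ` q) l) cTest
      cPred = At-tail cJump
      cNext = At-++ʳ (len-compA j (pred′ q)) cPred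
      cBody = At-++ʳ (len-compA q (next′ j nx)) cNext
      cBack = At-++ʳ (len-compS s l₁) cBody
      pos-end : suc (l₁ + lenS s) ≡ p + lenS W
      pos-end = solve 6 (λ p a b c d e → con 1 :+ (con 1 :+ (p :+ a :+ b) :+ c :+ d :+ e) := p :+ (a :+ (b :+ (con 1 :+ (c :+ (d :+ (e :+ con 1))))))) refl
                  p (lenA q h) (lenC (# 0 ≺ ` q)) (lenA j (pred′ q)) (lenA q (next′ j nx)) (lenS s)
      nx-kept : ∀ {τ} → Frame W σ τ → ∀ y → arr τ nx y ≡ arr σ nx y
      nx-kept (_ , g) = g nx (false-not nnx)
      q≢ : q ≢ j
      q≢ = ≡ᵇ-false (false-not q≢j)
      others : ∀ y → writesV W y ≡ false → (y ≡ᵇ q) ≡ false × (y ≡ᵇ j) ≡ false × writesV s y ≡ false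
      others y e with ∨-false {y ≡ᵇ q} e
      ... | a , b with ∨-false {y ≡ᵇ j} b
      ... | c , d = a , c , d
      merged : ∀ z τ → (z ≡ᵇ q) ≡ false → (z ≡ᵇ j) ≡ false → Frame W σ τ → (if writesV s z then var τ z else var σ z) ≡ var τ z
      merged z τ e₁ e₂ (f , _) with writesV s z in eq
      ... | true  = refl
      ... | false = sym (f z (cong₂ _∨_ e₁ (cong₂ _∨_ e₂ eq)))
      body-frame : ∀ {y τ τ′} → Frame s (walkSt q j h nx s σ y τ) τ′ → Frame W σ τ′
      body-frame {y} {τ} {τ′} (f , g) = f′ , g′
        where
        f′ : ∀ z → writesV W z ≡ false → var τ′ z ≡ var σ z
        f′ z e with others z e
        ... | a , b , c = trans (f z c) lemma
          where
          lemma : var (walkSt q j h nx s σ y τ) z ≡ var σ z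
          lemma rewrite b | a | c = refl
        g′ : ∀ i → writesA s i ≡ false → ∀ z → arr τ′ i z ≡ arr σ i z
        g′ i e z = trans (g i e z) (proj₂ (merge-Frame W {σ} {τ}) i e z)
      end-frame : ∀ {τ} → Frame W σ (walkEnd q j h nx s σ τ)
      end-frame {τ} = f , λ i e z → proj₂ (merge-Frame W {σ} {τ}) i e z
        where
        f : ∀ z → writesV W z ≡ false → var (walkEnd q j h nx s σ τ) z ≡ var σ z
        f z e with others z e
        ... | a , b , c rewrite a | b | c = refl
      end-var : ∀ {τ} → Frame W σ τ → ∀ z → var (walkEnd q j h nx s σ τ) z ≡ var (setV q 0 τ) z
      end-var {τ} fr z with z ≡ᵇ q in eq | z ≡ᵇ j in eq₂
      ... | true  | _     = refl
      ... | false | true  = refl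
      ... | false | false = merged z τ eq eq₂ fr
      entry-var : ∀ {y τ} → Frame W σ τ → ∀ a b → a ≡ y → b ≡ y → ∀ z →
        var (walkSt q j h nx s σ y τ) z ≡ var (setV q (arr τ nx b) (setV j a (setV q (suc y) τ))) z
      entry-var {y} {τ} fr a b refl refl z with z ≡ᵇ q in eq | z ≡ᵇ j in eq₂
      ... | true  | true  = contradiction (trans (sym (≡ᵇ⇒≡ z q (subst T (sym eq) tt))) (≡ᵇ⇒≡ z j (subst T (sym eq₂) tt))) q≢
      ... | true  | false = sym (nx-kept {τ} fr y)
      ... | false | true  = refl
      ... | false | false = merged z τ eq eq₂ fr
      next-var : ∀ {y τ τ′} → Frame s (walkSt q j h nx s σ y τ) τ′ → ∀ z → var (setV q (arr σ nx y) τ′) z ≡ var τ′ z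
      next-var {y} {τ} {τ′} fr₄ z with z ≟ q
      ... | no z≢q = upd-other (var τ′) _ z≢q
      ... | yes refl = trans (upd-same (var τ′) q _) (sym (trans (proj₁ fr₄ q (false-not nq)) (trans (upd-other (var (merge W σ τ) [ q ↦ arr σ nx y ]) {j} {q} y q≢) (upd-same (var (merge W σ τ)) q _))))

      loop : ∀ ys v τ {R M} → Chain (arr σ nx) v ys → All (_< X) ys → Frame W σ τ → Sim (setV q v τ) R M →
        iterWalk (wp s) (walkSt q j h nx s σ) (walkEnd q j h nx s σ) Q ys τ → LoopOut W Q σ τ p p₁ R M
      loop ys v τ ch bd fr S it with cond (# 0 ≺ ` q) l (At-++ˡ (compC (# 0 ≺ ` q) l) cTest) S _ (_ , (_ , q<ᵇ))
      loop [] v τ refl bd fr S it | R₁ , S₁ , inj₁ (lt , _) = ⊥-elim (<-irrefl refl (subst (0 <_) (upd-same (var τ) q 0) lt))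
      loop [] v τ refl bd fr S it | R₁ , S₁ , inj₂ (_ , r) =
        out (at pos-end (r then go1 cJump)) (Sim-ext (end-var {τ} fr) (merge-arr W {σ} {τ} fr) S₁) it (end-frame {τ})
          (≤-trans (+-monoˡ-≤ (K * suc (clk τ)) (≤ᵇ⇒≤ 5 10 _)) (≤-reflexive (+-comm 10 (K * suc (clk τ)))))
      loop (y ∷ ys) v τ (refl , ch) bd fr S it | R₁ , S₁ , inj₂ (le , _) = ⊥-elim (<-irrefl refl (<-≤-trans (s≤s z≤n) (subst (_≤ 0) (upd-same (var τ) q v) le)))
      loop (y ∷ ys) v τ (refl , ch) (y<X ∷ bd) fr S it | R₁ , S₁ , inj₁ (_ , r)
        with assign j (pred′ q) (At-++ˡ (compA j (pred′ q)) cPred) S₁ (_ , _ , subst (1 ≤_) (sym (upd-same (var τ) q v)) (s≤s z≤n)) (q<ᵇ , _) j<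
      ... | R₂ , r₂ , S₂
        with trans (upd-same (var τ [ q ↦ v ]) j ((var τ [ q ↦ v ]) q ∸ 1)) (cong (_∸ 1) (upd-same (var τ) q v))
      ... | j≡y
        with assign q (next′ j nx) (At-++ˡ (compA q (next′ j nx)) cNext) S₂ (_ , subst (_< X) (sym j≡y) y<X) (nx<ᵇ , j<ᵇ) q<
      ... | R₃ , r₃ , S₃
        with sound s (At-++ˡ (compS l₁ s) cBody) wfs (Sim-ext (entry-var {y} {τ} fr _ _ (cong (_∸ 1) (upd-same (var τ) q v)) j≡y) (merge-arr W {σ} {τ} fr) S₃) it
      ... | out {t₄} {R₄} {M₄} {τ′} r₄ S₄ it₄ fr₄ cost₄
        with loop ys (arr σ nx y) τ′ ch bd (body-frame {y} {τ} {τ′} fr₄) (Sim-ext (next-var {y} {τ} {τ′} fr₄) (λ _ _ → refl) S₄) it₄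
      ... | out {t₅} r₅ S₅ post fr₅ cost₅ =
        out (taking (solve 2 (λ t u → con 18 :+ (t :+ (con 1 :+ u)) := con 19 :+ (t :+ u)) refl t₄ t₅) ((r then (r₂ then r₃)) then (r₄ then (go1 cBack then r₅))))
          S₅ post fr₅ (iteration-cost 19 (≤ᵇ⇒≤ 19 100 _) {t₄} cost₄ cost₅)

    sound (x ≔ e) {σ = σ} cd (x< , sh , wfe) S (sf , q) with assign x e cd S sf wfe (<ᵇ⇒< x nV x<)
    ... | R₁ , r₁ , S₁ = out r₁ S₁ q (setV-frame {x} {val e σ} {σ} , λ _ _ _ → refl)
      (one-tick (clk σ) (≤-trans (+-monoˡ-≤ 2 (≤ᵇ⇒≤ (lenE e) 30 sh)) (≤ᵇ⇒≤ 32 100 _)))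
    sound (j ⟦ a ⟧≔ e) {p = p} {M = M} {σ} cd (j<ᵇ , (sha , wa) , (she , we)) S (sa , se , y< , q) with operands a e cd S sa se wa we
    ... | R₁ , r₁ , S₁ , v₁ , v₂ , c₁ =
      out {R′ = R₄} (at (pos p (lenE a) (lenE e)) (r₁ then (go1 c₁ then (go1 (At-tail c₁) then (go1 (At-tail (At-tail c₁)) then go1 (At-tail (At-tail (At-tail c₁))))))))
        (subst₂ (λ u v → Sim (setA j (val a σ) (val e σ) σ) R₄ (M [ u ↦ v ])) (sym e₃) (sym v₂) (Sim-setA j< y< (val< e S se we) S₄))
        q ((λ _ _ → refl) , setA-frame {j} {val a σ} {val e σ} {σ})
        (one-tick (clk σ) (≤-trans (short2≤ a e 4 (sha , wa) (she , we)) (≤ᵇ⇒≤ 64 100 _)))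
      where
      j< = <ᵇ⇒< j nA j<ᵇ
      R₂ = R₁ [ 3 + nV ↦ trunc w j ]
      R₃ = R₂ [ 3 + nV ↦ eval w mul (R₂ (3 + nV)) (R₂ nV) ]
      R₄ = R₃ [ suc nV ↦ eval w add (R₃ (suc nV)) (R₃ (3 + nV)) ]
      S₄ : Sim σ R₄ M
      S₄ = Sim-regs {R = R₁} {t = suc nV} ≤-refl (λ r r< → trans (upd-< R₃ _ r<) (trans (upd-< R₂ _ (m<n⇒m<1+n (m<n⇒m<1+n r<))) (upd-< R₁ _ (m<n⇒m<1+n (m<n⇒m<1+n r<))))) S₁
      e₁ : R₃ (3 + nV) ≡ j * X
      e₁ = trans (upd-same R₂ (3 + nV) _) (trans (cong (trunc w) (cong₂ _*_ (trans (upd-same R₁ (3 + nV) _) (trunc-id (≤-trans j< (≤-trans (≤ᵇ⇒≤ nA 32 _) 32≤))))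
             (reg-X S₁)))
             (trunc-id (≤-<-trans (m≤m+n (j * X) (val a σ)) (address j< y<))))
      e₃ : R₄ (suc nV) ≡ j * X + val a σ
      e₃ = trans (upd-same R₃ (suc nV) _) (trans (cong (trunc w) (trans (cong₂ _+_ v₁ e₁) (+-comm (val a σ) (j * X))))
             (trunc-id (address j< y<)))
      pos : ∀ p a b → suc (suc (suc (suc (p + a + b)))) ≡ p + (a + b + 4)
      pos = solve 3 (λ p a b → con 4 :+ (p :+ a :+ b) := p :+ (a :+ b :+ con 4)) refl
    sound (s ⨾ t) {p = p} {σ = σ} cd (ws , wt) S h with sound s (At-++ˡ (compS p s) cd) ws S h
    ... | out {t₁} {σ′ = σ₁} r₁ S₁ q₁ (f₁ , g₁) k₁ with sound t (At-++ʳ (len-compS s p) cd) wt S₁ q₁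
    ... | out {t₂} {σ′ = σ₂} r₂ S₂ q₂ (f₂ , g₂) k₂ = out (at (+-assoc p (lenS s) (lenS t)) (r₁ then r₂)) S₂ q₂
      ((λ y e → let a , b = ∨-false {writesV s y} e in trans (f₂ y b) (f₁ y a)) ,
       (λ j e y → let a , b = ∨-false {writesA s j} e in trans (g₂ j b y) (g₁ j a y)))
      (≤-trans (≤-reflexive (solve 3 (λ a b c → a :+ b :+ c := b :+ (a :+ c)) refl t₁ t₂ (K * clk σ))) (≤-trans (+-monoʳ-≤ t₂ k₁) k₂))
    sound (when c s) {Q} {p} {R} {M} {σ} cd (wc , ws) S (sc , hs , fs)
      with cond c (suc (p + lenC c)) (At-++ˡ (compC c _) cd) S sc wc
         | trans (cong suc (+-assoc p (lenC c) (lenS s))) (trans (sym (+-suc p _)) (cong (p +_) (sym (+-suc (lenC c) (lenS s)))))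
    ... | R₁ , S₁ , inj₂ (fl , r₁) | end = out (at end (r₁ then go1 (At-++ʳ (len-compC c _) cd)))
        (Sim-ext {σ} (λ _ → refl) (λ _ _ → refl) S₁) (fs fl) ((λ _ _ → refl) , λ _ _ _ → refl)
        (one-tick (clk σ) (≤-trans (+-monoˡ-≤ 1 (lenC≤ c wc)) (≤ᵇ⇒≤ 62 100 _)))
    ... | R₁ , S₁ , inj₁ (hl , r₁) | end
      with sound s {σ = tick σ} (At-tail (At-++ʳ (len-compC c _) cd)) ws (Sim-ext {σ} (λ _ → refl) (λ _ _ → refl) S₁) (hs hl)
    ... | out {t₂} r₂ S₂ q₂ fr₂ k₂ = out (at end (r₁ then r₂)) S₂ q₂ fr₂
        (≤-trans (≤-reflexive (solve 3 (λ a b c → a :+ b :+ c := b :+ (a :+ c)) refl (lenC c) t₂ (K * clk σ)))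
          (≤-trans (+-monoʳ-≤ t₂ (one-tick (clk σ) (≤-trans (lenC≤ c wc) (≤ᵇ⇒≤ 61 100 _)))) k₂))
    sound (for x b s) {Q} {p} {R} {M} {σ} cd W@(x<ᵇ , _) S it
      with assign x (# 0) (At-++ˡ (compA x (# 0)) cd) S _ _ (<ᵇ⇒< x nV x<ᵇ)
    ... | R₁ , r₁ , S₁
      with forLoop x b s {Q} {p} {σ} cd W (var σ b) 0 σ (+-identityʳ _) (Sim-ext {setV x 0 σ} (ev σ) (λ j y → merge-arr (for x b s) {σ} {σ} ((λ _ _ → refl) , λ _ _ _ → refl) j y) S₁) it
      where
      ev : ∀ σ y → var (forSt x b s σ 0 σ) y ≡ var (setV x 0 σ) y
      ev σ y with y ≡ᵇ x | writesV s y
      ... | true  | _     = refl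
      ... | false | true  = refl
      ... | false | false = refl
    ... | out {t} r₂ S₂ q fr k = out (r₁ then r₂) S₂ q fr (entry-cost 3 (≤ᵇ⇒≤ 13 100 _) {t} k)
    sound (walk q j h nx s) {Q} {p} {R} {M} {σ} cd W@(q<ᵇ , _ , _ , (hlen , hwf) , _) S (sh , ys , ch , bd , it)
      with assign q h (At-++ˡ (compA q h) cd) S sh hwf (<ᵇ⇒< q nV q<ᵇ)
    ... | R₁ , r₁ , S₁
      with walkLoop q j h nx s {Q} {p} {σ} cd W ys (val h σ) σ ch bd ((λ _ _ → refl) , λ _ _ _ → refl) S₁ it
    ... | out {t} r₂ S₂ post fr k = out (r₁ then r₂) S₂ post fr
      (entry-cost (lenA q h) (≤-trans (+-monoˡ-≤ 10 (+-monoˡ-≤ 2 (≤ᵇ⇒≤ (lenE h) 30 hlen))) (≤ᵇ⇒≤ 42 100 _)) {t} k)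
    sound (block s) {p = p} {σ = σ} cd ws S h with sound s cd ws S h
    ... | out {σ′ = τ} r S₁ q fr k = out r (Sim-ext (merge-var s {σ} {τ} fr) (merge-arr s {σ} {τ} fr) S₁) q (merge-Frame s {σ} {τ}) k

-- Subsets, finite sums, bucket lists and numerical inequalities

module Combinatorics where

  open import Defs using (_[_↦_])
  open Language using (Chain; upd-same; upd-other)
  open import Data.Bool using (true; false; if_then_else_; T)
  open import Data.Empty using (⊥-elim)
  open import Data.Fin using (Fin; zero; suc; toℕ)
  import Data.Fin.Properties as Fin
  open import Data.Fin.Subset using (Subset; ∣_∣; _∈_; _∉_; inside; outside)
  import Data.Fin.Subset as Sub
  open import Data.Fin.Subset.Properties using (⊆-antisym; p⊆q⇒∣p∣≤∣q∣)
  open import Data.List using (List; []; _∷_; _++_; length)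
  import Data.List.Membership.Propositional as L
  open import Data.List.Membership.Propositional.Properties using (∈-∃++; ∈-++⁺ˡ; ∈-++⁺ʳ; ∈-++⁻)
  open import Data.List.Properties using (length-++)
  open import Data.List.Relation.Unary.All as All using (All; []; _∷_)
  open import Data.List.Relation.Unary.AllPairs using ([]; _∷_)
  open import Data.List.Relation.Unary.Any using (here; there)
  open import Data.List.Relation.Unary.Unique.Propositional using (Unique)
  open import Data.Nat
  open import Data.Nat.Properties
  open import Data.Nat.Solver using (module +-*-Solver)
  open import Data.Product using (_×_; _,_; proj₁; proj₂)
  open import Data.Sum using (_⊎_; inj₁; inj₂)
  open import Data.Unit using (tt)
  open import Data.Vec using ([]; _∷_; here; there; _[_]≔_; lookup)
  open import Data.Vec.Properties using ([]≔-minimal; []=⇒lookup; lookup⇒[]=; lookup∘update; lookup∘update′)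
  open import Function using (_∘_; case_of_)
  open import Relation.Binary.PropositionalEquality
  open import Relation.Nullary using (yes; no; contradiction)
  open +-*-Solver using (solve; _:+_; _:*_; _:=_; con)

  infix 4 _⊑_
  -- The element argument of `_⊆_` is implicit, so a proof of it is instantiated as soon as it is
  -- mentioned; wrapped in a record it can be passed around as a value.
  record _⊑_ {m : ℕ} (p q : Subset m) : Set where
    constructor incl
    field mem : ∀ x → x ∈ p → x ∈ q
  open _⊑_ public

  module _ {m : ℕ} where

    ⊑-refl : {p : Subset m} → p ⊑ p
    ⊑-refl = incl λ _ h → h

    ⊑-trans : {p q r : Subset m} → p ⊑ q → q ⊑ r → p ⊑ r
    ⊑-trans a b = incl λ x h → mem b x (mem a x h)

    ⊑-antisym : {p q : Subset m} → p ⊑ q → q ⊑ p → p ≡ q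
    ⊑-antisym a b = ⊆-antisym (λ {x} → mem a x) (λ {x} → mem b x)

    ⊑-reflexive : {p q : Subset m} → p ≡ q → p ⊑ q
    ⊑-reflexive refl = ⊑-refl

    ⊑-size : {p q : Subset m} → p ⊑ q → ∣ p ∣ ≤ ∣ q ∣
    ⊑-size a = p⊆q⇒∣p∣≤∣q∣ (λ {x} → mem a x)

    ins del : Fin m → Subset m → Subset m
    ins e S = S [ e ]≔ inside
    del e S = S [ e ]≔ outside

    ∈-ins-same : ∀ e (S : Subset m) → e ∈ ins e S
    ∈-ins-same e S = lookup⇒[]= e (ins e S) (lookup∘update e S inside)

    ∈-ins : ∀ e {x} {S : Subset m} → x ∈ S → x ∈ ins e S
    ∈-ins e {x} {S} h with e Fin.≟ x
    ... | yes refl = ∈-ins-same e S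
    ... | no e≢x   = []≔-minimal S x e (e≢x ∘ sym) h

    ∈-ins⁻ : ∀ e {x} {S : Subset m} → x ∈ ins e S → x ≡ e ⊎ x ∈ S
    ∈-ins⁻ e {x} {S} h with x Fin.≟ e
    ... | yes x≡e = inj₁ x≡e
    ... | no x≢e  = inj₂ (lookup⇒[]= x S (trans (sym (lookup∘update′ x≢e S inside)) ([]=⇒lookup h)))

    ∉-del : ∀ e (S : Subset m) → e ∉ del e S
    ∉-del e S h with trans (sym (lookup∘update e S outside)) ([]=⇒lookup h)
    ... | ()

    ∈-del : ∀ e {x} {S : Subset m} → x ≢ e → x ∈ S → x ∈ del e S
    ∈-del e {x} {S} x≢e h = []≔-minimal S x e x≢e h

    ∈-del⁻ : ∀ e {x} {S : Subset m} → x ∈ del e S → x ≢ e × x ∈ S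
    ∈-del⁻ e {x} {S} h with x Fin.≟ e
    ... | yes refl = contradiction h (∉-del e S)
    ... | no x≢e   = x≢e , lookup⇒[]= x S (trans (sym (lookup∘update′ x≢e S outside)) ([]=⇒lookup h))

    ins-del : ∀ e {S : Subset m} → e ∈ S → ins e (del e S) ≡ S
    ins-del e {S} e∈S = ⊑-antisym (incl f) (incl g)
      where
      f : ∀ x → x ∈ ins e (del e S) → x ∈ S
      f x h with ∈-ins⁻ e h
      ... | inj₁ refl = e∈S
      ... | inj₂ h′   = proj₂ (∈-del⁻ e h′)
      g : ∀ x → x ∈ S → x ∈ ins e (del e S)
      g x h with x Fin.≟ e
      ... | yes refl = ∈-ins-same e (del e S)
      ... | no x≢e   = ∈-ins e (∈-del e x≢e h)

    ins-mono : ∀ e {S T : Subset m} → S ⊑ T → ins e S ⊑ ins e T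
    ins-mono e {S} {T} h = incl λ x x∈ → case ∈-ins⁻ e x∈ of λ where
      (inj₁ refl) → ∈-ins-same e T
      (inj₂ x∈S)  → ∈-ins e (mem h x x∈S)

    ⊑-ins : ∀ e (S : Subset m) → S ⊑ ins e S
    ⊑-ins e S = incl λ x → ∈-ins e

    ins-cancel : ∀ e {S T : Subset m} → e ∉ S → ins e S ⊑ ins e T → S ⊑ T
    ins-cancel e {S} {T} e∉S h = incl λ x x∈S → case ∈-ins⁻ e (mem h x (∈-ins e x∈S)) of λ where
      (inj₁ refl) → contradiction x∈S e∉S
      (inj₂ x∈T)  → x∈T

    ins-injective : ∀ e {S T : Subset m} → e ∉ S → e ∉ T → ins e S ≡ ins e T → S ≡ T
    ins-injective e a b eq = ⊑-antisym (ins-cancel e a (⊑-reflexive eq)) (ins-cancel e b (⊑-reflexive (sym eq)))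

    ⊑-ins-del : ∀ e {S T : Subset m} → S ⊑ ins e T → del e S ⊑ T
    ⊑-ins-del e {S} {T} h = incl λ x x∈ → let x≢e , x∈S = ∈-del⁻ e x∈ in case ∈-ins⁻ e (mem h x x∈S) of λ where
      (inj₁ x≡e) → contradiction x≡e x≢e
      (inj₂ x∈T) → x∈T

    ⊑-ins-avoid : ∀ e {S T : Subset m} → e ∉ S → S ⊑ ins e T → S ⊑ T
    ⊑-ins-avoid e {S} {T} e∉S h = incl λ x x∈S → case ∈-ins⁻ e (mem h x x∈S) of λ where
      (inj₁ refl) → contradiction x∈S e∉S
      (inj₂ x∈T)  → x∈T

  ins-size : ∀ {m} (e : Fin m) {S : Subset m} → e ∉ S → ∣ ins e S ∣ ≡ suc ∣ S ∣
  ins-size zero    {false ∷ S} h = refl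
  ins-size zero    {true ∷ S}  h = contradiction here h
  ins-size (suc e) {false ∷ S} h = ins-size e (h ∘ there)
  ins-size (suc e) {true ∷ S}  h = cong suc (ins-size e (h ∘ there))

  -- For a row `S` this is the part present in the trie when element `t` is about to be inserted.
  cut : ∀ {m} → Subset m → ℕ → Subset m
  cut []      t       = []
  cut (x ∷ S) zero    = outside ∷ cut S zero
  cut (x ∷ S) (suc t) = x ∷ cut S t

  ∈-cut : ∀ {m} {S : Subset m} {t x} → x ∈ S → toℕ x < t → x ∈ cut S t
  ∈-cut {S = _ ∷ S} {suc t} here      h       = here
  ∈-cut {S = _ ∷ S} {suc t} (there p) (s≤s h) = there (∈-cut p h)

  ∈-cut⁻ : ∀ {m} {S : Subset m} t {x} → x ∈ cut S t → x ∈ S × toℕ x < t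
  ∈-cut⁻ {S = _ ∷ S} zero    (there p) = case ∈-cut⁻ {S = S} zero p of λ ()
  ∈-cut⁻ {S = _ ∷ S} (suc t) here      = here , s≤s z≤n
  ∈-cut⁻ {S = _ ∷ S} (suc t) (there p) = let a , b = ∈-cut⁻ {S = S} t p in there a , s≤s b

  module _ {m : ℕ} (S : Subset m) where

    cut-zero : cut S 0 ≡ Sub.⊥
    cut-zero = ⊑-antisym (incl λ x h → case ∈-cut⁻ 0 h of λ ()) (incl λ x h → contradiction h Data.Fin.Subset.Properties.∉⊥)

    cut-all : cut S m ≡ S
    cut-all = ⊑-antisym (incl λ x h → proj₁ (∈-cut⁻ m h)) (incl λ x h → ∈-cut h (Fin.toℕ<n x))

    cut-⊑ : ∀ t → cut S t ⊑ S
    cut-⊑ t = incl λ x h → proj₁ (∈-cut⁻ t h)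

    cut-in : ∀ (e : Fin m) → e ∈ S → cut S (suc (toℕ e)) ≡ ins e (cut S (toℕ e))
    cut-in e e∈S = ⊑-antisym (incl f) (incl g)
      where
      f : ∀ x → x ∈ cut S (suc (toℕ e)) → x ∈ ins e (cut S (toℕ e))
      f x h with ∈-cut⁻ (suc (toℕ e)) h
      ... | x∈S , s≤s le with m≤n⇒m<n∨m≡n le
      ... | inj₁ lt = ∈-ins e (∈-cut x∈S lt)
      ... | inj₂ eq = subst (_∈ ins e (cut S (toℕ e))) (sym (Fin.toℕ-injective eq)) (∈-ins-same e _)
      g : ∀ x → x ∈ ins e (cut S (toℕ e)) → x ∈ cut S (suc (toℕ e))
      g x h with ∈-ins⁻ e h
      ... | inj₁ refl = ∈-cut e∈S ≤-refl
      ... | inj₂ h′   = let a , b = ∈-cut⁻ (toℕ e) h′ in ∈-cut a (m<n⇒m<1+n b)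

    cut-out : ∀ (e : Fin m) → e ∉ S → cut S (suc (toℕ e)) ≡ cut S (toℕ e)
    cut-out e e∉S = ⊑-antisym (incl f) (incl λ x h → let a , b = ∈-cut⁻ (toℕ e) h in ∈-cut a (m<n⇒m<1+n b))
      where
      f : ∀ x → x ∈ cut S (suc (toℕ e)) → x ∈ cut S (toℕ e)
      f x h with ∈-cut⁻ (suc (toℕ e)) h
      ... | x∈S , s≤s le with m≤n⇒m<n∨m≡n le
      ... | inj₁ lt = ∈-cut x∈S lt
      ... | inj₂ eq = contradiction (subst (_∈ S) (Fin.toℕ-injective eq) x∈S) e∉S

  infixl 30 _⟨_≔_⟩
  _⟨_≔_⟩ : {A : Set} → (ℕ → A) → ℕ → A → ℕ → A
  (f ⟨ a ≔ v ⟩) x = if x ≡ᵇ a then v else f x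

  ≔-same : ∀ {A : Set} (f : ℕ → A) a v → (f ⟨ a ≔ v ⟩) a ≡ v
  ≔-same f a v with a ≡ᵇ a in eq
  ... | true  = refl
  ... | false = ⊥-elim (subst T eq (≡⇒≡ᵇ a a refl))

  ≔-other : ∀ {A : Set} (f : ℕ → A) {a x} v → x ≢ a → (f ⟨ a ≔ v ⟩) x ≡ f x
  ≔-other f {a} {x} v x≢a with x ≡ᵇ a in eq
  ... | true  = contradiction (≡ᵇ⇒≡ x a (subst T (sym eq) tt)) x≢a
  ... | false = refl

  sumTo : ℕ → (ℕ → ℕ) → ℕ
  sumTo zero    g = 0
  sumTo (suc n) g = sumTo n g + g n

  sumTo-mono : ∀ n {g h} → (∀ i → i < n → g i ≤ h i) → sumTo n g ≤ sumTo n h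
  sumTo-mono zero    le = z≤n
  sumTo-mono (suc n) le = +-mono-≤ (sumTo-mono n (λ i i< → le i (m<n⇒m<1+n i<))) (le n ≤-refl)

  sumTo-cong : ∀ n {g h} → (∀ i → i < n → g i ≡ h i) → sumTo n g ≡ sumTo n h
  sumTo-cong zero    eq = refl
  sumTo-cong (suc n) eq = cong₂ _+_ (sumTo-cong n (λ i i< → eq i (m<n⇒m<1+n i<))) (eq n ≤-refl)

  sumTo-≤ : ∀ {k n} g → k ≤ n → sumTo k g ≤ sumTo n g
  sumTo-≤ {k} {zero} g z≤n = z≤n
  sumTo-≤ {k} {suc n} g le with m≤n⇒m<n∨m≡n le
  ... | inj₂ refl     = ≤-refl
  ... | inj₁ (s≤s le′) = ≤-trans (sumTo-≤ g le′) (m≤m+n _ _)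

  sumTo-const : ∀ n c → sumTo n (λ _ → c) ≡ n * c
  sumTo-const zero    c = refl
  sumTo-const (suc n) c = trans (+-comm _ c) (cong (c +_) (sumTo-const n c))

  sumTo-+ : ∀ a b g → sumTo (a + b) g ≡ sumTo a g + sumTo b (λ i → g (a + i))
  sumTo-+ a zero    g = trans (cong (λ x → sumTo x g) (+-identityʳ a)) (sym (+-identityʳ _))
  sumTo-+ a (suc b) g = trans (cong (λ x → sumTo x g) (+-suc a b)) (trans (cong (_+ g (a + b)) (sumTo-+ a b g)) (+-assoc (sumTo a g) _ _))

  sumTo-* : ∀ c n g → sumTo n (λ i → c * g i) ≡ c * sumTo n g
  sumTo-* c zero    g = sym (*-zeroʳ c)
  sumTo-* c (suc n) g = trans (cong (_+ c * g n) (sumTo-* c n g)) (sym (*-distribˡ-+ c (sumTo n g) (g n)))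

  sumTo-swap : ∀ a b (g : ℕ → ℕ → ℕ) → sumTo a (λ i → sumTo b (g i)) ≡ sumTo b (λ j → sumTo a (λ i → g i j))
  sumTo-swap zero    b g = sym (trans (sumTo-const b 0) (*-zeroʳ b))
  sumTo-swap (suc a) b g = trans (cong (_+ sumTo b (g a)) (sumTo-swap a b g)) (merge b)
    where
    merge : ∀ b → sumTo b (λ j → sumTo a (λ i → g i j)) + sumTo b (g a) ≡ sumTo b (λ j → sumTo a (λ i → g i j) + g a j)
    merge zero    = refl
    merge (suc b) = trans (solve 4 (λ x y z u → (x :+ y) :+ (z :+ u) := (x :+ z) :+ (y :+ u)) refl (sumTo b (λ j → sumTo a (λ i → g i j))) _ (sumTo b (g a)) _)
      (cong (_+ (sumTo a (λ i → g i b) + g a b)) (merge b))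

  sumTo-update : ∀ n {g h δ} f → f < n → h f ≡ g f + δ → (∀ i → i < n → i ≢ f → h i ≡ g i) → sumTo n h ≡ sumTo n g + δ
  sumTo-update (suc n) {g} {h} {δ} f f< eq same with f ≟ n
  ... | yes refl = trans (cong₂ _+_ (sumTo-cong n (λ i i< → same i (m<n⇒m<1+n i<) (<⇒≢ i<))) eq) (sym (+-assoc (sumTo n g) (g n) δ))
  ... | no f≢n   = trans (cong₂ _+_ (sumTo-update n {g} f (≤∧≢⇒< (≤-pred f<) f≢n) eq (λ i i< → same i (m<n⇒m<1+n i<))) (same n ≤-refl (f≢n ∘ sym)))
    (solve 3 (λ a b c → a :+ b :+ c := a :+ c :+ b) refl (sumTo n g) δ (g n))

  sumTo-indicator : ∀ n e → sumTo n (λ i → if e ≡ᵇ i then 1 else 0) ≤ 1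
  sumTo-indicator zero    e = z≤n
  sumTo-indicator (suc n) e with e ≡ᵇ n in eq
  ... | false = ≤-trans (≤-reflexive (+-identityʳ _)) (sumTo-indicator n e)
  ... | true  = ≤-reflexive (cong (_+ 1) (none n (≡ᵇ⇒≡ e n (subst T (sym eq) tt)) ≤-refl))
    where
    none : ∀ k → e ≡ n → k ≤ n → sumTo k (λ i → if e ≡ᵇ i then 1 else 0) ≡ 0
    none zero    _ _ = refl
    none (suc k) e≡n k< with e ≡ᵇ k in eq′
    ... | false = trans (+-identityʳ _) (none k e≡n (<⇒≤ k<))
    ... | true  = ⊥-elim (<-irrefl (trans (sym (≡ᵇ⇒≡ e k (subst T (sym eq′) tt))) e≡n) k<)

  -- Linear arithmetic by certificate: a ≤ b follows from x ≤ y once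
  -- b - a = (y - x) + s, with both sides moved so that no subtraction occurs.
  from-≤ : ∀ {x y a b} s → x ≤ y → a + y + s ≡ b + x → a ≤ b
  from-≤ {x} {y} {a} {b} s x≤y eq = +-cancelʳ-≤ y a b (≤-trans (m≤m+n (a + y) s) (≤-trans (≤-reflexive eq) (+-monoʳ-≤ b x≤y)))

  -- The order is decreasing because the program pushes each new position at the head of its linked
  -- list.
  bucket : (ℕ → ℕ) → ℕ → ℕ → List ℕ
  bucket f e zero    = []
  bucket f e (suc c) = if f c ≡ᵇ e then c ∷ bucket f e c else bucket f e c

  bucket-< : ∀ f e c → All (_< c) (bucket f e c)
  bucket-< f e zero    = []
  bucket-< f e (suc c) with f c ≡ᵇ e
  ... | true  = ≤-refl ∷ All.map m<n⇒m<1+n (bucket-< f e c)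
  ... | false = All.map m<n⇒m<1+n (bucket-< f e c)

  bucket-key : ∀ f e c → All (λ i → f i ≡ e) (bucket f e c)
  bucket-key f e zero    = []
  bucket-key f e (suc c) with f c ≡ᵇ e in eq
  ... | true  = ≡ᵇ⇒≡ (f c) e (subst T (sym eq) tt) ∷ bucket-key f e c
  ... | false = bucket-key f e c

  bucket-∈ : ∀ f e c i → i < c → f i ≡ e → i L.∈ bucket f e c
  bucket-∈ f e (suc c) i i< eq with f c ≡ᵇ e in h | i ≟ c
  ... | true  | yes refl = here refl
  ... | true  | no i≢c   = there (bucket-∈ f e c i (≤∧≢⇒< (≤-pred i<) i≢c) eq)
  ... | false | yes refl = ⊥-elim (subst T h (≡⇒≡ᵇ (f c) e eq))
  ... | false | no i≢c   = bucket-∈ f e c i (≤∧≢⇒< (≤-pred i<) i≢c) eq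

  bucket-unique : ∀ f e c → Unique (bucket f e c)
  bucket-unique f e zero    = []
  bucket-unique f e (suc c) with f c ≡ᵇ e
  ... | true  = All.map (λ i< c≡i → <-irrefl (sym c≡i) i<) (bucket-< f e c) ∷ bucket-unique f e c
  ... | false = bucket-unique f e c

  bucket-length : ∀ f e c → length (bucket f e c) ≡ sumTo c (λ i → if f i ≡ᵇ e then 1 else 0)
  bucket-length f e zero    = refl
  bucket-length f e (suc c) with f c ≡ᵇ e
  ... | true  = trans (cong suc (bucket-length f e c)) (+-comm 1 _)
  ... | false = trans (bucket-length f e c) (sym (+-identityʳ _))

  -- Double counting: summed over positions instead of keys, every position contributes at most 1,
  -- through its own key.
  buckets-total : ∀ f k c → sumTo k (λ e → length (bucket f e c)) ≤ c
  buckets-total f k c = ≤-trans (≤-reflexive (trans (sumTo-cong k (λ e _ → bucket-length f e c)) (sumTo-swap k c _)))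
    (≤-trans (sumTo-mono c (λ i _ → sumTo-indicator k (f i))) (≤-reflexive (trans (sumTo-const c 1) (*-identityʳ c))))

  Chain-update : ∀ {nx i v} ys {q} → All (_< i) ys → Chain nx q ys → Chain (nx [ i ↦ v ]) q ys
  Chain-update []       bd ch = ch
  Chain-update {nx} {i} {v} (y ∷ ys) (y< ∷ bd) (eq , ch) =
    eq , subst (λ q → Chain (nx [ i ↦ v ]) q ys) (sym (upd-other nx v (<⇒≢ y<))) (Chain-update ys bd ch)

  -- Pushing `i` writes the successor array only at `i`, and all lists built so far consist of
  -- smaller positions, so the other chains are not disturbed.
  Chain-bucket : ∀ {nx h : ℕ → ℕ} f i → (∀ e → Chain nx (h e) (bucket f e i)) →
    ∀ e → Chain (nx [ i ↦ h (f i) ]) ((h [ f i ↦ suc i ]) e) (bucket f e (suc i))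
  Chain-bucket {nx} {h} f i ch e with f i ≡ᵇ e in eq
  ... | true rewrite ≡ᵇ⇒≡ (f i) e (subst T (sym eq) tt) | upd-same h e (suc i) | upd-same nx i (h e) =
    refl , Chain-update (bucket f e i) (bucket-< f e i) (ch e)
  ... | false = subst (λ q → Chain (nx [ i ↦ h (f i) ]) q (bucket f e i))
    (sym (upd-other h (suc i) (λ e≡ → subst T eq (≡⇒≡ᵇ (f i) e (sym e≡))))) (Chain-update (bucket f e i) (bucket-< f e i) (ch e))

  unique-length : ∀ {A : Set} {xs : List A} → Unique xs → ∀ ys → (∀ x → x L.∈ xs → x L.∈ ys) → length xs ≤ length ys
  unique-length {xs = []}     u ys h = z≤n
  unique-length {xs = x ∷ xs} (x∉ ∷ u) ys h with ∈-∃++ (h x (here refl))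
  ... | as , bs , refl = ≤-trans (s≤s (unique-length u (as ++ bs) rest))
        (≤-reflexive (sym (trans (length-++ as) (trans (+-suc (length as) (length bs)) (cong suc (sym (length-++ as)))))))
    where
    rest : ∀ y → y L.∈ xs → y L.∈ (as ++ bs)
    rest y y∈ with ∈-++⁻ as (h y (there y∈))
    ... | inj₁ y∈as = ∈-++⁺ˡ y∈as
    ... | inj₂ (here refl)  = contradiction refl (All.lookup x∉ y∈)
    ... | inj₂ (there y∈bs) = ∈-++⁺ʳ as y∈bs

  -- The factor from one exponent to the next is 2(d + 2)/(d + 1) on the left, which is at most 3
  -- from d = 1 on. This bounds the counter cells, d + 1 for each node.
  [1+d]2^d≤2*3^d : ∀ d → suc d * 2 ^ d ≤ 2 * 3 ^ d
  [1+d]2^d≤2*3^d 0 = ≤ᵇ⇒≤ _ _ _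
  [1+d]2^d≤2*3^d 1 = ≤ᵇ⇒≤ _ _ _
  [1+d]2^d≤2*3^d (suc (suc d)) = from-≤ (d * 2 ^ suc d) (*-monoʳ-≤ 3 ([1+d]2^d≤2*3^d (suc d)))
    (solve 3 (λ d a b → (con 3 :+ d) :* (con 2 :* (con 2 :* a)) :+ con 3 :* (con 2 :* (con 3 :* b)) :+ d :* (con 2 :* a)
      := con 2 :* (con 3 :* (con 3 :* b)) :+ con 3 :* ((con 2 :+ d) :* (con 2 :* a))) refl d (2 ^ d) (3 ^ d))

  cube : ℕ → ℕ
  cube x = x * (x * x)

  -- Here 7 is the first x with 2(x + 1)³ ≤ 3x³: the two sides are 1024 and 1029.
  cube-step : ∀ k → cube (8 + k) * 2 ≤ 3 * cube (7 + k)
  cube-step k = ≤-trans (m≤m+n _ (5 + (57 * k + (15 * k * k + k * k * k)))) (≤-reflexive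
    (solve 1 (λ k → (con 8 :+ k) :* ((con 8 :+ k) :* (con 8 :+ k)) :* con 2 :+ (con 5 :+ (con 57 :* k :+ (con 15 :* k :* k :+ k :* k :* k)))
      := con 3 :* ((con 7 :+ k) :* ((con 7 :+ k) :* (con 7 :+ k)))) refl k))

  -- The quotient (d + 1)³ (2/3) ^ d is largest at d = 6, where it is 343 * 64 / 729, slightly above
  -- 30. Up to there the inequality is computed, from there on `cube-step` applies.
  [1+d]³2^d≤31*3^d : ∀ d → cube (suc d) * 2 ^ d ≤ 31 * 3 ^ d
  [1+d]³2^d≤31*3^d 0 = ≤ᵇ⇒≤ _ _ _
  [1+d]³2^d≤31*3^d 1 = ≤ᵇ⇒≤ _ _ _
  [1+d]³2^d≤31*3^d 2 = ≤ᵇ⇒≤ _ _ _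
  [1+d]³2^d≤31*3^d 3 = ≤ᵇ⇒≤ _ _ _
  [1+d]³2^d≤31*3^d 4 = ≤ᵇ⇒≤ _ _ _
  [1+d]³2^d≤31*3^d 5 = ≤ᵇ⇒≤ _ _ _
  [1+d]³2^d≤31*3^d 6 = ≤ᵇ⇒≤ _ _ _
  [1+d]³2^d≤31*3^d (suc d@(suc (suc (suc (suc (suc (suc k))))))) = begin
    cube (8 + k) * (2 * 2 ^ d)  ≡⟨ *-assoc (cube (8 + k)) 2 (2 ^ d) ⟨
    cube (8 + k) * 2 * 2 ^ d    ≤⟨ *-monoˡ-≤ (2 ^ d) (cube-step k) ⟩
    3 * cube (7 + k) * 2 ^ d    ≡⟨ *-assoc 3 (cube (7 + k)) (2 ^ d) ⟩
    3 * (cube (7 + k) * 2 ^ d)  ≤⟨ *-monoʳ-≤ 3 ([1+d]³2^d≤31*3^d d) ⟩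
    3 * (31 * 3 ^ d)            ≡⟨ trans (sym (*-assoc 3 31 (3 ^ d))) (trans (cong (_* 3 ^ d) (*-comm 3 31)) (*-assoc 31 3 (3 ^ d))) ⟩
    31 * (3 * 3 ^ d)            ∎
    where open ≤-Reasoning

-- The kernelization program

module KernelProgram where

  open Language
  open Compiler
  open import Defs
  open import Data.List using ([]; _∷_; _++_)
  open import Data.Nat using (ℕ)

  vOut vd vk vm vn vX vnd vdm vi ve vq vj vf vP vo vl vi1 vR vNN vdl vo2 vl2 vi2 vx vz vL vT vc vb vr0 vr vv vs vy vp vp0 vcnt : ℕ
  vOut = 0
  vd = 1
  vk = 2
  vm = 3
  vn = 4
  vX = 6
  vnd = 7
  vdm = 8
  vi = 9
  ve = 10
  vq = 11
  vj = 12
  vf = 13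
  vP = 14
  vo = 15
  vl = 16
  vi1 = 17
  vR = 18
  vNN = 19
  vdl = 20
  vo2 = 21
  vl2 = 22
  vi2 = 23
  vx = 24
  vz = 25
  vL = 26
  vT = 27
  vc = 28
  vb = 29
  vr0 = 30
  vr = 31
  vv = 32
  vs = 33
  vy = 34
  vp = 35
  vp0 = 36
  vcnt = 37

  -- aHd, aNx: lists of the input positions of each element; aCur f: node of the
  -- part of row f inserted so far; aStp, aTmp: node reached from a node by the
  -- current element; aPar, aLab: last element added to a node and what it was
  -- added to; aD, aOwn: the pairs of nodes S ⊆ T, in segments given by aOff, aPw;
  -- aLh, aLn: lists of the pairs (S, T) by |S|; aCnt: number of strong T ⊇ S, by
  -- |T|; aAct: nodes that are good and contain no bad subset so far.
  aIn aHd aNx aCur aStp aTmp aPar aLab aSz aOff aPw aD aOwn aLh aLn aGd aAct aCnt aNm aMk aOut : ℕ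
  aIn = 0
  aHd = 1
  aNx = 2
  aCur = 3
  aStp = 4
  aTmp = 5
  aPar = 6
  aLab = 7
  aSz = 8
  aOff = 9
  aPw = 10
  aD = 11
  aOwn = 12
  aLh = 13
  aLn = 14
  aGd = 15
  aAct = 16
  aCnt = 17
  aNm = 18
  aMk = 19
  aOut = 20

  occurrencesBody : Stmt
  occurrencesBody =
      -- Array number 0 starts at address 0, so the input is already in place as `aIn`; its first
      -- four cells are the header.
      aNx ⟦ ` vi ⟧≔ aHd ⟦ aIn ⟦ # 4 ⊕ ` vi ⟧ ⟧
    ⨾ aHd ⟦ aIn ⟦ # 4 ⊕ ` vi ⟧ ⟧≔ # 1 ⊕ ` vi

  occurrences : Stmt
  occurrences = for vi vnd occurrencesBody

  copyBody : Stmt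
  copyBody =
      vx ≔ aD ⟦ ` vo2 ⊕ ` vi2 ⟧
    ⨾ aD ⟦ ` vdl ⊕ ` vi2 ⟧≔ ` vx
    -- The second half of the new segment: `aTmp` leads from a subset of R to its extension by the
    -- current element.
    ⨾ aD ⟦ ` vdl ⊕ (` vl2 ⊕ ` vi2) ⟧≔ aTmp ⟦ ` vx ⟧
    ⨾ aOwn ⟦ ` vdl ⊕ ` vi2 ⟧≔ ` vNN
    ⨾ aOwn ⟦ ` vdl ⊕ (` vl2 ⊕ ` vi2) ⟧≔ ` vNN

  copySegment : Stmt
  copySegment = for vi2 vl2 copyBody

  createNode : Stmt
  createNode =
      vo2 ≔ aOff ⟦ ` vR ⟧
    ⨾ vl2 ≔ aPw ⟦ ` vR ⟧
    -- The stamp is shifted by 1 so that zeroed memory does not look stamped by element 0. Stamp and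
    -- child are set before the copy, which meets R as a subset of itself.
    ⨾ aStp ⟦ ` vR ⟧≔ # 1 ⊕ ` ve
    ⨾ aTmp ⟦ ` vR ⟧≔ ` vNN
    ⨾ aPar ⟦ ` vNN ⟧≔ ` vR
    ⨾ aLab ⟦ ` vNN ⟧≔ ` ve
    ⨾ aSz ⟦ ` vNN ⟧≔ # 1 ⊕ aSz ⟦ ` vR ⟧
    ⨾ aOff ⟦ ` vNN ⟧≔ ` vdl
    ⨾ aPw ⟦ ` vNN ⟧≔ ` vl2 ⊕ ` vl2
    ⨾ copySegment
    ⨾ vdl ≔ ` vdl ⊕ (` vl2 ⊕ ` vl2)
    ⨾ vNN ≔ # 1 ⊕ ` vNN

  scanBody : Stmt
  scanBody =
      vR ≔ aD ⟦ ` vo ⊕ ` vi1 ⟧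
    ⨾ when (aStp ⟦ ` vR ⟧ ≺ # 1 ⊕ ` ve) (block createNode)

  scan : Stmt
  scan = for vi1 vl scanBody

  insertElement : Stmt
  insertElement =
      -- All rows have d entries, so the row of input position j is j / d; the divisor is 1 + `vdm`.
      vf ≔ ` vj ⊘ ` vdm
    ⨾ vP ≔ aCur ⟦ ` vf ⟧
    ⨾ vo ≔ aOff ⟦ ` vP ⟧
    ⨾ vl ≔ aPw ⟦ ` vP ⟧
    ⨾ scan
    ⨾ aCur ⟦ ` vf ⟧≔ aTmp ⟦ ` vP ⟧

  insertEverywhere : Stmt
  insertEverywhere = walk vq vj (aHd ⟦ ` ve ⟧) aNx insertElement

  buildTrie : Stmt
  buildTrie =
      -- Node 0 is the empty set, with the single pair (∅, ∅) at position 0. Apart from its segment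
      -- length, zeroed memory already describes it correctly.
      vNN ≔ # 1
    ⨾ vdl ≔ # 1
    ⨾ aPw ⟦ # 0 ⟧≔ # 1
    ⨾ for ve vm insertEverywhere

  levelsBody : Stmt
  levelsBody =
      aLn ⟦ ` vi ⟧≔ aLh ⟦ aSz ⟦ aD ⟦ ` vi ⟧ ⟧ ⟧
    ⨾ aLh ⟦ aSz ⟦ aD ⟦ ` vi ⟧ ⟧ ⟧≔ # 1 ⊕ ` vi

  levels : Stmt
  levels = for vi vdl levelsBody

  seedBody : Stmt
  seedBody =
      vx ≔ aCur ⟦ ` vi ⟧
    ⨾ aGd ⟦ ` vx ⟧≔ # 1
    ⨾ aAct ⟦ ` vx ⟧≔ # 1

  seed : Stmt
  seed = for vi vn seedBody

  tallyBody : Stmt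
  tallyBody =
      vT ≔ aOwn ⟦ ` vj ⟧
    ⨾ vc ≔ aD ⟦ ` vj ⟧ ⊗ (# 1 ⊕ ` vd) ⊕ aSz ⟦ ` vT ⟧
    ⨾ aCnt ⟦ ` vc ⟧≔ aCnt ⟦ ` vc ⟧ ⊕ aAct ⟦ ` vT ⟧

  tally : Stmt
  tally = walk vq vj (aLh ⟦ ` vL ⟧) aLn tallyBody

  divideBody : Stmt
  -- Round i divides by k + 1 and by i + 1, so r rounds divide by r! (k + 1) ^ r.
  divideBody = vv ≔ (` vv ⊘ ` vk) ⊘ ` vi

  judgeCell : Stmt
  judgeCell =
      vr ≔ # 1 ⊕ ` vr0
    ⨾ vc ≔ ` vx ⊗ (# 1 ⊕ ` vd) ⊕ (` vL ⊕ ` vr)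
    ⨾ vv ≔ aCnt ⟦ ` vc ⟧
    ⨾ for vi vr divideBody
    ⨾ aCnt ⟦ ` vc ⟧≔ ` vv
    ⨾ when (# 0 ≺ ` vv) (aGd ⟦ ` vx ⟧≔ # 1 ⨾ aAct ⟦ ` vx ⟧≔ # 1)

  judgeNode : Stmt
  judgeNode = vb ≔ ` vd ⊖ ` vL ⨾ for vr0 vb judgeCell

  judgeBody : Stmt
  judgeBody = when (aSz ⟦ ` vx ⟧ ≐ ` vL) judgeNode

  judge : Stmt
  -- Every level passes over all nodes. This costs only d * N in addition, so no lists of nodes by
  -- size are kept.
  judge = for vx vNN judgeBody

  retireBody : Stmt
  retireBody =
      vT ≔ aOwn ⟦ ` vj ⟧
    ⨾ vs ≔ aD ⟦ ` vj ⟧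
    -- After `judge` this counter is positive exactly if S is (ℓ, |T| - ℓ)-good for ℓ = |S|, in
    -- which case T is not strong at any lower level.
    ⨾ when (aSz ⟦ ` vs ⟧ ≺ aSz ⟦ ` vT ⟧) (when (# 0 ≺ aCnt ⟦ ` vs ⊗ (# 1 ⊕ ` vd) ⊕ aSz ⟦ ` vT ⟧ ⟧) (aAct ⟦ ` vT ⟧≔ # 0))

  retire : Stmt
  retire = walk vq vj (aLh ⟦ ` vL ⟧) aLn retireBody

  sweepBody : Stmt
  sweepBody = vL ≔ ` vdm ⊖ ` vz ⨾ block tally ⨾ block judge ⨾ block retire

  sweep : Stmt
  sweep = for vz vdm sweepBody

  minimalBody : Stmt
  minimalBody =
      vs ≔ aD ⟦ ` vi ⟧
    ⨾ vT ≔ aOwn ⟦ ` vi ⟧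
    ⨾ when (# 0 ≺ aGd ⟦ ` vs ⟧) (when (aSz ⟦ ` vs ⟧ ≺ aSz ⟦ ` vT ⟧) (aNm ⟦ ` vT ⟧≔ # 1))

  minimal : Stmt
  minimal = for vi vdl minimalBody

  markStep : Stmt
  markStep = aMk ⟦ aLab ⟦ ` vy ⟧ ⟧≔ # 1 ⨾ vy ≔ aPar ⟦ ` vy ⟧

  markNode : Stmt
  markNode =
      vy ≔ ` vx
    ⨾ vs ≔ aSz ⟦ ` vx ⟧
    ⨾ for vi vs markStep

  markBody : Stmt
  -- Both flags are 0 or 1, so the comparison singles out the nodes that are good and not marked as
  -- containing a smaller good set.
  markBody = when (aNm ⟦ ` vx ⟧ ≺ aGd ⟦ ` vx ⟧) markNode

  mark : Stmt
  mark = for vx vNN markBody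

  putElement : Stmt
  putElement = when (# 0 ≺ aMk ⟦ ` ve ⟧) (aOut ⟦ ` vp ⟧≔ ` ve ⨾ vp ≔ # 1 ⊕ ` vp)

  putElements : Stmt
  putElements =
      vp ≔ # 1
    ⨾ for ve vm putElement
    ⨾ aOut ⟦ # 0 ⟧≔ ` vp ⊖ # 1

  putLabel : Stmt
  putLabel = aOut ⟦ ` vp ⟧≔ aLab ⟦ ` vy ⟧ ⨾ vp ≔ # 1 ⊕ ` vp ⨾ vy ≔ aPar ⟦ ` vy ⟧

  putNode : Stmt
  putNode =
      vs ≔ aSz ⟦ ` vx ⟧
    ⨾ aOut ⟦ ` vp ⟧≔ ` vs
    ⨾ vp ≔ # 1 ⊕ ` vp
    ⨾ vy ≔ ` vx
    ⨾ for vi vs putLabel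
    ⨾ vcnt ≔ # 1 ⊕ ` vcnt

  putSet : Stmt
  putSet = when (aNm ⟦ ` vx ⟧ ≺ aGd ⟦ ` vx ⟧) putNode

  putSets : Stmt
  putSets =
      -- The number of sets precedes them in the output but is known only afterwards; its cell is
      -- remembered and filled in last.
      vp0 ≔ ` vp
    ⨾ vp ≔ # 1 ⊕ ` vp
    ⨾ vcnt ≔ # 0
    ⨾ for vx vNN putSet
    ⨾ aOut ⟦ ` vp0 ⟧≔ ` vcnt

  afterTrie : Stmt
  afterTrie = block levels ⨾ block seed ⨾ block sweep ⨾ block minimal ⨾ block mark ⨾ block putElements ⨾ block putSets ⨾ vOut ≔ # aOut ⊗ ` vX

  kernel : Stmt
  kernel =
      vnd ≔ ` vn ⊗ ` vd
    ⨾ vdm ≔ # 0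
    ⨾ when (# 0 ≺ ` vd) (vdm ≔ ` vd ⊖ # 1)
    ⨾ block occurrences
    ⨾ block buildTrie
    ⨾ afterTrie

  -- Without sets the two zero cells at addresses 4 and 5 are the output.
  main : Stmt
  main = vOut ≔ # 4 ⨾ when (# 0 ≺ ` vn) kernel

  wf-main : wf main
  wf-main = _

  -- Loads the parameters and sets the common length of the arrays, in register
  -- nV and in variable vX, to (2 ^ w - 1) / nA; here 0 - 1 wraps around.
  prologue : Program
  prologue =
    const 51 0 ∷ load vd 51 ∷ const 51 1 ∷ load vk 51 ∷ const 51 2 ∷ load vm 51 ∷ const 51 3 ∷ load vn 51 ∷
    const 51 0 ∷ const 52 1 ∷ arith sub 51 51 52 ∷ const 52 nA ∷ arith div nV 51 52 ∷ arith div vX 51 52 ∷ []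

  program : Program
  -- The code is placed behind the 14 instructions of the prologue.
  program = prologue ++ compS 14 main

-- Tries of subsets with their lists of subsets

module Tries where

  open Combinatorics
  open import Data.Fin using (Fin; toℕ)
  open import Data.Fin.Subset using (Subset; ∣_∣; _∉_)
  import Data.Fin.Subset as Sub
  open import Data.Fin.Subset.Properties using (_∈?_)
  open import Data.Nat
  open import Data.Nat.Properties
  open import Data.Product using (∃; _×_; _,_; proj₁; proj₂)
  open import Data.Sum using (_⊎_; inj₁; inj₂)
  open import Relation.Binary.PropositionalEquality
  open import Relation.Nullary using (¬_; yes; no; contradiction)

  record Arrays : Set where
    constructor arrays
    field par lab sz off pw D own : ℕ → ℕ
  open Arrays public

  split-< : ∀ a {b i} → i < a + b → i < a ⊎ ∃ λ j → i ≡ a + j × j < b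
  split-< a {b} {i} i< with i <? a
  ... | yes lt = inj₁ lt
  ... | no ge  = inj₂ (i ∸ a , sym (m+[n∸m]≡n (≮⇒≥ ge)) , +-cancelˡ-< a _ _ (subst (_< a + b) (sym (m+[n∸m]≡n (≮⇒≥ ge))) i<))

  module _ {m : ℕ} where

    -- The sets contained in node x are listed in the segment of D starting at
    -- off x, of length pw x = 2 ^ sz x, no set before one of its subsets.
    record Node (A : Arrays) (nd : ℕ → Subset m) (N dl x : ℕ) : Set where
      field
        size     : sz A x ≡ ∣ nd x ∣
        power    : pw A x ≡ 2 ^ sz A x
        seg≤     : off A x + pw A x ≤ dl
        seg<     : ∀ i → i < pw A x → D A (off A x + i) < N
        seg⊑     : ∀ i → i < pw A x → nd (D A (off A x + i)) ⊑ nd x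
        seg-own  : ∀ i → i < pw A x → own A (off A x + i) ≡ x
        seg-all  : ∀ S → S ⊑ nd x → ∃ λ i → i < pw A x × nd (D A (off A x + i)) ≡ S
        seg-ord  : ∀ i j → i < j → j < pw A x → ¬ nd (D A (off A x + j)) ⊑ nd (D A (off A x + i))
        seg-sum  : sumTo (pw A x) (λ i → pw A (D A (off A x + i))) ≡ 3 ^ sz A x
        ancestor : nd x ≡ Sub.⊥ ⊎ ∃ λ e → lab A x ≡ toℕ e × par A x < N × e ∉ nd (par A x) × nd x ≡ ins e (nd (par A x))

    record Trie (A : Arrays) (nd : ℕ → Subset m) (N dl : ℕ) : Set where
      field
        node      : ∀ x → x < N → Node A nd N dl x
        injective : ∀ x y → x < N → y < N → nd x ≡ nd y → x ≡ y
        owner     : ∀ q → q < dl → own A q < N × off A (own A q) ≤ q × q < off A (own A q) + pw A (own A q)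

    record Extends (A : Arrays) (nd : ℕ → Subset m) (N dl : ℕ) (A′ : Arrays) (nd′ : ℕ → Subset m) (N′ dl′ : ℕ) : Set where
      field
        N≤   : N ≤ N′
        dl≤  : dl ≤ dl′
        nd≡  : ∀ x → x < N → nd′ x ≡ nd x
        par≡ : ∀ x → x < N → par A′ x ≡ par A x
        lab≡ : ∀ x → x < N → lab A′ x ≡ lab A x
        sz≡  : ∀ x → x < N → sz A′ x ≡ sz A x
        off≡ : ∀ x → x < N → off A′ x ≡ off A x
        pw≡  : ∀ x → x < N → pw A′ x ≡ pw A x
        D≡   : ∀ q → q < dl → D A′ q ≡ D A q
        own≡ : ∀ q → q < dl → own A′ q ≡ own A q

    Extends-refl : ∀ {A nd N dl} → Extends A nd N dl A nd N dl
    Extends-refl = record { N≤ = ≤-refl ; dl≤ = ≤-refl ; nd≡ = λ _ _ → refl ; par≡ = λ _ _ → refl ; lab≡ = λ _ _ → refl ; sz≡ = λ _ _ → refl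
      ; off≡ = λ _ _ → refl ; pw≡ = λ _ _ → refl ; D≡ = λ _ _ → refl ; own≡ = λ _ _ → refl }

    Extends-trans : ∀ {A nd N dl A₁ nd₁ N₁ dl₁ A₂ nd₂ N₂ dl₂} →
      Extends A nd N dl A₁ nd₁ N₁ dl₁ → Extends A₁ nd₁ N₁ dl₁ A₂ nd₂ N₂ dl₂ → Extends A nd N dl A₂ nd₂ N₂ dl₂
    Extends-trans E F = record
      { N≤ = ≤-trans (N≤ E) (N≤ F) ; dl≤ = ≤-trans (dl≤ E) (dl≤ F)
      ; nd≡  = λ x h → trans (nd≡ F x (<-≤-trans h (N≤ E))) (nd≡ E x h)
      ; par≡ = λ x h → trans (par≡ F x (<-≤-trans h (N≤ E))) (par≡ E x h)
      ; lab≡ = λ x h → trans (lab≡ F x (<-≤-trans h (N≤ E))) (lab≡ E x h)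
      ; sz≡  = λ x h → trans (sz≡ F x (<-≤-trans h (N≤ E))) (sz≡ E x h)
      ; off≡ = λ x h → trans (off≡ F x (<-≤-trans h (N≤ E))) (off≡ E x h)
      ; pw≡  = λ x h → trans (pw≡ F x (<-≤-trans h (N≤ E))) (pw≡ E x h)
      ; D≡   = λ q h → trans (D≡ F q (<-≤-trans h (dl≤ E))) (D≡ E q h)
      ; own≡ = λ q h → trans (own≡ F q (<-≤-trans h (dl≤ E))) (own≡ E q h) }
      where open Extends

    Node-extend : ∀ {A nd N dl A′ nd′ N′ dl′ x} → x < N → Extends A nd N dl A′ nd′ N′ dl′ → Node A nd N dl x → Node A′ nd′ N′ dl′ x
    Node-extend {A} {nd} {N} {dl} {A′} {nd′} {N′} {dl′} {x} x< E n = record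
      { size     = trans (sz≡ x x<) (trans (size) (cong ∣_∣ (sym (nd≡ x x<))))
      ; power    = trans (pw≡ x x<) (trans power (cong (2 ^_) (sym (sz≡ x x<))))
      ; seg≤     = ≤-trans (≤-reflexive (cong₂ _+_ (off≡ x x<) (pw≡ x x<))) (≤-trans seg≤ dl≤)
      ; seg<     = λ i i< → subst (_< N′) (sym (dat i (i<′ i<))) (<-≤-trans (seg< i (i<′ i<)) N≤)
      ; seg⊑     = λ i i< → subst₂ _⊑_ (sym (ndat i (i<′ i<))) (sym (nd≡ x x<)) (seg⊑ i (i<′ i<))
      ; seg-own  = λ i i< → trans (cong (own A′) (cong (_+ i) (off≡ x x<))) (trans (own≡ _ (in-dl i (i<′ i<))) (seg-own i (i<′ i<)))
      ; seg-all  = λ S S⊑ → let i , i< , eq = seg-all S (subst (S ⊑_) (nd≡ x x<) S⊑) in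
                     i , subst (i <_) (sym (pw≡ x x<)) i< , trans (ndat i i<) eq
      ; seg-ord  = λ i j i<j j< le → seg-ord i j i<j (i<′ j<) (subst₂ _⊑_ (ndat j (i<′ j<)) (ndat i (<-trans i<j (i<′ j<))) le)
      ; seg-sum  = trans (cong (λ l → sumTo l _) (pw≡ x x<)) (trans (sumTo-cong (pw A x) (λ i i< → trans (cong (pw A′) (dat i i<)) (pw≡ _ (seg< i i<))))
                     (trans seg-sum (cong (3 ^_) (sym (sz≡ x x<)))))
      ; ancestor = anc ancestor }
      where
      open Node n
      open Extends E
      i<′ : ∀ {i} → i < pw A′ x → i < pw A x
      i<′ {i} = subst (i <_) (pw≡ x x<)
      in-dl : ∀ i → i < pw A x → off A x + i < dl
      in-dl i i< = <-≤-trans (+-monoʳ-< (off A x) i<) seg≤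
      dat : ∀ i → i < pw A x → D A′ (off A′ x + i) ≡ D A (off A x + i)
      dat i i< = trans (cong (D A′) (cong (_+ i) (off≡ x x<))) (D≡ _ (in-dl i i<))
      ndat : ∀ i → i < pw A x → nd′ (D A′ (off A′ x + i)) ≡ nd (D A (off A x + i))
      ndat i i< = trans (cong nd′ (dat i i<)) (nd≡ _ (seg< i i<))
      anc : _ → nd′ x ≡ Sub.⊥ ⊎ ∃ λ e → lab A′ x ≡ toℕ e × par A′ x < N′ × e ∉ nd′ (par A′ x) × nd′ x ≡ ins e (nd′ (par A′ x))
      anc (inj₁ e) = inj₁ (trans (nd≡ x x<) e)
      anc (inj₂ (e , l , p , a , b)) = inj₂ (e , trans (lab≡ x x<) l , subst (_< N′) (sym (par≡ x x<)) (<-≤-trans p N≤) ,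
        subst (e ∉_) (sym nd-par) a , trans (nd≡ x x<) (trans b (cong (ins e) (sym nd-par))))
        where
        nd-par : nd′ (par A′ x) ≡ nd (par A x)
        nd-par = trans (cong nd′ (par≡ x x<)) (nd≡ _ p)

    -- A′ is A with a new node N for nd R ∪ {e}, where child gives the node of
    -- S ∪ {e} for each S contained in nd R.
    record Created (A : Arrays) (nd : ℕ → Subset m) (N dl R : ℕ) (e : Fin m) (child : ℕ → ℕ) (A′ : Arrays) : Set where
      field
        old   : Extends A nd N dl A′ (nd ⟨ N ≔ ins e (nd R) ⟩) (suc N) (dl + (pw A R + pw A R))
        parN  : par A′ N ≡ R
        labN  : lab A′ N ≡ toℕ e
        szN   : sz A′ N ≡ suc (sz A R)
        offN  : off A′ N ≡ dl
        pwN   : pw A′ N ≡ pw A R + pw A R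
        D₁    : ∀ i → i < pw A R → D A′ (dl + i) ≡ D A (off A R + i)
        D₂    : ∀ i → i < pw A R → D A′ (dl + (pw A R + i)) ≡ child (D A (off A R + i))
        ownN  : ∀ i → i < pw A R + pw A R → own A′ (dl + i) ≡ N

    -- The subsets of R ∪ {e} are those of R followed by the same sets with e adjoined. The order
    -- stays admissible because a set containing e lies in no set avoiding it. Adjoining e doubles
    -- each summand 2 ^ |S|, so the sum becomes 3 ^ |R| + 2 * 3 ^ |R|.
    create : ∀ {A nd N dl R e child A′} → Trie A nd N dl → R < N → e ∉ nd R → (∀ y → y < N → nd y ≢ ins e (nd R)) →
      (∀ i → i < pw A R → let x = D A (off A R + i) in child x < suc N × (nd ⟨ N ≔ ins e (nd R) ⟩) (child x) ≡ ins e (nd x)) →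
      Created A nd N dl R e child A′ → Trie A′ (nd ⟨ N ≔ ins e (nd R) ⟩) (suc N) (dl + (pw A R + pw A R))
    create {A} {nd} {N} {dl} {R} {e} {child} {A′} T R< e∉ fresh ch C = record
      { node = nodes ; injective = inj ; owner = owners }
      where
      open Trie T
      open Created C
      open Extends old
      open Node (node R R<) renaming (seg< to Rseg<; seg⊑ to Rseg⊑; seg-all to Rseg-all; seg-ord to Rseg-ord; seg-sum to Rseg-sum; size to Rsize; power to Rpower; seg≤ to Rseg≤)
      nd′ = nd ⟨ N ≔ ins e (nd R) ⟩
      l = pw A R
      x_ : ℕ → ℕ
      x_ i = D A (off A R + i)
      ndN : nd′ N ≡ ins e (nd R)
      ndN = ≔-same nd N _
      nd₁ : ∀ i → i < l → nd′ (D A′ (dl + i)) ≡ nd (x_ i)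
      nd₁ i i< = trans (cong nd′ (D₁ i i<)) (nd≡ _ (Rseg< i i<))
      nd₂ : ∀ i → i < l → nd′ (D A′ (dl + (l + i))) ≡ ins e (nd (x_ i))
      nd₂ i i< = trans (cong nd′ (D₂ i i<)) (proj₂ (ch i i<))
      e∉x : ∀ i → i < l → e ∉ nd (x_ i)
      e∉x i i< h = e∉ (mem (Rseg⊑ i i<) e h)
      powers : ∀ y → y < suc N → pw A′ y ≡ 2 ^ ∣ nd′ y ∣
      powers y y< with m<1+n⇒m<n∨m≡n y<
      ... | inj₁ lt   = let n = Node-extend lt old (node y lt) in trans (Node.power n) (cong (2 ^_) (Node.size n))
      ... | inj₂ refl = trans pwN (trans (cong₂ _+_ Rpower (trans Rpower (sym (+-identityʳ _))))
                          (cong (2 ^_) (trans (cong suc Rsize) (sym (trans (cong ∣_∣ ndN) (ins-size e e∉))))))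
      seg⊑N : ∀ i → i < l + l → nd′ (D A′ (dl + i)) ⊑ ins e (nd R)
      seg⊑N i i< with split-< l i<
      ... | inj₁ i<l = ⊑-trans (⊑-reflexive (nd₁ i i<l)) (⊑-trans (Rseg⊑ i i<l) (⊑-ins e (nd R)))
      ... | inj₂ (j , refl , j<) = ⊑-trans (⊑-reflexive (nd₂ j j<)) (ins-mono e (Rseg⊑ j j<))
      seg<N : ∀ i → i < l + l → D A′ (dl + i) < suc N
      seg<N i i< with split-< l i<
      ... | inj₁ i<l = subst (_< suc N) (sym (D₁ i i<l)) (m<n⇒m<1+n (Rseg< i i<l))
      ... | inj₂ (j , refl , j<) = subst (_< suc N) (sym (D₂ j j<)) (proj₁ (ch j j<))
      segallN : ∀ S → S ⊑ ins e (nd R) → ∃ λ i → i < l + l × nd′ (D A′ (dl + i)) ≡ S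
      segallN S S⊑ with e ∈? S
      ... | no e∉S = let i , i< , eq = Rseg-all S (⊑-ins-avoid e e∉S S⊑) in i , <-≤-trans i< (m≤m+n l l) , trans (nd₁ i i<) eq
      ... | yes e∈S = let i , i< , eq = Rseg-all (del e S) (⊑-ins-del e S⊑) in
            l + i , +-monoʳ-< l i< , trans (nd₂ i i<) (trans (cong (ins e) eq) (ins-del e e∈S))
      segordN : ∀ i j → i < j → j < l + l → ¬ nd′ (D A′ (dl + j)) ⊑ nd′ (D A′ (dl + i))
      segordN i j i<j j< le with split-< l j<
      ... | inj₁ j<l = Rseg-ord i j i<j j<l (subst₂ _⊑_ (nd₁ j j<l) (nd₁ i (<-trans i<j j<l)) le)
      ... | inj₂ (j′ , refl , j′<) with split-< l {l} {i} (<-trans i<j j<)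
      ... | inj₁ i<l = e∉x i i<l (mem (subst₂ _⊑_ (nd₂ j′ j′<) (nd₁ i i<l) le) e (∈-ins-same e _))
      ... | inj₂ (i′ , refl , i′<) = Rseg-ord i′ j′ (+-cancelˡ-< l _ _ i<j) j′< (ins-cancel e (e∉x j′ j′<) (subst₂ _⊑_ (nd₂ j′ j′<) (nd₂ i′ i′<) le))
      sum₁ : sumTo l (λ i → pw A′ (D A′ (dl + i))) ≡ 3 ^ sz A R
      sum₁ = trans (sumTo-cong l (λ i i< → trans (cong (pw A′) (D₁ i i<)) (pw≡ _ (Rseg< i i<)))) Rseg-sum
      sum₂ : sumTo l (λ i → pw A′ (D A′ (dl + (l + i)))) ≡ 2 * 3 ^ sz A R
      sum₂ = trans (sumTo-cong l double) (trans (sumTo-* 2 l _) (cong (2 *_) Rseg-sum))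
        where
        double : ∀ i → i < l → pw A′ (D A′ (dl + (l + i))) ≡ 2 * pw A (x_ i)
        double i i< = trans (powers _ (seg<N (l + i) (+-monoʳ-< l i<))) (trans (cong (λ S → 2 ^ ∣ S ∣) (nd₂ i i<))
          (trans (cong (2 ^_) (ins-size e (e∉x i i<))) (cong (2 *_) (sym (trans (Node.power nx) (cong (2 ^_) (Node.size nx)))))))
          where nx = node (x_ i) (Rseg< i i<)
      segsumN : sumTo (l + l) (λ i → pw A′ (D A′ (dl + i))) ≡ 3 ^ suc (sz A R)
      segsumN = trans (sumTo-+ l l _) (cong₂ _+_ sum₁ sum₂)
      nodeN : Node A′ nd′ (suc N) (dl + (l + l)) N
      nodeN = record
        { size     = trans szN (trans (cong suc Rsize) (sym (trans (cong ∣_∣ ndN) (ins-size e e∉))))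
        ; power    = trans pwN (trans (cong₂ _+_ Rpower (trans Rpower (sym (+-identityʳ _)))) (cong (2 ^_) (sym szN)))
        ; seg≤     = ≤-reflexive (cong₂ _+_ offN pwN)
        ; seg<     = λ i i< → subst (λ o → D A′ (o + i) < suc N) (sym offN) (seg<N i (i<′ i<))
        ; seg⊑     = λ i i< → subst₂ (λ o S → nd′ (D A′ (o + i)) ⊑ S) (sym offN) (sym ndN) (seg⊑N i (i<′ i<))
        ; seg-own  = λ i i< → subst (λ o → own A′ (o + i) ≡ N) (sym offN) (ownN i (i<′ i<))
        ; seg-all  = λ S S⊑ → let i , i< , eq = segallN S (subst (S ⊑_) ndN S⊑) in
                       i , subst (i <_) (sym pwN) i< , subst (λ o → nd′ (D A′ (o + i)) ≡ S) (sym offN) eq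
        ; seg-ord  = λ i j i<j j< → subst (λ o → ¬ nd′ (D A′ (o + j)) ⊑ nd′ (D A′ (o + i))) (sym offN) (segordN i j i<j (i<′ j<))
        ; seg-sum  = trans (cong₂ (λ l o → sumTo l (λ i → pw A′ (D A′ (o + i)))) pwN offN) (trans segsumN (cong (3 ^_) (sym szN)))
        ; ancestor = inj₂ (e , labN , subst (_< suc N) (sym parN) (m<n⇒m<1+n R<) , subst (e ∉_) (sym nd-par) e∉ , trans ndN (cong (ins e) (sym nd-par))) }
        where
        i<′ : ∀ {i} → i < pw A′ N → i < l + l
        i<′ {i} = subst (i <_) pwN
        nd-par : nd′ (par A′ N) ≡ nd R
        nd-par = trans (cong nd′ parN) (nd≡ R R<)
      nodes : ∀ x → x < suc N → Node A′ nd′ (suc N) (dl + (l + l)) x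
      nodes x x< with m<1+n⇒m<n∨m≡n x<
      ... | inj₁ lt   = Node-extend lt old (node x lt)
      ... | inj₂ refl = nodeN
      inj : ∀ x y → x < suc N → y < suc N → nd′ x ≡ nd′ y → x ≡ y
      inj x y x< y< eq with m<1+n⇒m<n∨m≡n x< | m<1+n⇒m<n∨m≡n y<
      ... | inj₁ a    | inj₁ b    = injective x y a b (trans (sym (nd≡ x a)) (trans eq (nd≡ y b)))
      ... | inj₁ a    | inj₂ refl = contradiction (trans (sym (nd≡ x a)) (trans eq ndN)) (fresh x a)
      ... | inj₂ refl | inj₁ b    = contradiction (trans (sym (nd≡ y b)) (trans (sym eq) ndN)) (fresh y b)
      ... | inj₂ refl | inj₂ refl = refl
      owners : ∀ q → q < dl + (l + l) → own A′ q < suc N × off A′ (own A′ q) ≤ q × q < off A′ (own A′ q) + pw A′ (own A′ q)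
      owners q q< with split-< dl q<
      ... | inj₁ lt = let a , b , c = owner q lt in
            subst (λ o → o < suc N × off A′ o ≤ q × q < off A′ o + pw A′ o) (sym (own≡ q lt))
              (m<n⇒m<1+n a , subst (_≤ q) (sym (off≡ _ a)) b , subst (q <_) (sym (cong₂ _+_ (off≡ _ a) (pw≡ _ a))) c)
      ... | inj₂ (i , refl , i<) = subst (λ o → o < suc N × off A′ o ≤ dl + i × dl + i < off A′ o + pw A′ o) (sym (ownN i i<))
            (≤-refl , subst (_≤ dl + i) (sym offN) (m≤m+n dl i) , subst (dl + i <_) (sym (cong₂ _+_ offN pwN)) (+-monoʳ-< dl i<))

-- Stamps: finding the extension of a node by the current element

module StampedTries where

  open import Defs using (_[_↦_])
  open Language
  open Combinatorics
  open Tries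
  open import Data.Empty using (⊥-elim)
  open import Data.Fin using (Fin; toℕ)
  open import Data.Fin.Subset using (Subset; _∈_; _∉_)
  open import Data.Nat
  open import Data.Nat.Properties
  open import Data.Product using (∃; _×_; _,_; proj₂)
  open import Data.Sum using (inj₁; inj₂)
  open import Relation.Binary.Definitions using (tri<; tri≈; tri>)
  open import Relation.Binary.PropositionalEquality
  open import Relation.Nullary using (yes; no; contradiction)

  module _ {m : ℕ} where

    -- While element e is inserted, node x has stamp 1 + e exactly when the node
    -- tmp x of nd x ∪ {e} exists.
    record Stamps (e : Fin m) (nd : ℕ → Subset m) (N : ℕ) (stp tmp : ℕ → ℕ) : Set where
      field
        stp≤      : ∀ x → stp x ≤ suc (toℕ e)
        stp-fresh : ∀ x → N ≤ x → stp x ≡ 0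
        tmp-ok    : ∀ x → x < N → stp x ≡ suc (toℕ e) → tmp x < N × nd (tmp x) ≡ ins e (nd x) × e ∉ nd x
        made      : ∀ y → y < N → e ∈ nd y → ∃ λ x → x < N × stp x ≡ suc (toℕ e) × nd y ≡ ins e (nd x)
        below     : ∀ y → y < N → ∀ z → z ∈ nd y → toℕ z ≤ toℕ e

    module _ {e : Fin m} {nd : ℕ → Subset m} {N : ℕ} {stp tmp : ℕ → ℕ} (S : Stamps e nd N stp tmp) where
      open Stamps S

      -- A node of R ∪ {e} contains e, hence arose from some stamped x with the same extension. As
      -- neither x nor R contains e, they are the same set, so x = R by injectivity, but R is not
      -- stamped.
      fresh : ∀ {A dl R} → Trie A nd N dl → R < N → e ∉ nd R → stp R < suc (toℕ e) → ∀ y → y < N → nd y ≢ ins e (nd R)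
      fresh T R< e∉ unstamped y y< eq with made y y< (subst (e ∈_) (sym eq) (∈-ins-same e _))
      ... | x , x< , stamped , eq′ with Trie.injective T x _ x< R< (ins-injective e (proj₂ (proj₂ (tmp-ok x x< stamped))) e∉ (trans (sym eq′) eq))
      ... | refl = <-irrefl stamped unstamped

      Stamps-create : ∀ {R} → R < N → e ∉ nd R →
        Stamps e (nd ⟨ N ≔ ins e (nd R) ⟩) (suc N) (stp [ R ↦ suc (toℕ e) ]) (tmp [ R ↦ N ])
      Stamps-create {R} R< e∉ = record { stp≤ = a ; stp-fresh = b ; tmp-ok = c ; made = d ; below = f }
        where
        nd′ = nd ⟨ N ≔ ins e (nd R) ⟩
        stp′ = stp [ R ↦ suc (toℕ e) ]
        nd-old : ∀ {x} → x < N → nd′ x ≡ nd x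
        nd-old x< = ≔-other nd _ (<⇒≢ x<)
        stamp-R : stp′ R ≡ suc (toℕ e)
        stamp-R = upd-same stp R _
        a : ∀ x → stp′ x ≤ suc (toℕ e)
        a x with x ≟ R
        ... | yes refl = ≤-reflexive stamp-R
        ... | no x≢R   = ≤-trans (≤-reflexive (upd-other stp _ x≢R)) (stp≤ x)
        b : ∀ x → suc N ≤ x → stp′ x ≡ 0
        b x N<x = trans (upd-other stp _ (λ x≡R → <-asym N<x (subst (_< N) (sym x≡R) R<))) (stp-fresh x (<⇒≤ N<x))
        c : ∀ x → x < suc N → stp′ x ≡ suc (toℕ e) → (tmp [ R ↦ N ]) x < suc N × nd′ ((tmp [ R ↦ N ]) x) ≡ ins e (nd′ x) × e ∉ nd′ x
        c x x< st with x ≟ R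
        ... | yes refl = subst (λ y → y < suc N × nd′ y ≡ ins e (nd′ x) × e ∉ nd′ x) (sym (upd-same tmp x N))
              (≤-refl , trans (≔-same nd N _) (cong (ins e) (sym (nd-old R<))) , subst (e ∉_) (sym (nd-old R<)) e∉)
        ... | no x≢R with m<1+n⇒m<n∨m≡n x<
        ... | inj₂ refl = ⊥-elim (0≢1+n (trans (sym (trans (upd-other stp _ x≢R) (stp-fresh x ≤-refl))) st))
        ... | inj₁ lt with tmp-ok x lt (trans (sym (upd-other stp _ x≢R)) st)
        ... | t< , eq , e∉x = subst (λ y → y < suc N × nd′ y ≡ ins e (nd′ x) × e ∉ nd′ x) (sym (upd-other tmp N x≢R))
              (m<n⇒m<1+n t< , trans (nd-old t<) (trans eq (cong (ins e) (sym (nd-old lt)))) , subst (e ∉_) (sym (nd-old lt)) e∉x)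
        d : ∀ y → y < suc N → e ∈ nd′ y → ∃ λ x → x < suc N × stp′ x ≡ suc (toℕ e) × nd′ y ≡ ins e (nd′ x)
        d y y< e∈ with m<1+n⇒m<n∨m≡n y<
        ... | inj₂ refl = R , m<n⇒m<1+n R< , stamp-R , trans (≔-same nd N _) (cong (ins e) (sym (nd-old R<)))
        ... | inj₁ lt with made y lt (subst (e ∈_) (nd-old lt) e∈)
        ... | x , x< , st , eq = x , m<n⇒m<1+n x< , st′ , trans (nd-old lt) (trans eq (cong (ins e) (sym (nd-old x<))))
          where
          st′ : stp′ x ≡ suc (toℕ e)
          st′ with x ≟ R
          ... | yes refl = stamp-R
          ... | no x≢R   = trans (upd-other stp _ x≢R) st
        f : ∀ y → y < suc N → ∀ z → z ∈ nd′ y → toℕ z ≤ toℕ e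
        f y y< z z∈ with m<1+n⇒m<n∨m≡n y<
        ... | inj₁ lt = below y lt z (subst (z ∈_) (nd-old lt) z∈)
        ... | inj₂ refl with ∈-ins⁻ e (subst (z ∈_) (≔-same nd N _) z∈)
        ... | inj₁ refl = ≤-refl
        ... | inj₂ z∈R  = below R R< z z∈R

      -- The subsets of node R precede R in the segment of P, so they are
      -- stamped once everything before R is.
      subsets-stamped : ∀ {A dl P R i₀} → Trie A nd N dl → P < N → R < N → i₀ < pw A P → R ≡ D A (off A P + i₀) →
        (∀ i → i < i₀ → stp (D A (off A P + i)) ≡ suc (toℕ e)) →
        ∀ x → x < N → nd x ⊑ nd R → (stp [ R ↦ suc (toℕ e) ]) x ≡ suc (toℕ e)
      subsets-stamped {A} {dl} {P} {R} {i₀} T P< R< i₀< refl prefix x x< x⊑R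
        with Node.seg-all (Trie.node T P P<) (nd x) (⊑-trans x⊑R (Node.seg⊑ (Trie.node T P P<) i₀ i₀<))
      ... | i , i< , eq with Trie.injective T _ x (Node.seg< (Trie.node T P P<) i i<) x< eq | <-cmp i i₀
      ... | refl | tri≈ _ refl _ = upd-same stp R _
      ... | refl | tri> _ _ i₀<i = contradiction x⊑R (Node.seg-ord (Trie.node T P P<) i₀ i i₀<i i<)
      ... | refl | tri< i<i₀ _ _ with D A (off A P + i) ≟ R
      ... | yes eq′ = trans (cong (stp [ R ↦ suc (toℕ e) ]) eq′) (upd-same stp R _)
      ... | no ≢R  = trans (upd-other stp _ ≢R) (prefix i i<i₀)

-- Creation of a single node

module NodeCreation where

  open import Defs using (_[_↦_])
  open Language
  open KernelProgram
  open Combinatorics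
  open Tries
  open StampedTries
  open import Data.Fin using (Fin; toℕ)
  open import Data.Fin.Subset using (Subset; _∉_)
  open import Data.Nat
  open import Data.Nat.Properties
  open import Data.Nat.Solver using (module +-*-Solver)
  open import Data.Product using (_×_; _,_)
  open import Data.Sum using (inj₁; inj₂)
  open import Function using (_∘_; case_of_)
  open import Relation.Binary.PropositionalEquality
  open +-*-Solver using (solve; _:+_; _:*_; _:=_; con)

  arrs : State → Arrays
  arrs σ = arrays (arr σ aPar) (arr σ aLab) (arr σ aSz) (arr σ aOff) (arr σ aPw) (arr σ aD) (arr σ aOwn)

  module CreateSpec (w X : ℕ) (X< : X < 2 ^ w) where
    open Logic w X

    <W : ∀ {v} → v < X → v < 2 ^ w
    <W v< = <-trans v< X<

    ≤W : ∀ {v} → v ≤ X → v < 2 ^ w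
    ≤W v≤ = ≤-<-trans v≤ X<

    record Copied (i o l dl N : ℕ) (D₀ own₀ tmp D′ own′ : ℕ → ℕ) : Set where
      field
        D-old   : ∀ q → q < dl → D′ q ≡ D₀ q
        own-old : ∀ q → q < dl → own′ q ≡ own₀ q
        D-fst   : ∀ j → j < i → D′ (dl + j) ≡ D₀ (o + j)
        D-snd   : ∀ j → j < i → D′ (dl + (l + j)) ≡ tmp (D₀ (o + j))
        own-fst : ∀ j → j < i → own′ (dl + j) ≡ N
        own-snd : ∀ j → j < i → own′ (dl + (l + j)) ≡ N

    Copied-step : ∀ {i o l dl N D₀ own₀ tmp D′ own′} → i < l → Copied i o l dl N D₀ own₀ tmp D′ own′ →
      ∀ x y → x ≡ D₀ (o + i) → y ≡ tmp (D₀ (o + i)) →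
      Copied (suc i) o l dl N D₀ own₀ tmp (D′ [ dl + i ↦ x ] [ dl + (l + i) ↦ y ]) (own′ [ dl + i ↦ N ] [ dl + (l + i) ↦ N ])
    Copied-step {i} {o} {l} {dl} {N} {D₀} {own₀} {tmp} {D′} {own′} i<l C x y x≡ y≡ = record
      { D-old   = λ q q< → trans (old D′ x y q q<) (D-old q q<)
      ; own-old = λ q q< → trans (old own′ N N q q<) (own-old q q<)
      ; D-fst   = λ j j< → case m<1+n⇒m<n∨m≡n j< of λ where
          (inj₁ lt)   → trans (fst D′ x y j lt) (D-fst j lt)
          (inj₂ refl) → trans (trans (upd-other (D′ [ dl + i ↦ x ]) y ≢₁) (upd-same D′ (dl + i) x)) x≡
      ; D-snd   = λ j j< → case m<1+n⇒m<n∨m≡n j< of λ where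
          (inj₁ lt)   → trans (snd D′ x y j lt) (D-snd j lt)
          (inj₂ refl) → trans (upd-same (D′ [ dl + i ↦ x ]) (dl + (l + i)) y) y≡
      ; own-fst = λ j j< → case m<1+n⇒m<n∨m≡n j< of λ where
          (inj₁ lt)   → trans (fst own′ N N j lt) (own-fst j lt)
          (inj₂ refl) → trans (upd-other (own′ [ dl + i ↦ N ]) N ≢₁) (upd-same own′ (dl + i) N)
      ; own-snd = λ j j< → case m<1+n⇒m<n∨m≡n j< of λ where
          (inj₁ lt)   → trans (snd own′ N N j lt) (own-snd j lt)
          (inj₂ refl) → upd-same (own′ [ dl + i ↦ N ]) (dl + (l + i)) N }
      where
      open Copied C
      ≢₁ : dl + i ≢ dl + (l + i)
      ≢₁ e = <⇒≢ (<-≤-trans i<l (m≤m+n l i)) (+-cancelˡ-≡ dl _ _ e)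
      old : ∀ f u v q → q < dl → (f [ dl + i ↦ u ] [ dl + (l + i) ↦ v ]) q ≡ f q
      old f u v q q< = trans (upd-other (f [ dl + i ↦ u ]) v (<⇒≢ (<-≤-trans q< (m≤m+n dl _)))) (upd-other f u (<⇒≢ (<-≤-trans q< (m≤m+n dl i))))
      fst : ∀ f u v j → j < i → (f [ dl + i ↦ u ] [ dl + (l + i) ↦ v ]) (dl + j) ≡ f (dl + j)
      fst f u v j j<i = trans (upd-other (f [ dl + i ↦ u ]) v (<⇒≢ (+-monoʳ-< dl (<-≤-trans (<-trans j<i i<l) (m≤m+n l i)))))
        (upd-other f u (<⇒≢ (+-monoʳ-< dl j<i)))
      snd : ∀ f u v j → j < i → (f [ dl + i ↦ u ] [ dl + (l + i) ↦ v ]) (dl + (l + j)) ≡ f (dl + (l + j))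
      snd f u v j j<i = trans (upd-other (f [ dl + i ↦ u ]) v (<⇒≢ (+-monoʳ-< dl (+-monoʳ-< l j<i))))
        (upd-other f u (<⇒≢ (+-monoʳ-< dl (<-≤-trans i<l (m≤m+n l j))) ∘ sym))

    -- The source segment ends at or below `dl` and all writes go to `dl` and beyond, so no entry is
    -- overwritten before it is read.
    copySegment-spec : ∀ {σ} → let dl = var σ vdl ; l = var σ vl2 ; o = var σ vo2 ; N = var σ vNN in
      o + l ≤ dl → dl + (l + l) ≤ X → (∀ i → i < l → arr σ aD (o + i) < X) →
      ∀ {Q} → (∀ τ → Copied l o l dl N (arr σ aD) (arr σ aOwn) (arr σ aTmp) (arr τ aD) (arr τ aOwn) → clk τ ≤ l * 6 + clk σ → Q (forSt vi2 vl2 copyBody σ l τ)) →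
      wp copySegment Q σ
    copySegment-spec {σ} seg≤ room D< {Q} fin = for-cost {vi2} {vl2} {copyBody} {Q} {σ} 5
      (λ i τ → Copied i o l dl N (arr σ aD) (arr σ aOwn) (arr σ aTmp) (arr τ aD) (arr τ aOwn))
      (record { D-old = λ _ _ → refl ; own-old = λ _ _ → refl ; D-fst = λ _ () ; D-snd = λ _ () ; own-fst = λ _ () ; own-snd = λ _ () })
      body
      fin
      where
      dl = var σ vdl
      l = var σ vl2
      o = var σ vo2
      N = var σ vNN
      body : ∀ i τ → i < l → Copied i o l dl N (arr σ aD) (arr σ aOwn) (arr σ aTmp) (arr τ aD) (arr τ aOwn) →
        wp copyBody (λ τ′ → Copied (suc i) o l dl N (arr σ aD) (arr σ aOwn) (arr σ aTmp) (arr τ′ aD) (arr τ′ aOwn) × clk τ′ ≤ 5 + suc (clk τ)) (forSt vi2 vl2 copyBody σ i τ)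
      body i τ i<l C =
        ((_ , _ , <W (<-≤-trans o+i< (≤-trans (m≤m+n dl (l + l)) room))) , <-≤-trans o+i< (≤-trans (m≤m+n dl (l + l)) room)) ,
        (_ , _ , <W a₁) , _ , a₁ ,
        (_ , (_ , _ , <W l+i<) , <W a₂) , (_ , subst (_< X) (sym x≡) (D< i i<l)) , a₂ ,
        (_ , _ , <W a₁) , _ , a₁ ,
        (_ , (_ , _ , <W l+i<) , <W a₂) , _ , a₂ ,
        Copied-step i<l C _ _ x≡ (cong (arr σ aTmp) x≡) , ≤-refl
        where
        o+i< : o + i < dl
        o+i< = <-≤-trans (+-monoʳ-< o i<l) seg≤
        a₂ : dl + (l + i) < X
        a₂ = <-≤-trans (+-monoʳ-< dl (+-monoʳ-< l i<l)) room
        a₁ : dl + i < X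
        a₁ = ≤-<-trans (+-monoʳ-≤ dl (m≤n+m i l)) a₂
        l+i< : l + i < X
        l+i< = ≤-<-trans (m≤n+m (l + i) dl) a₂
        x≡ : arr τ aD (o + i) ≡ arr σ aD (o + i)
        x≡ = Copied.D-old C (o + i) o+i<

    n<2^n : ∀ n → n < 2 ^ n
    n<2^n zero    = s≤s z≤n
    n<2^n (suc n) = ≤-trans (s≤s (n<2^n n)) (≤-trans (+-monoˡ-≤ (2 ^ n) (m^n>0 2 n)) (≤-reflexive (cong (2 ^ n +_) (sym (+-identityʳ (2 ^ n))))))

    record NodeCreated {m : ℕ} (e : Fin m) (nd : ℕ → Subset m) (σ τ : State) : Set where
      field
        {nd′}   : ℕ → Subset m
        trie′   : Trie (arrs τ) nd′ (var τ vNN) (var τ vdl)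
        stamps′ : Stamps e nd′ (var τ vNN) (arr τ aStp) (arr τ aTmp)
        extends : Extends (arrs σ) nd (var σ vNN) (var σ vdl) (arrs τ) nd′ (var τ vNN) (var τ vdl)
        N≡      : var τ vNN ≡ suc (var σ vNN)
        dl≡     : var τ vdl ≡ var σ vdl + (arr σ aPw (var σ vR) + arr σ aPw (var σ vR))
        stp≡    : arr τ aStp ≡ arr σ aStp [ var σ vR ↦ suc (toℕ e) ]
        nd′-new : nd′ (var σ vNN) ≡ ins e (nd (var σ vR))
        cost    : clk τ ≤ 12 + arr σ aPw (var σ vR) * 6 + clk σ

    createNode-spec : ∀ {m} {e : Fin m} {nd σ} → let N = var σ vNN ; dl = var σ vdl ; R = var σ vR ; A = arrs σ in
      var σ ve ≡ toℕ e → Trie A nd N dl → Stamps e nd N (arr σ aStp) (arr σ aTmp) → R < N → e ∉ nd R →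
      arr σ aStp R < suc (toℕ e) →
      (∀ x → x < N → nd x ⊑ nd R → (arr σ aStp [ R ↦ suc (toℕ e) ]) x ≡ suc (toℕ e)) →
      N < X → toℕ e < X → dl + (pw A R + pw A R) ≤ X →
      wp createNode (NodeCreated e nd σ) σ
    createNode-spec {m} {e} {nd} {σ} e≡ T S R<N e∉ unstamped stamped N<X e<X room =
      (_ , R<X) , (_ , R<X) ,
      _ , (_ , _ , ≤W (subst (_< X) (sym e≡) e<X)) , R<X ,
      _ , _ , R<X ,
      _ , _ , N<X ,
      _ , _ , N<X ,
      _ , (_ , (_ , R<X) , ≤W (≤-trans (≤-trans (n<2^n (arr σ aSz R)) (≤-reflexive (sym (Node.power nR)))) l≤X)) , N<X ,
      _ , _ , N<X ,
      _ , (_ , _ , ≤W l+l≤X) , N<X ,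
      copySegment-spec {σ₉} (Node.seg≤ nR) room (λ i i< → <-trans (Node.seg< nR i i<) N<X) λ τ C c →
        (_ , (_ , _ , ≤W l+l≤X) , ≤W room) , (_ , _ , ≤W N<X) , post τ C c
      where
      N = var σ vNN
      dl = var σ vdl
      R = var σ vR
      A = arrs σ
      l = arr σ aPw R
      nR = Trie.node T R R<N
      R<X : R < X
      R<X = <-trans R<N N<X
      l+l≤X : l + l ≤ X
      l+l≤X = ≤-trans (m≤n+m (l + l) dl) room
      l≤X : l ≤ X
      l≤X = ≤-trans (m≤m+n l l) l+l≤X
      σ₂ = setV vl2 l (setV vo2 (arr σ aOff R) σ)
      σ₆ = setA aLab N (var σ ve) (setA aPar N R (setA aTmp R N (setA aStp R (1 + var σ ve) σ₂)))
      σ₉ = setA aPw N (l + l) (setA aOff N dl (setA aSz N (1 + arr σ aSz R) σ₆))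
      post : ∀ τ → Copied l (arr σ aOff R) l dl N (arr σ aD) (arr σ aOwn) (arr σ aTmp [ R ↦ N ]) (arr τ aD) (arr τ aOwn) → clk τ ≤ l * 6 + clk σ₉ →
        NodeCreated e nd σ (setV vNN (suc N) (setV vdl (dl + (l + l)) (forSt vi2 vl2 copyBody σ₉ l τ)))
      post τ C c = record
        { nd′ = nd⁺ ; trie′ = create T R<N e∉ (fresh S T R<N e∉ unstamped) child created
        ; stamps′ = subst (λ v → Stamps e nd⁺ (suc N) (arr σ aStp [ R ↦ suc v ]) (arr σ aTmp [ R ↦ N ])) (sym e≡) (Stamps-create S R<N e∉)
        ; extends = Created.old created ; N≡ = refl ; dl≡ = refl ; stp≡ = cong (λ v → arr σ aStp [ R ↦ suc v ]) e≡ ; nd′-new = ≔-same nd N _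
        ; cost = from-≤ 0 c (solve 3 (λ t l s → con 3 :+ t :+ (l :* con 6 :+ (con 9 :+ s)) :+ con 0 := con 12 :+ l :* con 6 :+ s :+ t) refl (clk τ) l (clk σ)) }
        where
        open Copied C
        nd⁺ = nd ⟨ N ≔ ins e (nd R) ⟩
        tmp⁺ = arr σ aTmp [ R ↦ N ]
        A⁺ = arrays (arr σ aPar [ N ↦ R ]) (arr σ aLab [ N ↦ var σ ve ]) (arr σ aSz [ N ↦ suc (arr σ aSz R) ]) (arr σ aOff [ N ↦ dl ]) (arr σ aPw [ N ↦ l + l ]) (arr τ aD) (arr τ aOwn)
        -- Every subset of R is stamped by now, so `tmp⁺` leads to its extension; for R itself this
        -- is the node being created.
        child : ∀ i → i < l → let x = arr σ aD (arr σ aOff R + i) in tmp⁺ x < suc N × nd⁺ (tmp⁺ x) ≡ ins e (nd x)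
        child i i< with Stamps.tmp-ok (Stamps-create S R<N e∉) _ (m<n⇒m<1+n (Node.seg< nR i i<)) (stamped _ (Node.seg< nR i i<) (Node.seg⊑ nR i i<))
        ... | a , b , _ = a , trans b (cong (ins e) (≔-other nd _ (<⇒≢ (Node.seg< nR i i<))))
        created : Created A nd N dl R e tmp⁺ A⁺
        created = record
          { old  = record { N≤ = n≤1+n N ; dl≤ = m≤m+n dl (l + l) ; nd≡ = λ x x< → ≔-other nd _ (<⇒≢ x<) ; par≡ = λ x → upd-< (arr σ aPar) _ ; lab≡ = λ x → upd-< (arr σ aLab) _
                          ; sz≡ = λ x → upd-< (arr σ aSz) _ ; off≡ = λ x → upd-< (arr σ aOff) _ ; pw≡ = λ x → upd-< (arr σ aPw) _ ; D≡ = D-old ; own≡ = own-old }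
          ; parN = upd-same (arr σ aPar) N R ; labN = trans (upd-same (arr σ aLab) N _) e≡ ; szN = upd-same (arr σ aSz) N _ ; offN = upd-same (arr σ aOff) N dl ; pwN = upd-same (arr σ aPw) N _
          ; D₁ = D-fst ; D₂ = D-snd ; ownN = λ i i< → case split-< l i< of λ where
              (inj₁ lt)            → own-fst i lt
              (inj₂ (j , refl , j<)) → own-snd j j< }

-- Extending all subsets of one node

module Scanning where

  open import Defs using (_[_↦_])
  open Language
  open KernelProgram
  open Combinatorics
  open Tries
  open StampedTries
  open NodeCreation
  open import Data.Fin using (Fin; toℕ)
  open import Data.Fin.Subset using (Subset; _∉_)
  open import Data.Nat
  open import Data.Nat.Properties
  open import Data.Nat.Solver using (module +-*-Solver)
  open import Data.Product using (_,_)
  open import Data.Sum using (inj₁; inj₂)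
  open import Function using (case_of_)
  open import Relation.Binary.PropositionalEquality
  open import Relation.Nullary using (yes; no; contradiction)
  open +-*-Solver using (solve; _:+_; _:*_; _:=_; con)

  -- `G` is a property that every created node has to acquire; later it is containment in a row,
  -- which rules out nodes for sets foreign to the instance.
  module ScanSpec (w X : ℕ) (X< : X < 2 ^ w) {m : ℕ} (G : Subset m → Set) where
    open Logic w X
    open CreateSpec w X X<

    -- The charge for the i-th subset R in the list is 2 ^ |R|, the length of the segment to be
    -- copied, and it is made whether or not a node is created.
    weight : State → ℕ → ℕ
    weight σ i = arr σ aPw (arr σ aD (var σ vo + i))

    record Scanned (e : Fin m) (nd₀ : ℕ → Subset m) (σ : State) (i : ℕ) (τ : State) : Set where
      field
        {nd}   : ℕ → Subset m
        trie   : Trie (arrs τ) nd (var τ vNN) (var τ vdl)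
        stamps : Stamps e nd (var τ vNN) (arr τ aStp) (arr τ aTmp)
        ext    : Extends (arrs σ) nd₀ (var σ vNN) (var σ vdl) (arrs τ) nd (var τ vNN) (var τ vdl)
        prefix : ∀ j → j < i → arr τ aStp (arr τ aD (var σ vo + j)) ≡ suc (toℕ e)
        inG    : ∀ x → x < var τ vNN → G (nd x)
        N≤     : var τ vNN ≤ var σ vNN + i
        dl≤    : var τ vdl ≤ var σ vdl + 2 * sumTo i (weight σ)
        cost   : clk τ ≤ 21 * sumTo i (weight σ) + clk σ

    skip-cost : ∀ {t g s c} → 1 ≤ g → t ≤ 21 * s + c → 3 + t ≤ 21 * (s + g) + c
    skip-cost {t} {g} {s} {c} g≥1 t≤ = from-≤ 18 (+-mono-≤ (*-monoʳ-≤ 21 g≥1) t≤)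
      (solve 4 (λ t g s c → con 3 :+ t :+ (con 21 :* g :+ (con 21 :* s :+ c)) :+ con 18 := con 21 :* (s :+ g) :+ c :+ (con 21 :+ t)) refl t g s c)

    -- Origin of the constant 21: a creation takes 6g ticks for copying and 15 besides, and g ≥ 1.
    create-cost : ∀ {t t′ g s c} → 1 ≤ g → t ≤ 21 * s + c → t′ ≤ 12 + g * 6 + (3 + t) → t′ ≤ 21 * (s + g) + c
    create-cost {t} {t′} {g} {s} {c} g≥1 t≤ t′≤ = from-≤ 0 (+-mono-≤ t′≤ (+-mono-≤ t≤ (*-monoʳ-≤ 15 g≥1)))
      (solve 5 (λ t u g s c → u :+ (con 12 :+ g :* con 6 :+ (con 3 :+ t) :+ (con 21 :* s :+ c :+ con 15 :* g)) :+ con 0 := con 21 :* (s :+ g) :+ c :+ (u :+ (t :+ con 15))) refl t t′ g s c)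

    scan-spec : ∀ {e nd₀ σ} → let N = var σ vNN ; P = var σ vP in
      var σ ve ≡ toℕ e → var σ vo ≡ arr σ aOff P → var σ vl ≡ arr σ aPw P →
      Trie (arrs σ) nd₀ N (var σ vdl) → Stamps e nd₀ N (arr σ aStp) (arr σ aTmp) →
      P < N → e ∉ nd₀ P → (∀ x → x < N → G (nd₀ x)) → (∀ S → S ⊑ ins e (nd₀ P) → G S) →
      N + var σ vl ≤ X → toℕ e < X → var σ vdl + 2 * sumTo (var σ vl) (weight σ) ≤ X →
      ∀ {Q} → (∀ τ → Scanned e nd₀ σ (var σ vl) τ → Q (forSt vi1 vl scanBody σ (var σ vl) τ)) → wp scan Q σ
    scan-spec {e} {nd₀} {σ} e≡ o≡ l≡ T₀ S₀ P< e∉P g₀ down roomN e<X roomD {Q} fin =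
      for-rule {vi1} {vl} {scanBody} {Q} {σ} (Scanned e nd₀ σ)
        (record { trie = T₀ ; stamps = S₀ ; ext = Extends-refl ; prefix = λ _ () ; inG = g₀ ; N≤ = ≤-reflexive (sym (+-identityʳ N₀)) ; dl≤ = ≤-reflexive (sym (+-identityʳ dl₀)) ; cost = ≤-refl })
        body fin
      where
      N₀ = var σ vNN
      dl₀ = var σ vdl
      P = var σ vP
      o = var σ vo
      l = var σ vl
      body : ∀ i τ → i < l → Scanned e nd₀ σ i τ → wp scanBody (Scanned e nd₀ σ (suc i)) (forSt vi1 vl scanBody σ i τ)
      body i τ i<l I =
        ((_ , _ , <W o+i<X) , o+i<X) , ((_ , <-trans R<N N<X) , (_ , _ , ≤W (subst (_< X) (sym e≡) e<X))) ,
        (λ lt → block-rule createNode {Q = Scanned e nd₀ σ (suc i)} {σ = σ′} (createNode-spec {σ = σ′} e≡ trie stamps R<N e∉R (subst (arr τ aStp R <_) (cong suc e≡) lt)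
          (subsets-stamped stamps trie P<N R<N i<pw R≡ (λ j j<i → trans (cong (λ o → arr τ aStp (arr τ aD (o + j))) off-P) (prefix j j<i)))
          N<X e<X room) made-new) ,
        λ ge → record
          { trie = trie ; stamps = stamps ; ext = ext ; inG = inG
          ; prefix = λ j j< → case m<1+n⇒m<n∨m≡n j< of λ where
              (inj₁ lt)   → prefix j lt
              (inj₂ refl) → ≤-antisym (Stamps.stp≤ stamps R) (subst (λ v → suc v ≤ arr τ aStp R) e≡ ge)
          ; N≤ = ≤-trans N≤ (≤-trans (n≤1+n _) (≤-reflexive (sym (+-suc N₀ i))))
          ; dl≤ = ≤-trans dl≤ (+-monoʳ-≤ dl₀ (*-monoʳ-≤ 2 (m≤m+n (sumTo i g) (g i))))
          ; cost = skip-cost {s = sumTo i g} g≥1 cost }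
        where
        open Scanned I
        g = weight σ
        σ′ = tick (setV vR (arr τ aD (o + i)) (forSt vi1 vl scanBody σ i τ))
        R = arr τ aD (o + i)
        P<N : P < var τ vNN
        P<N = <-≤-trans P< (Extends.N≤ ext)
        nP = Trie.node trie P P<N
        nP₀ = Trie.node T₀ P P<
        off-P : arr τ aOff P ≡ o
        off-P = trans (Extends.off≡ ext P P<) (sym o≡)
        i<pw : i < arr τ aPw P
        i<pw = subst (i <_) (trans l≡ (sym (Extends.pw≡ ext P P<))) i<l
        i<pw₀ : i < arr σ aPw P
        i<pw₀ = subst (i <_) l≡ i<l
        R≡ : R ≡ arr τ aD (arr τ aOff P + i)
        R≡ = cong (λ o → arr τ aD (o + i)) (sym off-P)
        R<N : R < var τ vNN
        R<N = subst (_< var τ vNN) (sym R≡) (Node.seg< nP i i<pw)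
        o+i<dl : o + i < dl₀
        o+i<dl = <-≤-trans (+-monoʳ-< o i<l) (≤-trans (≤-reflexive (cong₂ _+_ o≡ l≡)) (Node.seg≤ nP₀))
        o+i<X : o + i < X
        o+i<X = <-≤-trans o+i<dl (≤-trans (m≤m+n dl₀ _) roomD)
        N<X : var τ vNN < X
        N<X = ≤-<-trans N≤ (<-≤-trans (+-monoʳ-< N₀ i<l) roomN)
        R⊑P : nd R ⊑ nd₀ P
        R⊑P = subst₂ (λ r p → nd r ⊑ p) (sym R≡) (Extends.nd≡ ext P P<) (Node.seg⊑ nP i i<pw)
        e∉R : e ∉ nd R
        e∉R h = e∉P (mem R⊑P e h)
        -- The list of P does not change during the scan, so weights may be read in the initial
        -- state, where their sum is known to be a power of 3.
        R₀≡ : arr σ aD (o + i) ≡ R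
        R₀≡ = sym (Extends.D≡ ext _ o+i<dl)
        R₀<N₀ : R < N₀
        R₀<N₀ = subst (_< N₀) (trans (cong (λ o → arr σ aD (o + i)) (sym o≡)) R₀≡) (Node.seg< nP₀ i i<pw₀)
        g≡ : g i ≡ arr τ aPw R
        g≡ = trans (cong (arr σ aPw) R₀≡) (sym (Extends.pw≡ ext R R₀<N₀))
        g≥1 : 1 ≤ g i
        g≥1 = ≤-trans (m^n>0 2 (arr τ aSz R)) (≤-reflexive (trans (sym (Node.power (Trie.node trie R R<N))) (sym g≡)))
        grow : var τ vdl + (arr τ aPw R + arr τ aPw R) ≤ dl₀ + 2 * sumTo (suc i) g
        grow = ≤-trans (+-monoˡ-≤ _ dl≤) (≤-reflexive (trans (cong (λ p → dl₀ + 2 * sumTo i g + (p + p)) (sym g≡))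
          (solve 3 (λ d s g → d :+ con 2 :* s :+ (g :+ g) := d :+ con 2 :* (s :+ g)) refl dl₀ (sumTo i g) (g i))))
        room : var τ vdl + (arr τ aPw R + arr τ aPw R) ≤ X
        room = ≤-trans grow (≤-trans (+-monoʳ-≤ dl₀ (*-monoʳ-≤ 2 (sumTo-≤ g i<l))) roomD)
        made-new : ∀ τ′ → NodeCreated e nd σ′ τ′ → Scanned e nd₀ σ (suc i) (merge createNode σ′ τ′)
        made-new τ′ C = record
          { trie = trie′ ; stamps = stamps′ ; ext = Extends-trans ext extends
          ; prefix = λ j j< → trans (cong (λ d → arr τ′ aStp d) (Extends.D≡ extends _ (<-≤-trans (o+j< j (≤-trans j< i<l)) (Extends.dl≤ ext))))
              (trans (cong (λ f → f (arr τ aD (o + j))) stp≡) (stamp j j<))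
          ; inG = λ x x< → case m<1+n⇒m<n∨m≡n (subst (x <_) N≡ x<) of λ where
              (inj₁ lt)   → subst G (sym (Extends.nd≡ extends x lt)) (inG x lt)
              (inj₂ refl) → subst G (sym nd′-new) (down _ (ins-mono e R⊑P))
          ; N≤ = ≤-trans (≤-reflexive N≡) (≤-trans (s≤s N≤) (≤-reflexive (sym (+-suc N₀ i))))
          ; dl≤ = ≤-trans (≤-reflexive dl≡) grow
          ; cost = create-cost {s = sumTo i g} g≥1 cost (subst (λ p → clk τ′ ≤ 12 + p * 6 + (3 + clk τ)) (sym g≡) cost′) }
          where
          open NodeCreated C renaming (cost to cost′)
          o+j< : ∀ j → j < l → o + j < dl₀
          o+j< j j<l = <-≤-trans (+-monoʳ-< o j<l) (≤-trans (≤-reflexive (cong₂ _+_ o≡ l≡)) (Node.seg≤ nP₀))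
          stamp : ∀ j → j < suc i → (arr τ aStp [ R ↦ suc (toℕ e) ]) (arr τ aD (o + j)) ≡ suc (toℕ e)
          stamp j j< with arr τ aD (o + j) ≟ R | m<1+n⇒m<n∨m≡n j<
          ... | yes eq | _ = trans (cong (arr τ aStp [ R ↦ suc (toℕ e) ]) eq) (upd-same (arr τ aStp) R _)
          ... | no ≢R  | inj₁ lt = trans (upd-other (arr τ aStp) _ ≢R) (prefix j lt)
          ... | no ≢R  | inj₂ refl = contradiction refl ≢R

-- Construction of the trie and its amortized cost

module TrieConstruction where

  open import Defs using (_[_↦_])
  open Language
  open KernelProgram
  open Combinatorics
  open Tries
  open StampedTries
  open NodeCreation
  open Scanning
  open import Data.Empty using (⊥-elim)
  open import Data.Fin using (Fin; toℕ; fromℕ<)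
  open import Data.Fin.Properties using (toℕ-fromℕ<; toℕ<n)
  open import Data.Fin.Subset using (Subset; ∣_∣; _∈_; _∉_)
  import Data.Fin.Subset as Sub
  open import Data.Fin.Subset.Properties using (∉⊥; ∣⊥∣≡0)
  open import Data.List using (List; []; _∷_; map)
  import Data.List.Membership.Propositional as L
  open import Data.List.Membership.Propositional.Properties using (∈-map⁻)
  open import Data.List.Relation.Unary.All as All using (All; []; _∷_)
  open import Data.List.Relation.Unary.AllPairs using (AllPairs; []; _∷_)
  open import Data.List.Relation.Unary.Any using (here; there)
  open import Data.Nat
  open import Data.Nat.Properties
  open import Data.Nat.Solver using (module +-*-Solver)
  open import Data.Product using (∃; _×_; _,_; proj₁; proj₂)
  open import Data.Sum using (inj₁)
  open import Function using (case_of_)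
  open import Relation.Binary.PropositionalEquality
  open import Relation.Nullary using (¬_; yes; no; contradiction)
  open +-*-Solver using (solve; _:+_; _:*_; _:=_; con)

  module BuildSpec (w X : ℕ) (X< : X < 2 ^ w) {m : ℕ} (n d dm : ℕ) (n≥1 : 1 ≤ n) (Sf : ℕ → Subset m)
    (∣Sf∣ : ∀ f → f < n → ∣ Sf f ∣ ≡ d) (n*2^d≤X : n * 2 ^ d ≤ X) (n*3^d≤X : n * 3 ^ d ≤ X) (m≤X : m ≤ X) (n≤X : n ≤ X) where
    open Logic w X

    InRow : Subset m → Set
    InRow S = ∃ λ f → f < n × S ⊑ Sf f

    open CreateSpec w X X< using (<W; ≤W)
    open ScanSpec w X X< InRow

    row : ℕ → ℕ
    row j = j / suc dm

    -- Inserting an element into a row part of size p raises this by (b - 1) * b ^ p. For b = 2 that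
    -- is 2 ^ p, the greatest possible number of new nodes; for b = 3 it is 2 * 3 ^ p, the greatest
    -- possible number of new pairs, and it also pays for the time.
    potential : ℕ → State → ℕ
    potential b τ = sumTo n (λ f → b ^ arr τ aSz (arr τ aCur f))

    -- State while the rows listed in zs still have to receive element e.
    record Walking (c : ℕ) (e : Fin m) (zs : List ℕ) (τ : State) : Set where
      field
        {nd}    : ℕ → Subset m
        trie    : Trie (arrs τ) nd (var τ vNN) (var τ vdl)
        stamps  : Stamps e nd (var τ vNN) (arr τ aStp) (arr τ aTmp)
        inRow   : ∀ x → x < var τ vNN → InRow (nd x)
        cur<    : ∀ f → f < n → arr τ aCur f < var τ vNN
        cur⊑    : ∀ f → f < n → nd (arr τ aCur f) ⊑ Sf f
        pending : ∀ f → f < n → f L.∈ map row zs → nd (arr τ aCur f) ≡ cut (Sf f) (toℕ e)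
        done    : ∀ f → f < n → ¬ f L.∈ map row zs → nd (arr τ aCur f) ≡ cut (Sf f) (suc (toℕ e))
        valid   : All (λ j → row j < n × e ∈ Sf (row j)) zs
        apart   : AllPairs (λ i j → row i ≢ row j) zs
        N-bound : var τ vNN + n ≤ 1 + potential 2 τ
        D-bound : var τ vdl + n ≤ 1 + potential 3 τ
        cost    : clk τ + 14 * n ≤ 14 * potential 3 τ + c

    -- Even after the coming insertion no row part has more than d elements, so the raised potential
    -- is at most n * b ^ d. This gives the room in the arrays before anything is written.
    bump : ∀ b {τ f e nd N dl} → 1 ≤ b → f < n → Trie (arrs τ) nd N dl → (∀ f → f < n → arr τ aCur f < N) →
      (∀ f → f < n → nd (arr τ aCur f) ⊑ Sf f) → e ∉ nd (arr τ aCur f) → ins e (nd (arr τ aCur f)) ⊑ Sf f →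
      potential b τ + (b ∸ 1) * b ^ arr τ aSz (arr τ aCur f) ≤ n * b ^ d
    bump b@(suc b′) {τ} {f} {e} {nd} {N} {dl} b≥1 f<n T cur< cur⊑ e∉ ins⊑ = ≤-trans (≤-reflexive (sym eq)) (≤-trans (sumTo-mono n each) (≤-reflexive (sumTo-const n (b ^ d))))
      where
      g = λ f → b ^ arr τ aSz (arr τ aCur f)
      h = g ⟨ f ≔ b ^ suc (arr τ aSz (arr τ aCur f)) ⟩
      eq : sumTo n h ≡ sumTo n g + b′ * g f
      eq = sumTo-update n {g} {h} f f<n (≔-same g f _) (λ i _ i≢f → ≔-other g _ i≢f)
      size : ∀ f → f < n → arr τ aSz (arr τ aCur f) ≡ ∣ nd (arr τ aCur f) ∣
      size f f< = Node.size (Trie.node T _ (cur< f f<))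
      each : ∀ i → i < n → h i ≤ b ^ d
      each i i< with i ≟ f
      ... | yes refl = ≤-trans (≤-reflexive (≔-same g f _)) (^-monoʳ-≤ b (≤-trans (≤-reflexive (trans (cong suc (size f f<n)) (sym (ins-size e e∉)))) (≤-trans (⊑-size ins⊑) (≤-reflexive (∣Sf∣ f f<n)))))
      ... | no i≢f   = ≤-trans (≤-reflexive (≔-other g _ i≢f)) (^-monoʳ-≤ b (≤-trans (≤-reflexive (size i i<)) (≤-trans (⊑-size (cur⊑ i i<)) (≤-reflexive (∣Sf∣ i i<)))))

    -- The offsets come from the start, when there is one node, or one pair, and every row
    -- contributes b ^ 0 = 1 to the potential. Since n ≥ 1 they only help.
    room : ∀ {N p T Y} → N + n ≤ 1 + T → T + p ≤ Y → N + p ≤ Y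
    room {N} {p} {T} {Y} a b = from-≤ 0 (+-mono-≤ (+-mono-≤ a b) n≥1)
      (solve 5 (λ N p T Y n → N :+ p :+ (con 1 :+ T :+ Y :+ n) :+ con 0 := Y :+ (N :+ n :+ (T :+ p) :+ con 1)) refl N p T Y n)

    widen : ∀ {N N′ p T} → N + n ≤ 1 + T → N′ ≤ N + p → N′ + n ≤ 1 + (T + p)
    widen {N} {N′} {p} {T} a b = from-≤ 0 (+-mono-≤ a b)
      (solve 5 (λ N M p T n → M :+ n :+ (con 1 :+ T :+ (N :+ p)) :+ con 0 := con 1 :+ (T :+ p) :+ (N :+ n :+ M)) refl N N′ p T n)

    -- Origin of the constant 14: an insertion costs 21g + 7 ≤ 28g ticks with g = 3 ^ |P|, while the
    -- potential grows by 2g.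
    insert-cost : ∀ {t t′ g p c} → 1 ≤ g → t + 14 * n ≤ 14 * p + c → t′ ≤ 21 * g + (5 + t) → 2 + t′ + 14 * n ≤ 14 * (p + 2 * g) + c
    insert-cost {t} {t′} {g} {p} {c} g≥1 t≤ t′≤ = from-≤ 0 (+-mono-≤ t′≤ (+-mono-≤ t≤ (*-monoʳ-≤ 7 g≥1)))
      (solve 6 (λ t u g p c n → con 2 :+ u :+ con 14 :* n :+ (con 21 :* g :+ (con 5 :+ t) :+ (con 14 :* p :+ c :+ con 7 :* g)) :+ con 0
        := con 14 :* (p :+ con 2 :* g) :+ c :+ (u :+ (t :+ con 14 :* n :+ con 7))) refl t t′ g p c n)

    module _ {σ : State} {e : Fin m} (e≡ : var σ ve ≡ toℕ e) (dm≡ : var σ vdm ≡ dm) where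

      insertElement-spec : ∀ c j zs τ → j < X → Walking c e (j ∷ zs) τ →
        wp insertElement (Walking c e zs) (walkSt vq vj (aHd ⟦ ` ve ⟧) aNx insertElement σ j τ)
      insertElement-spec c j zs τ j<X I =
        _ , (_ , subst (_< X) (sym f≡) (<-≤-trans f<n n≤X)) , (_ , P′<X) , (_ , P′<X) ,
        scan-spec {e} {nd} {σ₄} e≡ refl refl trie stamps P′<N e∉P inRow down roomN e<X roomD
          λ τ′ S → _ , (_ , P′<X) , subst (_< X) (sym f≡) (<-≤-trans f<n n≤X) , finish τ′ S
        where
        open Walking I
        f = row j
        f<n = proj₁ (All.head valid)
        e∈S = proj₂ (All.head valid)
        f≡ : j / suc (var σ vdm) ≡ f
        f≡ = cong (λ x → j / suc x) dm≡
        f′ = j / suc (var σ vdm)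
        P = arr τ aCur f
        P′ = arr τ aCur f′
        P≡ : P′ ≡ P
        P≡ = cong (arr τ aCur) f≡
        φ = walkSt vq vj (aHd ⟦ ` ve ⟧) aNx insertElement σ j τ
        σ₄ = setV vl (arr τ aPw P′) (setV vo (arr τ aOff P′) (setV vP P′ (setV vf f′ φ)))
        N = var τ vNN
        P′<N : P′ < N
        P′<N = subst (_< N) (sym P≡) (cur< f f<n)
        P<N = cur< f f<n
        nP = Trie.node trie P P<N
        ndP : nd P ≡ cut (Sf f) (toℕ e)
        ndP = pending f f<n (here refl)
        e∉P₀ : e ∉ nd P
        e∉P₀ h = <-irrefl refl (proj₂ (∈-cut⁻ (toℕ e) (subst (e ∈_) ndP h)))
        e∉P : e ∉ nd P′
        e∉P = subst (λ x → e ∉ nd x) (sym P≡) e∉P₀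
        ins≡ : ins e (nd P) ≡ cut (Sf f) (suc (toℕ e))
        ins≡ = trans (cong (ins e) ndP) (sym (cut-in (Sf f) e e∈S))
        ins⊑ : ins e (nd P) ⊑ Sf f
        ins⊑ = ⊑-trans (⊑-reflexive ins≡) (cut-⊑ (Sf f) _)
        down : ∀ S → S ⊑ ins e (nd P′) → InRow S
        down S S⊑ = f , f<n , ⊑-trans S⊑ (subst (λ x → ins e (nd x) ⊑ Sf f) (sym P≡) ins⊑)
        p = arr τ aSz P
        pw≡ : arr τ aPw P′ ≡ 2 ^ p
        pw≡ = trans (cong (arr τ aPw) P≡) (Node.power nP)
        total : sumTo (arr τ aPw P′) (weight σ₄) ≡ 3 ^ p
        total = trans (cong (λ x → sumTo (arr τ aPw x) (λ i → arr τ aPw (arr τ aD (arr τ aOff x + i)))) P≡) (Node.seg-sum nP)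
        roomN : N + arr τ aPw P′ ≤ X
        roomN = ≤-trans (subst (λ l → N + l ≤ n * 2 ^ d) (sym pw≡) (room N-bound
          (subst (λ l → potential 2 τ + l ≤ n * 2 ^ d) (*-identityˡ (2 ^ p)) (bump 2 {τ} (s≤s z≤n) f<n trie cur< cur⊑ e∉P₀ ins⊑)))) n*2^d≤X
        roomD : var τ vdl + 2 * sumTo (arr τ aPw P′) (weight σ₄) ≤ X
        roomD = ≤-trans (subst (λ s → var τ vdl + 2 * s ≤ n * 3 ^ d) (sym total) (room D-bound (bump 3 {τ} (s≤s z≤n) f<n trie cur< cur⊑ e∉P₀ ins⊑))) n*3^d≤X
        e<X : toℕ e < X
        e<X = <-≤-trans (toℕ<n e) m≤X
        N<X : N < X
        N<X = <-≤-trans (m<m+n N (subst (0 <_) (sym pw≡) (m^n>0 2 p))) roomN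
        P′<X : P′ < X
        P′<X = <-trans P′<N N<X
        finish : ∀ τ′ → Scanned e nd σ₄ (arr τ aPw P′) τ′ →
          Walking c e zs (setA aCur f′ (arr τ′ aTmp P′) (forSt vi1 vl scanBody σ₄ (arr τ aPw P′) τ′))
        finish τ′ S = subst₂ (λ f P → Walking c e zs (setA aCur f (arr τ′ aTmp P) (forSt vi1 vl scanBody σ₄ (arr τ aPw P′) τ′))) (sym f≡) (sym P≡) result
          where
          open Scanned S renaming (nd to nd′; trie to trie′; stamps to stamps′; N≤ to N′≤; dl≤ to dl′≤; cost to cost′)
          open Extends ext using (nd≡; sz≡; D≡) renaming (N≤ to N≤N′)
          t = arr τ′ aTmp P
          cur′ = arr τ aCur [ f ↦ t ]
          -- P occurs in its own list of subsets, so the scan has stamped it, and `aTmp` holds the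
          -- new node of the row.
          stamped : arr τ′ aStp P ≡ suc (toℕ e)
          stamped with Node.seg-all nP (nd P) ⊑-refl
          ... | i , i< , eq = trans (cong (arr τ′ aStp) (sym D≡P)) (prefix i (subst (λ x → i < arr τ aPw x) (sym P≡) i<))
            where
            D≡P : arr τ′ aD (arr τ aOff P′ + i) ≡ P
            D≡P = trans (cong (λ x → arr τ′ aD (arr τ aOff x + i)) P≡) (trans (D≡ _ (<-≤-trans (+-monoʳ-< (arr τ aOff P) i<) (Node.seg≤ nP)))
              (Trie.injective trie _ P (Node.seg< nP i i<) P<N eq))
          tmp-P = Stamps.tmp-ok stamps′ P (<-≤-trans P<N N≤N′) stamped
          nd-t : nd′ t ≡ ins e (nd P)
          nd-t = trans (proj₁ (proj₂ tmp-P)) (cong (ins e) (nd≡ P P<N))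
          cur-f : cur′ f ≡ t
          cur-f = upd-same (arr τ aCur) f t
          cur-other : ∀ {i} → i ≢ f → cur′ i ≡ arr τ aCur i
          cur-other = upd-other (arr τ aCur) t
          sz-t : arr τ′ aSz t ≡ suc p
          sz-t = trans (Node.size (Trie.node trie′ t (proj₁ tmp-P))) (trans (cong ∣_∣ nd-t) (trans (ins-size e e∉P₀) (cong suc (sym (Node.size nP)))))
          nd-other : ∀ {i} → i < n → i ≢ f → nd′ (cur′ i) ≡ nd (arr τ aCur i)
          nd-other i< i≢f = trans (cong nd′ (cur-other i≢f)) (nd≡ _ (cur< _ i<))
          grows : ∀ b → sumTo n (λ i → suc b ^ arr τ′ aSz (cur′ i)) ≡ potential (suc b) τ + b * suc b ^ p
          grows b = sumTo-update n f f<n (cong (suc b ^_) (trans (cong (arr τ′ aSz) cur-f) sz-t))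
            (λ i i< i≢f → cong (suc b ^_) (trans (cong (arr τ′ aSz) (cur-other i≢f)) (sz≡ _ (cur< i i<))))
          -- A row contains e only once, so none of the remaining positions belongs to this row.
          f∉zs : ¬ f L.∈ map row zs
          f∉zs h with ∈-map⁻ row h
          ... | j′ , j′∈ , eq with apart
          ... | a ∷ _ = All.lookup a j′∈ eq
          result : Walking c e zs (setA aCur f (arr τ′ aTmp P) (forSt vi1 vl scanBody σ₄ (arr τ aPw P′) τ′))
          result = record
            { trie = trie′ ; stamps = stamps′ ; inRow = inG
            ; cur< = λ i i< → case i ≟ f of λ where
                (yes refl) → subst (_< var τ′ vNN) (sym cur-f) (proj₁ tmp-P)
                (no i≢f)   → subst (_< var τ′ vNN) (sym (cur-other i≢f)) (<-≤-trans (cur< i i<) N≤N′)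
            ; cur⊑ = λ i i< → case i ≟ f of λ where
                (yes refl) → ⊑-trans (⊑-reflexive (trans (cong nd′ cur-f) nd-t)) ins⊑
                (no i≢f)   → ⊑-trans (⊑-reflexive (nd-other i< i≢f)) (cur⊑ i i<)
            ; pending = λ i i< i∈ → case i ≟ f of λ where
                (yes refl) → contradiction i∈ f∉zs
                (no i≢f)   → trans (nd-other i< i≢f) (pending i i< (there i∈))
            ; done = λ i i< i∉ → case i ≟ f of λ where
                (yes refl) → trans (trans (cong nd′ cur-f) nd-t) ins≡
                (no i≢f)   → trans (nd-other i< i≢f) (done i i< λ where
                                      (here eq)  → i≢f eq
                                      (there i∈) → i∉ i∈)
            ; valid = All.tail valid ; apart = case apart of λ where (_ ∷ a) → a
            ; N-bound = subst (λ s → var τ′ vNN + n ≤ 1 + s) (sym (trans (grows 1) (cong (potential 2 τ +_) (*-identityˡ (2 ^ p)))))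
                (widen N-bound (subst (λ l → var τ′ vNN ≤ N + l) pw≡ N′≤))
            ; D-bound = subst (λ s → var τ′ vdl + n ≤ 1 + s) (sym (grows 2)) (widen D-bound (subst (λ s → var τ′ vdl ≤ var τ vdl + 2 * s) total dl′≤))
            ; cost = subst (λ s → 2 + clk τ′ + 14 * n ≤ 14 * s + c) (sym (grows 2))
                (insert-cost {p = potential 3 τ} (m^n>0 3 p) cost (subst (λ s → clk τ′ ≤ 21 * s + (5 + clk τ)) total cost′)) }

    -- State once the elements below t have been inserted.
    record Built (c t : ℕ) (τ : State) : Set where
      field
        {nd}      : ℕ → Subset m
        trie      : Trie (arrs τ) nd (var τ vNN) (var τ vdl)
        inRow     : ∀ x → x < var τ vNN → InRow (nd x)
        stp≤      : ∀ x → arr τ aStp x ≤ t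
        stp-fresh : ∀ x → var τ vNN ≤ x → arr τ aStp x ≡ 0
        below     : ∀ y → y < var τ vNN → ∀ z → z ∈ nd y → toℕ z < t
        cur<      : ∀ f → f < n → arr τ aCur f < var τ vNN
        cur≡      : ∀ f → f < n → nd (arr τ aCur f) ≡ cut (Sf f) t
        N-bound   : var τ vNN + n ≤ 1 + potential 2 τ
        D-bound   : var τ vdl + n ≤ 1 + potential 3 τ
        cost      : clk τ + 14 * n ≤ 14 * potential 3 τ + (2 * t + c)

    record Rows (key : ℕ → ℕ) (len : ℕ) (e : Fin m) : Set where
      field
        occurs : ∀ f → f < n → e ∈ Sf f → f L.∈ map row (bucket key (toℕ e) len)
        valid  : All (λ j → row j < n × e ∈ Sf (row j)) (bucket key (toℕ e) len)
        apart  : AllPairs (λ i j → row i ≢ row j) (bucket key (toℕ e) len)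

    module _ {key : ℕ → ℕ} {len : ℕ} (len≤X : len ≤ X) (rows : ∀ e → Rows key len e) where

      insertEverywhere-spec : ∀ c {σ} t → t < m → var σ ve ≡ t → var σ vdm ≡ dm → Built (suc c) t σ →
        (∀ e → Chain (arr σ aNx) (arr σ aHd e) (bucket key e len)) →
        wp insertEverywhere (Built c (suc t)) σ
      insertEverywhere-spec c {σ} t t<m e≡ dm≡ B chain =
        walk-rule {vq} {vj} {aHd ⟦ ` ve ⟧} {aNx} {insertElement} {Built c (suc t)} {σ} (bucket key t len) (Walking c′ e)
          (_ , subst (_< X) (sym e≡) (<-≤-trans t<m m≤X)) (subst (λ x → Chain (arr σ aNx) (arr σ aHd x) (bucket key t len)) (sym e≡) (chain t))
          (All.map (λ i< → <-≤-trans i< len≤X) (bucket-< key t len)) start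
          (λ j zs τ bd I → insertElement-spec {σ} e≡′ dm≡ c′ j zs τ (All.head bd) I)
          (λ τ I → end τ I)
        where
        open Built B
        e = fromℕ< t<m
        t≡ : toℕ e ≡ t
        t≡ = toℕ-fromℕ< t<m
        e≡′ : var σ ve ≡ toℕ e
        e≡′ = trans e≡ (sym t≡)
        c′ = 2 * t + suc c
        at-t : ∀ {A : ℕ → Set} → A (toℕ e) → A t
        at-t {A} = subst A t≡
        start : Walking c′ e (bucket key t len) σ
        start = record
          { trie = trie
          ; stamps = record
              { stp≤ = λ x → ≤-trans (stp≤ x) (≤-trans (≤-reflexive (sym t≡)) (n≤1+n _))
              ; stp-fresh = stp-fresh
              -- All stamps so far are at most t, so none equals 1 + t. Hence stamps are never
              -- cleared between elements.
              ; tmp-ok = λ x x< eq → ⊥-elim (<-irrefl (trans eq (cong suc t≡)) (s≤s (stp≤ x)))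
              ; made = λ y y< e∈ → ⊥-elim (<-irrefl t≡ (below y y< e e∈))
              ; below = λ y y< z z∈ → <⇒≤ (subst (toℕ z <_) (sym t≡) (below y y< z z∈)) }
          ; inRow = inRow ; cur< = cur<
          ; cur⊑ = λ f f< → ⊑-trans (⊑-reflexive (cur≡ f f<)) (cut-⊑ (Sf f) t)
          ; pending = λ f f< _ → trans (cur≡ f f<) (cong (cut (Sf f)) (sym t≡))
          ; done = λ f f< f∉ → trans (cur≡ f f<) (trans (cong (cut (Sf f)) (sym t≡))
              (sym (cut-out (Sf f) e (λ e∈ → f∉ (at-t {λ x → f L.∈ map row (bucket key x len)} (Rows.occurs (rows e) f f< e∈))))))
          ; valid = at-t {λ x → All (λ j → row j < n × e ∈ Sf (row j)) (bucket key x len)} (Rows.valid (rows e))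
          ; apart = at-t {λ x → AllPairs _ (bucket key x len)} (Rows.apart (rows e))
          ; N-bound = N-bound ; D-bound = D-bound ; cost = cost }
        end : ∀ τ → Walking c′ e [] τ → Built c (suc t) (walkEnd vq vj (aHd ⟦ ` ve ⟧) aNx insertElement σ τ)
        end τ I = record
          { trie = W.trie ; inRow = W.inRow
          ; stp≤ = λ x → subst (λ y → arr τ aStp x ≤ suc y) t≡ (S.stp≤ x)
          ; stp-fresh = S.stp-fresh
          ; below = λ y y< z z∈ → s≤s (subst (toℕ z ≤_) t≡ (S.below y y< z z∈))
          ; cur< = W.cur<
          ; cur≡ = λ f f< → trans (W.done f f< λ ()) (cong (λ x → cut (Sf f) (suc x)) t≡)
          ; N-bound = W.N-bound ; D-bound = W.D-bound
          -- An element costs two ticks beyond its insertions, one for the round of the outer loop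
          -- and one for the end of the walk. This is where m enters the running time of the
          -- construction.
          ; cost = from-≤ {clk τ + 14 * n} {14 * potential 3 τ + (2 * t + suc c)} 0 W.cost
              (solve 5 (λ u n p t c → con 1 :+ u :+ con 14 :* n :+ (con 14 :* p :+ (con 2 :* t :+ (con 1 :+ c))) :+ con 0
                := con 14 :* p :+ (con 2 :* (con 1 :+ t) :+ c) :+ (u :+ con 14 :* n)) refl (clk τ) n (potential 3 τ) t c) }
          where
          module W = Walking I
          module S = Stamps W.stamps

      buildTrie-spec : ∀ {σ} → var σ vm ≡ m → var σ vdm ≡ dm →
        (∀ e → Chain (arr σ aNx) (arr σ aHd e) (bucket key e len)) →
        (∀ j y → aCur ≤ j → j ≤ aOwn → arr σ j y ≡ 0) →
        wp buildTrie (Built (4 + clk σ) m) σ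
      buildTrie-spec {σ} m≡ dm≡ chain zeros =
        _ , _ , _ , _ , 0<X ,
        for-rule {ve} {vm} {insertEverywhere} {Built (4 + clk σ) m} {σ₃} (Built (3 + clk σ)) start
          (λ t τ t< B → insertEverywhere-spec (3 + clk σ) {forSt ve vm insertEverywhere σ₃ t τ} t (subst (t <_) m≡ t<) refl dm≡ (ticked t τ B) chain)
          (λ τ B → final τ (subst (λ t → Built (3 + clk σ) t τ) m≡ B))
        where
        0<X : 0 < X
        0<X = ≤-trans n≥1 n≤X
        σ₃ = setA aPw 0 1 (setV vdl 1 (setV vNN 1 σ))
        only-0 : ∀ {x} → x < 1 → x ≡ 0
        only-0 (s≤s z≤n) = refl
        z : ∀ y → arr σ aCur y ≡ 0
        z y = zeros aCur y (≤ᵇ⇒≤ _ _ _) (≤ᵇ⇒≤ _ _ _)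
        zSz : ∀ y → arr σ aSz y ≡ 0
        zSz y = zeros aSz y (≤ᵇ⇒≤ _ _ _) (≤ᵇ⇒≤ _ _ _)
        zOff : ∀ y → arr σ aOff y ≡ 0
        zOff y = zeros aOff y (≤ᵇ⇒≤ _ _ _) (≤ᵇ⇒≤ _ _ _)
        zD : ∀ y → arr σ aD y ≡ 0
        zD y = zeros aD y (≤ᵇ⇒≤ _ _ _) (≤ᵇ⇒≤ _ _ _)
        zOwn : ∀ y → arr σ aOwn y ≡ 0
        zOwn y = zeros aOwn y (≤ᵇ⇒≤ _ _ _) (≤ᵇ⇒≤ _ _ _)
        zStp : ∀ y → arr σ aStp y ≡ 0
        zStp y = zeros aStp y (≤ᵇ⇒≤ _ _ _) (≤ᵇ⇒≤ _ _ _)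
        nd₀ : ℕ → Subset m
        nd₀ _ = Sub.⊥
        root-node : Node (arrs σ₃) nd₀ 1 1 0
        root-node = record
          { size = trans (zSz 0) (sym (∣⊥∣≡0 m)) ; power = cong (2 ^_) (sym (zSz 0))
          ; seg≤ = ≤-reflexive (cong (_+ 1) (zOff 0))
          ; seg< = λ i _ → ≤-reflexive (cong suc (zD _))
          ; seg⊑ = λ _ _ → ⊑-refl
          ; seg-own = λ i _ → zOwn _
          ; seg-all = λ S S⊑ → 0 , ≤-refl , sym (⊑-antisym S⊑ (incl λ x x∈ → contradiction x∈ ∉⊥))
          ; seg-ord = λ i j i<j j<1 → ⊥-elim (<⇒≱ (≤-<-trans z≤n i<j) (≤-pred j<1))
          ; seg-sum = trans (cong (λ x → (arr σ aPw [ 0 ↦ 1 ]) x) (zD _)) (cong (3 ^_) (sym (zSz 0)))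
          ; ancestor = inj₁ refl }
        pot : ∀ b → potential b σ₃ ≡ n
        pot b = trans (sumTo-cong n (λ f _ → cong (b ^_) (zSz _))) (trans (sumTo-const n 1) (*-identityʳ n))
        start : Built (3 + clk σ) 0 σ₃
        start = record
          { nd = nd₀
          ; trie = record
              { node = λ x x< → subst (Node (arrs σ₃) nd₀ 1 1) (sym (only-0 x<)) root-node
              ; injective = λ x y x< y< _ → trans (only-0 x<) (sym (only-0 y<))
              ; owner = λ q q< → subst (λ o → o < 1 × arr σ aOff o ≤ q × q < arr σ aOff o + (arr σ aPw [ 0 ↦ 1 ]) o) (sym (zOwn q))
                  (≤-refl , ≤-trans (≤-reflexive (zOff 0)) z≤n , subst (λ o → q < o + 1) (sym (zOff 0)) q<) }
          ; inRow = λ x _ → 0 , n≥1 , incl λ x x∈ → contradiction x∈ ∉⊥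
          ; stp≤ = λ x → ≤-reflexive (zStp x) ; stp-fresh = λ x _ → zStp x
          ; below = λ y _ z z∈ → contradiction z∈ ∉⊥
          ; cur< = λ f _ → ≤-reflexive (cong suc (z f))
          ; cur≡ = λ f _ → sym (cut-zero (Sf f))
          ; N-bound = ≤-reflexive (cong suc (sym (pot 2)))
          ; D-bound = ≤-reflexive (cong suc (sym (pot 3)))
          ; cost = ≤-reflexive (trans (+-comm (3 + clk σ) (14 * n)) (cong (λ p → 14 * p + (3 + clk σ)) (sym (pot 3)))) }
        ticked : ∀ t τ → Built (3 + clk σ) t τ → Built (suc (3 + clk σ)) t (forSt ve vm insertEverywhere σ₃ t τ)
        ticked t τ B = record
          { trie = trie ; inRow = inRow ; stp≤ = stp≤ ; stp-fresh = stp-fresh ; below = below ; cur< = cur< ; cur≡ = cur≡ ; N-bound = N-bound ; D-bound = D-bound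
          ; cost = ≤-trans (s≤s cost) (≤-reflexive (solve 3 (λ p t c → con 1 :+ (p :+ (t :+ c)) := p :+ (t :+ (con 1 :+ c))) refl (14 * potential 3 τ) (2 * t) (3 + clk σ))) }
          where open Built B
        final : ∀ τ → Built (3 + clk σ) m τ → Built (4 + clk σ) m (forSt ve vm insertEverywhere σ₃ (var σ vm) τ)
        final τ B = record
          { trie = trie ; inRow = inRow ; stp≤ = stp≤ ; stp-fresh = stp-fresh ; below = below ; cur< = cur< ; cur≡ = cur≡ ; N-bound = N-bound ; D-bound = D-bound
          ; cost = ≤-trans (s≤s cost) (≤-reflexive (solve 3 (λ p t c → con 1 :+ (p :+ (t :+ c)) := p :+ (t :+ (con 1 :+ c))) refl (14 * potential 3 τ) (2 * m) (3 + clk σ))) }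
          where open Built B

-- Good sets in terms of nodes, pairs and counters

module PairIndex where

  open import Defs
  open Combinatorics
  open Tries using (Trie; Node; Arrays; sz; D; own; off; pw)
  open import Data.Bool using (true; false; if_then_else_; _∧_; T)
  open import Data.Empty using (⊥-elim)
  open import Data.Fin.Subset using (Subset; ∣_∣; _⊆_; _⊂_)
  open import Data.Fin.Subset.Properties using (p⊂q⇒∣p∣<∣q∣) renaming (_∈?_ to _∈ˢ?_)
  open import Data.Fin.Properties using (any?)
  open import Data.List using (List; []; _∷_; length)
  open import Data.List.Membership.Propositional using (_∈_)
  open import Data.List.Relation.Unary.All as All using (All; []; _∷_)
  open import Data.List.Relation.Unary.AllPairs using ([]; _∷_)
  open import Data.List.Relation.Unary.Any using (here; there)
  open import Data.List.Relation.Unary.Unique.Propositional using (Unique)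
  open import Data.Nat
  open import Data.Nat.DivMod using (m/n*n≤m; m*n/n≡m; /-monoˡ-≤)
  open import Data.Nat.Properties
  open import Data.Nat.Solver using (module +-*-Solver)
  open import Data.Product using (∃; _×_; _,_; proj₁; proj₂)
  open import Data.Sum using (_⊎_; inj₁; inj₂)
  open import Function using (_∘_; case_of_; _⇔_; mk⇔; Equivalence)
  open import Relation.Binary.Definitions using (tri<; tri≈; tri>)
  open import Relation.Binary.PropositionalEquality
  open import Relation.Nullary using (¬_; Dec; yes; no; contradiction)
  open import Relation.Nullary.Decidable using (_×-dec_; ¬?)
  open +-*-Solver using (solve; _:+_; _:*_; _:=_; con)

  -- The nodes 0, …, N - 1 are the subsets of the rows, and the positions below
  -- dl are the pairs of nodes D q ⊑ own q.
  record Index {m : ℕ} (Row : Subset m → Set) (sz D own : ℕ → ℕ) (nd : ℕ → Subset m) (N dl : ℕ) : Set where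
    field
      inRow    : ∀ x → x < N → ∃ λ F → Row F × nd x ⊑ F
      every    : ∀ S F → Row F → S ⊑ F → ∃ λ x → x < N × nd x ≡ S
      nd-inj   : ∀ x y → x < N → y < N → nd x ≡ nd y → x ≡ y
      size     : ∀ x → x < N → sz x ≡ ∣ nd x ∣
      D<       : ∀ q → q < dl → D q < N
      own<     : ∀ q → q < dl → own q < N
      pair⊑    : ∀ q → q < dl → nd (D q) ⊑ nd (own q)
      pair-all : ∀ x y → x < N → y < N → nd x ⊑ nd y → ∃ λ q → q < dl × D q ≡ x × own q ≡ y
      pair-inj : ∀ p q → p < dl → q < dl → D p ≡ D q → own p ≡ own q → p ≡ q

  trie-index : ∀ {m} {A : Arrays} {nd : ℕ → Subset m} {N dl} {Row : Subset m → Set} → Trie A nd N dl →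
    (∀ x → x < N → ∃ λ F → Row F × nd x ⊑ F) → (∀ F → Row F → ∃ λ x → x < N × nd x ≡ F) → Index Row (sz A) (D A) (own A) nd N dl
  trie-index {m} {A} {nd} {N} {dl} {Row} T inRow rows = record
    { inRow    = inRow
    ; every    = λ S F F∈ S⊑ → let x , x< , eq = rows F F∈ ; i , i< , eq′ = Node.seg-all (node x x<) S (subst (S ⊑_) (sym eq) S⊑) in
                   _ , Node.seg< (node x x<) i i< , eq′
    ; nd-inj   = injective
    ; size     = λ x x< → Node.size (node x x<)
    ; D<       = λ q q< → subst (λ p → D A p < N) (proj₂ (proj₂ (pos q q<))) (Node.seg< (node _ (proj₁ (owner q q<))) _ (proj₁ (proj₂ (pos q q<))))
    ; own<     = λ q q< → proj₁ (owner q q<)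
    ; pair⊑    = λ q q< → subst (λ p → nd (D A p) ⊑ nd (own A q)) (proj₂ (proj₂ (pos q q<))) (Node.seg⊑ (node _ (proj₁ (owner q q<))) _ (proj₁ (proj₂ (pos q q<))))
    ; pair-all = λ x y x< y< x⊑y → let i , i< , eq = Node.seg-all (node y y<) (nd x) x⊑y in
                   off A y + i , <-≤-trans (+-monoʳ-< (off A y) i<) (Node.seg≤ (node y y<)) ,
                   injective _ x (Node.seg< (node y y<) i i<) x< eq , Node.seg-own (node y y<) i i<
    ; pair-inj = pair-inj }
    where
    open Trie T
    pos : ∀ q → q < dl → ∃ λ i → i < pw A (own A q) × off A (own A q) + i ≡ q
    pos q q< = let _ , a , b = owner q q< in
      q ∸ off A (own A q) , +-cancelˡ-< (off A (own A q)) _ _ (subst (_< off A (own A q) + pw A (own A q)) (sym (m+[n∸m]≡n a)) b) , m+[n∸m]≡n a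
    pair-inj : ∀ p q → p < dl → q < dl → D A p ≡ D A q → own A p ≡ own A q → p ≡ q
    pair-inj p q p< q< D≡ own≡ with pos p p< | pos q q<
    ... | i , i< , ei | j , j< , ej with <-cmp i j
    ... | tri≈ _ refl _ = trans (sym ei) (trans (cong (λ o → off A o + i) own≡) ej)
    -- Two positions of one segment with the same node would make a later set a subset of an earlier
    -- one.
    ... | tri< i<j _ _ = ⊥-elim (Node.seg-ord (node _ (proj₁ (owner q q<))) i j i<j j<
          (⊑-reflexive (cong nd (trans (cong (D A) ej) (trans (sym D≡) (cong (D A) (trans (sym ei) (cong (λ o → off A o + i) own≡))))))))
    ... | tri> _ _ j<i = ⊥-elim (Node.seg-ord (node _ (proj₁ (owner p p<))) j i j<i i<
          (⊑-reflexive (cong nd (trans (cong (D A) ei) (trans D≡ (cong (D A) (trans (sym ej) (cong (λ o → off A o + j) (sym own≡)))))))))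

  -- By the pigeonhole principle no duplicate-free list of such elements is longer than a complete
  -- one.
  enumerate-AtLeast : ∀ {A : Set} {P : A → Set} {xs : List A} → Unique xs → All P xs → (∀ x → P x → x ∈ xs) → ∀ n → AtLeast n P ⇔ n ≤ length xs
  enumerate-AtLeast {xs = xs} u a c n = mk⇔
    (λ (ys , uy , ay , n≤) → ≤-trans n≤ (unique-length uy xs (λ y y∈ → c y (All.lookup ay y∈))))
    (λ n≤ → xs , u , a , n≤)

  -- Repeated floor division decides the threshold without computing it.
  divide : ℕ → ℕ → ℕ → ℕ
  divide k v zero    = v
  divide k v (suc r) = divide k v r / suc k / suc r

  ≤-/ : ∀ a b n → a ≤ b / suc n ⇔ a * suc n ≤ b
  ≤-/ a b n = mk⇔ (λ h → ≤-trans (*-monoˡ-≤ (suc n) h) (m/n*n≤m b (suc n))) (λ h → subst (_≤ b / suc n) (m*n/n≡m a (suc n)) (/-monoˡ-≤ (suc n) h))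

  -- Floor division is right adjoint to multiplication, and adjoints compose, so rounding down after
  -- every division loses nothing. The induction needs arbitrary `b`, though only `b` = 1 is of
  -- interest.
  divide-≤ : ∀ k v r b → b ≤ divide k v r ⇔ b * (r ! * (k + 1) ^ r) ≤ v
  divide-≤ k v zero b = mk⇔ (subst (_≤ v) (sym (*-identityʳ b))) (subst (_≤ v) (*-identityʳ b))
  divide-≤ k v (suc r) b = mk⇔
    (λ h → subst (_≤ v) eq (to (divide-≤ k v r _) (to (≤-/ _ _ k) (to (≤-/ b _ r) h))))
    (λ h → from (≤-/ b _ r) (from (≤-/ _ _ k) (from (divide-≤ k v r _) (subst (_≤ v) (sym eq) h))))
    where
    open Equivalence
    eq : b * suc r * suc k * (r ! * (k + 1) ^ r) ≡ b * (suc r * r ! * ((k + 1) * (k + 1) ^ r))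
    eq = solve 5 (λ b r k f p → b :* (con 1 :+ r) :* (con 1 :+ k) :* (f :* p) := b :* ((con 1 :+ r) :* f :* ((k :+ con 1) :* p))) refl b r k (r !) ((k + 1) ^ r)

  divide-pos : ∀ k v r → 0 < divide k v r ⇔ r ! * (k + 1) ^ r ≤ v
  divide-pos k v r = mk⇔ (λ h → subst (_≤ v) (*-identityˡ _) (to (divide-≤ k v r 1) h)) (λ h → from (divide-≤ k v r 1) (subst (_≤ v) (sym (*-identityˡ _)) h))
    where open Equivalence

  module GoodRows {d m : ℕ} (k : ℕ) (I : Instance d m) where
    open Goodness k I hiding (KernelSet; KernelElement)

    ν>0 : ∀ r → 0 < ν r
    ν>0 r = *-mono-≤ (1≤n! r) (subst (λ x → 1 ≤ x ^ r) (+-comm 1 k) (m^n>0 (suc k) r))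

    -- As ν r ≥ 1, a good set below level d lies in at least one strong, hence good, set of a higher
    -- level; climbing ends in a row. Therefore only subsets of rows need to be considered.
    upTo-inRow : ∀ f {ℓ r S} → GoodUpTo f ℓ r S → ∃ λ F → F ∈ sets I × S ⊑ F
    upTo-inRow zero    (_ , S∈) = _ , S∈ , ⊑-refl
    upTo-inRow (suc f) (inj₁ (_ , S∈)) = _ , S∈ , ⊑-refl
    upTo-inRow (suc f) {r = r} (inj₂ (_ , _ , _ , _ , _ , [] , _ , _ , ν≤)) = ⊥-elim (<⇒≱ (ν>0 r) ν≤)
    upTo-inRow (suc f) (inj₂ (_ , _ , _ , _ , _ , T ∷ _ , _ , (S⊆T , (_ , gT) , _) ∷ _ , _)) =
      let F , F∈ , T⊑ = upTo-inRow f gT in F , F∈ , ⊑-trans (incl λ x → S⊆T {x}) T⊑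

  module GoodNodes {d m : ℕ} (k : ℕ) (I : Instance d m) {sz D own : ℕ → ℕ} {nd : ℕ → Subset m} {N dl : ℕ}
    (Ix : Index (_∈ sets I) sz D own nd N dl) where
    open Goodness k I hiding (KernelSet; KernelElement)
    open Index Ix
    open GoodRows k I

    good-node : ∀ {ℓ r S} → GoodAt ℓ r S → ∃ λ x → x < N × nd x ≡ S
    good-node g = let F , F∈ , S⊑ = upTo-inRow d g in every _ F F∈ S⊑

    good-size : ∀ {ℓ r S} → GoodAt ℓ r S → ∣ S ∣ ≡ ℓ
    good-size {ℓ} {r} {S} g with Equivalence.to (good-unfold {ℓ} {r} {S}) g
    ... | inj₁ (refl , S∈) = All.lookup (uniform I) S∈
    ... | inj₂ (_ , _ , _ , _ , e , _) = e

    sz≤d : ∀ x → x < N → sz x ≤ d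
    sz≤d x x< = let F , F∈ , x⊑ = inRow x x< in ≤-trans (≤-reflexive (size x x<)) (≤-trans (⊑-size x⊑) (≤-reflexive (All.lookup (uniform I) F∈)))

    -- The index j of strength is replaced by the level `sz z` = `sz x` - j. In this form, lowering
    -- `L` by one adds only conditions on sets of the new level.
    NoBad : ℕ → ℕ → Set
    NoBad L x = ∀ z → z < N → nd z ⊑ nd x → L ≤ sz z → sz z < sz x → ¬ GoodAt (sz z) (sz x ∸ sz z) (nd z)

    strong-to : ∀ {ℓ} y → y < N → ℓ < sz y → Strong (sz y) (sz y ∸ ℓ) (nd y) → LevelGood (sz y) (nd y) × NoBad (suc ℓ) y
    strong-to {ℓ} y y< ℓ< (lg , none) = lg , λ z z< z⊑ ℓ<z z<y g →
      none (sz y ∸ sz z) (m<n⇒0<n∸m z<y) (∸-monoʳ-< ℓ<z (<⇒≤ z<y)) (nd z , (λ {x} → mem z⊑ x) ,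
        subst (λ l → GoodAt l (sz y ∸ sz z) (nd z)) (sym (m∸[m∸n]≡n (<⇒≤ z<y))) g)

    -- Strength speaks of all subsets, `NoBad` only of nodes. An offending subset is good, hence a
    -- node, and its size is determined by its level.
    strong-from : ∀ {ℓ} y → y < N → ℓ < sz y → LevelGood (sz y) (nd y) → NoBad (suc ℓ) y → Strong (sz y) (sz y ∸ ℓ) (nd y)
    strong-from {ℓ} y y< ℓ< lg nb = lg , λ j 1≤j j<r (R , R⊆ , g) → bad j 1≤j j<r R (incl λ x → R⊆ {x}) g
      where
      bad : ∀ j → 1 ≤ j → j < sz y ∸ ℓ → ∀ R → R ⊑ nd y → ¬ GoodAt (sz y ∸ j) j R
      bad j 1≤j j<r R R⊑ g with good-node {sz y ∸ j} {j} g
      ... | z , z< , refl = nb z z< R⊑ (subst (suc ℓ ≤_) (sym sz-z) ℓ<z) (subst (_< sz y) (sym sz-z) (∸-monoʳ-< 1≤j j≤))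
            (subst₂ (λ l j′ → GoodAt l j′ (nd z)) (sym sz-z) (sym (trans (cong (sz y ∸_) sz-z) (m∸[m∸n]≡n j≤))) g)
        where
        sz-z : sz z ≡ sz y ∸ j
        sz-z = trans (size z z<) (good-size {sz y ∸ j} {j} g)
        j≤ : j ≤ sz y
        j≤ = ≤-trans (<⇒≤ j<r) (m∸n≤m (sz y) ℓ)
        ℓ<z : suc ℓ ≤ sz y ∸ j
        ℓ<z = m+n≤o⇒m≤o∸n (suc ℓ) (subst (_≤ sz y) (cong suc (+-comm j ℓ)) (≤-trans (+-monoˡ-≤ ℓ j<r) (≤-reflexive (m∸n+n≡m (<⇒≤ ℓ<)))))

    cell : ℕ → ℕ → ℕ
    cell x t = x * suc d + t

    tallied : (ℕ → ℕ) → List ℕ → ℕ → ℕ → ℕ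
    tallied act []       x t = 0
    tallied act (q ∷ qs) x t = (if (D q ≡ᵇ x) ∧ (sz (own q) ≡ᵇ t) then act (own q) else 0) + tallied act qs x t

    -- A tally is identified with the length of an explicit list of sets, because `AtLeast` asks for
    -- such a list.
    module Count (act : ℕ → ℕ) (act01 : ∀ y → y < N → act y ≡ 1 ⊎ act y ≡ 0) (x t : ℕ) where

      Sel : ℕ → Set
      Sel q = (D q ≡ x × sz (own q) ≡ t) × act (own q) ≡ 1

      sel? : ∀ q → Dec (Sel q)
      sel? q = (D q ≟ x ×-dec sz (own q) ≟ t) ×-dec act (own q) ≟ 1

      chosen : List ℕ → List (Subset m)
      chosen []       = []
      chosen (q ∷ qs) with sel? q
      ... | yes _ = nd (own q) ∷ chosen qs
      ... | no _  = chosen qs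

      chosen-length : ∀ qs → All (_< dl) qs → length (chosen qs) ≡ tallied act qs x t
      chosen-length []       bd = refl
      chosen-length (q ∷ qs) (q< ∷ bd) with sel? q
      ... | yes ((a , b) , c) = cong₂ _+_ (sym eq) (chosen-length qs bd)
        where
        eq : (if (D q ≡ᵇ x) ∧ (sz (own q) ≡ᵇ t) then act (own q) else 0) ≡ 1
        eq with D q ≡ᵇ x in e₁ | sz (own q) ≡ᵇ t in e₂
        ... | true  | true  = c
        ... | false | _     = ⊥-elim (subst T e₁ (≡⇒≡ᵇ (D q) x a))
        ... | true  | false = ⊥-elim (subst T e₂ (≡⇒≡ᵇ (sz (own q)) t b))
      ... | no ¬sel = trans (chosen-length qs bd) (cong (_+ tallied act qs x t) (sym eq))
        where
        eq : (if (D q ≡ᵇ x) ∧ (sz (own q) ≡ᵇ t) then act (own q) else 0) ≡ 0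
        eq with D q ≡ᵇ x in e₁ | sz (own q) ≡ᵇ t in e₂
        ... | false | _     = refl
        ... | true  | false = refl
        ... | true  | true with act01 (own q) (own< q q<)
        ... | inj₂ a≡0 = a≡0
        ... | inj₁ a≡1 = contradiction ((≡ᵇ⇒≡ (D q) x (subst T (sym e₁) _) , ≡ᵇ⇒≡ (sz (own q)) t (subst T (sym e₂) _)) , a≡1) ¬sel

      chosen⁻ : ∀ qs {S} → S ∈ chosen qs → ∃ λ q → q ∈ qs × Sel q × S ≡ nd (own q)
      chosen⁻ (q ∷ qs) S∈ with sel? q
      chosen⁻ (q ∷ qs) (here eq)  | yes s = q , here refl , s , eq
      chosen⁻ (q ∷ qs) (there S∈) | yes s = let p , p∈ , r = chosen⁻ qs S∈ in p , there p∈ , r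
      chosen⁻ (q ∷ qs) S∈         | no _  = let p , p∈ , r = chosen⁻ qs S∈ in p , there p∈ , r

      chosen⁺ : ∀ qs {q} → q ∈ qs → Sel q → nd (own q) ∈ chosen qs
      chosen⁺ (p ∷ qs) (here refl) s with sel? p
      ... | yes _ = here refl
      ... | no ¬s = contradiction s ¬s
      chosen⁺ (p ∷ qs) (there q∈) s with sel? p
      ... | yes _ = there (chosen⁺ qs q∈ s)
      ... | no _  = chosen⁺ qs q∈ s

      -- All chosen pairs have the same smaller node x, and a pair is determined by its two nodes,
      -- so no set T is counted twice.
      chosen-unique : ∀ qs → All (_< dl) qs → Unique qs → Unique (chosen qs)
      chosen-unique [] bd u = []
      chosen-unique (q ∷ qs) (q< ∷ bd) (q∉ ∷ u) with sel? q
      ... | no _ = chosen-unique qs bd u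
      ... | yes s = All.tabulate (λ {S} S∈ eq → let p , p∈ , s′ , eq′ = chosen⁻ qs S∈ in
              All.lookup q∉ p∈ (pair-inj q p q< (All.lookup bd p∈) (trans (proj₁ (proj₁ s)) (sym (proj₁ (proj₁ s′))))
                (nd-inj _ _ (own< q q<) (own< p (All.lookup bd p∈)) (trans eq eq′)))) ∷ chosen-unique qs bd u

    Active : ℕ → ℕ → Set
    Active L y = L ≤ sz y × LevelGood (sz y) (nd y) × NoBad L y

    -- The state of the arrays once the levels L, …, d have been processed.
    record Swept (L : ℕ) (gd act cnt : ℕ → ℕ) : Set where
      field
        good   : ∀ x → x < N → (gd x ≡ 1 × L ≤ sz x × LevelGood (sz x) (nd x)) ⊎ (gd x ≡ 0 × (L ≤ sz x → ¬ LevelGood (sz x) (nd x)))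
        active : ∀ y → y < N → (act y ≡ 1 × Active L y) ⊎ (act y ≡ 0 × ¬ Active L y)
        blank  : ∀ x → x < N → sz x < L → ∀ t → t ≤ d → cnt (cell x t) ≡ 0

    level : ℕ → List ℕ
    level ℓ = bucket (sz ∘ D) ℓ dl

    Tallied : ℕ → (act cnt cnt′ : ℕ → ℕ) → Set
    Tallied ℓ act cnt cnt′ = ∀ x → x < N → ∀ t → t ≤ d → cnt′ (cell x t) ≡ cnt (cell x t) + tallied act (level ℓ) x t

    record Judged (ℓ : ℕ) (gd act cnt gd′ act′ cnt′ : ℕ → ℕ) : Set where
      field
        same-cnt : ∀ x → x < N → sz x ≢ ℓ → ∀ t → t ≤ d → cnt′ (cell x t) ≡ cnt (cell x t)
        same     : ∀ x → x < N → sz x ≢ ℓ → gd′ x ≡ gd x × act′ x ≡ act x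
        new-cnt  : ∀ x → x < N → sz x ≡ ℓ → ∀ r → 1 ≤ r → r ≤ d ∸ ℓ → cnt′ (cell x (ℓ + r)) ≡ divide k (cnt (cell x (ℓ + r))) r
        new      : ∀ x → x < N → sz x ≡ ℓ →
          (gd′ x ≡ 1 × act′ x ≡ 1 × ∃ λ r → 1 ≤ r × r ≤ d ∸ ℓ × 0 < cnt′ (cell x (ℓ + r))) ⊎
          (gd′ x ≡ gd x × act′ x ≡ act x × ∀ r → 1 ≤ r → r ≤ d ∸ ℓ → ¬ 0 < cnt′ (cell x (ℓ + r)))

    Culprit : (ℕ → ℕ) → ℕ → ℕ → Set
    Culprit cnt y q = own q ≡ y × sz (D q) < sz y × 0 < cnt (cell (D q) (sz y))

    Retired : ℕ → (act cnt act′ : ℕ → ℕ) → Set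
    Retired ℓ act cnt act′ = ∀ y → y < N →
      (act′ y ≡ 0 × ∃ λ q → q ∈ level ℓ × Culprit cnt y q) ⊎ (act′ y ≡ act y × ∀ q → q ∈ level ℓ → ¬ Culprit cnt y q)

    level< : ∀ ℓ → All (_< dl) (level ℓ)
    level< ℓ = bucket-< (sz ∘ D) ℓ dl

    tallied-other : ∀ act ℓ x t → sz x ≢ ℓ → tallied act (level ℓ) x t ≡ 0
    tallied-other act ℓ x t x≢ = go (level ℓ) (bucket-key (sz ∘ D) ℓ dl)
      where
      go : ∀ qs → All (λ q → sz (D q) ≡ ℓ) qs → tallied act qs x t ≡ 0
      go []       _ = refl
      go (q ∷ qs) (eq ∷ a) with D q ≡ᵇ x in e
      ... | false = go qs a
      ... | true  = contradiction (trans (cong sz (sym (≡ᵇ⇒≡ (D q) x (subst T (sym e) _)))) eq) x≢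

    -- One level of the sweep as a statement about functions alone. The program enters only through
    -- the relations `Tallied`, `Judged` and `Retired` between successive arrays.
    module Step {ℓ : ℕ} (1≤ℓ : 1 ≤ ℓ) (ℓ<d : ℓ < d) {gd act cnt : ℕ → ℕ} (S : Swept (suc ℓ) gd act cnt)
      {cnt₁ : ℕ → ℕ} (Ta : Tallied ℓ act cnt cnt₁) {gd₂ act₂ cnt₂ : ℕ → ℕ} (J : Judged ℓ gd act cnt₁ gd₂ act₂ cnt₂)
      {act₃ : ℕ → ℕ} (Re : Retired ℓ act₂ cnt₂ act₃) where
      open Swept S
      open Judged J

      act01 : ∀ y → y < N → act y ≡ 1 ⊎ act y ≡ 0
      act01 y y< with active y y<
      ... | inj₁ (e , _) = inj₁ e
      ... | inj₂ (e , _) = inj₂ e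

      -- The chosen sets are exactly the strong sets in question: an active owner is strong by
      -- `strong-from`, and conversely a strong set is good, hence a node, so its pair with x is
      -- listed at level ℓ and its flag is set.
      count-strong : ∀ x r → x < N → sz x ≡ ℓ → 1 ≤ r → r ≤ d ∸ ℓ →
        AtLeast (ν r) (λ T → nd x ⊆ T × Strong (ℓ + r) r T) ⇔ ν r ≤ tallied act (level ℓ) x (ℓ + r)
      count-strong x r x< x≡ 1≤r r≤ = subst (λ l → _ ⇔ ν r ≤ l) (chosen-length (level ℓ) (level< ℓ))
        (enumerate-AtLeast (chosen-unique (level ℓ) (level< ℓ) (bucket-unique (sz ∘ D) ℓ dl)) (All.tabulate sound) complete (ν r))
        where
        open Count act act01 x (ℓ + r)
        sound : ∀ {T} → T ∈ chosen (level ℓ) → nd x ⊆ T × Strong (ℓ + r) r T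
        sound T∈ with chosen⁻ (level ℓ) T∈
        ... | q , q∈ , ((refl , sz≡) , a≡1) , refl with active (own q) (own< q (All.lookup (level< ℓ) q∈))
        ... | inj₂ (a≡0 , _) = ⊥-elim (1+n≢0 (trans (sym a≡1) a≡0))
        ... | inj₁ (_ , ℓ<y , lg , nb) = (λ {z} → mem (pair⊑ q (All.lookup (level< ℓ) q∈)) z) ,
              subst₂ (λ s r → Strong s r (nd (own q))) sz≡ (trans (cong (_∸ ℓ) sz≡) (m+n∸m≡n ℓ r))
                (strong-from (own q) (own< q (All.lookup (level< ℓ) q∈)) ℓ<y lg nb)
        complete : ∀ T → nd x ⊆ T × Strong (ℓ + r) r T → T ∈ chosen (level ℓ)
        complete T (x⊆T , st@((s , g) , _)) with good-node {ℓ + r} {s} g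
        ... | y , y< , refl with pair-all x y x< y< (incl λ z → x⊆T {z})
        ... | q , q< , refl , refl with active y y<
        ... | inj₁ (a≡1 , _) = chosen⁺ (level ℓ) (bucket-∈ (sz ∘ D) ℓ dl q q< x≡) ((refl , trans (size y y<) (good-size {ℓ + r} {s} g)) , a≡1)
        ... | inj₂ (_ , no-act) = contradiction (ℓ<y , strong-to y y< ℓ<y (subst₂ (λ a b → Strong a b (nd y)) (sym sz-y) (sym (trans (cong (_∸ ℓ) sz-y) (m+n∸m≡n ℓ r))) st)) no-act
          where
          sz-y : sz y ≡ ℓ + r
          sz-y = trans (size y y<) (good-size {ℓ + r} {s} g)
          ℓ<y : ℓ < sz y
          ℓ<y = subst (ℓ <_) (sym sz-y) (m<m+n ℓ 1≤r)

      judged-good : ∀ x r → x < N → sz x ≡ ℓ → 1 ≤ r → r ≤ d ∸ ℓ → 0 < cnt₂ (cell x (ℓ + r)) ⇔ GoodAt ℓ r (nd x)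
      judged-good x r x< x≡ 1≤r r≤ = mk⇔ to′ from′
        where
        open Equivalence
        t≤d : ℓ + r ≤ d
        t≤d = ≤-trans (+-monoʳ-≤ ℓ r≤) (≤-reflexive (m+[n∸m]≡n (<⇒≤ ℓ<d)))
        value : cnt₂ (cell x (ℓ + r)) ≡ divide k (tallied act (level ℓ) x (ℓ + r)) r
        value = trans (new-cnt x x< x≡ r 1≤r r≤) (cong (λ v → divide k v r)
          (trans (Ta x x< (ℓ + r) t≤d) (cong (_+ tallied act (level ℓ) x (ℓ + r)) (blank x x< (≤-reflexive (cong suc x≡)) (ℓ + r) t≤d))))
        to′ : 0 < cnt₂ (cell x (ℓ + r)) → GoodAt ℓ r (nd x)
        to′ h = from (good-unfold {ℓ} {r} {nd x}) (inj₂ (1≤ℓ , ℓ<d , 1≤r , r≤ , trans (sym (size x x<)) x≡ ,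
          from (count-strong x r x< x≡ 1≤r r≤) (to (divide-pos k _ r) (subst (0 <_) value h))))
        from′ : GoodAt ℓ r (nd x) → 0 < cnt₂ (cell x (ℓ + r))
        from′ g with to (good-unfold {ℓ} {r} {nd x}) g
        ... | inj₁ (ℓ≡d , _) = ⊥-elim (<-irrefl ℓ≡d ℓ<d)
        ... | inj₂ (_ , _ , _ , _ , _ , al) = subst (0 <_) (sym value) (from (divide-pos k _ r) (to (count-strong x r x< x≡ 1≤r r≤) al))

      good-range : ∀ x r → GoodAt ℓ r (nd x) → 1 ≤ r × r ≤ d ∸ ℓ
      good-range x r g with Equivalence.to (good-unfold {ℓ} {r} {nd x}) g
      ... | inj₁ (ℓ≡d , _) = ⊥-elim (<-irrefl ℓ≡d ℓ<d)
      ... | inj₂ (_ , _ , 1≤r , r≤ , _) = 1≤r , r≤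

      good₂ : ∀ x → x < N → (gd₂ x ≡ 1 × ℓ ≤ sz x × LevelGood (sz x) (nd x)) ⊎ (gd₂ x ≡ 0 × (ℓ ≤ sz x → ¬ LevelGood (sz x) (nd x)))
      good₂ x x< with sz x ≟ ℓ
      ... | no x≢ with good x x<
      ... | inj₁ (a , b , c) = inj₁ (trans (proj₁ (same x x< x≢)) a , <⇒≤ b , c)
      ... | inj₂ (a , b) = inj₂ (trans (proj₁ (same x x< x≢)) a , λ ℓ≤ → b (≤∧≢⇒< ℓ≤ (x≢ ∘ sym)))
      good₂ x x< | yes refl with new x x< refl
      ... | inj₁ (a , _ , r , 1≤r , r≤ , p) = inj₁ (a , ≤-refl , r , Equivalence.to (judged-good x r x< refl 1≤r r≤) p)
      ... | inj₂ (a , _ , none) with good x x<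
      ... | inj₁ (_ , b , _) = ⊥-elim (<-irrefl refl b)
      ... | inj₂ (b , _) = inj₂ (trans a b , λ _ (r , g) → let 1≤r , r≤ = good-range x r g in none r 1≤r r≤ (Equivalence.from (judged-good x r x< refl 1≤r r≤) g))

      -- The situation between `judge` and `retire`: goodness is settled down to level ℓ, bad
      -- subsets only above it. For a node of size ℓ the latter condition is vacuous.
      active₂ : ∀ y → y < N → (act₂ y ≡ 1 × ℓ ≤ sz y × LevelGood (sz y) (nd y) × NoBad (suc ℓ) y) ⊎ (act₂ y ≡ 0 × ¬ (ℓ ≤ sz y × LevelGood (sz y) (nd y) × NoBad (suc ℓ) y))
      active₂ y y< with sz y ≟ ℓ
      ... | no y≢ with active y y<
      ... | inj₁ (a , b , c) = inj₁ (trans (proj₂ (same y y< y≢)) a , <⇒≤ b , c)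
      ... | inj₂ (a , b) = inj₂ (trans (proj₂ (same y y< y≢)) a , λ (ℓ≤ , c) → b (≤∧≢⇒< ℓ≤ (y≢ ∘ sym) , c))
      active₂ y y< | yes refl with new y y< refl
      ... | inj₁ (_ , a , r , 1≤r , r≤ , p) = inj₁ (a , ≤-refl , (r , Equivalence.to (judged-good y r y< refl 1≤r r≤) p) , λ z z< _ a b _ → <-asym a b)
      ... | inj₂ (_ , a , none) with active y y<
      ... | inj₁ (_ , b , _) = ⊥-elim (<-irrefl refl b)
      ... | inj₂ (b , _) = inj₂ (trans a b , λ (_ , (r , g) , _) → let 1≤r , r≤ = good-range y r g in none r 1≤r r≤ (Equivalence.from (judged-good y r y< refl 1≤r r≤) g))

      culprit-bad : ∀ y q → y < N → q ∈ level ℓ → Culprit cnt₂ y q → ¬ NoBad ℓ y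
      culprit-bad y q y< q∈ (refl , x<y , p) nb = nb (D q) x< (pair⊑ q q<) (≤-reflexive (sym x≡)) x<y
        (subst (λ l → GoodAt l (sz y ∸ l) (nd (D q))) (sym x≡)
          (Equivalence.to (judged-good (D q) (sz y ∸ ℓ) x< x≡ (m<n⇒0<n∸m ℓ<y) (∸-monoˡ-≤ ℓ (sz≤d y y<)))
            (subst (λ t → 0 < cnt₂ (cell (D q) t)) (sym (m+[n∸m]≡n (<⇒≤ ℓ<y))) p)))
        where
        q< = All.lookup (level< ℓ) q∈
        x< = D< q q<
        x≡ : sz (D q) ≡ ℓ
        x≡ = All.lookup (bucket-key (sz ∘ D) ℓ dl) q∈
        ℓ<y : ℓ < sz y
        ℓ<y = subst (_< sz y) x≡ x<y

      -- The additional bad sets have size exactly ℓ. Such a set forms a listed pair with y, and by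
      -- `judged-good` its counter would be positive.
      no-culprit : ∀ y → y < N → (∀ q → q ∈ level ℓ → ¬ Culprit cnt₂ y q) → NoBad (suc ℓ) y → NoBad ℓ y
      no-culprit y y< none nb z z< z⊑ ℓ≤ z<y g with m≤n⇒m<n∨m≡n ℓ≤
      ... | inj₁ ℓ<z = nb z z< z⊑ ℓ<z z<y g
      ... | inj₂ refl with pair-all z y z< y< z⊑
      ... | q , q< , refl , refl = none q (bucket-∈ (sz ∘ D) ℓ dl q q< refl) (refl , z<y ,
            subst (λ t → 0 < cnt₂ (cell z t)) (m+[n∸m]≡n (<⇒≤ z<y))
              (Equivalence.from (judged-good z (sz y ∸ ℓ) z< refl (m<n⇒0<n∸m z<y) (∸-monoˡ-≤ ℓ (sz≤d y y<))) g))

      NoBad-weaken : ∀ y → NoBad ℓ y → NoBad (suc ℓ) y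
      NoBad-weaken y nb z z< z⊑ ℓ<z = nb z z< z⊑ (<⇒≤ ℓ<z)

      swept : Swept ℓ gd₂ act₃ cnt₂
      swept = record { good = good₂ ; active = active₃ ; blank = blank₂ }
        where
        active₃ : ∀ y → y < N → (act₃ y ≡ 1 × Active ℓ y) ⊎ (act₃ y ≡ 0 × ¬ Active ℓ y)
        active₃ y y< with Re y y<
        ... | inj₁ (a , q , q∈ , c) = inj₂ (a , λ (_ , _ , nb) → culprit-bad y q y< q∈ c nb)
        ... | inj₂ (a , none) with active₂ y y<
        ... | inj₁ (b , ℓ≤ , lg , nb) = inj₁ (trans a b , ℓ≤ , lg , no-culprit y y< none nb)
        ... | inj₂ (b , no-act) = inj₂ (trans a b , λ (ℓ≤ , lg , nb) → no-act (ℓ≤ , lg , NoBad-weaken y nb))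
        blank₂ : ∀ x → x < N → sz x < ℓ → ∀ t → t ≤ d → cnt₂ (cell x t) ≡ 0
        blank₂ x x< x<ℓ t t≤ = trans (same-cnt x x< (<⇒≢ x<ℓ) t t≤) (trans (Ta x x< t t≤)
          (cong₂ _+_ (blank x x< (m<n⇒m<1+n x<ℓ) t t≤) (tallied-other act ℓ x t (<⇒≢ x<ℓ))))

    level-d : ∀ {r S} → GoodAt d r S → S ∈ sets I
    level-d {r} {S} g with Equivalence.to (good-unfold {d} {r} {S}) g
    ... | inj₁ (_ , S∈) = S∈
    ... | inj₂ (_ , d<d , _) = ⊥-elim (<-irrefl refl d<d)

    Seeded : (gd act : ℕ → ℕ) → Set
    Seeded gd act = ∀ x → x < N → (nd x ∈ sets I × gd x ≡ 1 × act x ≡ 1) ⊎ (¬ nd x ∈ sets I × gd x ≡ 0 × act x ≡ 0)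

    -- At level d goodness means belonging to the family, and since no node has more than d
    -- elements, no proper subset reaches that level.
    swept-seed : ∀ {gd act cnt} → Seeded gd act → (∀ q → cnt q ≡ 0) → Swept d gd act cnt
    swept-seed {gd} {act} seed zeros = record { good = good ; active = active ; blank = λ _ _ _ _ _ → zeros _ }
      where
      row-good : ∀ x → x < N → nd x ∈ sets I → d ≤ sz x × LevelGood (sz x) (nd x)
      row-good x x< x∈ = ≤-reflexive (sym sz≡) , 0 , Equivalence.from (good-unfold {sz x} {0} {nd x}) (inj₁ (sz≡ , x∈))
        where
        sz≡ : sz x ≡ d
        sz≡ = trans (size x x<) (All.lookup (uniform I) x∈)
      good-row : ∀ x → x < N → d ≤ sz x → LevelGood (sz x) (nd x) → nd x ∈ sets I
      good-row x x< d≤ (r , g) = level-d {r} (subst (λ l → GoodAt l r (nd x)) (≤-antisym (sz≤d x x<) d≤) g)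
      good : ∀ x → x < N → (gd x ≡ 1 × d ≤ sz x × LevelGood (sz x) (nd x)) ⊎ (gd x ≡ 0 × (d ≤ sz x → ¬ LevelGood (sz x) (nd x)))
      good x x< with seed x x<
      ... | inj₁ (x∈ , a , _) = inj₁ (a , row-good x x< x∈)
      ... | inj₂ (x∉ , a , _) = inj₂ (a , λ d≤ lg → x∉ (good-row x x< d≤ lg))
      active : ∀ y → y < N → (act y ≡ 1 × Active d y) ⊎ (act y ≡ 0 × ¬ Active d y)
      active y y< with seed y y<
      ... | inj₁ (y∈ , _ , a) = let p , q = row-good y y< y∈ in inj₁ (a , p , q , λ z _ _ d≤z z<y _ → <⇒≱ (≤-<-trans d≤z z<y) (sz≤d y y<))
      ... | inj₂ (y∉ , _ , a) = inj₂ (a , λ (d≤ , lg , _) → y∉ (good-row y y< d≤ lg))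

    Minimized : (gd nm : ℕ → ℕ) → Set
    Minimized gd nm = ∀ x → x < N →
      (nm x ≡ 1 × ∃ λ y → y < N × gd y ≡ 1 × nd y ⊑ nd x × sz y < sz x) ⊎
      (nm x ≡ 0 × ∀ y → y < N → gd y ≡ 1 → nd y ⊑ nd x → sz y < sz x → Data.Empty.⊥)

    -- `_⊂_` demands an element of the difference, which is found by search; if there were none, the
    -- sizes could not differ.
    ⊑-<⇒⊂ : ∀ {p q : Subset m} → p ⊑ q → ∣ p ∣ < ∣ q ∣ → p ⊂ q
    ⊑-<⇒⊂ {p} {q} p⊑q lt with any? (λ x → (x ∈ˢ? q) ×-dec ¬? (x ∈ˢ? p))
    ... | yes w = (λ {x} → mem p⊑q x) , w
    ... | no none = ⊥-elim (<⇒≱ lt (⊑-size (incl λ x x∈q → case x ∈ˢ? p of λ where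
            (yes x∈p) → x∈p
            (no x∉p)  → contradiction (x , x∈q , x∉p) none)))

    -- The sweep ends at L = d - (d - 1), which is 1, except that it is 0 for d = 0; there the empty
    -- set may itself be a row. The two bounds on `L` cover both cases.
    module Kernel {L : ℕ} (L≤1 : L ≤ 1) (L≤d : L ≤ d) {gd act cnt nm : ℕ → ℕ} (S : Swept L gd act cnt) (Mn : Minimized gd nm) where
      open Swept S

      good-above : ∀ x → x < N → LevelGood (sz x) (nd x) → L ≤ sz x
      good-above x x< (r , g) with Equivalence.to (good-unfold {sz x} {r} {nd x}) g
      ... | inj₁ (e , _) = ≤-trans L≤d (≤-reflexive (sym e))
      ... | inj₂ (1≤ , _) = ≤-trans L≤1 1≤

      gd-Good : ∀ x → x < N → gd x ≡ 1 ⇔ Good (nd x)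
      gd-Good x x< with good x x<
      ... | inj₁ (a , _ , b) = mk⇔ (λ _ → subst (λ l → LevelGood l (nd x)) (size x x<) b) (λ _ → a)
      ... | inj₂ (a , b) = mk⇔ (λ e → ⊥-elim (1+n≢0 (trans (sym e) a)))
            (λ g → let g′ = subst (λ l → LevelGood l (nd x)) (sym (size x x<)) g in contradiction g′ (b (good-above x x< g′)))

      Kept : ℕ → Set
      Kept x = nm x < gd x

      kept : ∀ x → x < N → Kept x ⇔ KernelSet k I (nd x)
      kept x x< with Mn x x<
      ... | inj₁ (a , y , y< , gy , y⊑ , lt) = mk⇔
            (λ h → ⊥-elim (<⇒≱ h (≤-trans (gd≤1 x x<) (≤-reflexive (sym a)))))
            (λ (_ , none) → ⊥-elim (none (nd y) (⊑-<⇒⊂ y⊑ (subst₂ _<_ (size y y<) (size x x<) lt)) (Equivalence.to (gd-Good y y<) gy)))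
        where
        gd≤1 : ∀ x → x < N → gd x ≤ 1
        gd≤1 x x< with good x x<
        ... | inj₁ (e , _) = ≤-reflexive e
        ... | inj₂ (e , _) = ≤-trans (≤-reflexive e) z≤n
      ... | inj₂ (a , none) = mk⇔
            (λ h → Equivalence.to (gd-Good x x<) (gd≡1 h) , λ R (R⊆ , z) g → lesser R R⊆ z g)
            (λ (g , _) → subst₂ _<_ (sym a) (sym (Equivalence.from (gd-Good x x<) g)) (s≤s z≤n))
        where
        gd≡1 : nm x < gd x → gd x ≡ 1
        gd≡1 h with good x x<
        ... | inj₁ (e , _) = e
        ... | inj₂ (e , _) = ⊥-elim (<⇒≱ h (≤-trans (≤-reflexive e) z≤n))
        lesser : ∀ R → R ⊆ nd x → _ → ¬ Good R
        lesser R R⊆ z (r , g) with good-node {∣ R ∣} {r} g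
        ... | y , y< , refl = none y y< (Equivalence.from (gd-Good y y<) (r , g)) (incl λ u → R⊆ {u})
              (subst₂ _<_ (sym (size y y<)) (sym (size x x<)) (p⊂q⇒∣p∣<∣q∣ ((λ {u} → R⊆ {u}) , z)))

      kernel-node : ∀ T → KernelSet k I T → ∃ λ x → x < N × nd x ≡ T × Kept x
      kernel-node T ks@((r , g) , _) with good-node {∣ T ∣} {r} g
      ... | x , x< , refl = x , x< , refl , Equivalence.from (kept x x<) ks

-- The program phases of the level sweep

module LevelSweep where

  open import Defs hiding (KernelSet; KernelElement)
  open Language
  open KernelProgram
  open Combinatorics
  open PairIndex
  open NodeCreation using (module CreateSpec)
  open import Data.Bool using (true; false; _∧_; T)
  open import Data.Empty using (⊥-elim)
  open import Data.Fin.Subset using (Subset)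
  open import Data.List using (List; []; _∷_; length)
  open import Data.List.Membership.Propositional using (_∈_)
  open import Data.List.Relation.Unary.All as All using (All; []; _∷_)
  open import Data.List.Relation.Unary.Any using (here; there)
  open import Data.Nat
  open import Data.Nat.Properties
  open import Data.Nat.Solver using (module +-*-Solver)
  open import Data.Product using (∃; _×_; _,_; proj₁; proj₂)
  open import Data.Sum using (_⊎_; inj₁; inj₂)
  open import Function using (_∘_; case_of_)
  open import Relation.Binary.PropositionalEquality
  open import Relation.Nullary using (¬_; yes; no; contradiction)
  open +-*-Solver using (solve; _:+_; _:*_; _:=_; con)

  bucket-≤ : ∀ f e c → length (bucket f e c) ≤ c
  bucket-≤ f e zero    = z≤n
  bucket-≤ f e (suc c) with f c ≡ᵇ e
  ... | true  = s≤s (bucket-≤ f e c)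
  ... | false = m≤n⇒m≤1+n (bucket-≤ f e c)

  cell-injective : ∀ d {x y t u} → t ≤ d → u ≤ d → x * suc d + t ≡ y * suc d + u → x ≡ y × t ≡ u
  cell-injective d {zero}  {zero}  t≤ u≤ e = refl , e
  cell-injective d {zero}  {suc y} {t} {u} t≤ u≤ e = ⊥-elim (<⇒≱ (s≤s t≤) (≤-trans (m≤m+n (suc d) (y * suc d + u)) (≤-reflexive (trans (sym (+-assoc (suc d) (y * suc d) u)) (sym e)))))
  cell-injective d {suc x} {zero}  {t} {u} t≤ u≤ e = ⊥-elim (<⇒≱ (s≤s u≤) (≤-trans (m≤m+n (suc d) (x * suc d + t)) (≤-reflexive (trans (sym (+-assoc (suc d) (x * suc d) t)) e))))
  cell-injective d {suc x} {suc y} {t} {u} t≤ u≤ e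
    with cell-injective d {x} {y} t≤ u≤ (+-cancelˡ-≡ (suc d) _ _ (trans (sym (+-assoc (suc d) (x * suc d) t)) (trans e (+-assoc (suc d) (y * suc d) u))))
  ... | refl , e′ = refl , e′

  module SweepSpec (w X : ℕ) (X< : X < 2 ^ w) where
    open Logic w X
    open CreateSpec w X X< using (<W; ≤W)

    occurrences-spec : ∀ {σ} → let key = λ j → arr σ aIn (4 + j) ; len = var σ vnd in
      (∀ e → arr σ aHd e ≡ 0) → 4 + len ≤ X → (∀ j → j < len → key j < X) →
      wp occurrences (λ τ → (∀ e → Chain (arr τ aNx) (arr τ aHd e) (bucket key e len)) × clk τ ≤ 1 + len * 3 + clk σ) σ
    occurrences-spec {σ} zeros room key< =
      for-cost {vi} {vnd} {occurrencesBody} {σ = σ} 2 (λ i τ → ∀ e → Chain (arr τ aNx) (arr τ aHd e) (bucket key e i)) zeros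
        (λ i τ i< ch → let 4+i< = <-≤-trans (+-monoʳ-< 4 i<) room ; i<X = ≤-<-trans (m≤n+m i 4) 4+i< in
          _ , (((_ , _ , <W 4+i<) , 4+i<) , key< i i<) , i<X ,
          ((_ , _ , <W 4+i<) , 4+i<) , (_ , _ , ≤W i<X) , key< i i< ,
          Chain-bucket key i ch , ≤-refl)
        λ τ ch c → ch , s≤s c
      where
      key = λ j → arr σ aIn (4 + j)

    levels-spec : ∀ {σ} → let key = λ q → arr σ aSz (arr σ aD q) ; dl = var σ vdl in
      (∀ e → arr σ aLh e ≡ 0) → dl ≤ X → (∀ q → q < dl → arr σ aD q < X × key q < X) →
      wp levels (λ τ → (∀ e → Chain (arr τ aLn) (arr τ aLh e) (bucket key e dl)) × clk τ ≤ 1 + dl * 3 + clk σ) σ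
    levels-spec {σ} zeros room key< =
      for-cost {vi} {vdl} {levelsBody} {σ = σ} 2 (λ i τ → ∀ e → Chain (arr τ aLn) (arr τ aLh e) (bucket key e i)) zeros
        (λ i τ i< ch → let i<X = <-≤-trans i< room ; D<X , k<X = key< i i< in
          _ , (((_ , i<X) , D<X) , k<X) , i<X ,
          ((_ , i<X) , D<X) , (_ , _ , ≤W i<X) , k<X ,
          Chain-bucket key i ch , ≤-refl)
        λ τ ch c → ch , s≤s c
      where
      key = λ q → arr σ aSz (arr σ aD q)

    Planted : (cur gd act : ℕ → ℕ) → ℕ → Set
    Planted cur gd act i = ∀ x → (∃ λ f → f < i × cur f ≡ x × gd x ≡ 1 × act x ≡ 1) ⊎ ((∀ f → f < i → cur f ≢ x) × gd x ≡ 0 × act x ≡ 0)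

    seed-spec : ∀ {σ} → (∀ x → arr σ aGd x ≡ 0) → (∀ x → arr σ aAct x ≡ 0) → var σ vn ≤ X → (∀ f → f < var σ vn → arr σ aCur f < X) →
      wp seed (λ τ → Planted (arr σ aCur) (arr τ aGd) (arr τ aAct) (var σ vn) × clk τ ≤ 1 + var σ vn * 4 + clk σ) σ
    seed-spec {σ} zg za room cur< =
      for-cost {vi} {vn} {seedBody} {σ = σ} 3 (λ i τ → Planted (arr σ aCur) (arr τ aGd) (arr τ aAct) i) (λ x → inj₂ ((λ _ ()) , zg x , za x))
        (λ i τ i< I → (_ , <-≤-trans i< room) , _ , _ , cur< i i< , _ , _ , cur< i i< , next i τ I , ≤-refl)
        λ τ I c → I , s≤s c
      where
      next : ∀ i τ → Planted (arr σ aCur) (arr τ aGd) (arr τ aAct) i →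
        Planted (arr σ aCur) (arr τ aGd [ arr σ aCur i ↦ 1 ]) (arr τ aAct [ arr σ aCur i ↦ 1 ]) (suc i)
      next i τ I x with x ≟ arr σ aCur i
      ... | yes refl = inj₁ (i , ≤-refl , refl , upd-same (arr τ aGd) x 1 , upd-same (arr τ aAct) x 1)
      ... | no x≢ with I x
      ... | inj₁ (f , f< , e , a , b) = inj₁ (f , m<n⇒m<1+n f< , e , trans (upd-other (arr τ aGd) 1 x≢) a , trans (upd-other (arr τ aAct) 1 x≢) b)
      ... | inj₂ (none , a , b) = inj₂ ((λ f f< → case m<1+n⇒m<n∨m≡n f< of λ where
              (inj₁ lt)   → none f lt
              (inj₂ refl) → x≢ ∘ sym) , trans (upd-other (arr τ aGd) 1 x≢) a , trans (upd-other (arr τ aAct) 1 x≢) b)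

    -- The state is a parameter because the three phases start in different states. Through `merge`
    -- the arrays describing pairs and lists are definitionally the same in all of them, so the same
    -- evidence serves each time.
    module Levels {m : ℕ} (σ : State) (I : Instance (var σ vd) m) {nd : ℕ → Subset m}
      (Ix : Index (_∈ sets I) (arr σ aSz) (arr σ aD) (arr σ aOwn) nd (var σ vNN) (var σ vdl))
      (roomC : var σ vNN * suc (var σ vd) ≤ X) (roomD : var σ vdl ≤ X)
      (chain : ∀ ℓ → Chain (arr σ aLn) (arr σ aLh ℓ) (bucket (arr σ aSz ∘ arr σ aD) ℓ (var σ vdl))) where
      open GoodNodes (var σ vk) I Ix
      open Index Ix

      d = var σ vd
      N = var σ vNN
      dl = var σ vdl

      cell< : ∀ x t → x < N → t ≤ d → cell x t < X
      cell< x t x< t≤ = <-≤-trans (+-monoʳ-< (x * suc d) (s≤s t≤)) (≤-trans (≤-reflexive (+-comm (x * suc d) (suc d))) (≤-trans (*-monoˡ-≤ (suc d) x<) roomC))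

      N≤X : N ≤ X
      N≤X = ≤-trans (m≤m*n N (suc d)) roomC

      level<X : ∀ ℓ → All (_< X) (level ℓ)
      level<X ℓ = All.map (λ q< → <-≤-trans q< roomD) (level< ℓ)

      row*<W : ∀ x → x < N → x * suc d < X
      row*<W x x< = ≤-<-trans (≤-reflexive (sym (+-identityʳ _))) (cell< x 0 x< z≤n)

      ℓ = var σ vL

      same-cell : ∀ {x y t u} → t ≤ d → u ≤ d → cell x t ≡ cell y u → x ≡ y × t ≡ u
      same-cell = cell-injective d

      -- Visiting a pair moves its contribution from the tally still to come into the counter, so
      -- their sum is invariant along the walk.
      tally-hit : ∀ (f : ℕ → ℕ) q zs → q < dl → ∀ x t → x < N → t ≤ d →
        let c = cell (arr σ aD q) (arr σ aSz (arr σ aOwn q)) ; a = arr σ aAct (arr σ aOwn q) in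
        (f [ c ↦ f c + a ]) (cell x t) + tallied (arr σ aAct) zs x t ≡ f (cell x t) + tallied (arr σ aAct) (q ∷ zs) x t
      tally-hit f q zs q< x t x< t≤ with arr σ aD q ≡ᵇ x in e₁ | arr σ aSz (arr σ aOwn q) ≡ᵇ t in e₂
      ... | true | true with ≡ᵇ⇒≡ (arr σ aD q) x (subst T (sym e₁) _) | ≡ᵇ⇒≡ (arr σ aSz (arr σ aOwn q)) t (subst T (sym e₂) _)
      ... | refl | refl = trans (cong (_+ tallied (arr σ aAct) zs x t) (upd-same f (cell x t) _)) (+-assoc (f (cell x t)) _ _)
      tally-hit f q zs q< x t x< t≤ | true | false = cong (_+ tallied (arr σ aAct) zs x t)
        (upd-other f _ (λ e → subst T e₂ (≡⇒≡ᵇ _ t (sym (proj₂ (same-cell {x} {arr σ aD q} t≤ (sz≤d _ (own< q q<)) e))))))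
      tally-hit f q zs q< x t x< t≤ | false | _ = cong (_+ tallied (arr σ aAct) zs x t)
        (upd-other f _ (λ e → subst T e₁ (≡⇒≡ᵇ (arr σ aD q) x (sym (proj₁ (same-cell {x} {arr σ aD q} t≤ (sz≤d _ (own< q q<)) e))))))

      tally-spec : ℓ < X → suc d < 2 ^ w →
        (∀ x t → x < N → t ≤ d → arr σ aSz x ≡ ℓ → arr σ aCnt (cell x t) + tallied (arr σ aAct) (level ℓ) x t ≤ X) →
        wp tally (λ τ → Tallied ℓ (arr σ aAct) (arr σ aCnt) (arr τ aCnt) × clk τ ≤ 1 + length (level ℓ) * 4 + clk σ) σ
      tally-spec ℓ<X d<W total =
        walk-rule {vq} {vj} {aLh ⟦ ` vL ⟧} {aLn} {tallyBody} {σ = σ} (level ℓ) Inv (_ , ℓ<X) (chain ℓ) (level<X ℓ)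
          ((λ _ _ _ _ → refl) , level< ℓ , bucket-key (arr σ aSz ∘ arr σ aD) ℓ dl , ≤-reflexive (+-comm (clk σ) _))
          body
          λ τ (eq , _ , _ , c) → (λ x x< t t≤ → trans (sym (+-identityʳ _)) (eq x t x< t≤)) , s≤s (subst (_≤ length (level ℓ) * 4 + clk σ) (+-identityʳ (clk τ)) c)
        where
        Inv : List ℕ → State → Set
        Inv zs τ = (∀ x t → x < N → t ≤ d → arr τ aCnt (cell x t) + tallied (arr σ aAct) zs x t ≡ arr σ aCnt (cell x t) + tallied (arr σ aAct) (level ℓ) x t) ×
          All (_< dl) zs × All (λ q → arr σ aSz (arr σ aD q) ≡ ℓ) zs × clk τ + length zs * 4 ≤ length (level ℓ) * 4 + clk σ
        body : ∀ q zs τ → All (_< X) (q ∷ zs) → Inv (q ∷ zs) τ → wp tallyBody (Inv zs) (walkSt vq vj (aLh ⟦ ` vL ⟧) aLn tallyBody σ q τ)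
        body q zs τ (q<X ∷ _) (eq , q< ∷ bd , key ∷ keys , c) =
          (_ , q<X) , (((_ , q<X) , (_ , _ , d<W) , <W (row*<W (arr σ aD q) D<N)) , (_ , own<X) , <W c<X) ,
          _ , ((_ , c<X) , (_ , own<X) , ≤W no-overflow) , c<X ,
          (λ x t x< t≤ → trans (tally-hit (arr τ aCnt) q zs q< x t x< t≤) (eq x t x< t≤)) , bd , keys ,
          from-≤ 0 c (solve 4 (λ u l t s → con 4 :+ u :+ l :* con 4 :+ (t :* con 4 :+ s) :+ con 0 := t :* con 4 :+ s :+ (u :+ (con 1 :+ l) :* con 4)) refl (clk τ) (length zs) (length (level ℓ)) (clk σ))
          where
          y = arr σ aOwn q
          D<N = D< q q<
          own<X = <-≤-trans (own< q q<) N≤X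
          t≤d = sz≤d y (own< q q<)
          c<X = cell< (arr σ aD q) (arr σ aSz y) D<N t≤d
          -- By the invariant the new value is at most the final one, which is bounded by
          -- hypothesis.
          no-overflow : arr τ aCnt (cell (arr σ aD q) (arr σ aSz y)) + arr σ aAct y ≤ X
          no-overflow = ≤-trans (≤-trans (≤-reflexive (sym (upd-same (arr τ aCnt) cl _))) (≤-trans (m≤m+n _ (tallied (arr σ aAct) zs (arr σ aD q) (arr σ aSz y)))
              (≤-reflexive (trans (tally-hit (arr τ aCnt) q zs q< (arr σ aD q) (arr σ aSz y) D<N t≤d) (eq _ _ D<N t≤d)))))
            (total _ _ D<N t≤d key)
            where cl = cell (arr σ aD q) (arr σ aSz y)

      divide-spec : ∀ {ψ : State} {Q : State → Set} →
        (∀ τ → var τ vv ≡ divide (var ψ vk) (var ψ vv) (var ψ vr) → clk τ ≤ var ψ vr * 2 + clk ψ → Q (forSt vi vr divideBody ψ (var ψ vr) τ)) →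
        wp (for vi vr divideBody) Q ψ
      divide-spec {ψ} {Q} fin = for-cost {vi} {vr} {divideBody} {Q} {ψ} 1 (λ i τ → var τ vv ≡ divide (var ψ vk) (var ψ vv) i) refl
        (λ i τ _ eq → _ , cong (λ v → v / suc (var ψ vk) / suc i) eq , ≤-refl) fin

      k = var σ vk

      -- Quotients overwrite counts in place: up to r = i the cells are decided, beyond it they
      -- still hold counts.
      record Cells (x i : ℕ) (gd act cnt gd′ act′ cnt′ : ℕ → ℕ) : Set where
        field
          done   : ∀ r → 1 ≤ r → r ≤ i → cnt′ (cell x (ℓ + r)) ≡ divide k (cnt (cell x (ℓ + r))) r
          undone : ∀ q → (∀ r → 1 ≤ r → r ≤ i → q ≢ cell x (ℓ + r)) → cnt′ q ≡ cnt q
          flag   : (gd′ x ≡ 1 × act′ x ≡ 1 × ∃ λ r → 1 ≤ r × r ≤ i × 0 < cnt′ (cell x (ℓ + r))) ⊎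
                   (gd′ x ≡ gd x × act′ x ≡ act x × ∀ r → 1 ≤ r → r ≤ i → ¬ 0 < cnt′ (cell x (ℓ + r)))
          others : ∀ y → y ≢ x → gd′ y ≡ gd y × act′ y ≡ act y

      Cells-start : ∀ {x gd act cnt} → Cells x 0 gd act cnt gd act cnt
      Cells-start = record { done = λ r 1≤r r≤0 → ⊥-elim (<⇒≱ 1≤r r≤0) ; undone = λ _ _ → refl
        ; flag = inj₂ (refl , refl , λ r 1≤r r≤0 → ⊥-elim (<⇒≱ 1≤r r≤0)) ; others = λ _ _ → refl , refl }

      module CellStep {x i : ℕ} {gd act cnt gd′ act′ cnt′ : ℕ → ℕ} (C : Cells x i gd act cnt gd′ act′ cnt′)
        (v : ℕ) (v≡ : v ≡ divide k (cnt′ (cell x (ℓ + suc i))) (suc i)) where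
        open Cells C
        here-cell = cell x (ℓ + suc i)
        cnt″ = cnt′ [ here-cell ↦ v ]
        hit : cnt″ here-cell ≡ v
        hit = upd-same cnt′ here-cell v
        differs : ∀ r → r ≤ i → cell x (ℓ + r) ≢ here-cell
        differs r r≤ e = <⇒≢ (s≤s r≤) (+-cancelˡ-≡ ℓ _ _ (+-cancelˡ-≡ (x * suc d) _ _ e))
        keep : ∀ r → r ≤ i → cnt″ (cell x (ℓ + r)) ≡ cnt′ (cell x (ℓ + r))
        keep r r≤ = upd-other cnt′ v (differs r r≤)
        done″ : ∀ r → 1 ≤ r → r ≤ suc i → cnt″ (cell x (ℓ + r)) ≡ divide k (cnt (cell x (ℓ + r))) r
        done″ r 1≤r r≤ with m≤n⇒m<n∨m≡n r≤
        ... | inj₁ (s≤s lt) = trans (keep r lt) (done r 1≤r lt)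
        ... | inj₂ refl = trans hit (trans v≡ (cong (λ u → divide k u (suc i)) (undone here-cell (λ r _ r≤i e → differs r r≤i (sym e)))))
        undone″ : ∀ q → (∀ r → 1 ≤ r → r ≤ suc i → q ≢ cell x (ℓ + r)) → cnt″ q ≡ cnt q
        undone″ q h = trans (upd-other cnt′ v (h (suc i) (s≤s z≤n) ≤-refl)) (undone q (λ r 1≤r r≤ → h r 1≤r (m≤n⇒m≤1+n r≤)))
        positive : 0 < v → Cells x (suc i) gd act cnt (gd′ [ x ↦ 1 ]) (act′ [ x ↦ 1 ]) cnt″
        positive v>0 = record { done = done″ ; undone = undone″
          ; flag = inj₁ (upd-same gd′ x 1 , upd-same act′ x 1 , suc i , s≤s z≤n , ≤-refl , subst (0 <_) (sym hit) v>0)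
          ; others = λ y y≢ → trans (upd-other gd′ 1 y≢) (proj₁ (others y y≢)) , trans (upd-other act′ 1 y≢) (proj₂ (others y y≢)) }
        nonpositive : v ≤ 0 → Cells x (suc i) gd act cnt gd′ act′ cnt″
        nonpositive v≤0 = record { done = done″ ; undone = undone″ ; flag = fl flag ; others = others }
          where
          fl : _ → (gd′ x ≡ 1 × act′ x ≡ 1 × ∃ λ r → 1 ≤ r × r ≤ suc i × 0 < cnt″ (cell x (ℓ + r))) ⊎
                   (gd′ x ≡ gd x × act′ x ≡ act x × ∀ r → 1 ≤ r → r ≤ suc i → ¬ 0 < cnt″ (cell x (ℓ + r)))
          fl (inj₁ (a , b , r , 1≤r , r≤ , p)) = inj₁ (a , b , r , 1≤r , m≤n⇒m≤1+n r≤ , subst (0 <_) (sym (keep r r≤)) p)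
          fl (inj₂ (a , b , none)) = inj₂ (a , b , λ r 1≤r r≤ p → case m≤n⇒m<n∨m≡n r≤ of λ where
            (inj₁ (s≤s lt)) → none r 1≤r lt (subst (0 <_) (keep r lt) p)
            (inj₂ refl)     → <⇒≱ (subst (0 <_) hit p) v≤0)

      judgeNode-spec : ∀ {x τ} → ℓ ≤ d → x < N → suc d < 2 ^ w → let ψ = tick (forSt vx vNN judgeBody σ x τ) in
        wp judgeNode (λ τ′ → Cells x (d ∸ ℓ) (arr τ aGd) (arr τ aAct) (arr τ aCnt) (arr τ′ aGd) (arr τ′ aAct) (arr τ′ aCnt) ×
                             clk τ′ ≤ 4 + d * (9 + d * 2) + clk τ) ψ
      judgeNode-spec {x} {τ} ℓ≤d x< d<W = (_ , _ , ℓ≤d) ,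
        for-cost {vr0} {vb} {judgeCell} {σ = ψ₁} (8 + d * 2) (λ i τ′ → Cells x i (arr τ aGd) (arr τ aAct) (arr τ aCnt) (arr τ′ aGd) (arr τ′ aAct) (arr τ′ aCnt))
          Cells-start body
          λ τ′ C c → C , s≤s (≤-trans c (≤-trans (+-monoˡ-≤ (3 + clk τ) (*-monoˡ-≤ (9 + d * 2) (m∸n≤m d ℓ)))
            (≤-reflexive (solve 2 (λ a c → a :+ (con 3 :+ c) := con 3 :+ a :+ c) refl (d * (9 + d * 2)) (clk τ)))))
        where
        ψ = tick (forSt vx vNN judgeBody σ x τ)
        ψ₁ = setV vb (d ∸ ℓ) ψ
        body : ∀ i τ′ → i < d ∸ ℓ → Cells x i (arr τ aGd) (arr τ aAct) (arr τ aCnt) (arr τ′ aGd) (arr τ′ aAct) (arr τ′ aCnt) →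
          wp judgeCell (λ τ″ → Cells x (suc i) (arr τ aGd) (arr τ aAct) (arr τ aCnt) (arr τ″ aGd) (arr τ″ aAct) (arr τ″ aCnt) × clk τ″ ≤ 8 + d * 2 + suc (clk τ′)) (forSt vr0 vb judgeCell ψ₁ i τ′)
        body i τ′ i< C =
          (_ , _ , ≤-<-trans r≤d (<-trans ≤-refl d<W)) , ((_ , (_ , _ , d<W) , <W (row*<W x x<)) , (_ , _ , ≤-<-trans t≤d (<-trans ≤-refl d<W)) , <W c<X) ,
          (_ , c<X) , divide-spec {ψ₄} λ τ″ v≡ ck →
            _ , _ , c<X ,
            (_ , (λ lt → _ , _ , <-≤-trans x< N≤X , _ , _ , <-≤-trans x< N≤X , CellStep.positive C (var τ″ vv) v≡ lt , time τ″ ck) ,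
                 λ ge → CellStep.nonpositive C (var τ″ vv) v≡ ge , ≤-trans (m≤n+m _ 2) (time τ″ ck))
          where
          ψ₄ = setV vv (arr τ′ aCnt (cell x (ℓ + suc i))) (setV vc (cell x (ℓ + suc i)) (setV vr (suc i) (forSt vr0 vb judgeCell ψ₁ i τ′)))
          t≤d : ℓ + suc i ≤ d
          t≤d = ≤-trans (+-monoʳ-≤ ℓ i<) (≤-reflexive (m+[n∸m]≡n ℓ≤d))
          r≤d : suc i ≤ d
          r≤d = ≤-trans (m≤n+m (suc i) ℓ) t≤d
          c<X = cell< x (ℓ + suc i) x< t≤d
          time : ∀ τ″ → clk τ″ ≤ suc i * 2 + (4 + clk τ′) → 5 + clk τ″ ≤ 8 + d * 2 + suc (clk τ′)
          time τ″ h = from-≤ 0 (+-mono-≤ h (*-monoˡ-≤ 2 r≤d)) (solve 4 (λ u i d t → con 5 :+ u :+ ((con 1 :+ i) :* con 2 :+ (con 4 :+ t) :+ d :* con 2) :+ con 0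
            := con 8 :+ d :* con 2 :+ (con 1 :+ t) :+ (u :+ (con 1 :+ i) :* con 2)) refl (clk τ″) i d (clk τ′))

      record JudgedBelow (i : ℕ) (gd′ act′ cnt′ : ℕ → ℕ) : Set where
        field
          same-cnt : ∀ x → x < N → i ≤ x ⊎ arr σ aSz x ≢ ℓ → ∀ t → t ≤ d → cnt′ (cell x t) ≡ arr σ aCnt (cell x t)
          same     : ∀ x → x < N → i ≤ x ⊎ arr σ aSz x ≢ ℓ → gd′ x ≡ arr σ aGd x × act′ x ≡ arr σ aAct x
          new-cnt  : ∀ x → x < i → arr σ aSz x ≡ ℓ → ∀ r → 1 ≤ r → r ≤ d ∸ ℓ → cnt′ (cell x (ℓ + r)) ≡ divide k (arr σ aCnt (cell x (ℓ + r))) r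
          new      : ∀ x → x < i → arr σ aSz x ≡ ℓ →
            (gd′ x ≡ 1 × act′ x ≡ 1 × ∃ λ r → 1 ≤ r × r ≤ d ∸ ℓ × 0 < cnt′ (cell x (ℓ + r))) ⊎
            (gd′ x ≡ arr σ aGd x × act′ x ≡ arr σ aAct x × ∀ r → 1 ≤ r → r ≤ d ∸ ℓ → ¬ 0 < cnt′ (cell x (ℓ + r)))

      judge-skip : ∀ {i gd′ act′ cnt′} → arr σ aSz i ≢ ℓ → JudgedBelow i gd′ act′ cnt′ → JudgedBelow (suc i) gd′ act′ cnt′
      judge-skip {i} i≢ J = record
        { same-cnt = λ x x< → λ where
            (inj₁ lt) → same-cnt x x< (inj₁ (<⇒≤ lt))
            (inj₂ ne) → same-cnt x x< (inj₂ ne)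
        ; same = λ x x< → λ where
            (inj₁ lt) → same x x< (inj₁ (<⇒≤ lt))
            (inj₂ ne) → same x x< (inj₂ ne)
        ; new-cnt = λ x x< e → case m<1+n⇒m<n∨m≡n x< of λ where
            (inj₁ lt)   → new-cnt x lt e
            (inj₂ refl) → contradiction e i≢
        ; new = λ x x< e → case m<1+n⇒m<n∨m≡n x< of λ where
            (inj₁ lt)   → new x lt e
            (inj₂ refl) → contradiction e i≢ }
        where open JudgedBelow J

      judge-node : ∀ {i gd′ act′ cnt′ gd″ act″ cnt″} → ℓ ≤ d → i < N → arr σ aSz i ≡ ℓ → JudgedBelow i gd′ act′ cnt′ →
        Cells i (d ∸ ℓ) gd′ act′ cnt′ gd″ act″ cnt″ → JudgedBelow (suc i) gd″ act″ cnt″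
      judge-node {i} {gd′} {act′} {cnt′} {gd″} {act″} {cnt″} ℓ≤d i<N i≡ J C = record { same-cnt = sc ; same = sm ; new-cnt = nc ; new = nw }
        where
        open JudgedBelow J
        open Cells C
        range : ∀ {r} → r ≤ d ∸ ℓ → ℓ + r ≤ d
        range r≤ = ≤-trans (+-monoʳ-≤ ℓ r≤) (≤-reflexive (m+[n∸m]≡n ℓ≤d))
        elsewhere : ∀ x t → t ≤ d → x ≢ i → cnt″ (cell x t) ≡ cnt′ (cell x t)
        elsewhere x t t≤ x≢ = undone (cell x t) (λ r _ r≤ e → x≢ (proj₁ (same-cell {x} {i} t≤ (range r≤) e)))
        weaken : ∀ {x} → suc i ≤ x ⊎ arr σ aSz x ≢ ℓ → i ≤ x ⊎ arr σ aSz x ≢ ℓ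
        weaken (inj₁ lt) = inj₁ (<⇒≤ lt)
        weaken (inj₂ ne) = inj₂ ne
        other : ∀ {x} → suc i ≤ x ⊎ arr σ aSz x ≢ ℓ → x ≢ i
        other (inj₁ lt) refl = <-irrefl refl lt
        other (inj₂ ne) refl = ne i≡
        sc : ∀ x → x < N → suc i ≤ x ⊎ arr σ aSz x ≢ ℓ → ∀ t → t ≤ d → cnt″ (cell x t) ≡ arr σ aCnt (cell x t)
        sc x x< h t t≤ = trans (elsewhere x t t≤ (other h)) (same-cnt x x< (weaken h) t t≤)
        sm : ∀ x → x < N → suc i ≤ x ⊎ arr σ aSz x ≢ ℓ → gd″ x ≡ arr σ aGd x × act″ x ≡ arr σ aAct x
        sm x x< h = let a , b = others x (other h) ; a′ , b′ = same x x< (weaken h) in trans a a′ , trans b b′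
        nc : ∀ x → x < suc i → arr σ aSz x ≡ ℓ → ∀ r → 1 ≤ r → r ≤ d ∸ ℓ → cnt″ (cell x (ℓ + r)) ≡ divide k (arr σ aCnt (cell x (ℓ + r))) r
        nc x x< e r 1≤r r≤ with m<1+n⇒m<n∨m≡n x<
        ... | inj₁ lt   = trans (elsewhere x (ℓ + r) (range r≤) (<⇒≢ lt)) (new-cnt x lt e r 1≤r r≤)
        ... | inj₂ refl = trans (done r 1≤r r≤) (cong (λ u → divide k u r) (same-cnt i i<N (inj₁ ≤-refl) (ℓ + r) (range r≤)))
        nw : ∀ x → x < suc i → arr σ aSz x ≡ ℓ →
            (gd″ x ≡ 1 × act″ x ≡ 1 × ∃ λ r → 1 ≤ r × r ≤ d ∸ ℓ × 0 < cnt″ (cell x (ℓ + r))) ⊎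
            (gd″ x ≡ arr σ aGd x × act″ x ≡ arr σ aAct x × ∀ r → 1 ≤ r → r ≤ d ∸ ℓ → ¬ 0 < cnt″ (cell x (ℓ + r)))
        nw x x< e with m<1+n⇒m<n∨m≡n x<
        nw x x< e | inj₂ refl with flag
        ... | inj₁ p = inj₁ p
        ... | inj₂ (a , b , none) = let a′ , b′ = same i i<N (inj₁ ≤-refl) in inj₂ (trans a a′ , trans b b′ , none)
        nw x x< e | inj₁ lt with new x lt e | others x (<⇒≢ lt)
        ... | inj₁ (a , b , r , 1≤r , r≤ , p) | g , h = inj₁ (trans g a , trans h b , r , 1≤r , r≤ , subst (0 <_) (sym (elsewhere x (ℓ + r) (range r≤) (<⇒≢ lt))) p)
        ... | inj₂ (a , b , none) | g , h = inj₂ (trans g a , trans h b , λ r 1≤r r≤ p → none r 1≤r r≤ (subst (0 <_) (elsewhere x (ℓ + r) (range r≤) (<⇒≢ lt)) p))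

      judge-spec : ℓ ≤ d → suc d < 2 ^ w →
        wp judge (λ τ → Judged ℓ (arr σ aGd) (arr σ aAct) (arr σ aCnt) (arr τ aGd) (arr τ aAct) (arr τ aCnt) ×
                        clk τ ≤ 1 + N * (4 + d * (9 + d * 2)) + clk σ) σ
      judge-spec ℓ≤d d<W = for-cost {vx} {vNN} {judgeBody} {σ = σ} (3 + d * (9 + d * 2)) (λ i τ → JudgedBelow i (arr τ aGd) (arr τ aAct) (arr τ aCnt))
        (record { same-cnt = λ _ _ _ _ _ → refl ; same = λ _ _ _ → refl , refl ; new-cnt = λ _ () ; new = λ _ () })
        (λ i τ i< J → ((_ , <-≤-trans i< N≤X) , _) ,
          (λ e → at-node i τ i< e J) ,
          λ ne → judge-skip ne J , s≤s (m≤n+m _ (2 + d * (9 + d * 2))))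
        λ τ J c → let open JudgedBelow J in
          record { same-cnt = λ x x< ne → same-cnt x x< (inj₂ ne) ; same = λ x x< ne → same x x< (inj₂ ne) ; new-cnt = new-cnt ; new = new } , s≤s c
        where
        at-node : ∀ i τ → i < N → arr σ aSz i ≡ ℓ → JudgedBelow i (arr τ aGd) (arr τ aAct) (arr τ aCnt) →
          wp judgeNode (λ τ′ → JudgedBelow (suc i) (arr τ′ aGd) (arr τ′ aAct) (arr τ′ aCnt) × clk τ′ ≤ 3 + d * (9 + d * 2) + suc (clk τ)) (tick (forSt vx vNN judgeBody σ i τ))
        at-node i τ i< e J = wp-mono judgeNode
          {λ τ′ → Cells i (d ∸ ℓ) (arr τ aGd) (arr τ aAct) (arr τ aCnt) (arr τ′ aGd) (arr τ′ aAct) (arr τ′ aCnt) × clk τ′ ≤ 4 + d * (9 + d * 2) + clk τ}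
          {λ τ′ → JudgedBelow (suc i) (arr τ′ aGd) (arr τ′ aAct) (arr τ′ aCnt) × clk τ′ ≤ 3 + d * (9 + d * 2) + suc (clk τ)}
          (λ τ′ (C , c) → judge-node ℓ≤d i< e J C , ≤-trans c (≤-reflexive (sym (+-suc (3 + d * (9 + d * 2)) (clk τ)))))
          {tick (forSt vx vNN judgeBody σ i τ)} (judgeNode-spec {i} {τ} ℓ≤d i< d<W)

      retire-spec : ℓ < X → suc d < 2 ^ w →
        wp retire (λ τ → Retired ℓ (arr σ aAct) (arr σ aCnt) (arr τ aAct) × clk τ ≤ 1 + length (level ℓ) * 6 + clk σ) σ
      retire-spec ℓ<X d<W = walk-rule {vq} {vj} {aLh ⟦ ` vL ⟧} {aLn} {retireBody} {σ = σ} (level ℓ) Inv (_ , ℓ<X) (chain ℓ) (level<X ℓ)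
          ((λ y y< → inj₂ (refl , λ q q∈ → inj₁ q∈)) , All.tabulate (λ q∈ → q∈) , ≤-reflexive (+-comm (clk σ) _)) body
          λ τ (R , _ , c) → (λ y y< → case R y y< of λ where
              (inj₁ p)       → inj₁ p
              (inj₂ (a , h)) → inj₂ (a , λ q q∈ → case h q q∈ of λ where (inj₂ n) → n)) ,
            s≤s (subst (_≤ length (level ℓ) * 6 + clk σ) (+-identityʳ (clk τ)) c)
        where
        Inv : List ℕ → State → Set
        -- A pair not yet refuted as a culprit must still lie ahead; when the list is exhausted, all
        -- have been refuted.
        Inv zs τ = (∀ y → y < N → (arr τ aAct y ≡ 0 × ∃ λ q → q ∈ level ℓ × Culprit (arr σ aCnt) y q) ⊎
                                  (arr τ aAct y ≡ arr σ aAct y × ∀ q → q ∈ level ℓ → q ∈ zs ⊎ ¬ Culprit (arr σ aCnt) y q)) ×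
          All (_∈ level ℓ) zs × clk τ + length zs * 6 ≤ length (level ℓ) * 6 + clk σ
        body : ∀ q zs τ → All (_< X) (q ∷ zs) → Inv (q ∷ zs) τ → wp retireBody (Inv zs) (walkSt vq vj (aLh ⟦ ` vL ⟧) aLn retireBody σ q τ)
        body q zs τ (q<X ∷ _) (R , q∈ ∷ qs∈ , c) =
          (_ , q<X) , (_ , q<X) , ((_ , <-≤-trans D<N N≤X) , (_ , own<X)) ,
          (λ lt → (_ , ((_ , (_ , _ , d<W) , <W (row*<W x D<N)) , (_ , own<X) , <W c<X) , c<X) ,
            (λ p → _ , _ , own<X , hit lt p , qs∈ , time) ,
            λ p → miss (λ (_ , _ , p′) → <⇒≱ p′ p) , qs∈ , ≤-trans (n≤1+n _) time) ,
          λ ge → miss (λ (_ , lt , _) → <⇒≱ lt ge) , qs∈ , ≤-trans (m≤n+m _ 2) time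
          where
          x = arr σ aD q
          y = arr σ aOwn q
          q<dl = All.lookup (level< ℓ) q∈
          D<N = D< q q<dl
          own<X = <-≤-trans (own< q q<dl) N≤X
          c<X = cell< x (arr σ aSz y) D<N (sz≤d y (own< q q<dl))
          time : 6 + clk τ + length zs * 6 ≤ length (level ℓ) * 6 + clk σ
          time = from-≤ 0 c (solve 4 (λ u l t s → con 6 :+ u :+ l :* con 6 :+ (t :* con 6 :+ s) :+ con 0 := t :* con 6 :+ s :+ (u :+ (con 1 :+ l) :* con 6)) refl (clk τ) (length zs) (length (level ℓ)) (clk σ))
          hit : arr σ aSz x < arr σ aSz y → 0 < arr σ aCnt (cell x (arr σ aSz y)) → ∀ z → z < N →
            ((arr τ aAct [ y ↦ 0 ]) z ≡ 0 × ∃ λ q → q ∈ level ℓ × Culprit (arr σ aCnt) z q) ⊎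
            ((arr τ aAct [ y ↦ 0 ]) z ≡ arr σ aAct z × ∀ q → q ∈ level ℓ → q ∈ zs ⊎ ¬ Culprit (arr σ aCnt) z q)
          hit lt p z z< with z ≟ y
          ... | yes refl = inj₁ (upd-same (arr τ aAct) y 0 , q , q∈ , refl , lt , p)
          ... | no z≢ with R z z<
          ... | inj₁ (a , b) = inj₁ (trans (upd-other (arr τ aAct) 0 z≢) a , b)
          ... | inj₂ (a , b) = inj₂ (trans (upd-other (arr τ aAct) 0 z≢) a , λ q′ q′∈ → case b q′ q′∈ of λ where
                  (inj₁ (here refl)) → inj₂ (λ (e , _) → z≢ (sym e))
                  (inj₁ (there i))   → inj₁ i
                  (inj₂ n)           → inj₂ n)
          miss : ¬ Culprit (arr σ aCnt) y q → ∀ z → z < N →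
            (arr τ aAct z ≡ 0 × ∃ λ q → q ∈ level ℓ × Culprit (arr σ aCnt) z q) ⊎
            (arr τ aAct z ≡ arr σ aAct z × ∀ q → q ∈ level ℓ → q ∈ zs ⊎ ¬ Culprit (arr σ aCnt) z q)
          miss ¬c z z< with R z z<
          ... | inj₁ p = inj₁ p
          ... | inj₂ (a , b) = inj₂ (a , λ q′ q′∈ → case b q′ q′∈ of λ where
                  (inj₁ (here refl)) → inj₂ (λ { (refl , cu) → ¬c (refl , cu) })
                  (inj₁ (there i))   → inj₁ i
                  (inj₂ n)           → inj₂ n)

    module Sweeping {m : ℕ} (σ : State) (I : Instance (var σ vd) m) {nd : ℕ → Subset m}
      (Ix : Index (_∈ sets I) (arr σ aSz) (arr σ aD) (arr σ aOwn) nd (var σ vNN) (var σ vdl))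
      (roomC : var σ vNN * suc (var σ vd) ≤ X) (roomD : var σ vdl ≤ X)
      (chain : ∀ ℓ → Chain (arr σ aLn) (arr σ aLh ℓ) (bucket (arr σ aSz ∘ arr σ aD) ℓ (var σ vdl))) where
      open GoodNodes (var σ vk) I Ix

      d = var σ vd
      N = var σ vNN
      dl = var σ vdl
      dm = var σ vdm

      loadOf : ℕ → ℕ
      loadOf ℓ = length (level ℓ)

      roundCost : ℕ
      roundCost = 5 + N * (4 + d * (9 + d * 2))

      tallied≤ : ∀ act → (∀ y → y < N → act y ≡ 1 ⊎ act y ≡ 0) → ∀ ℓ x t → tallied act (level ℓ) x t ≤ dl
      tallied≤ act act01 ℓ x t = ≤-trans (go (level ℓ) (level< ℓ)) (bucket-≤ (arr σ aSz ∘ arr σ aD) ℓ dl)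
        where
        go : ∀ qs → All (_< dl) qs → tallied act qs x t ≤ length qs
        go []       _ = z≤n
        go (q ∷ qs) (q< ∷ bd) with (arr σ aD q ≡ᵇ x) ∧ (arr σ aSz (arr σ aOwn q) ≡ᵇ t)
        ... | false = m≤n⇒m≤1+n (go qs bd)
        ... | true with act01 (arr σ aOwn q) (Index.own< Ix q q<)
        ... | inj₁ e = +-mono-≤ (≤-reflexive e) (go qs bd)
        ... | inj₂ e = ≤-trans (≤-reflexive (cong (_+ tallied act qs x t) e)) (m≤n⇒m≤1+n (go qs bd))

      -- The 10 consists of 4 ticks per pair in `tally` and 6 in `retire`, spent at the one level to
      -- which the pair belongs. The load of the levels still to come stands on the left as unspent
      -- budget.
      Round : ℕ → State → Set
      Round z τ = Swept (d ∸ z) (arr τ aGd) (arr τ aAct) (arr τ aCnt) ×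
        clk τ + 10 * sumTo (suc (dm ∸ z)) loadOf ≤ 10 * sumTo (suc dm) loadOf + z * roundCost + clk σ

      round : dm ≡ d ∸ 1 → suc d ≤ X → ∀ z τ → z < dm → Round z τ → wp sweepBody (Round (suc z)) (forSt vz vdm sweepBody σ z τ)
      round dm≡ d<X z τ z<dm (S , c) = (_ , _ , <⇒≤ z<dm) ,
        block-rule tally {Q = wp (block judge ⨾ block retire) (Round (suc z))} {σ = ψ₁} (Levels.tally-spec ψ₁ I Ix roomC roomD chain ℓ<X (≤W d<X) total) λ τ₁ (Ta , c₁) →
        block-rule judge {Q = wp (block retire) (Round (suc z))} {σ = merge tally ψ₁ τ₁} (Levels.judge-spec (merge tally ψ₁ τ₁) I Ix roomC roomD chain (<⇒≤ ℓ<d) (≤W d<X)) λ τ₂ (J , c₂) →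
        block-rule retire {Q = Round (suc z)} {σ = merge judge (merge tally ψ₁ τ₁) τ₂}
          (Levels.retire-spec (merge judge (merge tally ψ₁ τ₁) τ₂) I Ix roomC roomD chain ℓ<X (≤W d<X)) λ τ₃ (Re , c₃) →
        subst (λ L → Swept L (arr τ₂ aGd) (arr τ₃ aAct) (arr τ₂ aCnt)) L≡ (Step.swept 1≤ℓ ℓ<d S′ Ta J Re) ,
        time (clk τ₁) (clk τ₂) (clk τ₃) c₁ c₂ c₃
        where
        ℓ = dm ∸ z
        ψ₁ = setV vL ℓ (forSt vz vdm sweepBody σ z τ)
        2≤d : suc z < d
        2≤d = ≤-trans (s≤s (subst (z <_) dm≡ z<dm)) (≤-reflexive (m+[n∸m]≡n {1} 1≤d))
          where
          1≤d : 1 ≤ d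
          1≤d = ≤-trans (≤-trans (s≤s z≤n) (subst (z <_) dm≡ z<dm)) (m∸n≤m d 1)
        suc-ℓ : suc ℓ ≡ d ∸ z
        suc-ℓ = trans (cong (λ x → suc (x ∸ z)) dm≡) (trans (cong suc (∸-+-assoc d 1 z)) (sym (+-∸-assoc 1 (<⇒≤ 2≤d))))
        1≤ℓ : 1 ≤ ℓ
        1≤ℓ = m<n⇒0<n∸m z<dm
        ℓ<d : ℓ < d
        ℓ<d = ≤-trans (≤-reflexive suc-ℓ) (m∸n≤m d z)
        ℓ<X : ℓ < X
        ℓ<X = <-≤-trans ℓ<d (≤-trans (n≤1+n d) d<X)
        L≡ : ℓ ≡ d ∸ suc z
        L≡ = trans (cong (_∸ z) dm≡) (∸-+-assoc d 1 z)
        S′ : Swept (suc ℓ) (arr τ aGd) (arr τ aAct) (arr τ aCnt)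
        S′ = subst (λ L → Swept L (arr τ aGd) (arr τ aAct) (arr τ aCnt)) (sym suc-ℓ) S
        act01 : ∀ y → y < N → arr τ aAct y ≡ 1 ⊎ arr τ aAct y ≡ 0
        act01 y y< with Swept.active S′ y y<
        ... | inj₁ (e , _) = inj₁ e
        ... | inj₂ (e , _) = inj₂ e
        total : ∀ x t → x < N → t ≤ d → arr σ aSz x ≡ ℓ → arr τ aCnt (cell x t) + tallied (arr τ aAct) (level ℓ) x t ≤ X
        total x t x< t≤ x≡ = ≤-trans (+-mono-≤ (≤-reflexive (Swept.blank S′ x x< (≤-reflexive (cong suc x≡)) t t≤)) (tallied≤ (arr τ aAct) act01 ℓ x t)) roomD
        cn = N * (4 + d * (9 + d * 2))
        time : ∀ t₁ t₂ t₃ → t₁ ≤ 1 + loadOf ℓ * 4 + (2 + clk τ) → t₂ ≤ 1 + cn + t₁ → t₃ ≤ 1 + loadOf ℓ * 6 + t₂ →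
          t₃ + 10 * sumTo (suc (dm ∸ suc z)) loadOf ≤ 10 * sumTo (suc dm) loadOf + suc z * roundCost + clk σ
        time t₁ t₂ t₃ h₁ h₂ h₃ = subst (λ s → t₃ + 10 * sumTo s loadOf ≤ 10 * sumTo (suc dm) loadOf + suc z * roundCost + clk σ) (sym (trans (cong suc (sym ∸-suc)) (m+[n∸m]≡n 1≤ℓ)))
          (from-≤ 0 (+-mono-≤ c (+-mono-≤ h₁ (+-mono-≤ h₂ h₃)))
            (solve 10 (λ t₁ t₂ t₃ t s l cn tot z c → t₃ :+ con 10 :* s :+ (con 10 :* tot :+ z :* (con 5 :+ cn) :+ c :+ (con 1 :+ l :* con 4 :+ (con 2 :+ t) :+ (con 1 :+ cn :+ t₁ :+ (con 1 :+ l :* con 6 :+ t₂)))) :+ con 0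
              := con 10 :* tot :+ (con 1 :+ z) :* (con 5 :+ cn) :+ c :+ (t :+ con 10 :* (s :+ l) :+ (t₁ :+ (t₂ :+ t₃)))) refl t₁ t₂ t₃ (clk τ) (sumTo ℓ loadOf) (loadOf ℓ) cn (sumTo (suc dm) loadOf) z (clk σ)))
          where
          ∸-suc : dm ∸ z ∸ 1 ≡ dm ∸ suc z
          ∸-suc = trans (∸-+-assoc dm z 1) (cong (dm ∸_) (+-comm z 1))

      sweep-spec : dm ≡ d ∸ 1 → suc d ≤ X → Swept d (arr σ aGd) (arr σ aAct) (arr σ aCnt) →
        wp sweep (λ τ → Swept (d ∸ dm) (arr τ aGd) (arr τ aAct) (arr τ aCnt) × clk τ ≤ 1 + (10 * dl + d * roundCost + clk σ)) σ
      sweep-spec dm≡ d<X S = for-rule {vz} {vdm} {sweepBody} {σ = σ} Round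
        (S , ≤-reflexive (trans (+-comm (clk σ) _) (cong (_+ clk σ) (sym (+-identityʳ _))))) (round dm≡ d<X)
        λ τ (S′ , c) → S′ , s≤s (≤-trans (≤-trans (m≤m+n (clk τ) _) c) (+-monoˡ-≤ (clk σ) (+-mono-≤ (*-monoʳ-≤ 10 (buckets-total (arr σ aSz ∘ arr σ aD) (suc dm) dl))
          (*-monoˡ-≤ roundCost (≤-trans (≤-reflexive dm≡) (m∸n≤m d 1))))))

      minimal-spec : N ≤ X → (∀ q → q < dl → arr σ aD q < N × arr σ aOwn q < N) → (∀ x → arr σ aNm x ≡ 0) → (∀ x → x < N → arr σ aGd x ≡ 1 ⊎ arr σ aGd x ≡ 0) →
        wp minimal (λ τ → Minimized (arr σ aGd) (arr τ aNm) × clk τ ≤ 1 + dl * 6 + clk σ) σ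
      minimal-spec N≤X pair< zeros gd01 = for-cost {vi} {vdl} {minimalBody} {σ = σ} 5 Inv (λ x → inj₂ (zeros x , λ _ ())) body
        λ τ R c → (λ x x< → case R x of λ where
            (inj₁ p) → inj₁ p
            (inj₂ (a , none)) → inj₂ (a , λ y y< gy y⊑ lt → let q , q< , e₁ , e₂ = Index.pair-all Ix y x y< x< y⊑ in
              none q q< (e₂ , subst (λ u → 0 < arr σ aGd u) (sym e₁) (subst (0 <_) (sym gy) ≤-refl) , subst (λ u → arr σ aSz u < arr σ aSz x) (sym e₁) lt))) , s≤s c
        where
        Above : ℕ → ℕ → Set
        Above x q = arr σ aOwn q ≡ x × 0 < arr σ aGd (arr σ aD q) × arr σ aSz (arr σ aD q) < arr σ aSz x
        Inv : ℕ → State → Set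
        Inv i τ = ∀ x → (arr τ aNm x ≡ 1 × ∃ λ y → y < N × arr σ aGd y ≡ 1 × nd y ⊑ nd x × arr σ aSz y < arr σ aSz x) ⊎
          (arr τ aNm x ≡ 0 × ∀ q → q < i → ¬ Above x q)
        body : ∀ i τ → i < dl → Inv i τ → wp minimalBody (λ τ′ → Inv (suc i) τ′ × clk τ′ ≤ 5 + suc (clk τ)) (forSt vi vdl minimalBody σ i τ)
        body i τ i< R = (_ , i<X) , (_ , i<X) , (_ , (_ , D<X)) ,
          (λ g → ((_ , D<X) , (_ , own<X)) , (λ lt → _ , _ , own<X , hit g lt , ≤-refl) , λ ge → miss (λ (_ , _ , lt) → <⇒≱ lt ge) , n≤1+n _) ,
          λ ge → miss (λ (_ , g , _) → <⇒≱ g ge) , m≤n+m _ 2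
          where
          i<X = <-≤-trans i< roomD
          D<N = proj₁ (pair< i i<)
          D<X = <-≤-trans D<N N≤X
          own<X = <-≤-trans (proj₂ (pair< i i<)) N≤X
          y = arr σ aOwn i
          gd≡1 : 0 < arr σ aGd (arr σ aD i) → arr σ aGd (arr σ aD i) ≡ 1
          gd≡1 g with gd01 (arr σ aD i) D<N
          ... | inj₁ e = e
          ... | inj₂ e = ⊥-elim (<-irrefl (sym e) g)
          hit : 0 < arr σ aGd (arr σ aD i) → arr σ aSz (arr σ aD i) < arr σ aSz y → ∀ x →
            ((arr τ aNm [ y ↦ 1 ]) x ≡ 1 × ∃ λ y → y < N × arr σ aGd y ≡ 1 × nd y ⊑ nd x × arr σ aSz y < arr σ aSz x) ⊎ ((arr τ aNm [ y ↦ 1 ]) x ≡ 0 × ∀ q → q < suc i → ¬ Above x q)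
          hit g lt x with x ≟ y
          ... | yes refl = inj₁ (upd-same (arr τ aNm) y 1 , arr σ aD i , D<N , gd≡1 g , Index.pair⊑ Ix i i< , lt)
          ... | no x≢ with R x
          ... | inj₁ (a , p) = inj₁ (trans (upd-other (arr τ aNm) 1 x≢) a , p)
          ... | inj₂ (a , none) = inj₂ (trans (upd-other (arr τ aNm) 1 x≢) a , λ q q< ab → case m<1+n⇒m<n∨m≡n q< of λ where
                  (inj₁ lt′)  → none q lt′ ab
                  (inj₂ refl) → x≢ (sym (proj₁ ab)))
          miss : ¬ Above y i → Inv (suc i) τ
          miss ¬ab x with R x
          ... | inj₁ p = inj₁ p
          ... | inj₂ (a , none) = inj₂ (a , λ q q< ab → case m<1+n⇒m<n∨m≡n q< of λ where
                  (inj₁ lt)   → none q lt ab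
                  (inj₂ refl) → ¬ab (refl , subst (λ u → 0 < arr σ aGd (arr σ aD i) × arr σ aSz (arr σ aD i) < arr σ aSz u) (sym (proj₁ ab)) (proj₂ ab)))

-- Minimal sets, their elements, and the output block

module KernelOutput where

  open import Defs hiding (KernelSet; KernelElement)
  open Language
  open KernelProgram
  open Combinatorics
  open Tries using (Trie; Node)
  open NodeCreation using (module CreateSpec; arrs)
  open import Data.Empty using (⊥-elim)
  open import Data.Fin using (Fin; toℕ; fromℕ<)
  open import Data.Fin.Properties using (toℕ-fromℕ<; toℕ<n; toℕ-injective)
  open import Data.Fin.Subset using (Subset; ∣_∣)
  import Data.Fin.Subset as Sub
  open import Data.Fin.Subset.Properties using (∉⊥; ∣⊥∣≡0)
  open import Data.List using (List; []; _∷_; _++_; length; map; concatMap)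
  open import Data.List.Membership.Propositional using (_∈_)
  open import Data.List.Membership.Propositional.Properties using (∈-++⁺ˡ; ∈-++⁺ʳ; ∈-++⁻)
  open import Data.List.Properties using (length-++; length-map; map-++; concatMap-++; ++-identityʳ)
  open import Data.List.Relation.Binary.Pointwise using ([]; _∷_)
  import Data.List.Relation.Binary.Pointwise as Pw
  open import Data.List.Relation.Unary.All as All using (All; []; _∷_)
  open import Data.List.Relation.Unary.AllPairs using ([]; _∷_)
  open import Data.List.Relation.Unary.Any using (here; there)
  open import Data.List.Relation.Unary.Unique.Propositional using (Unique)
  open import Data.Nat
  open import Data.Nat.Properties
  open import Data.Nat.Solver using (module +-*-Solver)
  open import Data.Product using (∃; _×_; _,_; proj₁; proj₂)
  open import Data.Sum using (_⊎_; inj₁; inj₂)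
  open import Data.Unit using (⊤; tt)
  open import Function using (_∘_; case_of_; _⇔_; mk⇔; Equivalence)
  open import Relation.Binary.PropositionalEquality
  open import Relation.Nullary using (¬_; yes; no; contradiction)
  open +-*-Solver using (solve; _:+_; _:=_; con)

  Holds : (ℕ → ℕ) → ℕ → List ℕ → Set
  Holds A p xs = ∀ i → i < length xs → A (p + i) ≡ contents xs i

  contents-++ˡ : ∀ xs {ys i} → i < length xs → contents (xs ++ ys) i ≡ contents xs i
  contents-++ˡ (x ∷ xs) {i = zero}  _       = refl
  contents-++ˡ (x ∷ xs) {i = suc i} (s≤s h) = contents-++ˡ xs h

  contents-++ʳ : ∀ xs {ys} i → contents (xs ++ ys) (length xs + i) ≡ contents ys i
  contents-++ʳ []       i = refl
  contents-++ʳ (x ∷ xs) i = contents-++ʳ xs i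

  Holds-++ : ∀ {A p} xs {ys} → Holds A p xs → Holds A (p + length xs) ys → Holds A p (xs ++ ys)
  Holds-++ {A} {p} xs {ys} h₁ h₂ i i< with i <? length xs
  ... | yes lt = trans (h₁ i lt) (sym (contents-++ˡ xs lt))
  ... | no ge  = trans (cong A (trans (cong (p +_) (sym eq)) (sym (+-assoc p (length xs) j)))) (trans (h₂ j j<) (trans (sym (contents-++ʳ xs j)) (cong (contents (xs ++ ys)) eq)))
    where
    j = i ∸ length xs
    eq : length xs + j ≡ i
    eq = m+[n∸m]≡n (≮⇒≥ ge)
    j< : j < length ys
    j< = +-cancelˡ-< (length xs) _ _ (subst₂ _<_ (sym eq) (length-++ xs) i<)

  Holds-frame : ∀ {A a v p} xs → (∀ i → i < length xs → p + i ≢ a) → Holds A p xs → Holds (A [ a ↦ v ]) p xs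
  Holds-frame {A} {a} {v} xs ne h i i< = trans (upd-other A v (ne i i<)) (h i i<)

  Holds-one : ∀ (A : ℕ → ℕ) p v → Holds (A [ p ↦ v ]) p (v ∷ [])
  Holds-one A p v zero    _        = trans (cong (A [ p ↦ v ]) (+-identityʳ p)) (upd-same A p v)
  Holds-one A p v (suc i) (s≤s ())

  Holds-snoc : ∀ {A p v} xs → Holds A p xs → Holds (A [ p + length xs ↦ v ]) p (xs ++ v ∷ [])
  Holds-snoc {A} {p} {v} xs h = Holds-++ {A [ p + length xs ↦ v ]} {p} xs (Holds-frame {A} {p + length xs} {v} {p} xs (λ i i< e → <⇒≢ i< (+-cancelˡ-≡ p _ _ e)) h) (Holds-one A (p + length xs) v)

  Holds-agree : ∀ {A B p} xs → (∀ q → q < p + length xs → B q ≡ A q) → Holds A p xs → Holds B p xs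
  Holds-agree {p = p} xs eq h i i< = trans (eq _ (+-monoʳ-< p i<)) (h i i<)

  length-snoc : ∀ {A : Set} (xs : List A) x → length (xs ++ x ∷ []) ≡ suc (length xs)
  length-snoc xs x = trans (length-++ xs) (+-comm (length xs) 1)

  encodeRow : ∀ {m} → List (Fin m) → List ℕ
  encodeRow row = length row ∷ map toℕ row

  snoc-unique : ∀ {A : Set} {xs : List A} {x} → Unique xs → ¬ x ∈ xs → Unique (xs ++ x ∷ [])
  snoc-unique {xs = []}     u x∉ = [] ∷ []
  snoc-unique {xs = y ∷ xs} (y∉ ∷ u) x∉ =
    All.tabulate (λ z∈ → case ∈-++⁻ xs z∈ of λ where
      (inj₁ z∈xs)        → All.lookup y∉ z∈xs
      (inj₂ (here refl)) → λ y≡x → x∉ (here (sym y≡x))) ∷ snoc-unique u (x∉ ∘ there)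

  module OutputSpec (w X : ℕ) (X< : X < 2 ^ w) {m : ℕ} (m≤X : m ≤ X) (σ : State) (nd : ℕ → Subset m) (trie : Trie (arrs σ) nd (var σ vNN) (var σ vdl))
    (N≤X : var σ vNN ≤ X) where
    open Logic w X
    open CreateSpec w X X< using (<W; ≤W)

    N = var σ vNN

    Path : ℕ → List (Fin m) → Set
    Path y []       = ⊤
    Path y (e ∷ es) = y < N × arr σ aLab y ≡ toℕ e × Path (arr σ aPar y) es

    -- A parent has one element less, so following the parents reaches the empty set after |nd x|
    -- steps, and the labels met on the way are the elements. The recursion is on this size because
    -- parents are mere array entries.
    listing : ∀ s x → x < N → ∣ nd x ∣ ≡ s → ∃ λ es → length es ≡ s × Enumerates es (Sub._∈ nd x) × Path x es
    listing s x x< eq with Node.ancestor (Trie.node trie x x<)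
    ... | inj₁ x≡⊥ = [] , trans (sym (trans (cong ∣_∣ x≡⊥) (∣⊥∣≡0 m))) eq , ([] , λ e → mk⇔ (λ ()) (λ e∈ → contradiction (subst (e Sub.∈_) x≡⊥ e∈) ∉⊥)) , tt
    listing zero x x< eq | inj₂ (e , _ , _ , e∉ , x≡) = ⊥-elim (1+n≢0 (trans (sym (trans (cong ∣_∣ x≡) (ins-size e e∉))) eq))
    listing (suc s) x x< eq | inj₂ (e , l≡ , p< , e∉ , x≡)
      with listing s (arr σ aPar x) p< (suc-injective (trans (sym (trans (cong ∣_∣ x≡) (ins-size e e∉))) eq))
    ... | es , len , (u , iff) , path = e ∷ es , cong suc len ,
      (All.tabulate (λ {z} z∈ e≡z → e∉ (subst (Sub._∈ nd (arr σ aPar x)) (sym e≡z) (Equivalence.to (iff z) z∈))) ∷ u ,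
       λ z → mk⇔ (λ where
         (here refl) → subst (z Sub.∈_) (sym x≡) (∈-ins-same e _)
         (there z∈)  → subst (z Sub.∈_) (sym x≡) (∈-ins e (Equivalence.to (iff z) z∈)))
         (λ z∈ → case ∈-ins⁻ e (subst (z Sub.∈_) x≡ z∈) of λ where
           (inj₁ refl) → here refl
           (inj₂ z∈p)  → there (Equivalence.from (iff z) z∈p))) ,
      x< , l≡ , path

    list-of : ∀ x → x < N → ∃ λ es → length es ≡ arr σ aSz x × Enumerates es (Sub._∈ nd x) × Path x es
    list-of x x< = listing (arr σ aSz x) x x< (sym (Node.size (Trie.node trie x x<)))

    Kept : ℕ → Set
    Kept x = arr σ aNm x < arr σ aGd x

    next-label : ∀ {es : List (Fin m)} {pre post j} → es ≡ pre ++ post → length pre ≡ j → j < length es → ∃ λ e → ∃ λ post′ → post ≡ e ∷ post′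
    next-label {pre = pre} {[]} refl refl j< = ⊥-elim (<-irrefl (sym (cong length (++-identityʳ pre))) j<)
    next-label {post = e ∷ post} _ _ _ = e , post , refl

    advance : ∀ {es : List (Fin m)} pre e post → es ≡ pre ++ e ∷ post → es ≡ (pre ++ e ∷ []) ++ post
    advance pre e post eq = trans eq (sym (Data.List.Properties.++-assoc pre (e ∷ []) post))

    Marks : List (Fin m) → (mk mk′ : ℕ → ℕ) → Set
    Marks pre mk mk′ = ∀ e → (e ∈ pre × mk′ (toℕ e) ≡ 1) ⊎ (¬ e ∈ pre × mk′ (toℕ e) ≡ mk (toℕ e))

    Marks-snoc : ∀ {pre mk mk′} e → Marks pre mk mk′ → Marks (pre ++ e ∷ []) mk (mk′ [ toℕ e ↦ 1 ])
    Marks-snoc {pre} {mk} {mk′} e M z with toℕ z ≟ toℕ e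
    ... | yes eq with toℕ-injective eq
    ... | refl = inj₁ (∈-++⁺ʳ pre (here refl) , upd-same mk′ (toℕ e) 1)
    Marks-snoc {pre} {mk} {mk′} e M z | no ne with M z
    ... | inj₁ (a , b) = inj₁ (∈-++⁺ˡ a , trans (upd-other mk′ 1 ne) b)
    ... | inj₂ (a , b) = inj₂ ((λ z∈ → case ∈-++⁻ pre z∈ of λ where
            (inj₁ z∈pre)      → a z∈pre
            (inj₂ (here refl)) → ne refl) , trans (upd-other mk′ 1 ne) b)

    module _ (d : ℕ) (sz≤d : ∀ x → x < N → arr σ aSz x ≤ d) where

      markNode-spec : ∀ {x τ} (x< : x < N) → let ψ = tick (forSt vx vNN markBody σ x τ) in
        wp markNode (λ τ′ → Marks (proj₁ (list-of x x<)) (arr τ aMk) (arr τ′ aMk) × clk τ′ ≤ 4 + d * 3 + suc (clk τ)) ψ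
      markNode-spec {x} {τ} x< = _ , (_ , <-≤-trans x< N≤X) ,
        for-cost {vi} {vs} {markStep} {σ = ψ₂} 2 Inv ([] , es , refl , refl , path , λ e → inj₂ ((λ ()) , refl)) body
          λ τ′ I c → finish τ′ I , ≤-trans (s≤s (≤-trans c (+-monoˡ-≤ (clk ψ₂) (*-monoˡ-≤ 3 (sz≤d x x<)))))
            (≤-reflexive (solve 2 (λ a t → con 1 :+ (a :+ (con 4 :+ t)) := con 4 :+ a :+ (con 1 :+ t)) refl (d * 3) (clk τ)))
        where
        ψ₂ = setV vs (arr σ aSz x) (setV vy x (tick (forSt vx vNN markBody σ x τ)))
        L = list-of x x<
        es = proj₁ L
        len = proj₁ (proj₂ L)
        path = proj₂ (proj₂ (proj₂ L))
        Inv : ℕ → State → Set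
        Inv j τ′ = ∃ λ pre → ∃ λ post → es ≡ pre ++ post × length pre ≡ j × Path (var τ′ vy) post × Marks pre (arr τ aMk) (arr τ′ aMk)
        body : ∀ j τ′ → j < arr σ aSz x → Inv j τ′ → wp markStep (λ τ″ → Inv (suc j) τ″ × clk τ″ ≤ 2 + suc (clk τ′)) (forSt vi vs markStep ψ₂ j τ′)
        body j τ′ j< (pre , post , eq , l , p , M) with next-label {es} {pre} {post} eq l (subst (j <_) (sym len) j<)
        ... | e , post′ , refl = let y< , le , p′ = p ; y<X = <-≤-trans y< N≤X in
          (_ , y<X) , _ , subst (_< X) (sym le) (<-≤-trans (toℕ<n e) m≤X) , (_ , y<X) ,
          (pre ++ e ∷ [] , post′ , advance pre e post′ eq , trans (length-snoc pre e) (cong suc l) , p′ ,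
            subst (λ a → Marks (pre ++ e ∷ []) (arr τ aMk) (arr τ′ aMk [ a ↦ 1 ])) (sym le) (Marks-snoc {pre} {arr τ aMk} {arr τ′ aMk} e M)) , ≤-refl
        finish : ∀ τ′ → Inv (arr σ aSz x) τ′ → Marks es (arr τ aMk) (arr τ′ aMk)
        finish τ′ (pre , [] , eq , l , _ , M) = subst (λ p → Marks p (arr τ aMk) (arr τ′ aMk)) (sym (trans eq (++-identityʳ pre))) M
        finish τ′ (pre , e ∷ post , eq , l , _) = ⊥-elim (m≢1+m+n (arr σ aSz x) (trans (trans (sym len) (cong length eq)) (trans (length-++ pre) (trans (cong (_+ suc (length post)) l) (+-suc (arr σ aSz x) (length post))))))

      Marked : ℕ → (ℕ → ℕ) → Set
      Marked i mk = ∀ (e : Fin m) → (mk (toℕ e) ≡ 1 × ∃ λ x → x < i × Kept x × e Sub.∈ nd x) ⊎ (mk (toℕ e) ≡ 0 × ∀ x → x < i → Kept x → ¬ e Sub.∈ nd x)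

      mark-spec : (∀ e → arr σ aMk e ≡ 0) → wp mark (λ τ → Marked N (arr τ aMk) × clk τ ≤ 1 + (N * (5 + d * 3) + clk σ)) σ
      mark-spec zeros = for-cost {vx} {vNN} {markBody} {σ = σ} (4 + d * 3) (λ i τ → Marked i (arr τ aMk)) (λ e → inj₂ (zeros (toℕ e) , λ _ ()))
        (λ i τ i< M → ((_ , <-≤-trans i< N≤X) , (_ , <-≤-trans i< N≤X)) , (λ kept → at-node i τ i< M kept) ,
          λ ge → skipped i τ M ge , s≤s (m≤n+m _ (3 + d * 3)))
        λ τ M c → M , s≤s c
        where
        skipped : ∀ i τ → Marked i (arr τ aMk) → arr σ aGd i ≤ arr σ aNm i → Marked (suc i) (arr τ aMk)
        skipped i τ M ge e with M e
        ... | inj₁ (a , x , x< , b) = inj₁ (a , x , m<n⇒m<1+n x< , b)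
        ... | inj₂ (a , none) = inj₂ (a , λ x x< k e∈ → case m<1+n⇒m<n∨m≡n x< of λ where
                (inj₁ lt)   → none x lt k e∈
                (inj₂ refl) → <⇒≱ k ge)
        at-node : ∀ i τ → i < N → Marked i (arr τ aMk) → Kept i →
          wp markNode (λ τ′ → Marked (suc i) (arr τ′ aMk) × clk τ′ ≤ 4 + d * 3 + suc (clk τ)) (tick (forSt vx vNN markBody σ i τ))
        at-node i τ i< M kept = wp-mono markNode
          {λ τ′ → Marks (proj₁ (list-of i i<)) (arr τ aMk) (arr τ′ aMk) × clk τ′ ≤ 4 + d * 3 + suc (clk τ)}
          {λ τ′ → Marked (suc i) (arr τ′ aMk) × clk τ′ ≤ 4 + d * 3 + suc (clk τ)}
          (λ τ′ (Ms , c) → join τ′ Ms , c) {tick (forSt vx vNN markBody σ i τ)} (markNode-spec {i} {τ} i<)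
          where
          iff = proj₂ (proj₁ (proj₂ (proj₂ (list-of i i<))))
          join : ∀ τ′ → Marks (proj₁ (list-of i i<)) (arr τ aMk) (arr τ′ aMk) → Marked (suc i) (arr τ′ aMk)
          join τ′ Ms e with Ms e
          ... | inj₁ (e∈ , a) = inj₁ (a , i , ≤-refl , kept , Equivalence.to (iff e) e∈)
          ... | inj₂ (e∉ , a) with M e
          ... | inj₁ (b , x , x< , c) = inj₁ (trans a b , x , m<n⇒m<1+n x< , c)
          ... | inj₂ (b , none) = inj₂ (trans a b , λ x x< k e∈ → case m<1+n⇒m<n∨m≡n x< of λ where
                  (inj₁ lt)   → none x lt k e∈
                  (inj₂ refl) → e∉ (Equivalence.from (iff e) e∈))

      Elements : ℕ → State → Set
      Elements i τ = ∃ λ (us : List (Fin m)) → Holds (arr τ aOut) 1 (map toℕ us) × var τ vp ≡ suc (length us) × Unique us × length us ≤ i ×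
        (∀ e → e ∈ us ⇔ (toℕ e < i × 0 < arr σ aMk (toℕ e)))

      ElementsPut : State → Set
      ElementsPut τ = (∃ λ (us : List (Fin m)) → Holds (arr τ aOut) 0 (length us ∷ map toℕ us) × var τ vp ≡ suc (length us) × Unique us × length us ≤ m ×
        (∀ e → e ∈ us ⇔ 0 < arr σ aMk (toℕ e))) × clk τ ≤ 3 + (m * 4 + clk σ)

      putElements-spec : var σ vm ≡ m → suc m < X →
        wp putElements ElementsPut σ
      putElements-spec m≡ m<X = _ ,
        for-cost {ve} {vm} {putElement} {σ = σ₁} 3 Elements ([] , (λ _ ()) , refl , [] , z≤n , λ e → mk⇔ (λ ()) λ ()) body
          λ τ I c → _ , (_ , _ , subst (1 ≤_) (sym (proj₁ (proj₂ (proj₂ I)))) (s≤s z≤n)) , ≤-trans (s≤s z≤n) m<X , finish τ (subst (λ i → Elements i τ) m≡ I) ,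
            ≤-trans (s≤s (s≤s (subst (λ i → clk τ ≤ i * 4 + suc (clk σ)) m≡ c))) (≤-reflexive (cong (λ u → suc (suc u)) (+-suc (m * 4) (clk σ))))
        where
        σ₁ = setV vp 1 σ
        body : ∀ i τ → i < var σ vm → Elements i τ → wp putElement (λ τ′ → Elements (suc i) τ′ × clk τ′ ≤ 3 + suc (clk τ)) (forSt ve vm putElement σ₁ i τ)
        body i τ i<′ (us , h , p≡ , u , l≤ , iff) = (_ , (_ , <-≤-trans i< m≤X)) , (λ mk → _ , _ , p<X , (_ , _ , ≤W p<X) , put mk , ≤-refl) ,
          λ z → (us , h , p≡ , u , m≤n⇒m≤1+n l≤ , λ e → mk⇔ (λ e∈ → let a , b = Equivalence.to (iff e) e∈ in m<n⇒m<1+n a , b)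
            (λ (a , b) → case m<1+n⇒m<n∨m≡n a of λ where
              (inj₁ lt) → Equivalence.from (iff e) (lt , b)
              (inj₂ eq) → ⊥-elim (<⇒≱ b (≤-trans (≤-reflexive (cong (arr σ aMk) eq)) z)))) , m≤n+m _ 2
          where
          i< = subst (i <_) m≡ i<′
          p<X : var τ vp < X
          p<X = subst (_< X) (sym p≡) (≤-<-trans (s≤s (≤-trans l≤ (<⇒≤ i<))) m<X)
          f = fromℕ< i<
          f≡ : toℕ f ≡ i
          f≡ = toℕ-fromℕ< i<
          put : 0 < arr σ aMk i → ∃ λ (us′ : List (Fin m)) → Holds (arr τ aOut [ var τ vp ↦ i ]) 1 (map toℕ us′) × suc (var τ vp) ≡ suc (length us′) × Unique us′ × length us′ ≤ suc i ×
            (∀ e → e ∈ us′ ⇔ (toℕ e < suc i × 0 < arr σ aMk (toℕ e)))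
          put mk = us ++ f ∷ [] ,
            subst₂ (λ a xs → Holds (arr τ aOut [ a ↦ i ]) 1 xs) (trans (cong suc (length-map toℕ us)) (sym p≡)) (sym (trans (map-++ toℕ us (f ∷ [])) (cong (λ v → map toℕ us ++ v ∷ []) f≡)))
              (Holds-snoc {arr τ aOut} {1} (map toℕ us) h) ,
            cong suc (trans p≡ (sym (length-snoc us f))) , snoc-unique u (λ f∈ → <-irrefl f≡ (proj₁ (Equivalence.to (iff f) f∈))) ,
            ≤-trans (≤-reflexive (length-snoc us f)) (s≤s l≤) ,
            λ e → mk⇔ (λ e∈ → case ∈-++⁻ us e∈ of λ where
                (inj₁ e∈us)        → let a , b = Equivalence.to (iff e) e∈us in m<n⇒m<1+n a , b
                (inj₂ (here refl)) → ≤-reflexive (cong suc f≡) , subst (λ j → 0 < arr σ aMk j) (sym f≡) mk)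
              λ (a , b) → case m<1+n⇒m<n∨m≡n a of λ where
                (inj₁ lt) → ∈-++⁺ˡ (Equivalence.from (iff e) (lt , b))
                (inj₂ eq) → ∈-++⁺ʳ us (here (toℕ-injective (trans eq (sym f≡))))
        finish : ∀ τ → Elements m τ → ∃ λ (us : List (Fin m)) → Holds (arr τ aOut [ 0 ↦ var τ vp ∸ 1 ]) 0 (length us ∷ map toℕ us) × var τ vp ≡ suc (length us) × Unique us × length us ≤ m ×
          (∀ e → e ∈ us ⇔ 0 < arr σ aMk (toℕ e))
        finish τ (us , h , p≡ , u , l≤ , iff) = us , cells , p≡ , u , l≤ , λ e → mk⇔ (λ e∈ → proj₂ (Equivalence.to (iff e) e∈)) (λ b → Equivalence.from (iff e) (toℕ<n e , b))
          where
          cells : Holds (arr τ aOut [ 0 ↦ var τ vp ∸ 1 ]) 0 (length us ∷ map toℕ us)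
          cells zero    _        = cong (_∸ 1) p≡
          cells (suc i) (s≤s i<) = h i i<

      RowPut : ℕ → List (Fin m) → State → State → Set
      RowPut p es τ τ′ = Holds (arr τ′ aOut) p (encodeRow es) × (∀ q → q < p → arr τ′ aOut q ≡ arr τ aOut q) × var τ′ vp ≡ suc p + length es × var τ′ vcnt ≡ suc (var τ vcnt)

      -- `σ₃` is the state on entry to the loop and differs from σ in clock and variables only;
      -- equality of the arrays makes `list-of`, built for σ, applicable.
      putNode-spec : ∀ (σ₃ : State) {x τ} (x< : x < N) → arr σ₃ ≡ arr σ → var τ vp + suc d ≤ X → var τ vcnt < X →
        wp putNode (λ τ′ → RowPut (var τ vp) (proj₁ (list-of x x<)) τ τ′ × clk τ′ ≤ 7 + d * 4 + suc (clk τ)) (tick (forSt vx vNN putSet σ₃ x τ))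
      putNode-spec σ₃@(⟪ c₃ , v₃ , _ ⟫) {x} {τ} x< refl room cnt< =
        (_ , <-≤-trans x< N≤X) , _ , _ , p<X , (_ , _ , ≤W p<X) , _ ,
        for-cost {vi} {vs} {putLabel} {σ = ψ₄} 3 Inv ([] , es , refl , refl , path , (λ _ ()) , sym (+-identityʳ (suc p)) , λ _ _ → refl) body
          λ τ′ I c → (_ , _ , ≤W cnt<) , finish τ′ I , ≤-trans (s≤s (s≤s (≤-trans c (+-monoˡ-≤ (clk ψ₄) (*-monoˡ-≤ 4 (sz≤d x x<))))))
            (≤-reflexive (solve 2 (λ a t → con 2 :+ (a :+ (con 6 :+ t)) := con 7 :+ a :+ (con 1 :+ t)) refl (d * 4) (clk τ)))
        where
        p = var τ vp
        s = arr σ aSz x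
        ψ₄ = setV vy x (setV vp (suc p) (setA aOut p s (setV vs s (tick (forSt vx vNN putSet σ₃ x τ)))))
        L = list-of x x<
        es = proj₁ L
        len = proj₁ (proj₂ L)
        path = proj₂ (proj₂ (proj₂ L))
        p<X : p < X
        p<X = <-≤-trans (m<m+n p (s≤s z≤n)) room
        out₁ = arr τ aOut [ p ↦ s ]
        Inv : ℕ → State → Set
        Inv j τ′ = ∃ λ pre → ∃ λ post → es ≡ pre ++ post × length pre ≡ j × Path (var τ′ vy) post × Holds (arr τ′ aOut) (suc p) (map toℕ pre) ×
          var τ′ vp ≡ suc p + j × (∀ q → q < suc p → arr τ′ aOut q ≡ out₁ q)
        body : ∀ j τ′ → j < s → Inv j τ′ → wp putLabel (λ τ″ → Inv (suc j) τ″ × clk τ″ ≤ 3 + suc (clk τ′)) (forSt vi vs putLabel ψ₄ j τ′)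
        body j τ′ j< (pre , post , eq , l , pa , h , v , fr) with next-label {es} {pre} {post} eq l (subst (j <_) (sym len) j<)
        ... | e , post′ , refl = let y< , le , pa′ = pa ; y<X = <-≤-trans y< N≤X in
          _ , (_ , y<X) , vp<X , (_ , _ , ≤W vp<X) , (_ , y<X) ,
          (pre ++ e ∷ [] , post′ , advance pre e post′ eq , trans (length-snoc pre e) (cong suc l) , pa′ ,
            subst₂ (λ a xs → Holds (arr τ′ aOut [ a ↦ arr σ aLab (var τ′ vy) ]) (suc p) xs) (trans (cong (suc p +_) (trans (length-map toℕ pre) l)) (sym v))
              (sym (trans (map-++ toℕ pre (e ∷ [])) (cong (λ u → map toℕ pre ++ u ∷ []) (sym le))))
              (Holds-snoc {arr τ′ aOut} {suc p} (map toℕ pre) h) ,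
            trans (cong suc v) (sym (+-suc (suc p) j)) ,
            λ q q< → trans (upd-other (arr τ′ aOut) _ (<⇒≢ (<-≤-trans q< (≤-trans (m≤m+n (suc p) j) (≤-reflexive (sym v)))))) (fr q q<)) , ≤-refl
          where
          vp<X : var τ′ vp < X
          vp<X = subst (_< X) (sym v) (<-≤-trans (+-monoʳ-< (suc p) j<) (≤-trans (+-monoʳ-≤ (suc p) (sz≤d x x<)) (≤-trans (≤-reflexive (sym (+-suc p d))) room)))
        finish : ∀ τ′ → Inv s τ′ → Holds (arr τ′ aOut) p (encodeRow es) × (∀ q → q < p → arr τ′ aOut q ≡ arr τ aOut q) × var τ′ vp ≡ suc p + length es × suc (var τ vcnt) ≡ suc (var τ vcnt)
        finish τ′ (pre , e ∷ post , eq , l , _) = ⊥-elim (m≢1+m+n s (trans (trans (sym len) (cong length eq)) (trans (length-++ pre) (trans (cong (_+ suc (length post)) l) (+-suc s (length post))))))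
        finish τ′ (pre , [] , eq , l , _ , h , v , fr) = cells , (λ q q< → trans (fr q (m<n⇒m<1+n q<)) (upd-< (arr τ aOut) s q<)) , trans v (cong (suc p +_) (sym len)) , refl
          where
          pre≡ : pre ≡ es
          pre≡ = sym (trans eq (++-identityʳ pre))
          cells : Holds (arr τ′ aOut) p (encodeRow es)
          cells zero    _ = trans (cong (arr τ′ aOut) (+-identityʳ p)) (trans (fr p ≤-refl) (trans (upd-same (arr τ aOut) p s) (sym len)))
          cells (suc i) (s≤s i<) = trans (cong (arr τ′ aOut) (+-suc p i)) (trans (h i (subst (λ z → i < length (map toℕ z)) (sym pre≡) i<)) (cong (λ z → contents (map toℕ z) i) pre≡))

      Catalogue : ℕ → List (Subset m) → List (List (Fin m)) → Set
      Catalogue i Ss rows = ListsSets rows Ss × Unique Ss × (∀ S → S ∈ Ss ⇔ ∃ λ x → x < i × Kept x × nd x ≡ S)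

      SetsPut : State → Set
      SetsPut τ = let p₀ = var σ vp in
        (∃ λ Ss → ∃ λ rows → Catalogue N Ss rows × Holds (arr τ aOut) p₀ (length rows ∷ concatMap encodeRow rows) ×
          (∀ q → q < p₀ → arr τ aOut q ≡ arr σ aOut q) × suc p₀ + length (concatMap encodeRow rows) ≤ X) × clk τ ≤ 5 + (N * (8 + d * 4) + clk σ)

      -- A row of the output takes at most d + 1 cells, its length and its elements.
      putSets-spec : suc (var σ vp) + N * suc d ≤ X →
        wp putSets SetsPut σ
      putSets-spec room = _ , (_ , _ , ≤W p₀<X) , _ ,
        for-cost {vx} {vNN} {putSet} {σ = σ₃} (7 + d * 4) Inv
          ([] , [] , ([] , [] , λ S → mk⇔ (λ ()) λ ()) , (λ _ ()) , sym (+-identityʳ (suc p₀)) , refl , z≤n , ≤-reflexive (sym (+-identityʳ (suc p₀))) , λ _ _ → refl)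
          body
          λ τ I c → _ , _ , p₀<X , finish τ I , ≤-trans (s≤s (s≤s c)) (≤-reflexive (solve 2 (λ a t → con 2 :+ (a :+ (con 3 :+ t)) := con 5 :+ (a :+ t)) refl (N * (8 + d * 4)) (clk σ)))
        where
        p₀ = var σ vp
        p₀<X : p₀ < X
        p₀<X = ≤-trans (m≤m+n (suc p₀) (N * suc d)) room
        σ₃ = setV vcnt 0 (setV vp (suc p₀) (setV vp0 p₀ σ))
        Inv : ℕ → State → Set
        Inv i τ = ∃ λ Ss → ∃ λ rows → Catalogue i Ss rows × Holds (arr τ aOut) (suc p₀) (concatMap encodeRow rows) ×
          var τ vp ≡ suc p₀ + length (concatMap encodeRow rows) × var τ vcnt ≡ length rows × length rows ≤ i × var τ vp ≤ suc p₀ + i * suc d ×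
          (∀ q → q < suc p₀ → arr τ aOut q ≡ arr σ aOut q)
        skipped : ∀ {i Ss rows} → ¬ Kept i → Catalogue i Ss rows → Catalogue (suc i) Ss rows
        skipped ¬k (ls , u , iff) = ls , u , λ S → mk⇔ (λ S∈ → let x , x< , r = Equivalence.to (iff S) S∈ in x , m<n⇒m<1+n x< , r)
          (λ (x , x< , k , e) → case m<1+n⇒m<n∨m≡n x< of λ where
            (inj₁ lt)   → Equivalence.from (iff S) (x , lt , k , e)
            (inj₂ refl) → contradiction k ¬k)
        kept-row : ∀ {i Ss rows} (i< : i < N) → Kept i → Catalogue i Ss rows → Catalogue (suc i) (Ss ++ nd i ∷ []) (rows ++ proj₁ (list-of i i<) ∷ [])
        kept-row {i} {Ss} i< k (ls , u , iff) = Pw.++⁺ ls (proj₁ (proj₂ (proj₂ (list-of i i<))) ∷ []) ,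
          snoc-unique u (λ S∈ → let x , x< , _ , e = Equivalence.to (iff (nd i)) S∈ in <⇒≢ x< (Trie.injective trie x i (<-trans x< i<) i< e)) ,
          λ S → mk⇔ (λ S∈ → case ∈-++⁻ Ss S∈ of λ where
              (inj₁ S∈Ss)        → let x , x< , r = Equivalence.to (iff S) S∈Ss in x , m<n⇒m<1+n x< , r
              (inj₂ (here refl)) → i , ≤-refl , k , refl)
            λ (x , x< , k , e) → case m<1+n⇒m<n∨m≡n x< of λ where
              (inj₁ lt)   → ∈-++⁺ˡ (Equivalence.from (iff S) (x , lt , k , e))
              (inj₂ refl) → ∈-++⁺ʳ Ss (here (sym e))
        next : ∀ {i τ τ′} (i< : i < N) → Kept i → Inv i τ → RowPut (var τ vp) (proj₁ (list-of i i<)) τ τ′ → Inv (suc i) τ′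
        next {i} {τ} {τ′} i< k (Ss , rows , cat , h , v , c , l , b , fr) (h′ , fr′ , v′ , c′) =
          Ss ++ nd i ∷ [] , rows ++ es ∷ [] , kept-row i< k cat ,
          subst (Holds (arr τ′ aOut) (suc p₀)) (sym enc) (Holds-++ {arr τ′ aOut} {suc p₀} (concatMap encodeRow rows)
            (Holds-agree {arr τ aOut} {arr τ′ aOut} {suc p₀} (concatMap encodeRow rows) (λ q q< → fr′ q (subst (q <_) (sym v) q<)) h)
            (subst (λ a → Holds (arr τ′ aOut) a (encodeRow es)) v h′)) ,
          trans v′ (trans (sym (+-suc (var τ vp) (length es))) (trans (cong (_+ suc (length es)) v) (trans (+-assoc (suc p₀) _ _)
            (cong (suc p₀ +_) (sym (trans (cong length enc) (trans (length-++ (concatMap encodeRow rows)) (cong (λ z → length (concatMap encodeRow rows) + suc z) (length-map toℕ es))))))))) ,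
          trans c′ (trans (cong suc c) (sym (length-snoc rows es))) , ≤-trans (≤-reflexive (length-snoc rows es)) (s≤s l) ,
          ≤-trans (≤-reflexive (trans v′ (sym (+-suc (var τ vp) (length es))))) (≤-trans (+-mono-≤ b (s≤s (≤-trans (≤-reflexive (proj₁ (proj₂ (list-of i i<)))) (sz≤d i i<))))
            (≤-reflexive (trans (+-assoc (suc p₀) (i * suc d) (suc d)) (cong (suc p₀ +_) (+-comm (i * suc d) (suc d)))))) ,
          λ q q< → trans (fr′ q (<-≤-trans q< (≤-trans (m≤m+n (suc p₀) _) (≤-reflexive (sym v))))) (fr q q<)
          where
          es = proj₁ (list-of i i<)
          enc : concatMap encodeRow (rows ++ es ∷ []) ≡ concatMap encodeRow rows ++ encodeRow es
          enc = trans (concatMap-++ encodeRow rows (es ∷ [])) (cong (concatMap encodeRow rows ++_) (++-identityʳ (encodeRow es)))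
        at-node : ∀ i τ → i < N → Kept i → Inv i τ →
          wp putNode (λ τ′ → Inv (suc i) τ′ × clk τ′ ≤ 7 + d * 4 + suc (clk τ)) (tick (forSt vx vNN putSet σ₃ i τ))
        at-node i τ i< k I@(_ , _ , _ , _ , _ , c , l , b , _) = wp-mono putNode
          {λ τ′ → RowPut (var τ vp) (proj₁ (list-of i i<)) τ τ′ × clk τ′ ≤ 7 + d * 4 + suc (clk τ)}
          {λ τ′ → Inv (suc i) τ′ × clk τ′ ≤ 7 + d * 4 + suc (clk τ)}
          (λ τ′ (R , t) → next {i} {τ} {τ′} i< k I R , t) {tick (forSt vx vNN putSet σ₃ i τ)}
          (putNode-spec σ₃ {i} {τ} i< refl
            (≤-trans (+-monoˡ-≤ (suc d) b) (≤-trans (≤-reflexive (trans (+-assoc (suc p₀) (i * suc d) (suc d)) (cong (suc p₀ +_) (+-comm (i * suc d) (suc d)))))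
              (≤-trans (+-monoʳ-≤ (suc p₀) (*-monoˡ-≤ (suc d) i<)) room)))
            (subst (_< X) (sym c) (≤-<-trans l (<-≤-trans i< N≤X))))
        body : ∀ i τ → i < N → Inv i τ → wp putSet (λ τ′ → Inv (suc i) τ′ × clk τ′ ≤ 7 + d * 4 + suc (clk τ)) (forSt vx vNN putSet σ₃ i τ)
        body i τ i< I = ((_ , <-≤-trans i< N≤X) , (_ , <-≤-trans i< N≤X)) , (λ k → at-node i τ i< k I) , λ ge → no-node I ge , s≤s (m≤n+m _ (6 + d * 4))
          where
          no-node : Inv i τ → arr σ aGd i ≤ arr σ aNm i → Inv (suc i) τ
          no-node (Ss , rows , cat , h , v , c , l , b , fr) ge = Ss , rows , skipped (≤⇒≯ ge) cat , h , v , c , m≤n⇒m≤1+n l ,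
            ≤-trans b (+-monoʳ-≤ (suc p₀) (m≤n+m (i * suc d) (suc d))) , fr
        finish : ∀ τ → Inv N τ → ∃ λ Ss → ∃ λ rows → Catalogue N Ss rows × Holds (arr τ aOut [ p₀ ↦ var τ vcnt ]) p₀ (length rows ∷ concatMap encodeRow rows) ×
          (∀ q → q < p₀ → (arr τ aOut [ p₀ ↦ var τ vcnt ]) q ≡ arr σ aOut q) × suc p₀ + length (concatMap encodeRow rows) ≤ X
        finish τ (Ss , rows , cat , h , v , c , l , b , fr) = Ss , rows , cat , cells , (λ q q< → trans (upd-< (arr τ aOut) _ q<) (fr q (m<n⇒m<1+n q<))) ,
          ≤-trans (≤-reflexive (sym v)) (≤-trans b room)
          where
          cells : Holds (arr τ aOut [ p₀ ↦ var τ vcnt ]) p₀ (length rows ∷ concatMap encodeRow rows)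
          cells zero    _ = trans (cong (arr τ aOut [ p₀ ↦ var τ vcnt ]) (+-identityʳ p₀)) (trans (upd-same (arr τ aOut) p₀ _) c)
          cells (suc i) (s≤s i<) = trans (cong (arr τ aOut [ p₀ ↦ var τ vcnt ]) (+-suc p₀ i)) (trans (upd-other (arr τ aOut) _ (<⇒≢ (s≤s (m≤m+n p₀ i)) ∘ sym)) (h i i<))

-- Rows and elements in the flat input

module InputDecoding where

  open import Defs
  open Combinatorics
  open KernelOutput using (contents-++ˡ; contents-++ʳ)
  open import Data.Empty using (⊥; ⊥-elim)
  open import Data.Fin using (Fin; toℕ)
  open import Data.Fin.Properties using (toℕ<n; toℕ-injective)
  open import Data.Fin.Subset using (Subset; ∣_∣)
  import Data.Fin.Subset as Sub
  open import Data.Fin.Subset.Properties using (∣⊥∣≡0; ∉⊥)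
  open import Data.List using (List; []; _∷_; length; map; concatMap)
  open import Data.List.Membership.Propositional using (_∈_)
  open import Data.List.Membership.Propositional.Properties using (∈-map⁺)
  open import Data.List.Properties using (length-++; length-map)
  open import Data.List.Relation.Binary.Pointwise using ([]; _∷_; Pointwise-length)
  open import Data.List.Relation.Unary.All as All using (All; []; _∷_)
  open import Data.List.Relation.Unary.AllPairs as AllPairs using (AllPairs; []; _∷_)
  open import Data.List.Relation.Unary.Any using (here; there)
  open import Data.List.Relation.Unary.Unique.Propositional using (Unique)
  open import Data.Nat
  open import Data.Nat.DivMod using (m≡m%n+[m/n]*n; m%n<n; m<n*o⇒m/o<n; +-distrib-/-∣ʳ; m*n/n≡m; m<n⇒m/n≡0)
  open import Data.Nat.Divisibility using (n∣m*n)
  open import Data.Nat.Properties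
  open import Data.Product using (∃; _×_; _,_; proj₁; proj₂)
  open import Function using (case_of_; mk⇔; Equivalence)
  open import Relation.Binary.PropositionalEquality
  open import Relation.Nullary using (contradiction)

  enumeration-size : ∀ {m} es {S : Subset m} → Enumerates es (Sub._∈ S) → length es ≡ ∣ S ∣
  enumeration-size {m} [] {S} (_ , iff) = sym (trans (cong ∣_∣ (⊑-antisym {q = Sub.⊥} (incl λ x x∈ → case Equivalence.from (iff x) x∈ of λ ()) (incl λ x x∈ → contradiction x∈ ∉⊥))) (∣⊥∣≡0 m))
  enumeration-size (e ∷ es) {S} (e∉ ∷ u , iff) =
    trans (cong suc (enumeration-size es {del e S} (u , λ z → mk⇔ (λ z∈ → ∈-del e (λ z≡e → All.lookup e∉ z∈ (sym z≡e)) (Equivalence.to (iff z) (there z∈)))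
      (λ z∈ → let z≢e , z∈S = ∈-del⁻ e z∈ in case Equivalence.from (iff z) z∈S of λ where
        (here z≡e) → contradiction z≡e z≢e
        (there z∈) → z∈))))
      (trans (sym (ins-size e (∉-del e S))) (cong ∣_∣ (ins-del e (Equivalence.to (iff e) (here refl)))))

  nth : {A : Set} → A → List A → ℕ → A
  nth a []       _       = a
  nth a (x ∷ xs) zero    = x
  nth a (x ∷ xs) (suc i) = nth a xs i

  nth-∈ : ∀ {A : Set} {a : A} xs {i} → i < length xs → nth a xs i ∈ xs
  nth-∈ (x ∷ xs) {zero}  _       = here refl
  nth-∈ (x ∷ xs) {suc i} (s≤s h) = there (nth-∈ xs h)

  ∈-nth : ∀ {A : Set} {a : A} xs {x} → x ∈ xs → ∃ λ i → i < length xs × nth a xs i ≡ x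
  ∈-nth (x ∷ xs) (here refl) = 0 , s≤s z≤n , refl
  ∈-nth (x ∷ xs) (there x∈)  = let i , i< , e = ∈-nth xs x∈ in suc i , s≤s i< , e

  contents-map : ∀ {m} (es : List (Fin m)) c → c < length es → ∃ λ e → e ∈ es × contents (map toℕ es) c ≡ toℕ e
  contents-map (e ∷ es) zero    _       = e , here refl , refl
  contents-map (e ∷ es) (suc c) (s≤s h) = let e′ , e∈ , eq = contents-map es c h in e′ , there e∈ , eq

  map-contents : ∀ {m} (es : List (Fin m)) {e} → e ∈ es → ∃ λ c → c < length es × contents (map toℕ es) c ≡ toℕ e
  map-contents (e ∷ es) (here refl) = 0 , s≤s z≤n , refl
  map-contents (e ∷ es) (there e∈)  = let c , c< , eq = map-contents es e∈ in suc c , s≤s c< , eq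

  contents-injective : ∀ {m} (es : List (Fin m)) → Unique es → ∀ c c′ → c < length es → c′ < length es →
    contents (map toℕ es) c ≡ contents (map toℕ es) c′ → c ≡ c′
  contents-injective (e ∷ es) u zero zero _ _ _ = refl
  contents-injective (e ∷ es) (e∉ ∷ u) zero (suc c′) _ (s≤s h) eq = let e′ , e∈ , eq′ = contents-map es c′ h in contradiction (toℕ-injective (trans eq eq′)) (All.lookup e∉ e∈)
  contents-injective (e ∷ es) (e∉ ∷ u) (suc c) zero (s≤s h) _ eq = let e′ , e∈ , eq′ = contents-map es c h in contradiction (toℕ-injective (trans (sym eq) eq′)) (All.lookup e∉ e∈)
  contents-injective (e ∷ es) (e∉ ∷ u) (suc c) (suc c′) (s≤s h) (s≤s h′) eq = cong suc (contents-injective es u c c′ h h′ eq)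

  contents-beyond : ∀ xs a → length xs ≤ a → contents xs a ≡ 0
  contents-beyond []       a       _       = refl
  contents-beyond (x ∷ xs) (suc a) (s≤s h) = contents-beyond xs a h

  contents-All : ∀ {b} xs → All (_< b) xs → 0 < b → ∀ a → contents xs a < b
  contents-All []       _         0<b a       = 0<b
  contents-All (x ∷ xs) (h ∷ _)   0<b zero    = h
  contents-All (x ∷ xs) (_ ∷ hs)  0<b (suc a) = contents-All xs hs 0<b a

  flat : ∀ {m} → List (List (Fin m)) → List ℕ
  flat = concatMap (map toℕ)

  flat-length : ∀ {m d} (rows : List (List (Fin m))) → All (λ r → length r ≡ d) rows → length (flat rows) ≡ length rows * d
  flat-length []         _         = refl
  flat-length (r ∷ rows) (eq ∷ as) = trans (length-++ (map toℕ r)) (cong₂ _+_ (trans (length-map toℕ r) eq) (flat-length rows as))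

  flat-< : ∀ {m} (rows : List (List (Fin m))) → All (_< m) (flat rows)
  flat-< []                = []
  flat-< ([] ∷ rows)       = flat-< rows
  flat-< ((e ∷ r) ∷ rows)  = toℕ<n e ∷ flat-< (r ∷ rows)

  flat-cell : ∀ {m d} (rows : List (List (Fin m))) → All (λ r → length r ≡ d) rows → ∀ f c → f < length rows → c < d →
    contents (flat rows) (c + f * d) ≡ contents (map toℕ (nth [] rows f)) c
  flat-cell {d = d} (r ∷ rows) (eq ∷ as) zero c _ c< =
    trans (cong (contents (flat (r ∷ rows))) (+-identityʳ c)) (contents-++ˡ (map toℕ r) (subst (c <_) (sym (trans (length-map toℕ r) eq)) c<))
  flat-cell {d = d} (r ∷ rows) (eq ∷ as) (suc f) c (s≤s f<) c< =
    trans (cong (contents (flat (r ∷ rows))) (trans (sym (+-assoc c d (f * d))) (trans (cong (_+ f * d) (+-comm c d)) (trans (+-assoc d c (f * d)) (cong (_+ (c + f * d)) (sym (trans (length-map toℕ r) eq)))))))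
      (trans (contents-++ʳ (map toℕ r) (c + f * d)) (flat-cell rows as f c f< c<))

  module Decode {d m : ℕ} (I : Instance d m) {rows : List (List (Fin m))} (ls : ListsSets rows (sets I)) where

    Sf : ℕ → Subset m
    Sf = nth Sub.⊥ (sets I)

    n = length (sets I)

    rows-length : length rows ≡ n
    rows-length = Pointwise-length ls

    Sf-size : ∀ f → f < n → ∣ Sf f ∣ ≡ d
    Sf-size f f< = All.lookup (uniform I) (nth-∈ (sets I) f<)

    row-enumerates : ∀ f → f < n → Enumerates (nth [] rows f) (Sub._∈ Sf f)
    row-enumerates = go ls
      where
      go : ∀ {rs Ss} → ListsSets rs Ss → ∀ f → f < length Ss → Enumerates (nth [] rs f) (Sub._∈ nth Sub.⊥ Ss f)
      go (p ∷ ps) zero    _       = p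
      go (p ∷ ps) (suc f) (s≤s h) = go ps f h

    row-lengths : All (λ r → length r ≡ d) rows
    row-lengths = go ls (uniform I)
      where
      go : ∀ {rs Ss} → ListsSets rs Ss → All (λ S → ∣ S ∣ ≡ d) Ss → All (λ r → length r ≡ d) rs
      go []       _         = []
      go (p ∷ ps) (eq ∷ as) = trans (enumeration-size _ p) eq ∷ go ps as

    row-length : ∀ f → f < n → length (nth [] rows f) ≡ d
    row-length f f< = All.lookup row-lengths (nth-∈ rows (subst (f <_) (sym rows-length) f<))

    key : ℕ → ℕ
    key = contents (flat rows)

    cell-key : ∀ f c → f < n → c < d → key (c + f * d) ≡ contents (map toℕ (nth [] rows f)) c
    cell-key f c f< c< = flat-cell rows row-lengths f c (subst (f <_) (sym rows-length) f<) c<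

    -- The divisor is d if d ≥ 1. For d = 0 there are no input positions, and the form 1 + (d - 1)
    -- spares a case distinction in the program.
    row : ℕ → ℕ
    row j = j / suc (d ∸ 1)

    suc-pred-d : 1 ≤ d → suc (d ∸ 1) ≡ d
    suc-pred-d = m+[n∸m]≡n

    split : ∀ j → j < n * d → row j < n × ∃ λ c → c < d × j ≡ c + row j * d
    split j j< = m<n*o⇒m/o<n (subst (λ x → j < n * x) (sym D≡) j<) , j % suc (d ∸ 1) , subst (j % suc (d ∸ 1) <_) D≡ (m%n<n j (suc (d ∸ 1))) ,
      trans (m≡m%n+[m/n]*n j (suc (d ∸ 1))) (cong (λ x → j % suc (d ∸ 1) + row j * x) D≡)
      where
      d≥1 : ∀ d → j < n * d → 1 ≤ d
      d≥1 zero    h = ⊥-elim (<⇒≱ h (≤-trans (≤-reflexive (*-zeroʳ n)) z≤n))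
      d≥1 (suc _) _ = s≤s z≤n
      D≡ = suc-pred-d (d≥1 d j<)

    row-cell : ∀ f c → c < d → row (c + f * d) ≡ f
    row-cell f c c< = trans (cong (λ x → (c + f * x) / suc (d ∸ 1)) (sym D≡))
      (trans (+-distrib-/-∣ʳ c (n∣m*n f)) (trans (cong₂ _+_ (m<n⇒m/n≡0 (subst (c <_) (sym D≡) c<)) (m*n/n≡m f (suc (d ∸ 1)))) refl))
      where
      D≡ = suc-pred-d (≤-trans (s≤s z≤n) c<)

    cell-inside : ∀ f c → f < n → c < d → c + f * d < n * d
    cell-inside f c f< c< = <-≤-trans (+-monoˡ-< (f * d) c<) (*-monoˡ-≤ d f<)

    occurs : ∀ e f → f < n → e Sub.∈ Sf f → ∃ λ j → j < n * d × key j ≡ toℕ e × row j ≡ f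
    occurs e f f< e∈ with map-contents (nth [] rows f) (Equivalence.from (proj₂ (row-enumerates f f<) e) e∈)
    ... | c , c<′ , eq = let c< = subst (c <_) (row-length f f<) c<′ in c + f * d , cell-inside f c f< c< , trans (cell-key f c f< c<) eq , row-cell f c c<

    valid : ∀ e j → j < n * d → key j ≡ toℕ e → row j < n × e Sub.∈ Sf (row j)
    valid e j j< eq with split j j<
    ... | f< , c , c< , j≡ with contents-map (nth [] rows (row j)) c (subst (c <_) (sym (row-length (row j) f<)) c<)
    ... | e′ , e′∈ , eq′ = f< , subst (Sub._∈ Sf (row j)) (toℕ-injective (trans (sym eq′) (trans (sym (trans (cong key j≡) (cell-key (row j) c f< c<))) eq)))
          (Equivalence.to (proj₂ (row-enumerates (row j) f<) e′) e′∈)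

    -- Within one row an element determines its column, as rows list elements without repetition,
    -- and row and column determine the position.
    apart : ∀ i j → i < n * d → j < n * d → key i ≡ key j → row i ≡ row j → i ≡ j
    apart i j i< j< eq r with split i i< | split j j<
    ... | f< , c , c< , i≡ | f<′ , c′ , c<′ , j≡ = trans i≡ (trans (cong₂ (λ c f → c + f * d) c≡ r) (sym j≡))
      where
      c≡ : c ≡ c′
      c≡ = contents-injective (nth [] rows (row i)) (proj₁ (row-enumerates (row i) f<)) c c′ (subst (c <_) (sym (row-length (row i) f<)) c<) (subst (c′ <_) (sym (row-length (row i) f<)) c<′)
        (trans (sym (trans (cong key i≡) (cell-key (row i) c f< c<))) (trans eq (trans (cong key j≡) (trans (cell-key (row j) c′ f<′ c<′) (cong (λ f → contents (map toℕ (nth [] rows f)) c′) (sym r))))))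

    bucket-occurs : ∀ e f → f < n → e Sub.∈ Sf f → f ∈ map row (bucket key (toℕ e) (n * d))
    bucket-occurs e f f< e∈ = let j , j< , k≡ , r≡ = occurs e f f< e∈ in subst (_∈ map row (bucket key (toℕ e) (n * d))) r≡ (∈-map⁺ row (bucket-∈ key (toℕ e) (n * d) j j< k≡))

    bucket-valid : ∀ e → All (λ j → row j < n × e Sub.∈ Sf (row j)) (bucket key (toℕ e) (n * d))
    bucket-valid e = All.tabulate λ {j} j∈ → valid e j (All.lookup (bucket-< key (toℕ e) (n * d)) j∈) (All.lookup (bucket-key key (toℕ e) (n * d)) j∈)

    bucket-apart : ∀ (e : Fin m) → AllPairs (λ i j → row i ≢ row j) (bucket key (toℕ e) (n * d))
    bucket-apart e = go (bucket key (toℕ e) (n * d)) (bucket-< key (toℕ e) (n * d)) (bucket-key key (toℕ e) (n * d)) (bucket-unique key (toℕ e) (n * d))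
      where
      go : ∀ js → All (_< n * d) js → All (λ j → key j ≡ toℕ e) js → Unique js → AllPairs (λ i j → row i ≢ row j) js
      go []       _ _ _ = []
      go (j ∷ js) (j< ∷ bd) (k ∷ ks) (j∉ ∷ u) =
        All.tabulate (λ {i} i∈ r → All.lookup j∉ i∈ (apart j i j< (All.lookup bd i∈) (trans k (sym (All.lookup ks i∈))) r)) ∷ go js bd ks u

-- Space and time in terms of 3 ^ d * n + m

module SizeBounds where

  open Combinatorics
  open import Data.Nat
  open import Data.Nat.Properties
  open import Data.Nat.Solver using (module +-*-Solver)
  open import Relation.Binary.PropositionalEquality
  open +-*-Solver using (solve; _:+_; _:*_; _:=_; con)

  n<3^n : ∀ n → n < 3 ^ n
  n<3^n zero    = s≤s z≤n
  n<3^n (suc n) = ≤-trans (s≤s (n<3^n n)) (≤-trans (+-monoˡ-≤ (3 ^ n) (m^n>0 3 n)) (+-monoʳ-≤ (3 ^ n) (m≤m+n (3 ^ n) _)))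

  -- The left side bounds the ticks spent on one node by `judge` over all levels: d levels, up to d
  -- values of r, up to d divisions each.
  cubic : ∀ d → d * (4 + d * (9 + d * 2)) ≤ 3 * cube (suc d)
  cubic d = ≤-trans (m≤m+n _ (d * d * d + 5 * d + 3)) (≤-reflexive
    (solve 1 (λ d → d :* (con 4 :+ d :* (con 9 :+ d :* con 2)) :+ (d :* d :* d :+ con 5 :* d :+ con 3)
      := con 3 :* ((con 1 :+ d) :* ((con 1 :+ d) :* (con 1 :+ d)))) refl d))

  module Sizes (n d N dl m : ℕ) (n≥1 : 1 ≤ n) (N≤ : N ≤ n * 2 ^ d) (dl≤ : dl ≤ n * 3 ^ d) where

    Y B : ℕ
    Y = n * 3 ^ d
    B = Y + m + 1

    d<Y : d < Y
    d<Y = <-≤-trans (n<3^n d) (≤-trans (≤-reflexive (sym (*-identityˡ (3 ^ d)))) (*-monoˡ-≤ (3 ^ d) n≥1))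

    n≤Y : n ≤ Y
    n≤Y = ≤-trans (≤-reflexive (sym (*-identityʳ n))) (*-monoʳ-≤ n (m^n>0 3 d))

    nd≤Y : n * d ≤ Y
    nd≤Y = *-monoʳ-≤ n (<⇒≤ (n<3^n d))

    cells≤ : N * suc d ≤ 2 * Y
    cells≤ = begin
      N * suc d           ≤⟨ *-monoˡ-≤ (suc d) N≤ ⟩
      n * 2 ^ d * suc d   ≡⟨ trans (*-assoc n (2 ^ d) (suc d)) (cong (n *_) (*-comm (2 ^ d) (suc d))) ⟩
      n * (suc d * 2 ^ d) ≤⟨ *-monoʳ-≤ n ([1+d]2^d≤2*3^d d) ⟩
      n * (2 * 3 ^ d)     ≡⟨ solve 2 (λ n t → n :* (con 2 :* t) := con 2 :* (n :* t)) refl n (3 ^ d) ⟩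
      2 * Y               ∎
      where open ≤-Reasoning

    cubes≤ : N * cube (suc d) ≤ 31 * Y
    cubes≤ = begin
      N * cube (suc d)           ≤⟨ *-monoˡ-≤ (cube (suc d)) N≤ ⟩
      n * 2 ^ d * cube (suc d)   ≡⟨ trans (*-assoc n (2 ^ d) (cube (suc d))) (cong (n *_) (*-comm (2 ^ d) (cube (suc d)))) ⟩
      n * (cube (suc d) * 2 ^ d) ≤⟨ *-monoʳ-≤ n ([1+d]³2^d≤31*3^d d) ⟩
      n * (31 * 3 ^ d)           ≡⟨ solve 2 (λ n t → n :* (con 31 :* t) := con 31 :* (n :* t)) refl n (3 ^ d) ⟩
      31 * Y                     ∎
      where open ≤-Reasoning

    -- The constant is 98 = 5 + 3 * 31, with 3 from `cubic` and 31 from the comparison of (d + 1)³ 2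
    -- ^ d with 3 ^ d.
    rounds≤ : d * (5 + N * (4 + d * (9 + d * 2))) ≤ 98 * Y
    rounds≤ = begin
      d * (5 + N * (4 + d * (9 + d * 2)))       ≡⟨ solve 3 (λ d N x → d :* (con 5 :+ N :* x) := con 5 :* d :+ N :* (d :* x)) refl d N (4 + d * (9 + d * 2)) ⟩
      5 * d + N * (d * (4 + d * (9 + d * 2)))   ≤⟨ +-mono-≤ (*-monoʳ-≤ 5 (<⇒≤ d<Y)) (*-monoʳ-≤ N (cubic d)) ⟩
      5 * Y + N * (3 * cube (suc d))            ≡⟨ solve 3 (λ Y N x → con 5 :* Y :+ N :* (con 3 :* x) := con 5 :* Y :+ con 3 :* (N :* x)) refl Y N (cube (suc d)) ⟩
      5 * Y + 3 * (N * cube (suc d))            ≤⟨ +-monoʳ-≤ (5 * Y) (*-monoʳ-≤ 3 cubes≤) ⟩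
      5 * Y + 3 * (31 * Y)                      ≡⟨ solve 1 (λ Y → con 5 :* Y :+ con 3 :* (con 31 :* Y) := con 98 :* Y) refl Y ⟩
      98 * Y                                    ∎
      where open ≤-Reasoning

    per-node : ∀ a b → b ≤ a → N * (a + d * b) ≤ 2 * a * Y
    per-node a b b≤a = begin
      N * (a + d * b)   ≤⟨ *-monoʳ-≤ N (+-monoʳ-≤ a (*-monoʳ-≤ d b≤a)) ⟩
      N * (a + d * a)   ≡⟨ solve 3 (λ N a d → N :* (a :+ d :* a) := a :* (N :* (con 1 :+ d))) refl N a d ⟩
      a * (N * suc d)   ≤⟨ *-monoʳ-≤ a cells≤ ⟩
      a * (2 * Y)       ≡⟨ solve 2 (λ a Y → a :* (con 2 :* Y) := con 2 :* a :* Y) refl a Y ⟩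
      2 * a * Y         ∎
      where open ≤-Reasoning

    record Within (t k t′ : ℕ) : Set where
      constructor within
      field bound : t ≤ k * B + t′
    open Within

    phase : ∀ {t t′ x} k c a → c ≤ k → a ≤ k → x ≤ a * Y → t ≤ c + x + t′ → Within t k t′
    phase {t} {t′} {x} k c a c≤ a≤ x≤ t≤ = within (≤-trans t≤ (+-monoˡ-≤ t′ (≤-trans (+-mono-≤ c≤ (≤-trans x≤ (*-monoˡ-≤ Y a≤)))
      (≤-trans (m≤m+n (k + k * Y) (k * m)) (≤-reflexive (solve 3 (λ k Y m → k :+ k :* Y :+ k :* m := k :* (Y :+ m :+ con 1)) refl k Y m))))))

    infixr 4 _▹_
    _▹_ : ∀ {t t′ t″ k l} → Within t k t′ → Within t′ l t″ → Within t (k + l) t″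
    _▹_ {t″ = t″} {k} {l} (within p) (within q) = within (≤-trans p (≤-trans (+-monoʳ-≤ (k * B) q)
      (≤-reflexive (trans (sym (+-assoc (k * B) (l * B) t″)) (cong (_+ t″) (sym (*-distribʳ-+ B k l)))))))

    -- 169 is the sum of the constants of the phases. The largest is 108 for the sweep: 10 for the
    -- pairs and 98 for the nodes.
    kernel-time : ∀ {t₀ t₁ t₂ t₃ t₄ t₅ t₆ t₇ t₈ t₉} →
      t₁ ≤ 1 + n * d * 3 + t₀ → t₂ + 14 * n ≤ 14 * Y + (2 * m + (4 + t₁)) → t₃ ≤ 1 + dl * 3 + t₂ → t₄ ≤ 1 + n * 4 + t₃ →
      t₅ ≤ 1 + (10 * dl + d * (5 + N * (4 + d * (9 + d * 2))) + t₄) → t₆ ≤ 1 + dl * 6 + t₅ → t₇ ≤ 1 + (N * (5 + d * 3) + t₆) →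
      t₈ ≤ 3 + (m * 4 + t₇) → t₉ ≤ 5 + (N * (8 + d * 4) + t₈) → suc t₉ ≤ 169 * B + t₀
    kernel-time {t₀} {t₁} {t₂} {t₃} {t₄} {t₅} {t₆} {t₇} {t₈} {t₉} h₁ h₂ h₃ h₄ h₅ h₆ h₇ h₈ h₉ =
      bound {suc t₉} {169} {t₀} (phase {t′ = t₉} {0} 1 1 0 ≤-refl z≤n z≤n ≤-refl ▹
      phase {t′ = t₈} 16 5 16 (≤ᵇ⇒≤ _ _ _) ≤-refl (per-node 8 4 (≤ᵇ⇒≤ _ _ _)) h₉ ▹
      elements ▹
      phase {t′ = t₆} 10 1 10 (≤ᵇ⇒≤ _ _ _) ≤-refl (per-node 5 3 (≤ᵇ⇒≤ _ _ _)) h₇ ▹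
      phase {t′ = t₅} 6 1 6 (≤ᵇ⇒≤ _ _ _) ≤-refl (≤-trans (≤-reflexive (*-comm dl 6)) (*-monoʳ-≤ 6 dl≤)) h₆ ▹
      phase {t′ = t₄} 108 1 108 (≤ᵇ⇒≤ _ _ _) ≤-refl (≤-trans (+-mono-≤ (*-monoʳ-≤ 10 dl≤) rounds≤) (≤-reflexive (sym (*-distribʳ-+ Y 10 98)))) h₅ ▹
      phase {t′ = t₃} 4 1 4 (≤ᵇ⇒≤ _ _ _) ≤-refl (≤-trans (≤-reflexive (*-comm n 4)) (*-monoʳ-≤ 4 n≤Y)) h₄ ▹
      phase {t′ = t₂} 3 1 3 (≤ᵇ⇒≤ _ _ _) ≤-refl (≤-trans (≤-reflexive (*-comm dl 3)) (*-monoʳ-≤ 3 dl≤)) h₃ ▹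
      trie ▹
      phase {t′ = t₀} 3 1 3 (≤ᵇ⇒≤ _ _ _) ≤-refl (≤-trans (≤-reflexive (*-comm (n * d) 3)) (*-monoʳ-≤ 3 nd≤Y)) h₁)
      where
      elements : Within t₈ 4 t₇
      elements = within (from-≤ (4 * Y + 1) h₈ (solve 4 (λ t m Y s → t :+ (con 3 :+ (m :* con 4 :+ s)) :+ (con 4 :* Y :+ con 1) := con 4 :* (Y :+ m :+ con 1) :+ s :+ t) refl t₈ m Y t₇))
      trie : Within t₂ 14 t₁
      trie = within (from-≤ (12 * m + 10 + 14 * n) h₂ (solve 5 (λ t m Y s n → t :+ (con 14 :* Y :+ (con 2 :* m :+ (con 4 :+ s))) :+ (con 12 :* m :+ con 10 :+ con 14 :* n)
        := con 14 :* (Y :+ m :+ con 1) :+ s :+ (t :+ con 14 :* n)) refl t₂ m Y t₁ n))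

-- Assembling the phases

module KernelCorrectness where

  open import Defs
  open Language
  open KernelProgram
  open Combinatorics
  open Tries
  open NodeCreation using (module CreateSpec; arrs)
  open TrieConstruction
  open PairIndex
  open LevelSweep
  open KernelOutput
  open InputDecoding
  open SizeBounds
  open import Data.List.Relation.Unary.Unique.Propositional using (Unique)
  open import Data.Empty using (⊥; ⊥-elim)
  open import Data.Fin using (Fin; toℕ)
  open import Data.Fin.Subset using (Subset; ∣_∣)
  import Data.Fin.Subset as Sub
  open import Data.List using (List; _∷_; length; map; concatMap)
  open import Data.List.Membership.Propositional using (_∈_)
  open import Data.List.Properties using (length-++; length-map)
  open import Data.List.Relation.Unary.All as All using (All; _∷_)
  open import Data.Nat
  open import Data.Nat.Properties
  open import Data.Nat.Solver using (module +-*-Solver)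
  open import Data.Product using (∃; _×_; _,_)
  open import Data.Sum using (_⊎_; inj₁; inj₂)
  open import Function using (_⇔_; mk⇔; Equivalence)
  open import Relation.Binary.PropositionalEquality
  open import Relation.Nullary using (¬_; contradiction)
  open +-*-Solver using (solve; _:+_; _:*_; _:=_; con)

  module KernelPhases (w X : ℕ) (X< : X < 2 ^ w) (22X≤ : 22 * X ≤ 2 ^ w) {m : ℕ} where
    open Logic w X
    open CreateSpec w X X< using (<W; ≤W)
    open SweepSpec w X X<

    -- The output block starts at index base of array j.
    record Delivered {d : ℕ} (k : ℕ) (I : Instance d m) (τ : State) : Set where
      field
        us        : List (Fin m)
        Ss        : List (Subset m)
        rows      : List (List (Fin m))
        elements  : Enumerates us (KernelElement k I)
        kernel-sets : Enumerates Ss (KernelSet k I)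
        listed    : ListsSets rows Ss
        j base    : ℕ
        j<        : j < 22
        at        : var τ vOut ≡ j * X + base
        fits      : base + length (encodeOutput us rows) ≤ X
        cells     : Holds (arr τ j) base (encodeOutput us rows)

    L≤1 : ∀ d → d ∸ (d ∸ 1) ≤ 1
    L≤1 zero    = z≤n
    L≤1 (suc d) = ≤-reflexive (m+n∸n≡m 1 d)

    module AfterTrie (σ : State) (I : Instance (var σ vd) m) (nd : ℕ → Subset m) (trie : Trie (arrs σ) nd (var σ vNN) (var σ vdl))
      (n≡ : var σ vn ≡ length (sets I)) (n≥1 : 1 ≤ length (sets I)) (m≡ : var σ vm ≡ m) (dm≡ : var σ vdm ≡ var σ vd ∸ 1) (X≡ : var σ vX ≡ X)
      (zeros : ∀ i y → aLh ≤ i → arr σ i y ≡ 0)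
      (inRow : ∀ x → x < var σ vNN → ∃ λ F → F ∈ sets I × nd x ⊑ F)
      (cur< : ∀ f → f < length (sets I) → arr σ aCur f < var σ vNN)
      (cur≡ : ∀ f → f < length (sets I) → nd (arr σ aCur f) ≡ nth Sub.⊥ (sets I) f)
      (N≤ : var σ vNN ≤ length (sets I) * 2 ^ var σ vd) (dl≤ : var σ vdl ≤ length (sets I) * 3 ^ var σ vd)
      (room : 4 * (length (sets I) * 3 ^ var σ vd + m + 1) ≤ X) where

      n = length (sets I)
      d = var σ vd
      k = var σ vk
      N = var σ vNN
      dl = var σ vdl
      open Sizes n d N dl m n≥1 N≤ dl≤

      Y≤X : Y ≤ X
      Y≤X = ≤-trans (≤-trans (m≤m+n Y (3 * Y + 4 * m + 4)) (≤-reflexive (solve 2 (λ Y m → Y :+ (con 3 :* Y :+ con 4 :* m :+ con 4) := con 4 :* (Y :+ m :+ con 1)) refl Y m))) room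

      rows-nodes : ∀ F → F ∈ sets I → ∃ λ x → x < N × nd x ≡ F
      rows-nodes F F∈ = let f , f< , e = ∈-nth (sets I) F∈ in arr σ aCur f , cur< f f< , trans (cur≡ f f<) e

      Ix : Index (_∈ sets I) (arr σ aSz) (arr σ aD) (arr σ aOwn) nd N dl
      Ix = trie-index trie inRow rows-nodes

      open GoodNodes k I Ix

      roomC : N * suc d ≤ X
      roomC = ≤-trans cells≤ (≤-trans (≤-trans (m≤m+n (2 * Y) (2 * Y + 4 * m + 4)) (≤-reflexive (solve 2 (λ Y m → con 2 :* Y :+ (con 2 :* Y :+ con 4 :* m :+ con 4) := con 4 :* (Y :+ m :+ con 1)) refl Y m))) room)

      roomD : dl ≤ X
      roomD = ≤-trans dl≤ Y≤X

      N≤X : N ≤ X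
      N≤X = ≤-trans (m≤m*n N (suc d)) roomC

      d<X : suc d ≤ X
      d<X = ≤-trans d<Y Y≤X

      m<X : suc m < X
      m<X = ≤-trans (≤-trans (m≤m+n (2 + m) (4 * Y + 3 * m + 2)) (≤-reflexive (solve 2 (λ Y m → con 2 :+ m :+ (con 4 :* Y :+ con 3 :* m :+ con 2) := con 4 :* (Y :+ m :+ con 1)) refl Y m))) room

      -- Two count cells, at most m elements, and at most 2 * Y cells for the rows: the whole output
      -- fits into one array.
      putRoom : ∀ {l} → l ≤ m → 2 + l + N * suc d ≤ X
      putRoom {l} l≤ = ≤-trans (+-mono-≤ (+-monoʳ-≤ 2 l≤) cells≤) (≤-trans (≤-trans (m≤m+n (2 + m + 2 * Y) (2 * Y + 3 * m + 2)) (≤-reflexive (solve 2 (λ Y m → con 2 :+ m :+ con 2 :* Y :+ (con 2 :* Y :+ con 3 :* m :+ con 2) := con 4 :* (Y :+ m :+ con 1)) refl Y m))) room)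

      -- A node that is the row f as a set is the final node of row f by injectivity, so exactly the
      -- rows get flagged.
      seeded : ∀ {gd act} → Planted (arr σ aCur) gd act n → Seeded gd act
      seeded P x x< with P x
      ... | inj₁ (f , f< , refl , a , b) = inj₁ (subst (_∈ sets I) (sym (cur≡ f f<)) (nth-∈ (sets I) f<) , a , b)
      ... | inj₂ (none , a , b) = inj₂ ((λ x∈ → let f , f< , e = ∈-nth (sets I) x∈ in none f f< (Index.nd-inj Ix _ x (cur< f f<) x< (trans (cur≡ f f<) e))) , a , b)

      -- The estimate of the total time is a hypothesis about clock readings, so that composing the
      -- phases involves no arithmetic.
      afterTrie-spec : ∀ t →
        (∀ {t₃ t₄ t₅ t₆ t₇ t₈ t₉} → t₃ ≤ 1 + dl * 3 + clk σ → t₄ ≤ 1 + n * 4 + t₃ →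
          t₅ ≤ 1 + (10 * dl + d * (5 + N * (4 + d * (9 + d * 2))) + t₄) → t₆ ≤ 1 + dl * 6 + t₅ → t₇ ≤ 1 + (N * (5 + d * 3) + t₆) →
          t₈ ≤ 3 + (m * 4 + t₇) → t₉ ≤ 5 + (N * (8 + d * 4) + t₈) → suc t₉ ≤ t) →
        wp afterTrie (λ τ → Delivered k I τ × clk τ ≤ t) σ
      afterTrie-spec t time =
        block-rule levels {Q = wp A₁ R} {σ} (levels-spec {σ} (λ e → zeros aLh e ≤-refl) roomD
          (λ q q< → <-≤-trans (Index.D< Ix q q<) N≤X , <-≤-trans (s≤s (sz≤d _ (Index.D< Ix q q<))) d<X)) λ τ₃ (ch , c₃) →
        let σ₃ = merge levels σ τ₃ in
        block-rule seed {Q = wp A₂ R} {σ₃} (seed-spec {σ₃} (λ x → zeros aGd x (≤ᵇ⇒≤ _ _ _)) (λ x → zeros aAct x (≤ᵇ⇒≤ _ _ _))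
          (subst (_≤ X) (sym n≡) (≤-trans n≤Y Y≤X)) (λ f f< → <-≤-trans (cur< f (subst (f <_) n≡ f<)) N≤X)) λ τ₄ (pl , c₄) →
        let σ₄ = merge seed σ₃ τ₄ in
        block-rule sweep {Q = wp A₃ R} {σ₄} (Sweeping.sweep-spec σ₄ I Ix roomC roomD ch dm≡ d<X
          (swept-seed (seeded (subst (Planted (arr σ aCur) (arr τ₄ aGd) (arr τ₄ aAct)) n≡ pl)) (λ q → zeros aCnt q (≤ᵇ⇒≤ _ _ _)))) λ τ₅ (sw , c₅) →
        let σ₅ = merge sweep σ₄ τ₅ in
        block-rule minimal {Q = wp A₄ R} {σ₅} (Sweeping.minimal-spec σ₅ I Ix roomC roomD ch N≤X (λ q q< → Index.D< Ix q q< , Index.own< Ix q q<)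
          (λ x → zeros aNm x (≤ᵇ⇒≤ _ _ _)) (gd01 sw)) λ τ₆ (mn , c₆) →
        let σ₆ = merge minimal σ₅ τ₆ in
        block-rule mark {Q = wp A₅ R} {σ₆} (OutputSpec.mark-spec w X X< m≤X σ₆ nd trie N≤X d sz≤d (λ e → zeros aMk e (≤ᵇ⇒≤ _ _ _))) λ τ₇ (mk , c₇) →
        let σ₇ = merge mark σ₆ τ₇ in
        block-rule putElements {OutputSpec.ElementsPut w X X< m≤X σ₇ nd trie N≤X d sz≤d} {wp A₆ R} {σ₇} (OutputSpec.putElements-spec w X X< m≤X σ₇ nd trie N≤X d sz≤d m≡ m<X) λ τ₈ ((us , h , p≡ , u , l≤ , iff) , c₈) →
        let σ₈ = merge putElements σ₇ τ₈ in
        block-rule putSets {OutputSpec.SetsPut w X X< m≤X σ₈ nd trie N≤X d sz≤d} {wp A₇ R} {σ₈} (OutputSpec.putSets-spec w X X< m≤X σ₈ nd trie N≤X d sz≤d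
          (subst (λ p → suc p + N * suc d ≤ X) (sym p≡) (putRoom l≤))) λ τ₉ ((Ss , rows , (ls , uS , iffS) , h′ , fr , fit) , c₉) →
        (_ , _ , aOut*<) , delivered {mk = arr τ₇ aMk} {arr τ₈ aOut} sw mn mk us h p≡ u iff (setV vOut (aOut * var σ vX) (merge putSets σ₈ τ₉)) Ss rows ls uS iffS h′ fr fit refl , time c₃ (subst (λ x → clk τ₄ ≤ 1 + x * 4 + clk τ₃) n≡ c₄) c₅ c₆ c₇ c₈ c₉
        where
        A₇ = vOut ≔ # aOut ⊗ ` vX
        A₆ = block putSets ⨾ A₇
        A₅ = block putElements ⨾ A₆
        A₄ = block mark ⨾ A₅
        A₃ = block minimal ⨾ A₄
        A₂ = block sweep ⨾ A₃
        A₁ = block seed ⨾ A₂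
        R : State → Set
        R τ = Delivered k I τ × clk τ ≤ t
        m≤X : m ≤ X
        m≤X = <⇒≤ (<-trans ≤-refl m<X)
        gd01 : ∀ {L gd act cnt} → Swept L gd act cnt → ∀ x → x < N → gd x ≡ 1 ⊎ gd x ≡ 0
        gd01 sw x x< with Swept.good sw x x<
        ... | inj₁ (e , _) = inj₁ e
        ... | inj₂ (e , _) = inj₂ e
        X>0 : 0 < X
        X>0 = ≤-trans (s≤s z≤n) m<X
        aOut*< : aOut * var σ vX < 2 ^ w
        aOut*< = subst (λ x → aOut * x < 2 ^ w) (sym X≡) (<-≤-trans (*-monoˡ-< X {{>-nonZero X>0}} (≤ᵇ⇒≤ 21 22 _)) 22X≤)
        delivered : ∀ {gd act cnt nm mk out₈ : ℕ → ℕ} → Swept (d ∸ var σ vdm) gd act cnt → Minimized gd nm →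
          (∀ (e : Fin m) → (mk (toℕ e) ≡ 1 × ∃ λ x → x < N × nm x < gd x × e Sub.∈ nd x) ⊎ (mk (toℕ e) ≡ 0 × ∀ x → x < N → nm x < gd x → ¬ e Sub.∈ nd x)) →
          ∀ us → Holds out₈ 0 (length us ∷ map toℕ us) → ∀ {p} → p ≡ suc (length us) → Unique us → (∀ e → e ∈ us ⇔ 0 < mk (toℕ e)) →
          ∀ τ Ss rows → ListsSets rows Ss → Unique Ss → (∀ S → S ∈ Ss ⇔ ∃ λ x → x < N × nm x < gd x × nd x ≡ S) →
          Holds (arr τ aOut) p (length rows ∷ concatMap encodeRow rows) → (∀ q → q < p → arr τ aOut q ≡ out₈ q) → suc p + length (concatMap encodeRow rows) ≤ X →
          var τ vOut ≡ aOut * var σ vX → Delivered k I τ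
        delivered {gd} {act} {cnt} {nm} {mk} {out₈} sw mn marked us h {p} p≡ u iff τ Ss rows ls uS iffS h′ fr fit v≡ = record
          { us = us ; Ss = Ss ; rows = rows
          ; elements = u , λ e → mk⇔ (to-element e) (from-element e)
          ; kernel-sets = uS , λ S → mk⇔ (to-set S) (from-set S)
          ; listed = ls ; j = aOut ; base = 0 ; j< = ≤ᵇ⇒≤ 21 22 _
          ; at = trans v≡ (trans (cong (aOut *_) X≡) (sym (+-identityʳ (aOut * X))))
          ; fits = ≤-trans (≤-reflexive (trans (length-++ header) (trans (+-suc (length header) _) (cong (λ l → suc (l + length (concatMap encodeRow rows))) header-length)))) fit
          ; cells = Holds-++ {arr τ aOut} {0} header (Holds-agree {out₈} {arr τ aOut} {0} header (λ q q< → fr q (subst (q <_) header-length q<)) h)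
                      (subst (λ a → Holds (arr τ aOut) a (length rows ∷ concatMap encodeRow rows)) (sym header-length) h′) }
          where
          open Kernel {d ∸ var σ vdm} (subst (λ x → d ∸ x ≤ 1) (sym dm≡) (L≤1 d)) (m∸n≤m d (var σ vdm)) sw mn
          header = length us ∷ map toℕ us
          header-length : length header ≡ p
          header-length = trans (cong suc (length-map toℕ us)) (sym p≡)
          to-element : ∀ e → e ∈ us → KernelElement k I e
          to-element e e∈ with marked e
          ... | inj₁ (_ , x , x< , kp , e∈x) = nd x , Equivalence.to (kept x x<) kp , e∈x
          ... | inj₂ (z , _) = ⊥-elim (<⇒≱ (Equivalence.to (iff e) e∈) (≤-reflexive z))
          from-element : ∀ e → KernelElement k I e → e ∈ us
          from-element e (S , ks , e∈S) with kernel-node S ks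
          ... | x , x< , refl , kp with marked e
          ... | inj₁ (o , _) = Equivalence.from (iff e) (subst (0 <_) (sym o) ≤-refl)
          ... | inj₂ (_ , none) = contradiction e∈S (none x x< kp)
          to-set : ∀ S → S ∈ Ss → KernelSet k I S
          to-set S S∈ with Equivalence.to (iffS S) S∈
          ... | x , x< , kp , refl = Equivalence.to (kept x x<) kp
          from-set : ∀ S → KernelSet k I S → S ∈ Ss
          from-set S ks = let x , x< , e , kp = kernel-node S ks in Equivalence.from (iffS S) (x , x< , kp , e)

    module Start (σ : State) (I : Instance (var σ vd) m) {rows : List (List (Fin m))} (ls : ListsSets rows (sets I))
      (n≡ : var σ vn ≡ length (sets I)) (n≥1 : 1 ≤ length (sets I)) (m≡ : var σ vm ≡ m) (X≡ : var σ vX ≡ X)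
      (inp : (λ j → arr σ aIn (4 + j)) ≡ contents (flat rows)) (zeros : ∀ i y → aHd ≤ i → arr σ i y ≡ 0)
      (room : 4 * (length (sets I) * 3 ^ var σ vd + m + 1) ≤ X) (nd≡ : var σ vnd ≡ length (sets I) * var σ vd) (dm≡ : var σ vdm ≡ var σ vd ∸ 1) where
      open Decode I ls hiding (n)

      n = length (sets I)
      d = var σ vd
      Y = n * 3 ^ d
      B = Y + m + 1

      below-X : ∀ {x} → x ≤ 4 * B → x ≤ X
      below-X h = ≤-trans h room

      n*3^d≤X : n * 3 ^ d ≤ X
      n*3^d≤X = below-X (≤-trans (m≤m+n Y (3 * Y + 4 * m + 4)) (≤-reflexive (solve 2 (λ Y m → Y :+ (con 3 :* Y :+ con 4 :* m :+ con 4) := con 4 :* (Y :+ m :+ con 1)) refl Y m)))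

      n*2^d≤X : n * 2 ^ d ≤ X
      n*2^d≤X = ≤-trans (*-monoʳ-≤ n (^-monoˡ-≤ d (≤ᵇ⇒≤ 2 3 _))) n*3^d≤X

      m≤X : m ≤ X
      m≤X = below-X (≤-trans (m≤m+n m (4 * Y + 3 * m + 4)) (≤-reflexive (solve 2 (λ Y m → m :+ (con 4 :* Y :+ con 3 :* m :+ con 4) := con 4 :* (Y :+ m :+ con 1)) refl Y m)))

      n≤X : n ≤ X
      n≤X = ≤-trans (≤-trans (≤-reflexive (sym (*-identityʳ n))) (*-monoʳ-≤ n (m^n>0 3 d))) n*3^d≤X

      input≤X : 4 + n * d ≤ X
      input≤X = below-X (≤-trans (+-monoʳ-≤ 4 (*-monoʳ-≤ n (<⇒≤ (n<3^n d)))) (≤-trans (m≤m+n (4 + Y) (3 * Y + 4 * m)) (≤-reflexive (solve 2 (λ Y m → con 4 :+ Y :+ (con 3 :* Y :+ con 4 :* m) := con 4 :* (Y :+ m :+ con 1)) refl Y m))))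

      open BuildSpec w X X< n d (d ∸ 1) n≥1 Sf Sf-size n*2^d≤X n*3^d≤X m≤X n≤X using (Built; Rows; buildTrie-spec; potential)

      key<X : ∀ j → j < n * d → contents (flat rows) j < X
      key<X j j< = contents-All (flat rows) (All.map (λ h → <-≤-trans h m≤X) (flat-< rows)) (≤-trans n≥1 n≤X) j

      rowsFor : ∀ e → Rows (contents (flat rows)) (n * d) e
      rowsFor e = record { occurs = bucket-occurs e ; valid = bucket-valid e ; apart = bucket-apart e }

      -- Once all elements are inserted every row part is the whole row, of size d, so the potential
      -- is known exactly.
      full : ∀ {c τ} → (b : Built c m τ) → ∀ a → potential a τ ≡ n * a ^ d
      full {c} {τ} b a = trans (sumTo-cong n (λ f f< → cong (a ^_) (trans (Node.size (Trie.node trie _ (cur< f f<)))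
        (trans (cong ∣_∣ (trans (cur≡ f f<) (cut-all (Sf f)))) (Sf-size f f<))))) (sumTo-const n (a ^ d))
        where open Built b

      at-most : ∀ {x y} → x + n ≤ 1 + y → x ≤ y
      at-most {x} {y} h = from-≤ 0 (+-mono-≤ h n≥1) (solve 3 (λ x y n → x :+ (con 1 :+ y :+ n) :+ con 0 := y :+ (x :+ n :+ con 1)) refl x y n)

      start-spec : wp (block occurrences ⨾ block buildTrie ⨾ afterTrie) (λ τ → Delivered (var σ vk) I τ × clk τ ≤ 169 * B + clk σ) σ
      start-spec =
        block-rule occurrences {Q = wp (block buildTrie ⨾ afterTrie) R} {σ}
          (occurrences-spec {σ} (λ e → zeros aHd e ≤-refl) (subst (λ l → 4 + l ≤ X) (sym nd≡) input≤X)
            (λ j j< → subst (λ f → f j < X) (sym inp) (key<X j (subst (j <_) nd≡ j<)))) λ τ₁ (ch , c₁) →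
        let σ₁ = merge occurrences σ τ₁ in
        block-rule buildTrie {Built (4 + clk σ₁) m} {wp afterTrie R} {σ₁}
          (buildTrie-spec {contents (flat rows)} {n * d} (≤-trans (m≤n+m (n * d) 4) input≤X) rowsFor {σ₁} m≡ dm≡
            (λ e → subst₂ (λ f l → Chain (arr τ₁ aNx) (arr τ₁ aHd e) (bucket f e l)) inp nd≡ (ch e))
            (λ j y 3≤j j≤ → zero-at τ₁ j y 3≤j)) λ τ₂ b → after τ₁ c₁ τ₂ b
        where
        R : State → Set
        R τ = Delivered (var σ vk) I τ × clk τ ≤ 169 * B + clk σ
        zero-at : ∀ τ j y → 3 ≤ j → arr (merge occurrences σ τ) j y ≡ 0
        zero-at τ (suc (suc (suc j))) y (s≤s (s≤s (s≤s z≤n))) = zeros (3 + j) y (s≤s z≤n)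
        after : ∀ τ₁ → clk τ₁ ≤ 1 + var σ vnd * 3 + clk σ → ∀ τ₂ → Built (4 + clk τ₁) m τ₂ → wp afterTrie R (merge buildTrie (merge occurrences σ τ₁) τ₂)
        after τ₁ c₁ τ₂ b = AfterTrie.afterTrie-spec (merge buildTrie (merge occurrences σ τ₁) τ₂) I nd trie n≡ n≥1 m≡ dm≡ X≡ zero-after
          (λ x x< → let f , f< , le = inRow x x< in Sf f , nth-∈ (sets I) f< , le) cur< (λ f f< → trans (cur≡ f f<) (cut-all (Sf f))) N≤ dl≤ room
          (169 * B + clk σ) λ h₃ h₄ h₅ h₆ h₇ h₈ h₉ → Sizes.kernel-time n d (var τ₂ vNN) (var τ₂ vdl) m n≥1 N≤ dl≤ (subst (λ l → clk τ₁ ≤ 1 + l * 3 + clk σ) nd≡ c₁)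
            (subst (λ p → clk τ₂ + 14 * n ≤ 14 * p + (2 * m + (4 + clk τ₁))) (full b 3) cost) h₃ h₄ h₅ h₆ h₇ h₈ h₉
          where
          open Built b
          -- Matching 13 successors lets `writesA` evaluate to false on the index, whereupon the
          -- merged array reduces to the old one.
          zero-after : ∀ i y → aLh ≤ i → arr (merge buildTrie (merge occurrences σ τ₁) τ₂) i y ≡ 0
          zero-after (suc (suc (suc (suc (suc (suc (suc (suc (suc (suc (suc (suc (suc i))))))))))))) y (s≤s (s≤s (s≤s (s≤s (s≤s (s≤s (s≤s (s≤s (s≤s (s≤s (s≤s (s≤s (s≤s z≤n))))))))))))) = zeros (13 + i) y (s≤s z≤n)
          N≤ : var τ₂ vNN ≤ n * 2 ^ d
          N≤ = at-most (subst (λ p → var τ₂ vNN + n ≤ 1 + p) (full b 2) N-bound)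
          dl≤ : var τ₂ vdl ≤ n * 3 ^ d
          dl≤ = at-most (subst (λ p → var τ₂ vdl + n ≤ 1 + p) (full b 3) D-bound)

-- The complete program and its constant

module ProgramCorrectness where

  open import Defs
  open Language
  open Compiler
  open Simulation
  open KernelProgram
  open Combinatorics
  open PairIndex
  open KernelOutput
  open InputDecoding
  open SizeBounds
  open KernelCorrectness
  open import Data.Bool using (true; false; T)
  open import Data.Empty using (⊥-elim)
  open import Data.Fin using (Fin; toℕ; zero; suc)
  open import Data.Fin.Properties using (toℕ<n)
  open import Data.List using (List; []; _∷_; length; map; drop; head; lookup)
  open import Data.List.Membership.Propositional using (_∈_)
  open import Data.List.Properties using (++-identityʳ)
  open import Data.List.Relation.Binary.Pointwise using ([]; _∷_)
  open import Data.List.Relation.Unary.All as All using (All; []; _∷_)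
  open import Data.List.Relation.Unary.AllPairs using ([]; _∷_)
  open import Data.Maybe using (nothing)
  open import Data.Nat
  open import Data.Nat.DivMod using (m/n*n≤m; m/n≤m)
  open import Data.Nat.Properties
  open import Data.Nat.Solver using (module +-*-Solver)
  open import Data.Product using (∃; _×_; _,_; proj₁; proj₂)
  open import Data.Sum using (inj₂)
  open import Function using (mk⇔; Equivalence)
  open import Relation.Binary.PropositionalEquality
  open import Relation.Nullary using (¬_)
  open +-*-Solver using (solve; _:+_; _:*_; _:=_; con)

  contents-lookup : ∀ xs (i : Fin (length xs)) → contents xs (toℕ i) ≡ lookup xs i
  contents-lookup (x ∷ xs) zero    = refl
  contents-lookup (x ∷ xs) (suc i) = contents-lookup xs i

  no-kernel : ∀ {d m} k (I : Instance d m) → sets I ≡ [] → ∀ S → ¬ KernelSet k I S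
  no-kernel {d} k I none S ((r , g) , _) with GoodRows.upTo-inRow k I d g
  ... | F , F∈ , _ with subst (F ∈_) none F∈
  ... | ()

  startArr : List ℕ → ℕ → ℕ → ℕ
  startArr input zero    = contents input
  startArr input (suc _) = λ _ → 0

  module MainSpec (w X : ℕ) (X< : X < 2 ^ w) (22X≤ : 22 * X ≤ 2 ^ w) {d m : ℕ} (k : ℕ) (I : Instance d m)
    {rows : List (List (Fin m))} (ls : ListsSets rows (sets I)) (6≤X : 6 ≤ X) (room : 4 * (length (sets I) * 3 ^ d + m + 1) ≤ X) where
    open Logic w X
    open KernelPhases w X X< 22X≤ {m}
    open Decode I ls using (rows-length)

    input : List ℕ
    input = encodeInput d k m rows

    n = length (sets I)
    B = n * 3 ^ d + m + 1

    startVar : ℕ → ℕ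
    startVar = (λ _ → 0) [ vd ↦ d ] [ vk ↦ k ] [ vm ↦ m ] [ vn ↦ length rows ] [ vX ↦ X ]

    start : State
    start = ⟪ 0 , startVar , startArr input ⟫

    Goal : State → Set
    Goal τ = Delivered k I τ × clk τ ≤ 169 * B + 6

    sets-[] : length rows ≤ 0 → sets I ≡ []
    sets-[] h = empty (sets I) (subst (_≤ 0) rows-length h)
      where
      empty : ∀ {A : Set} (xs : List A) → length xs ≤ 0 → xs ≡ []
      empty [] _ = refl

    nothing-to-do : length rows ≤ 0 → ∀ {c} → Delivered k I ⟪ c , startVar [ vOut ↦ 4 ] , startArr input ⟫
    nothing-to-do h = record
      { us = [] ; Ss = [] ; rows = []
      ; elements = [] , λ e → mk⇔ (λ ()) λ (S , ks , _) → ⊥-elim (no-kernel k I (sets-[] h) S ks)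
      ; kernel-sets = [] , λ S → mk⇔ (λ ()) λ ks → ⊥-elim (no-kernel k I (sets-[] h) S ks)
      ; listed = [] ; j = 0 ; base = 4 ; j< = s≤s z≤n ; at = refl
      ; fits = 6≤X
      ; cells = blank rows h }
      where
      blank : ∀ (rs : List (List (Fin m))) → length rs ≤ 0 → Holds (contents (encodeInput d k m rs)) 4 (0 ∷ 0 ∷ [])
      blank [] _ zero          _ = refl
      blank [] _ (suc zero)    _ = refl
      blank [] _ (suc (suc i)) (s≤s (s≤s ()))

    nd<W : n * d < 2 ^ w
    nd<W = ≤-<-trans (≤-trans (≤-trans (*-monoʳ-≤ n (<⇒≤ (n<3^n d))) (≤-trans (m≤m+n Y (3 * Y + 4 * m + 4))
      (≤-reflexive (solve 2 (λ Y m → Y :+ (con 3 :* Y :+ con 4 :* m :+ con 4) := con 4 :* (Y :+ m :+ con 1)) refl Y m)))) room) X<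
      where Y = n * 3 ^ d

    main-spec : wp main Goal start
    main-spec = _ , _ , kernel-run , λ h → nothing-to-do h , ≤-trans (≤ᵇ⇒≤ 2 6 _) (m≤n+m 6 (169 * B))
      where
      zeros : ∀ i y → 1 ≤ i → startArr input i y ≡ 0
      zeros (suc i) y _ = refl
      kernel-run : 0 < length rows → wp kernel Goal (tick (setV vOut 4 start))
      kernel-run n>0 = (_ , _ , subst (λ x → x * d < 2 ^ w) (sym rows-length) nd<W) , _ , _ ,
        (λ d>0 → (_ , _ , d>0) , Start.start-spec σ₂ I ls rows-length n≥1 refl refl refl zeros room (cong (_* d) rows-length) refl) ,
        -- For d = 0 the variable `vdm` keeps the value 0, which is d ∸ 1 as well; this branch takes
        -- one tick less.
        λ d≤0 → wp-mono rest {λ τ → Delivered k I τ × clk τ ≤ 169 * B + 5} {Goal} (λ τ (D , c) → D , ≤-trans c (+-monoʳ-≤ (169 * B) (n≤1+n 5))) {σ₁} (Start.start-spec σ₁ I ls rows-length n≥1 refl refl refl zeros room (cong (_* d) rows-length) (sym (m≤n⇒m∸n≡0 {d} {1} (≤-trans d≤0 z≤n))))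
        where
        rest = block occurrences ⨾ block buildTrie ⨾ afterTrie
        n≥1 : 1 ≤ n
        n≥1 = subst (0 <_) rows-length n>0
        σ₁ = tick (setV vdm 0 (setV vnd (length rows * d) (tick (setV vOut 4 start))))
        σ₂ = setV vdm (d ∸ 1) σ₁

  update-cong : ∀ (f g : ℕ → ℕ) a x {u v} → f x ≡ g x → u ≡ v → (f [ a ↦ u ]) x ≡ (g [ a ↦ v ]) x
  update-cong f g a x e e′ with x ≡ᵇ a
  ... | true  = e′
  ... | false = e

  update-< : ∀ (f : ℕ → ℕ) a x {b v} → f x < b → v < b → (f [ a ↦ v ]) x < b
  update-< f a x h h′ with x ≡ᵇ a
  ... | true  = h′
  ... | false = h

  -- There are 14 instructions in the prologue, then 100 for each of 169b + 6 ticks. For b ≥ 1 any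
  -- constant from 17514 on would do.
  estimate : ∀ b → 1 ≤ b → 14 + 100 * (169 * b + 6) ≤ 22000 * b
  estimate b b≥1 = from-≤ (4486 * b) (*-monoʳ-≤ 614 b≥1)
    (solve 1 (λ b → con 14 :+ con 100 :* (con 169 :* b :+ con 6) :+ con 614 :* b :+ con 4486 :* b := con 22000 :* b :+ con 614) refl b)

  module Run (w : ℕ) {d m : ℕ} (k : ℕ) (I : Instance d m) {rows : List (List (Fin m))} (ls : ListsSets rows (sets I))
    (C : ℕ) (C≥ : 22000 ≤ C) (d< : d < 2 ^ w) (k< : k < 2 ^ w) (big : C * (3 ^ d * length (sets I) + m + 1) ≤ 2 ^ w) where

    n = length (sets I)
    B = n * 3 ^ d + m + 1
    X = (2 ^ w ∸ 1) / 22
    open Decode I ls using (rows-length; row-lengths)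

    B≡ : 3 ^ d * n + m + 1 ≡ B
    B≡ = cong (λ y → y + m + 1) (*-comm (3 ^ d) n)

    scale : ∀ c → c ≤ 22000 → c * B ≤ 2 ^ w
    scale c c≤ = ≤-trans (*-monoˡ-≤ B (≤-trans c≤ C≥)) (subst (λ b → C * b ≤ 2 ^ w) B≡ big)

    B≥1 : 1 ≤ B
    B≥1 = m≤n+m 1 (n * 3 ^ d + m)

    c≤W : ∀ c → c ≤ 22000 → c ≤ 2 ^ w
    c≤W c c≤ = ≤-trans (≤-trans (≤-reflexive (sym (*-identityʳ c))) (*-monoʳ-≤ c B≥1)) (scale c c≤)

    32≤ : 32 ≤ 2 ^ w
    32≤ = c≤W 32 (≤ᵇ⇒≤ 32 22000 _)

    W-1< : 2 ^ w ∸ 1 < 2 ^ w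
    W-1< = ∸-monoʳ-< (s≤s z≤n) (≤-trans (s≤s z≤n) 32≤)

    22X≤ : 22 * X ≤ 2 ^ w
    22X≤ = ≤-trans (≤-reflexive (*-comm 22 X)) (≤-trans (m/n*n≤m (2 ^ w ∸ 1) 22) (<⇒≤ W-1<))

    X< : X < 2 ^ w
    X< = ≤-<-trans (m/n≤m (2 ^ w ∸ 1) 22) W-1<

    ≤X : ∀ x → suc (x * 22) ≤ 2 ^ w → x ≤ X
    ≤X x h = Equivalence.from (≤-/ x (2 ^ w ∸ 1) 21) (∸-monoˡ-≤ 1 h)

    room : 4 * B ≤ X
    -- 89 = 4 * 22 + 1: there are 22 arrays, and the 1 is due to dividing 2 ^ w - 1 instead of 2 ^
    -- w.
    room = ≤X (4 * B) (≤-trans (+-mono-≤ B≥1 (≤-reflexive (solve 1 (λ b → con 4 :* b :* con 22 := con 88 :* b) refl B))) (scale 89 (≤ᵇ⇒≤ 89 22000 _)))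

    6≤X : 6 ≤ X
    -- Without sets the output occupies addresses 4 and 5 of array 0, and 133 = 6 * 22 + 1.
    6≤X = ≤X 6 (c≤W 133 (≤ᵇ⇒≤ 133 22000 _))

    open MainSpec w X X< 22X≤ k I ls 6≤X room using (input; start; startVar; Goal; main-spec)
    open KernelPhases w X X< 22X≤ {m} using (module Delivered; Delivered)
    open Soundness w X program 100 ≤-refl 32≤ 22X≤
    open Machine w program

    Y≤ : n * 3 ^ d ≤ B
    Y≤ = ≤-trans (m≤m+n (n * 3 ^ d) m) (m≤m+n _ 1)

    B<W : B < 2 ^ w
    B<W = ≤-trans (+-monoˡ-≤ B B≥1) (≤-trans (≤-reflexive (cong (B +_) (sym (+-identityʳ B)))) (scale 2 (≤ᵇ⇒≤ 2 22000 _)))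

    n<W : length rows < 2 ^ w
    n<W = ≤-<-trans (≤-trans (≤-reflexive rows-length) (≤-trans (≤-trans (≤-reflexive (sym (*-identityʳ n))) (*-monoʳ-≤ n (m^n>0 3 d))) Y≤)) B<W

    m<W : m < 2 ^ w
    m<W = ≤-<-trans (≤-trans (m≤n+m m (n * 3 ^ d)) (m≤m+n _ 1)) B<W

    input< : All (_< 2 ^ w) input
    input< = d< ∷ k< ∷ m<W ∷ n<W ∷ All.map (λ h → <-trans h m<W) (flat-< rows)

    W>0 : 0 < 2 ^ w
    W>0 = ≤-trans (s≤s z≤n) 32≤

    input-length : length input ≤ X
    input-length = ≤-trans (+-monoʳ-≤ 4 (≤-trans (≤-reflexive (trans (flat-length rows row-lengths) (cong (_* d) rows-length))) (*-monoʳ-≤ n (<⇒≤ (n<3^n d)))))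
      (≤-trans (≤-trans (m≤m+n (4 + n * 3 ^ d) (3 * (n * 3 ^ d) + 4 * m)) (≤-reflexive (solve 2 (λ Y m → con 4 :+ Y :+ (con 3 :* Y :+ con 4 :* m) := con 4 :* (Y :+ m :+ con 1)) refl (n * 3 ^ d) m))) room)

    M = contents input
    R₁ R₂ R₃ R₄ R₅ R₆ R₇ R₈ R₉ R₁₀ R₁₁ R₁₂ R₁₃ R₁₄ : ℕ → ℕ
    R₁ = (λ _ → 0) [ 51 ↦ trunc w 0 ]
    R₂ = R₁ [ vd ↦ M (R₁ 51) ]
    R₃ = R₂ [ 51 ↦ trunc w 1 ]
    R₄ = R₃ [ vk ↦ M (R₃ 51) ]
    R₅ = R₄ [ 51 ↦ trunc w 2 ]
    R₆ = R₅ [ vm ↦ M (R₅ 51) ]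
    R₇ = R₆ [ 51 ↦ trunc w 3 ]
    R₈ = R₇ [ vn ↦ M (R₇ 51) ]
    R₉ = R₈ [ 51 ↦ trunc w 0 ]
    R₁₀ = R₉ [ 52 ↦ trunc w 1 ]
    R₁₁ = R₁₀ [ 51 ↦ eval w sub (R₁₀ 51) (R₁₀ 52) ]
    R₁₂ = R₁₁ [ 52 ↦ trunc w 22 ]
    R₁₃ = R₁₂ [ nV ↦ eval w div (R₁₂ 51) (R₁₂ 52) ]
    R₁₄ = R₁₃ [ vX ↦ eval w div (R₁₃ 51) (R₁₃ 52) ]

    loaded : initial input ⟶[ 14 ] ⟨ 14 , R₁₄ , M ⟩
    -- The prologue has no jumps, so its run is found by evaluation, with `w` left symbolic.
    loaded = steps refl

    trunc-const : ∀ c → suc c ≤ 32 → trunc w c ≡ c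
    trunc-const c c< = trunc-id (≤-trans c< 32≤)

    all-ones : eval w sub (trunc w 0) (trunc w 1) ≡ 2 ^ w ∸ 1
    all-ones = trans (cong₂ (eval w sub) (trunc-const 0 (≤ᵇ⇒≤ _ _ _)) (trunc-const 1 (≤ᵇ⇒≤ _ _ _))) (trunc-id W-1<)

    quotient : eval w div (eval w sub (trunc w 0) (trunc w 1)) (trunc w 22) ≡ X
    quotient = cong₂ (eval w div) all-ones (trunc-const 22 (≤ᵇ⇒≤ _ _ _))

    V₀ V₁ V₂ V₃ V₄ : ℕ → ℕ
    V₀ _ = 0
    V₁ = V₀ [ vd ↦ d ]
    V₂ = V₁ [ vk ↦ k ]
    V₃ = V₂ [ vm ↦ m ]
    V₄ = V₃ [ vn ↦ length rows ]

    regs : ∀ x → x < nV → R₁₄ x ≡ startVar x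
    regs x x< = update-cong R₁₃ V₄ vX x e₁₃ quotient
      where
      other : ∀ (f : ℕ → ℕ) a v → T (nV ≤ᵇ a) → (f [ a ↦ v ]) x ≡ f x
      other f a v h = upd-< f v (<-≤-trans x< (≤ᵇ⇒≤ nV a h))
      e₂ : R₂ x ≡ V₁ x
      e₂ = update-cong R₁ V₀ vd x (other V₀ 51 _ _) (cong M (trunc-const 0 (≤ᵇ⇒≤ _ _ _)))
      e₄ : R₄ x ≡ V₂ x
      e₄ = update-cong R₃ V₁ vk x (trans (other R₂ 51 _ _) e₂) (cong M (trunc-const 1 (≤ᵇ⇒≤ _ _ _)))
      e₆ : R₆ x ≡ V₃ x
      e₆ = update-cong R₅ V₂ vm x (trans (other R₄ 51 _ _) e₄) (cong M (trunc-const 2 (≤ᵇ⇒≤ _ _ _)))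
      e₈ : R₈ x ≡ V₄ x
      e₈ = update-cong R₇ V₃ vn x (trans (other R₆ 51 _ _) e₆) (cong M (trunc-const 3 (≤ᵇ⇒≤ _ _ _)))
      e₁₃ : R₁₃ x ≡ V₄ x
      e₁₃ = trans (other R₁₂ nV _ _) (trans (other R₁₁ 52 _ _) (trans (other R₁₀ 51 _ _) (trans (other R₉ 52 _ _) (trans (other R₈ 51 _ _) e₈))))

    start-sim : Sim start R₁₄ M
    start-sim = record
      { reg-var = regs
      ; reg-X   = quotient
      ; var<    = λ x _ → update-< V₄ vX x (update-< V₃ vn x (update-< V₂ vm x (update-< V₁ vk x (update-< V₀ vd x W>0 d<) k<) m<W) n<W) X<
      ; mem-arr = cells
      ; arr<    = bounded }
      where
      cells : ∀ j y → j < nA → y < X → M (j * X + y) ≡ startArr input j y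
      cells zero    y _ _ = refl
      -- The input ends within array 0, so all other arrays start out zero.
      cells (suc j) y _ _ = contents-beyond input (suc j * X + y) (≤-trans input-length (≤-trans (m≤m+n X (j * X)) (m≤m+n (X + j * X) y)))
      bounded : ∀ j y → j < nA → y < X → startArr input j y < 2 ^ w
      bounded zero    y _ _ = contents-All input input< W>0 y
      bounded (suc j) y _ _ = W>0

    placed : At program 14 (compS 14 main)
    placed = place [] (sym (++-identityʳ (compS 14 main)))

    -- From here on only the properties of this run are used; being opaque, it is not evaluated.
    abstract
      result : Out main Goal start 14 R₁₄ M
      result = sound main placed wf-main start-sim main-spec

    open Out result

    total : initial input ⟶[ 14 + time ] ⟨ 14 + lenS main , R′ , M′ ⟩
    total = loaded then moves

    drop-length : ∀ {A : Set} (xs : List A) → drop (length xs) xs ≡ []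
    drop-length []       = refl
    drop-length (x ∷ xs) = drop-length xs

    -- The code contains no `halt`; it stops by running past its last instruction.
    halted : fetch program (14 + lenS main) ≡ nothing
    halted = cong head (trans (cong (λ l → drop l (compS 14 main)) (sym (HasLen.unLen (len-compS main 14)))) (drop-length (compS 14 main)))

    in-time : 14 + time ≤ C * (3 ^ d * n + m + 1)
    in-time = ≤-trans (+-monoʳ-≤ 14 (≤-trans (≤-trans (m≤m+n time _) cost) (*-monoʳ-≤ 100 (proj₂ post)))) (≤-trans (estimate B B≥1) (≤-trans (*-monoˡ-≤ B C≥) (≤-reflexive (cong (C *_) (sym B≡)))))

    delivered : OutputsKernel w k I ⟨ 14 + lenS main , R′ , M′ ⟩
    delivered = us , Ss , rs , elements , kernel-sets , listed ,
      ≤-trans (≤-reflexive (trans (cong (_+ length out′) reg0) (+-assoc (j * X) base (length out′))))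
        (≤-trans (+-monoʳ-≤ (j * X) fits′) (≤-trans (≤-trans (≤-reflexive (+-comm (j * X) X)) (*-monoˡ-≤ X j<)) 22X≤)) ,
      λ i → trans (cong M′ (trans (cong (_+ toℕ i) reg0) (+-assoc (j * X) base (toℕ i))))
        (trans (mem-arr sim j (base + toℕ i) j< (<-≤-trans (+-monoʳ-< base (toℕ<n i)) fits′)) (trans (cells (toℕ i) (toℕ<n i)) (contents-lookup out′ i)))
      where
      open Delivered (proj₁ post) renaming (rows to rs; fits to fits′; at to at′)
      out′ = encodeOutput us rs
      reg0 : R′ 0 ≡ j * X + base
      reg0 = trans (reg-var sim 0 (s≤s z≤n)) at′

    conclusion : ∃ λ t → t ≤ C * (3 ^ d * n + m + 1) × Halted program (run w program t (initial input)) × OutputsKernel w k I (run w program t (initial input))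
    conclusion = 14 + time , in-time , subst (Halted program) (sym (reaches total)) (inj₂ halted) , subst (OutputsKernel w k I) (sym (reaches total)) delivered

open import Defs
open import Data.Fin using (Fin)
open import Data.List using (List; length)
open import Data.Nat using (ℕ; _+_; _*_; _^_; _≤_; _<_)
open import Data.Nat.Properties using (≤-refl)
open import Data.Product using (∃; _×_; _,_)
open KernelProgram using (program)
open ProgramCorrectness using (module Run)

lemma3 : ∃ λ (P : Program) → ∃ λ (C : ℕ) →
    ∀ (d k m : ℕ) (I : Instance d m) (rows : List (List (Fin m))) → ListsSets rows (sets I) →
    let n = length (sets I) in
    let bound = C * (3 ^ d * n + m + 1) in
    ∀ (w : ℕ) → d < 2 ^ w → k < 2 ^ w → bound ≤ 2 ^ w →
    ∃ λ (t : ℕ) → t ≤ bound ×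
    Halted P (run w P t (initial (encodeInput d k m rows))) ×
    OutputsKernel w k I (run w P t (initial (encodeInput d k m rows)))
lemma3 = program , 22000 , λ d k m I rows ls w d< k< big → Run.conclusion w k I ls 22000 ≤-refl d< k< big
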